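{- The single-deadline charge scheduling problem with gaps and with no constant bound on the number of periods (the number of periods is part of the input) is strongly NP-complete, even when restricted to instances with constant demand (i.e. there is a constant $D$ such that it remains strongly NP-complete when $w_i\le D$ for all agents $i$) in which all deadlines are at the end, $d_i=|T|$ for all $i$.
   Context: Single-deadline charge scheduling problem with gaps. An instance consists of a number $|T|\ge 1$ of periods, $T=\{1,\dots,|T|\}$; a supply $m_t\in\mathbb{Z}_{\ge 0}$ for each $t\in T$; and $n$ agents, where agent $i$ has a value $v_i$ (positive integer), a deadline $d_i\in T$, a demand $w_i$ (positive integer), and a set $G_i\subseteq T$ of gap periods. A feasible allocation is a family of functions $a_i:T\to\mathbb{R}_{\ge 0}$ with $\sum_i a_i(t)\le m_t$ for all $t$, and $a_i(t)=0$ whenever $t\in G_i$ (maximum charging speed $0$ in the gap periods, unbounded charging speed in the other periods). Agent $i$ obtains value $v_i$ if $\sum_{t=1}^{d_i}a_i(t)\ge w_i$, and $0$ otherwise. The goal is to maximize the total value obtained; in the decision version one is also given an integer $V$ and asks whether a feasible allocation with total value at least $V$ exists. The periods are listed explicitly (so the input length is at least $|T|$). "Strongly NP-complete" means that the decision version is in NP and is NP-hard even when all numbers in the input are bounded by a polynomial in the input length. -}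

module Defs where

open import Data.Bool.Base using (Bool; true; false)
open import Data.Fin.Base using (Fin; zero; suc; toℕ; inject≤; _↑ʳ_)
open import Data.Fin.Properties using (toℕ<n)
open import Data.Fin.Subset using (Subset; _∈_)
open import Data.Integer.Base as ℤ using (ℤ; +_; -[1+_])
open import Data.List.Base as List using (List; []; _∷_; _++_; length)
open import Data.List.Relation.Unary.All using (All)
open import Data.Maybe.Base as Maybe using (Maybe; just; nothing)
open import Data.Nat.Base as ℕ using (ℕ; zero; suc; _+_; _*_; _≤_; _<_; _⊔_)
import Data.Nat.Properties as ℕ
open import Data.Nat.Binary.Base using (ℕᵇ; zero; 2[1+_]; 1+[2_]; fromℕ)
open import Data.Product.Base using (Σ; ∃; ∃-syntax; _×_; _,_)
open import Data.Rational.Base as ℚ using (ℚ; 0ℚ; ½)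
import Data.Rational.Properties as ℚ
open import Data.Unit.Base using (⊤)
open import Data.Vec.Base as Vec using (Vec; []; _∷_)
open import Data.Vec.Functional as Vector using (Vector)
open import Function.Base using (_∘_)
open import Function.Bundles using (_⇔_)
open import Relation.Binary.PropositionalEquality
open import Relation.Nullary.Negation.Core using (¬_)

------------------------------------------------------------------------
-- Multi-tape Turing machines

Bits : Set
Bits = List Bool

-- nothing is the blank.
Symbol : Set
Symbol = Maybe Bool

data Move : Set where
  left right stay : Move

-- A tape that is infinite in both directions: all cells beyond the two
-- lists are blank, and both lists start next to the head.
record Tape : Set where
  constructor tape
  field
    before : List Symbol
    head   : Symbol
    after  : List Symbol

open Tape public using (head)

blankTape : Tape
blankTape = tape [] nothing []

load : Bits → Tape
load []       = blankTape
load (b ∷ bs) = tape [] (just b) (List.map just bs)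

move : Move → Tape → Tape
move stay  t                   = t
move left  (tape []       s r) = tape [] nothing (s ∷ r)
move left  (tape (l ∷ ls) s r) = tape ls l (s ∷ r)
move right (tape l s [])       = tape (s ∷ l) nothing []
move right (tape l s (r ∷ rs)) = tape (s ∷ l) r rs

write : Symbol → Tape → Tape
write s (tape l _ r) = tape l s r

upToBlank : List Symbol → Bits
upToBlank []             = []
upToBlank (nothing ∷ _)  = []
upToBlank (just b  ∷ ss) = b ∷ upToBlank ss

-- The word that starts under the head and extends to the first blank.
contents : Tape → Bits
contents (tape _ s r) = upToBlank (s ∷ r)

-- The tapes are, in this order, `arity` input tapes, one output tape and
-- `work` further tapes.  The machine halts where δ is undefined.
record Machine (arity : ℕ) : Set where
  field
    states : ℕ
    work   : ℕ

  tapes : ℕ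
  tapes = arity + suc work

  field
    start : Fin states
    δ     : Fin states → Vec Symbol tapes →
            Maybe (Fin states × Vec (Symbol × Move) tapes)

module _ {arity} (M : Machine arity) where
  open Machine M

  record Config : Set where
    constructor config
    field
      state : Fin states
      store : Vec Tape tapes

  act : Symbol × Move → Tape → Tape
  act (s , m) = move m ∘ write s

  step : Config → Maybe Config
  step (config q ts) = Maybe.map
    (λ (q′ , as) → config q′ (Vec.zipWith act as ts))
    (δ q (Vec.map head ts))

  initial : Vec Bits arity → Config
  initial xs = config start
    (Vec.map load xs Vec.++ Vec.replicate (suc work) blankTape)

  output : Config → Bits
  output (config _ ts) = contents (Vec.lookup ts (arity ↑ʳ zero))

  data HaltsIn : ℕ → Config → Config → Set where
    halted : ∀ {c} → step c ≡ nothing → HaltsIn 0 c c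
    next   : ∀ {t c c′ d} → step c ≡ just c′ →
             HaltsIn t c′ d → HaltsIn (suc t) c d

------------------------------------------------------------------------
-- Polynomial time and NP

-- Polynomials in one variable with natural number coefficients.
data Poly : Set where
  con       : ℕ → Poly
  var       : Poly
  _⊕_ _⊗_   : Poly → Poly → Poly

⟦_⟧ : Poly → ℕ → ℕ
⟦ con k ⟧ n = k
⟦ var   ⟧ n = n
⟦ p ⊕ q ⟧ n = ⟦ p ⟧ n + ⟦ q ⟧ n
⟦ p ⊗ q ⟧ n = ⟦ p ⟧ n * ⟦ q ⟧ n

size : ∀ {k} → Vec Bits k → ℕ
size = Vec.sum ∘ Vec.map length

PolyTime : ∀ {k} → (Vec Bits k → Bits) → Set
PolyTime {k} f = ∃[ M ] ∃[ p ] ∀ (xs : Vec Bits k) →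
  ∃[ t ] ∃[ c ] t ≤ ⟦ p ⟧ (size xs)
              × HaltsIn M t (initial M xs) c
              × output M c ≡ f xs

Language : Set₁
Language = Bits → Set

InNP : Language → Set
InNP L = ∃[ verify ] PolyTime {2} verify × ∃[ p ] ∀ x →
  L x ⇔ (∃[ c ] length c ≤ ⟦ p ⟧ (length x)
              × verify (x ∷ c ∷ []) ≡ true ∷ [])

_≤ₚ_ : Language → Language → Set
K ≤ₚ L = ∃[ f ] PolyTime {1} (f ∘ Vec.head) × ∀ x → K x ⇔ L (f x)

NPHard : Language → Set₁
NPHard L = ∀ K → InNP K → K ≤ₚ L

------------------------------------------------------------------------
-- Strong NP-completeness

record DecisionProblem : Set₁ where
  field
    Instance : Set
    encode   : Instance → Bits
    numbers  : Instance → List ℕ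
    Yes      : Instance → Set

module _ (P : DecisionProblem) where
  open DecisionProblem P

  -- The problem restricted to the instances in C.
  language : (Instance → Set) → Language
  language C x = ∃[ I ] encode I ≡ x × C I × Yes I

  NumbersBoundedBy : Poly → Instance → Set
  NumbersBoundedBy p I = All (_≤ ⟦ p ⟧ (length (encode I))) (numbers I)

  StronglyNPComplete : (Instance → Set) → Set₁
  StronglyNPComplete C =
    InNP (language C) ×
    ∃[ p ] NPHard (language (λ I → C I × NumbersBoundedBy p I))

------------------------------------------------------------------------
-- Real numbers as Cauchy sequences of rationals

record ℝ : Set where
  constructor real
  field
    seq    : ℕ → ℚ
    cauchy : ∀ ε → 0ℚ ℚ.< ε → ∃[ N ] ∀ m n → N ≤ m → N ≤ n →
             ℚ.∣ seq m ℚ.- seq n ∣ ℚ.< ε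

open ℝ public

infix 4 _≤ᴿ_ _≈ᴿ_
infixl 6 _+ᴿ_

_≤ᴿ_ : ℝ → ℝ → Set
x ≤ᴿ y = ∀ ε → 0ℚ ℚ.< ε → ∃[ N ] ∀ n → N ≤ n → seq x n ℚ.< seq y n ℚ.+ ε

_≈ᴿ_ : ℝ → ℝ → Set
x ≈ᴿ y = x ≤ᴿ y × y ≤ᴿ x

fromℚ : ℚ → ℝ
fromℚ q = real (λ _ → q) λ ε 0<ε → 0 , λ _ _ _ _ →
  subst (λ r → ℚ.∣ r ∣ ℚ.< ε) (sym (ℚ.+-inverseʳ q)) 0<ε

0ᴿ : ℝ
0ᴿ = fromℚ 0ℚ

fromNat : ℕ → ℝ
fromNat n = fromℚ (+ n ℚ./ 1)

private
  half-pos : ∀ ε → 0ℚ ℚ.< ε → 0ℚ ℚ.< ½ ℚ.* ε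
  half-pos ε 0<ε = subst (ℚ._< ½ ℚ.* ε) (ℚ.*-zeroʳ ½) (ℚ.*-monoʳ-<-pos ½ 0<ε)

  half+half : ∀ ε → ½ ℚ.* ε ℚ.+ ½ ℚ.* ε ≡ ε
  half+half ε = trans (sym (ℚ.*-distribʳ-+ ε ½ ½)) (ℚ.*-identityˡ ε)

  rearrange : ∀ a b c d →
              (a ℚ.+ b) ℚ.- (c ℚ.+ d) ≡ (a ℚ.- c) ℚ.+ (b ℚ.- d)
  rearrange a b c d = begin
    (a ℚ.+ b) ℚ.- (c ℚ.+ d)               ≡⟨ cong ((a ℚ.+ b) ℚ.+_) (ℚ.neg-distrib-+ c d) ⟩
    (a ℚ.+ b) ℚ.+ (ℚ.- c ℚ.+ ℚ.- d)       ≡⟨ ℚ.+-assoc a b _ ⟩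
    a ℚ.+ (b ℚ.+ (ℚ.- c ℚ.+ ℚ.- d))       ≡⟨ cong (a ℚ.+_) (ℚ.+-assoc b (ℚ.- c) (ℚ.- d)) ⟨
    a ℚ.+ ((b ℚ.+ ℚ.- c) ℚ.+ ℚ.- d)       ≡⟨ cong (λ z → a ℚ.+ (z ℚ.- d)) (ℚ.+-comm b (ℚ.- c)) ⟩
    a ℚ.+ ((ℚ.- c ℚ.+ b) ℚ.+ ℚ.- d)       ≡⟨ cong (a ℚ.+_) (ℚ.+-assoc (ℚ.- c) b (ℚ.- d)) ⟩
    a ℚ.+ (ℚ.- c ℚ.+ (b ℚ.- d))           ≡⟨ ℚ.+-assoc a (ℚ.- c) _ ⟨
    (a ℚ.- c) ℚ.+ (b ℚ.- d)               ∎
    where open ≡-Reasoning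

_+ᴿ_ : ℝ → ℝ → ℝ
x +ᴿ y = real (λ n → seq x n ℚ.+ seq y n) λ ε 0<ε →
  let N₁ , h₁ = cauchy x (½ ℚ.* ε) (half-pos ε 0<ε)
      N₂ , h₂ = cauchy y (½ ℚ.* ε) (half-pos ε 0<ε)
  in N₁ ⊔ N₂ , λ m n N≤m N≤n →
    let u = seq x m ℚ.- seq x n
        v = seq y m ℚ.- seq y n
        open ℚ.≤-Reasoning
    in begin-strict
      ℚ.∣ (seq x m ℚ.+ seq y m) ℚ.- (seq x n ℚ.+ seq y n) ∣
        ≡⟨ cong ℚ.∣_∣ (rearrange (seq x m) (seq y m) (seq x n) (seq y n)) ⟩
      ℚ.∣ u ℚ.+ v ∣
        ≤⟨ ℚ.∣p+q∣≤∣p∣+∣q∣ u v ⟩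
      ℚ.∣ u ∣ ℚ.+ ℚ.∣ v ∣
        <⟨ ℚ.+-mono-<
             (h₁ m n (ℕ.m⊔n≤o⇒m≤o N₁ N₂ N≤m) (ℕ.m⊔n≤o⇒m≤o N₁ N₂ N≤n))
             (h₂ m n (ℕ.m⊔n≤o⇒n≤o N₁ N₂ N≤m) (ℕ.m⊔n≤o⇒n≤o N₁ N₂ N≤n)) ⟩
      ½ ℚ.* ε ℚ.+ ½ ℚ.* ε
        ≡⟨ half+half ε ⟩
      ε ∎

sumᴿ : ∀ {n} → Vector ℝ n → ℝ
sumᴿ = Vector.foldr _+ᴿ_ 0ᴿ

------------------------------------------------------------------------
-- Single-deadline charge scheduling with gaps

-- Period t ∈ {1,…,T} is the element of Fin T with toℕ value t - 1.
record Agent (T : ℕ) : Set where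
  field
    value    : ℕ
    value>0  : 0 < value
    deadline : Fin T
    demand   : ℕ
    demand>0 : 0 < demand
    gaps     : Subset T

  due : ℕ
  due = suc (toℕ deadline)

record Scheduling : Set where
  field
    periods   : ℕ
    periods≥1 : 1 ≤ periods
    supply    : Vec ℕ periods
    n         : ℕ
    agents    : Vec (Agent periods) n

  agent : Fin n → Agent periods
  agent = Vec.lookup agents

module _ (I : Scheduling) where
  open Scheduling I
  open Agent

  Allocation : Set
  Allocation = Fin n → Fin periods → ℝ

  record Feasible (a : Allocation) : Set where
    field
      nonneg   : ∀ i t → 0ᴿ ≤ᴿ a i t
      supplied : ∀ t → sumᴿ (λ i → a i t) ≤ᴿ fromNat (Vec.lookup supply t)
      gap      : ∀ i t → t ∈ gaps (agent i) → a i t ≈ᴿ 0ᴿ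

  -- The sum of a i t over all periods t up to and including the deadline.
  charge : Allocation → Fin n → ℝ
  charge a i = sumᴿ {due (agent i)} λ t → a i (inject≤ t (toℕ<n (deadline (agent i))))

  -- The order on ℝ is not decidable, so the value obtained by an agent is
  -- given by the graph of the function defined by cases.
  data Obtains (a : Allocation) (i : Fin n) : ℕ → Set where
    met   :   fromNat (demand (agent i)) ≤ᴿ charge a i →
            Obtains a i (value (agent i))
    unmet : ¬ fromNat (demand (agent i)) ≤ᴿ charge a i →
            Obtains a i 0

  HasTotalValue : Allocation → ℕ → Set
  HasTotalValue a total = Σ (Vector ℕ n) λ u →
    (∀ i → Obtains a i (u i)) × Vector.foldr _+_ 0 u ≡ total

Achievable : Scheduling × ℤ → Set
Achievable (I , V) =
  ∃[ a ] Feasible I a × ∃[ total ] HasTotalValue I a total × V ℤ.≤ + total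

------------------------------------------------------------------------
-- Encoding

-- Self-delimiting: each bijective base-2 digit is announced by true, and
-- false ends the numeral.
encodeℕᵇ : ℕᵇ → Bits
encodeℕᵇ zero     = false ∷ []
encodeℕᵇ 2[1+ b ] = true ∷ true  ∷ encodeℕᵇ b
encodeℕᵇ 1+[2 b ] = true ∷ false ∷ encodeℕᵇ b

encodeℕ : ℕ → Bits
encodeℕ = encodeℕᵇ ∘ fromℕ

encodeℤ : ℤ → Bits
encodeℤ (+ k)    = true  ∷ encodeℕ k
encodeℤ -[1+ k ] = false ∷ encodeℕ k

encodeAgent : ∀ {T} → Agent T → Bits
encodeAgent A = encodeℕ value ++ encodeℕ due ++ encodeℕ demand ++ Vec.toList gaps
  where open Agent A

encodeInstance : Scheduling × ℤ → Bits
encodeInstance (I , V) =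
  encodeℕ periods ++ List.concatMap encodeℕ (Vec.toList supply) ++
  encodeℕ n       ++ List.concatMap encodeAgent (Vec.toList agents) ++
  encodeℤ V
  where open Scheduling I

numbersOfAgent : ∀ {T} → Agent T → List ℕ
numbersOfAgent A = value ∷ due ∷ demand ∷ []
  where open Agent A

numbersOf : Scheduling × ℤ → List ℕ
numbersOf (I , V) =
  periods ∷ Vec.toList supply ++
  n       ∷ List.concatMap numbersOfAgent (Vec.toList agents) ++
  ℤ.∣ V ∣ ∷ []
  where open Scheduling I

ChargeSchedulingWithGaps : DecisionProblem
ChargeSchedulingWithGaps = record
  { Instance = Scheduling × ℤ
  ; encode   = encodeInstance
  ; numbers  = numbersOf
  ; Yes      = Achievable
  }

------------------------------------------------------------------------
-- Classes of instances

AllInstances : Scheduling × ℤ → Set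
AllInstances _ = ⊤

DemandsAtMost : ℕ → Scheduling × ℤ → Set
DemandsAtMost D (I , _) = ∀ i → Agent.demand (agent i) ≤ D
  where open Scheduling I

DeadlinesAtEnd : Scheduling × ℤ → Set
DeadlinesAtEnd (I , _) = ∀ i → Agent.due (agent i) ≡ periods
  where open Scheduling I

{-# OPTIONS --safe #-}

-- Membership: an allocation gives, for the agents that obtain their value, the
-- cut inequalities (a set of agents demands at most the supply of the periods
-- that it can use in time), and by Hall's theorem these yield an integral
-- allocation to the same agents. A verifier guesses such an allocation while it
-- reads the instance.
--
-- Hardness: the computations of a verifier are the solutions of a tiling
-- system, in which the rows of a table are laid out one after the other. For
-- each cell u and each tile a, every occurrence of the variable "a is at u" in
-- a constraint gives two agents of value 1 that compete for a period with
-- supply 1, so that at most one of them is charged. They share further periods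
-- with the agents of the next occurrence, such that charging the true agent of
-- the last occurrence forces the choice true at all occurrences. A forbidden
-- pair of tiles is a period with supply 1 that the true agents of both
-- variables need, and a forbidden tile at a cell is a period with supply 0.
-- One further agent per cell can only be charged if some tile is at the cell.
-- The tiling exists iff the number of charged agents can be 1 + the number of
-- occurrences at every cell. All demands are at most 3.

module Submission where

open import Defs hiding (step; next; left; right; stay)
open import Algebra.Bundles using (CommutativeRing)
import Algebra.Properties.CommutativeMonoid.Sum as Sum
import Algebra.Properties.Monoid.Mult as Mult
import Algebra.Properties.Semiring.Mult as SemiringMult
open import Data.Bool.Base using (Bool; true; false; if_then_else_; _∧_; _∨_; not)
open import Data.Bool.Properties as Bool using (∨-zeroʳ)
open import Data.Empty using (⊥)
open import Data.Fin using (#_)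
open import Data.Fin.Base as Fin
  using (suc; zero; Fin; _↑ˡ_; _↑ʳ_; splitAt; toℕ; fromℕ<; inject≤; remQuot; inject₁)
open import Data.Fin.Induction using (>-weakInduction)
open import Data.Fin.Properties as Fin
  using (splitAt-↑ˡ; splitAt-↑ʳ; toℕ-fromℕ<; toℕ<n; any?; toℕ-injective; splitAt-join;
    join-splitAt; remQuot-combine; combine-remQuot)
open import Data.Fin.Subset.Properties using (_∈?_; anySubset?)
open import Data.Integer.Base as ℤ using (ℤ)
import Data.Integer.Properties as ℤ
open import Data.List.Base as List
  using (_∷_; []; List; _++_; length; _ʳ++_; replicate; concatMap; map; upTo; cartesianProduct;
    allFin; foldl; applyUpTo)
open import Data.List.Membership.Propositional.Properties
  using (∈-tabulate⁺; ∈-lookup; ∈-++⁺ˡ; ∈-++⁺ʳ; ∈-∃++; ∈-map⁺; ∈-map⁻; ∈-upTo⁺; ∈-upTo⁻;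
    ∈-cartesianProduct⁺; ∈-cartesianProduct⁻; ∈-allFin)
open import Data.List.Properties
  using (++-assoc; length-++; ++-identityʳ; ʳ++-ʳ++; ∷-injective; concatMap-++; length-replicate;
    length-map; length-upTo; concatMap-map; ʳ++-defn; foldl-∷ʳ; concatMap-cong; map-++; map-∘;
    map-applyUpTo; upTo-∷ʳ)
open import Data.List.Relation.Unary.All as All using (_∷_; []; All)
import Data.List.Relation.Unary.All.Properties as All
open import Data.List.Relation.Unary.AllPairs as AllPairs using (_∷_; []; AllPairs)
import Data.List.Relation.Unary.AllPairs.Properties as AllPairs
open import Data.List.Relation.Unary.Any using (here; there)
open import Data.List.Relation.Unary.Unique.Propositional using (Unique)
import Data.List.Relation.Unary.Unique.Propositional.Properties as Unique
open import Data.Maybe.Base as Maybe using (Maybe; just; nothing)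
open import Data.Nat.Base as ℕ
  using (suc; zero; ℕ; _+_; _≤_; _*_; z≤n; s≤s; _<_; _⊔_; _<ᵇ_; pred; _∸_; s≤s⁻¹; _^_; _≡ᵇ_)
open import Data.Nat.Binary.Base as ℕᵇ using (zero; ℕᵇ; 2[1+_]; 1+[2_])
import Data.Nat.Binary.Properties as ℕᵇ
open import Data.Nat.DivMod
  using (_/_; _%_; m≡m%n+[m/n]*n; m%n<n; [m+kn]%n≡m%n; m<n⇒m%n≡m; +-distrib-/-∣ʳ; m<n⇒m/n≡0;
    m*n/n≡m)
open import Data.Nat.Divisibility using (divides-refl)
open import Data.Nat.Properties as ℕ hiding (_≟_)
open import Data.Nat.Tactic.RingSolver using (solve-∀)
open import Data.Product.Base using (∃-syntax; _×_; _,_; proj₁; proj₂)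
import Data.Product.Properties as Product
open import Data.Rational.Base as ℚ using (ℚ; 0ℚ; 1ℚ; toℚᵘ)
import Data.Rational.Properties as ℚ
open import Data.Rational.Unnormalised.Base as ℚᵘ using (ℚᵘ; mkℚᵘ; *≡*; *<*; *≤*)
import Data.Rational.Unnormalised.Properties as ℚᵘ
open import Data.Sum.Base using (inj₁; inj₂; _⊎_; [_,_]′)
open import Data.Unit.Base using (tt)
open import Data.Vec.Base as Vec using (_∷_; []; Vec; lookup; zipWith; _[_]≔_; toList)
open import Data.Vec.Functional as Vector using (Vector)
open import Data.Vec.Functional.Properties using (updateAt-updates; updateAt-minimal)
open import Data.Vec.Properties
  using (lookup-map; lookup-zipWith; lookup∘updateAt; lookup∘updateAt′; lookup-replicate;
    lookup-splitAt; lookup-++ˡ; lookup-++ʳ; updateAt-id-local; updateAt-updateAt; lookup∘tabulate;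
    []=⇒lookup; lookup⇒[]=; toList-map; toList∘fromList)
open import Function.Base using (_∘_; _∘′_)
open import Function.Bundles using (mk⇔; _⇔_; Equivalence)
open import Function.Construct.Composition using (_⇔-∘_)
open import Relation.Binary.Definitions using (DecidableEquality)
open import Relation.Nullary using (yes; no; Dec; does; contradiction; ¬_)
open import Relation.Nullary.Decidable using (_×-dec_; dec-true; map′)
open import Relation.Binary.PropositionalEquality

module StackPrograms where

  open Defs using (next; left; right; stay)
  open import Data.Vec.Base using (updateAt)
  open import Data.Fin.Properties using (_≟_)

  top : Bits → Symbol
  top []      = nothing
  top (b ∷ _) = just b

  data AllBlank : List Symbol → Set where
    nil   : AllBlank []
    blank : ∀ {ss} → AllBlank ss → AllBlank (nothing ∷ ss)

  data Holds : Bits → List Symbol → Set where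
    []  : ∀ {ss} → AllBlank ss → Holds [] ss
    _∷_ : ∀ b {bs ss} → Holds bs ss → Holds (b ∷ bs) (just b ∷ ss)

  -- The tape holds the stack bs with its top under the head.
  record Stack (t : Tape) (bs : Bits) : Set where
    constructor stack
    field
      below : AllBlank (Tape.before t)
      holds : Holds bs (head t ∷ Tape.after t)

  stack-top : ∀ {t bs} → Stack t bs → head t ≡ top bs
  stack-top (stack _ ([] (blank _))) = refl
  stack-top (stack _ (_ ∷ _))    = refl

  stack-contents : ∀ {t bs} → Stack t bs → contents t ≡ bs
  stack-contents {t} (stack _ h) = go h
    where
    go : ∀ {bs ss} → Holds bs ss → upToBlank ss ≡ bs
    go ([] nil)       = refl
    go ([] (blank _)) = refl
    go (b ∷ h)    = cong (b ∷_) (go h)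

  load-stack : ∀ bs → Stack (load bs) bs
  load-stack []       = stack nil ([] (blank nil))
  load-stack (b ∷ bs) = stack nil (b ∷ go bs)
    where
    go : ∀ bs → Holds bs (List.map just bs)
    go []       = [] nil
    go (b ∷ bs) = b ∷ go bs

  pop-stack : ∀ {t bs} → Stack t bs → Stack (move right (write nothing t)) (List.drop 1 bs)
  pop-stack {tape l _ []}      (stack a ([] _))         = stack (blank a) ([] (blank nil))
  pop-stack {tape l _ []}      (stack a (b ∷ [] nil))   = stack (blank a) ([] (blank nil))
  pop-stack {tape l _ (x ∷ r)} (stack a ([] (blank h))) = stack (blank a) ([] h)
  pop-stack {tape l _ (x ∷ r)} (stack a (b ∷ h))        = stack (blank a) h

  push-stack : ∀ {t bs} b → Stack t bs → Stack (write (just b) (move left t)) (b ∷ bs)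
  push-stack {tape [] s r}       b (stack a h)         = stack nil (b ∷ h)
  push-stack {tape (l ∷ ls) s r} b (stack (blank a) h) = stack a (b ∷ h)

  apply : Symbol × Move → Tape → Tape
  apply (s , m) = move m ∘ write s

  Test : Set
  Test = Symbol → Bool

  infixr 5 _⍮_

  data Cmd (n : ℕ) : Set where
    skip  : Cmd n
    push  : Vec Bool n → Bool → Cmd n
    pop   : Fin n → Cmd n
    _⍮_   : Cmd n → Cmd n → Cmd n
    case  : Fin n → Cmd n → Cmd n → Cmd n → Cmd n
    while : Fin n → Test → Cmd n → Cmd n

  Stacks : ℕ → Set
  Stacks = Vec Bits

  pushAll : ∀ {n} → Vec Bool n → Bool → Stacks n → Stacks n
  pushAll mask b = zipWith (λ m s → if m then b ∷ s else s) mask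

  popAt : ∀ {n} → Fin n → Stacks n → Stacks n
  popAt r σ = updateAt σ r (List.drop 1)

  choose : ∀ {A : Set} → Symbol → A → A → A → A
  choose nothing      a b c = a
  choose (just false) a b c = b
  choose (just true)  a b c = c

  infix 4 _∶_⇓[_]_

  data _∶_⇓[_]_ {n} : Cmd n → Stacks n → ℕ → Stacks n → Set where
    skip : ∀ {σ} → skip ∶ σ ⇓[ 1 ] σ
    push : ∀ {mask b σ} → push mask b ∶ σ ⇓[ 2 ] pushAll mask b σ
    pop  : ∀ {r σ} → pop r ∶ σ ⇓[ 1 ] popAt r σ
    _⍮_  : ∀ {P Q σ σ′ σ″ t t′} → P ∶ σ ⇓[ t ] σ′ → Q ∶ σ′ ⇓[ t′ ] σ″ →
           P ⍮ Q ∶ σ ⇓[ t + t′ ] σ″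
    case : ∀ {r P Q R σ σ′ t} → choose (top (lookup σ r)) P Q R ∶ σ ⇓[ t ] σ′ →
           case r P Q R ∶ σ ⇓[ suc t ] σ′
    stop : ∀ {r f P σ} → f (top (lookup σ r)) ≡ false →
           while r f P ∶ σ ⇓[ 1 ] σ
    loop : ∀ {r f P σ σ′ σ″ t t′} → f (top (lookup σ r)) ≡ true →
           P ∶ σ ⇓[ t ] σ′ → while r f P ∶ σ′ ⇓[ t′ ] σ″ →
           while r f P ∶ σ ⇓[ suc (t + t′) ] σ″

  ⇓-deterministic : ∀ {n} {P : Cmd n} {σ σ₁ σ₂ t₁ t₂} →
                    P ∶ σ ⇓[ t₁ ] σ₁ → P ∶ σ ⇓[ t₂ ] σ₂ → σ₁ ≡ σ₂
  ⇓-deterministic skip skip = refl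
  ⇓-deterministic push push = refl
  ⇓-deterministic pop pop = refl
  ⇓-deterministic (p ⍮ q) (p′ ⍮ q′) with refl ← ⇓-deterministic p p′ = ⇓-deterministic q q′
  ⇓-deterministic (case p) (case p′) = ⇓-deterministic p p′
  ⇓-deterministic (stop _) (stop _) = refl
  ⇓-deterministic (stop e) (loop e′ _ _) with () ← trans (sym e) e′
  ⇓-deterministic (loop e′ _ _) (stop e) with () ← trans (sym e) e′
  ⇓-deterministic (loop _ p q) (loop _ p′ q′) with refl ← ⇓-deterministic p p′ = ⇓-deterministic q q′

  module _ {n : ℕ} where

    controls : Cmd n → ℕ
    controls skip           = 1
    controls (push _ _)     = 2
    controls (pop _)        = 1
    controls (P ⍮ Q)        = controls P + controls Q
    controls (case _ P Q R) = suc (controls P + (controls Q + controls R))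
    controls (while _ _ P)  = suc (controls P)

    entry : ∀ P → Fin (controls P)
    entry skip           = zero
    entry (push _ _)     = zero
    entry (pop _)        = zero
    entry (P ⍮ Q)        = entry P ↑ˡ controls Q
    entry (case _ _ _ _) = zero
    entry (while _ _ _)  = zero

    Actions : Set
    Actions = Vec (Symbol × Move) n

    idle : Vec Symbol n → Actions
    idle = Vec.map (_, stay)

    masked : Vec Bool n → (Symbol → Symbol × Move) → Vec Symbol n → Actions
    masked mask f = zipWith (λ m s → if m then f s else (s , stay)) mask

    -- The control nothing leaves the program.
    δ-cmd : ∀ P → Fin (controls P) → Vec Symbol n → Actions × Maybe (Fin (controls P))
    δ-cmd skip zero h = idle h , nothing
    δ-cmd (push mask b) zero       h = masked mask (_, left) h , just (suc zero)
    δ-cmd (push mask b) (suc zero) h = masked mask (λ _ → just b , stay) h , nothing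
    δ-cmd (pop r) zero h = updateAt (idle h) r (λ _ → nothing , right) , nothing
    δ-cmd (P ⍮ Q) c h with splitAt (controls P) c
    ... | inj₁ p = let as , d = δ-cmd P p h in
                   as , just (Maybe.maybe′ (_↑ˡ controls Q) (controls P ↑ʳ entry Q) d)
    ... | inj₂ q = let as , d = δ-cmd Q q h in as , Maybe.map (controls P ↑ʳ_) d
    δ-cmd (case r P Q R) zero h = idle h , just (suc (choose (lookup h r)
      (entry P ↑ˡ _) (controls P ↑ʳ (entry Q ↑ˡ _)) (controls P ↑ʳ (controls Q ↑ʳ entry R))))
    δ-cmd (case r P Q R) (suc c) h with splitAt (controls P) c
    ... | inj₁ p = let as , d = δ-cmd P p h in as , Maybe.map (λ d → suc (d ↑ˡ _)) d
    ... | inj₂ c′ with splitAt (controls Q) c′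
    ...   | inj₁ q = let as , d = δ-cmd Q q h in as , Maybe.map (λ d → suc (controls P ↑ʳ (d ↑ˡ _))) d
    ...   | inj₂ q = let as , d = δ-cmd R q h in as , Maybe.map (λ d → suc (controls P ↑ʳ (controls Q ↑ʳ d))) d
    δ-cmd (while r f P) zero    h = idle h , (if f (lookup h r) then just (suc (entry P)) else nothing)
    δ-cmd (while r f P) (suc p) h = let as , d = δ-cmd P p h in as , just (Maybe.maybe′ suc zero d)

    data Runs (P : Cmd n) : Fin (controls P) → Vec Tape n → ℕ → Vec Tape n → Set where
      exit : ∀ {p ts as} → δ-cmd P p (Vec.map head ts) ≡ (as , nothing) →
             Runs P p ts 1 (zipWith apply as ts)
      step : ∀ {p p′ ts as t ts′} → δ-cmd P p (Vec.map head ts) ≡ (as , just p′) →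
             Runs P p′ (zipWith apply as ts) t ts′ → Runs P p ts (suc t) ts′

    -- A part P of Q placed by e; leaving P means going to d.
    record Embeds (P Q : Cmd n) (e : Fin (controls P) → Fin (controls Q)) (d : Maybe (Fin (controls Q))) : Set where
      constructor embeds
      field
        placed : ∀ p h → δ-cmd Q (e p) h ≡ (proj₁ (δ-cmd P p h) , Maybe.maybe′ (just ∘ e) d (proj₂ (δ-cmd P p h)))

    embed-next : ∀ {P Q e d} → Embeds P Q e d → ∀ {p h as p′} → δ-cmd P p h ≡ (as , p′) →
                 δ-cmd Q (e p) h ≡ (as , Maybe.maybe′ (just ∘ e) d p′)
    embed-next {e = e} {d} (embeds emb) {p} {h} eq =
      trans (emb p h) (cong (λ z → proj₁ z , Maybe.maybe′ (just ∘ e) d (proj₂ z)) eq)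

    embed-exit : ∀ {P Q e} → Embeds P Q e nothing → ∀ {p ts t ts′} →
                 Runs P p ts t ts′ → Runs Q (e p) ts t ts′
    embed-exit emb (exit eq)   = exit (embed-next emb eq)
    embed-exit emb (step eq r) = step (embed-next emb eq) (embed-exit emb r)

    embed-continue : ∀ {P Q e q} → Embeds P Q e (just q) → ∀ {p ts t ts′ t′ ts″} →
                     Runs P p ts t ts′ → Runs Q q ts′ t′ ts″ → Runs Q (e p) ts (t + t′) ts″
    embed-continue emb (exit eq)   r′ = step (embed-next emb eq) r′
    embed-continue emb (step eq r) r′ = step (embed-next emb eq) (embed-continue emb r r′)

    maybe-map : ∀ {A B : Set} (f : A → B) d → Maybe.map f d ≡ Maybe.maybe′ (just ∘ f) nothing d
    maybe-map f nothing  = refl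
    maybe-map f (just _) = refl

    maybe-just : ∀ {A B : Set} (f : A → B) z d → just (Maybe.maybe′ f z d) ≡ Maybe.maybe′ (just ∘ f) (just z) d
    maybe-just f z nothing  = refl
    maybe-just f z (just _) = refl

    record Represents (ts : Vec Tape n) (σ : Stacks n) : Set where
      constructor represents
      field
        at : ∀ r → Stack (lookup ts r) (lookup σ r)

    open Represents

    head-top : ∀ ts {σ} → Represents ts σ → ∀ r → lookup (Vec.map head ts) r ≡ top (lookup σ r)
    head-top ts rep r = trans (lookup-map r head ts) (stack-top (at rep r))

    idle-stays : ∀ ts → zipWith apply (idle (Vec.map head ts)) ts ≡ ts
    idle-stays ts = go ts
      where
      go : ∀ {m} (ts : Vec Tape m) → zipWith apply (Vec.map (_, stay) (Vec.map head ts)) ts ≡ ts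
      go []                = refl
      go (tape _ _ _ ∷ ts) = cong (_ ∷_) (go ts)

    represents-pop : ∀ {ts σ} r → Represents ts σ →
      Represents (zipWith apply (updateAt (idle (Vec.map head ts)) r (λ _ → nothing , right)) ts) (popAt r σ)
    represents-pop {ts} {σ} r rep .at i
      rewrite lookup-zipWith apply i (updateAt (idle (Vec.map head ts)) r (λ _ → nothing , right)) ts
      with i ≟ r
    ... | yes refl rewrite lookup∘updateAt i {λ _ → nothing , right} (idle (Vec.map head ts))
                         | lookup∘updateAt i {List.drop 1} σ = pop-stack (at rep i)
    ... | no i≢r rewrite lookup∘updateAt′ i r {λ _ → nothing , right} i≢r (idle (Vec.map head ts))
                       | lookup∘updateAt′ i r {List.drop 1} i≢r σ
                       | lookup-map i (_, stay) (Vec.map head ts)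
                       | lookup-map i head ts = at rep i

    represents-push : ∀ {ts σ} mask b → Represents ts σ →
      let ts₁ = zipWith apply (masked mask (_, left) (Vec.map head ts)) ts in
      Represents (zipWith apply (masked mask (λ _ → just b , stay) (Vec.map head ts₁)) ts₁) (pushAll mask b σ)
    represents-push {ts} {σ} mask b rep .at i
      rewrite lookup-zipWith apply i (masked mask (λ _ → just b , stay)
                (Vec.map head (zipWith apply (masked mask (_, left) (Vec.map head ts)) ts)))
                (zipWith apply (masked mask (_, left) (Vec.map head ts)) ts)
            | lookup-zipWith (λ m s → if m then (just b , stay) else (s , stay)) i mask
                (Vec.map head (zipWith apply (masked mask (_, left) (Vec.map head ts)) ts))
            | lookup-map i head (zipWith apply (masked mask (_, left) (Vec.map head ts)) ts)
            | lookup-zipWith apply i (masked mask (_, left) (Vec.map head ts)) ts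
            | lookup-zipWith (λ m s → if m then (s , left) else (s , stay)) i mask (Vec.map head ts)
            | lookup-map i head ts
            | lookup-zipWith (λ m s → if m then b ∷ s else s) i mask σ
      with lookup mask i
    ... | true  = push-stack b (at rep i)
    ... | false = at rep i

    splitˡ : ∀ P Q p → splitAt (controls P) (p ↑ˡ Q) ≡ inj₁ p
    splitˡ P Q p = splitAt-↑ˡ (controls P) p Q

    splitʳ : ∀ P Q (q : Fin Q) → splitAt (controls P) (controls P ↑ʳ q) ≡ inj₂ q
    splitʳ P Q q = splitAt-↑ʳ (controls P) Q q

    simulate : ∀ {P σ t σ′ ts} → P ∶ σ ⇓[ t ] σ′ → Represents ts σ →
               ∃[ ts′ ] Represents ts′ σ′ × Runs P (entry P) ts t ts′
    simulate {ts = ts} skip rep = ts , rep , subst (Runs skip zero ts 1) (idle-stays ts) (exit refl)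
    simulate (push {mask} {b}) rep = _ , represents-push mask b rep , step refl (exit refl)
    simulate (pop {r}) rep = _ , represents-pop r rep , exit refl
    simulate (_⍮_ {P} {Q} p q) rep =
      let ts₁ , rep₁ , r₁ = simulate p rep
          ts₂ , rep₂ , r₂ = simulate q rep₁
      in ts₂ , rep₂ , embed-continue in-P r₁
                        (embed-exit in-Q r₂)
      where
      in-P : Embeds P (P ⍮ Q) (_↑ˡ controls Q) (just (controls P ↑ʳ entry Q))
      in-P .Embeds.placed p h rewrite splitˡ P (controls Q) p = cong₂ _,_ refl (maybe-just _ _ (proj₂ (δ-cmd P p h)))
      in-Q : Embeds Q (P ⍮ Q) (controls P ↑ʳ_) nothing
      in-Q .Embeds.placed q h rewrite splitʳ P (controls Q) q = cong₂ _,_ refl (maybe-map _ (proj₂ (δ-cmd Q q h)))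
    simulate {ts = ts₀} (case {r} {P} {Q} {R} {σ} {σ′} {t} p) rep =
      let ts′ , rep′ , r₁ = simulate p rep
      in ts′ , rep′ , step refl (subst (λ ts → Runs C (suc (choose (lookup (Vec.map head ts₀) r) (entry P ↑ˡ _) (controls P ↑ʳ (entry Q ↑ˡ _)) (controls P ↑ʳ (controls Q ↑ʳ entry R)))) ts t ts′) (sym (idle-stays ts₀)) (branch _ (head-top ts₀ {σ} rep r) r₁))
      where
      C = case r P Q R
      in-P : Embeds P C (λ p → suc (p ↑ˡ _)) nothing
      in-P .Embeds.placed p h rewrite splitˡ P (controls Q + controls R) p = cong₂ _,_ refl (maybe-map _ (proj₂ (δ-cmd P p h)))
      in-Q : Embeds Q C (λ q → suc (controls P ↑ʳ (q ↑ˡ _))) nothing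
      in-Q .Embeds.placed q h rewrite splitʳ P (controls Q + controls R) (q ↑ˡ controls R) | splitˡ Q (controls R) q
        = cong₂ _,_ refl (maybe-map _ (proj₂ (δ-cmd Q q h)))
      in-R : Embeds R C (λ q → suc (controls P ↑ʳ (controls Q ↑ʳ q))) nothing
      in-R .Embeds.placed q h rewrite splitʳ P (controls Q + controls R) (controls Q ↑ʳ q) | splitʳ Q (controls R) q
        = cong₂ _,_ refl (maybe-map _ (proj₂ (δ-cmd R q h)))
      branch : ∀ s {s′} → s′ ≡ s → ∀ {ts ts′ t} →
        Runs (choose s P Q R) (entry (choose s P Q R)) ts t ts′ →
        Runs C (suc (choose s′ (entry P ↑ˡ _) (controls P ↑ʳ (entry Q ↑ˡ _)) (controls P ↑ʳ (controls Q ↑ʳ entry R)))) ts t ts′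
      branch nothing      refl = embed-exit in-P
      branch (just false) refl = embed-exit in-Q
      branch (just true)  refl = embed-exit in-R
    simulate {ts = ts} (stop {r} {f} {P} {σ} e) rep = ts , rep ,
      subst (Runs (while r f P) zero ts 1) (idle-stays ts)
        (exit (cong (λ b → _ , (if b then just (suc (entry P)) else nothing))
                    (trans (cong f (head-top ts {σ} rep r)) e)))
    simulate {ts = ts} (loop {r} {f} {P} {σ} {σ′} {σ″} {t} {t′} e p q) rep =
      let ts₁ , rep₁ , r₁ = simulate p rep
          ts₂ , rep₂ , r₂ = simulate q rep₁
      in ts₂ , rep₂ ,
         step (cong (λ b → _ , (if b then just (suc (entry P)) else nothing))
                    (trans (cong f (head-top ts {σ} rep r)) e))
              (subst (λ ts → Runs (while r f P) (suc (entry P)) ts (t + t′) ts₂) (sym (idle-stays ts))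
                (embed-continue in-P r₁ r₂))
      where
      in-P : Embeds P (while r f P) suc (just zero)
      in-P .Embeds.placed p h = cong₂ _,_ refl (maybe-just _ _ (proj₂ (δ-cmd P p h)))

  module _ {arity work : ℕ} (P : Cmd (arity + suc work)) where

    machine : Machine arity
    machine = record
      { states = suc (controls P)
      ; work   = work
      ; start  = suc (entry P)
      ; δ      = λ { zero    h → nothing
                   ; (suc p) h → let as , d = δ-cmd P p h in just (Maybe.maybe′ suc zero d , as) }
      }

    act≡apply : ∀ {m} (as : Vec (Symbol × Move) m) ts → zipWith (act machine) as ts ≡ zipWith apply as ts
    act≡apply []       []       = refl
    act≡apply (a ∷ as) (t ∷ ts) = cong (_ ∷_) (act≡apply as ts)

    runs⇒halts : ∀ {p ts t ts′} → Runs P p ts t ts′ →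
                 HaltsIn machine t (config (suc p) ts) (config zero ts′)
    runs⇒halts {p} {ts} (exit {as = as} eq) =
      next (trans (cong (λ z → just (config (Maybe.maybe′ suc zero (proj₂ z)) (zipWith (act machine) (proj₁ z) ts))) eq)
                  (cong (just ∘ config zero) (act≡apply as ts)))
           (halted refl)
    runs⇒halts {p} {ts} (step {p′ = p′} {as = as} eq r) =
      next (trans (cong (λ z → just (config (Maybe.maybe′ suc zero (proj₂ z)) (zipWith (act machine) (proj₁ z) ts))) eq)
                  (cong (just ∘ config (suc p′)) (act≡apply as ts)))
           (runs⇒halts r)

    initial-stacks : Vec Bits arity → Stacks (arity + suc work)
    initial-stacks xs = xs Vec.++ Vec.replicate (suc work) []

    initial-represents : ∀ xs → Represents (Config.store (initial machine xs)) (initial-stacks xs)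
    initial-represents xs .Represents.at r rewrite lookup-splitAt arity (Vec.map load xs) (Vec.replicate (suc work) blankTape) r
                                  | lookup-splitAt arity xs (Vec.replicate (suc work) []) r
      with splitAt arity r
    ... | inj₁ i rewrite lookup-map i load xs = load-stack _
    ... | inj₂ j rewrite lookup-replicate j blankTape | lookup-replicate {A = Bits} j [] = load-stack []

    polyTime : ∀ {f} p →
      (∀ xs → ∃[ t ] ∃[ σ ] t ≤ ⟦ p ⟧ (size xs) × P ∶ initial-stacks xs ⇓[ t ] σ × lookup σ (arity ↑ʳ zero) ≡ f xs) →
      PolyTime f
    polyTime p run = machine , p , λ xs →
      let t , σ , t≤ , r , eq = run xs
          ts , rep , r′ = simulate r (initial-represents xs)
      in t , config zero ts , t≤ , runs⇒halts r′ , trans (stack-contents (Represents.at rep (arity ↑ʳ zero))) eq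

module GuessingPrograms where

  open StackPrograms

  infixr 5 _⨟_
  infixr 4 _∣_

  data NProg (n : ℕ) : Set where
    ε     : NProg n
    push  : Vec Bool n → Bool → NProg n
    pop   : Fin n → Bool → NProg n
    empty : Fin n → NProg n
    _⨟_   : NProg n → NProg n → NProg n
    _∣_   : NProg n → NProg n → NProg n
    star  : NProg n → NProg n

  -- The list of bits records the nondeterministic choices.
  data Run {n} : NProg n → Stacks n → Bits → Stacks n → Set where
    ε     : ∀ {σ} → Run ε σ [] σ
    push  : ∀ {mask b σ} → Run (push mask b) σ [] (pushAll mask b σ)
    pop   : ∀ {r b bs σ} → lookup σ r ≡ b ∷ bs → Run (pop r b) σ [] (popAt r σ)
    empty : ∀ {r σ} → lookup σ r ≡ [] → Run (empty r) σ [] σ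
    _⨟_   : ∀ {P Q σ σ′ σ″ h h′} → Run P σ h σ′ → Run Q σ′ h′ σ″ → Run (P ⨟ Q) σ (h ++ h′) σ″
    this  : ∀ {P Q σ σ′ h} → Run P σ h σ′ → Run (P ∣ Q) σ (true ∷ h) σ′
    that  : ∀ {P Q σ σ′ h} → Run Q σ h σ′ → Run (P ∣ Q) σ (false ∷ h) σ′
    done  : ∀ {P σ} → Run (star P) σ (false ∷ []) σ
    more  : ∀ {P σ σ′ σ″ h h′} → Run P σ h σ′ → Run (star P) σ′ h′ σ″ →
            Run (star P) σ (true ∷ h ++ h′) σ″

  module _ {m : ℕ} where

    private
      C F O : Fin (4 + m)
      C = suc zero
      O = suc (suc zero)
      F = suc (suc (suc zero))

    reg : Fin (suc m) → Fin (4 + m)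
    reg zero    = zero
    reg (suc r) = suc (suc (suc (suc r)))

    -- The choices are read from tape 1, tape 2 is the output, and a nonempty
    -- tape 3 signals failure.
    join : Stacks (suc m) → Bits → Bits → Stacks (4 + m)
    join σ c f = Vec.head σ ∷ c ∷ [] ∷ f ∷ Vec.tail σ

    fail : Cmd (4 + m)
    fail = push (false ∷ false ∷ false ∷ true ∷ Vec.replicate m false) true

    pushAll-none : ∀ {k} b (σ : Stacks k) → pushAll (Vec.replicate k false) b σ ≡ σ
    pushAll-none b []      = refl
    pushAll-none b (s ∷ σ) = cong (s ∷_) (pushAll-none b σ)

    isTrue : Test
    isTrue (just true) = true
    isTrue _           = false

    compile : NProg (suc m) → Cmd (4 + m)
    compile ε             = skip
    compile (push mask b) = push (Vec.head mask ∷ false ∷ false ∷ false ∷ Vec.tail mask) b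
    compile (pop r false) = case (reg r) fail (pop (reg r)) fail
    compile (pop r true)  = case (reg r) fail fail (pop (reg r))
    compile (empty r)     = case (reg r) skip fail fail
    compile (P ⨟ Q)       = compile P ⍮ compile Q
    compile (P ∣ Q)       = case C fail (pop C ⍮ compile Q) (pop C ⍮ compile P)
    compile (star P)      = while C isTrue (pop C ⍮ compile P) ⍮ case C fail (pop C) fail

    rate : NProg (suc m) → ℕ
    rate ε          = 1
    rate (push _ _) = 2
    rate (pop _ _)  = 3
    rate (empty _)  = 3
    rate (P ⨟ Q)    = rate P + rate Q
    rate (P ∣ Q)    = 3 + (rate P + rate Q)
    rate (star P)   = 4 + rate P

    lookup-join : ∀ r σ c f → lookup (join σ c f) (reg r) ≡ lookup σ r
    lookup-join zero    (x ∷ σ) c f = refl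
    lookup-join (suc r) (x ∷ σ) c f = refl

    popAt-join : ∀ r σ c f → popAt (reg r) (join σ c f) ≡ join (popAt r σ) c f
    popAt-join zero    (x ∷ σ) c f = refl
    popAt-join (suc r) (x ∷ σ) c f = refl

    fails : ∀ σ {c f} → fail ∶ join σ c f ⇓[ 2 ] join σ c (true ∷ f)
    fails σ {c} {f} = subst (λ τ → fail ∶ join σ c f ⇓[ 2 ] (Vec.head σ ∷ c ∷ [] ∷ (true ∷ f) ∷ τ))
                              (pushAll-none true (Vec.tail σ)) push

    pops-choice : ∀ σ {b c f} → pop C ∶ join σ (b ∷ c) f ⇓[ 1 ] join σ c f
    pops-choice σ = pop

    pops : ∀ r σ {c f} → pop (reg r) ∶ join σ c f ⇓[ 1 ] join (popAt r σ) c f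
    pops r σ {c} {f} = subst (pop (reg r) ∶ join σ c f ⇓[ 1 ]_) (popAt-join r σ c f) pop

    pushes : ∀ mask b σ {c f} → compile (push mask b) ∶ join σ c f ⇓[ 2 ] join (pushAll mask b σ) c f
    pushes mask b σ {c} {f} =
      subst (λ z → compile (push mask b) ∶ join σ c f ⇓[ 2 ] z) (eq mask σ) push
      where
      eq : ∀ mask σ → pushAll (Vec.head mask ∷ false ∷ false ∷ false ∷ Vec.tail mask) b (join σ c f)
                    ≡ join (pushAll mask b σ) c f
      eq (_ ∷ _) (_ ∷ _) = refl

    on-top : ∀ r {P Q R : Cmd (4 + m)} σ {c f τ t s} → top (lookup σ r) ≡ s →
             choose s P Q R ∶ join σ c f ⇓[ t ] τ → case (reg r) P Q R ∶ join σ c f ⇓[ suc t ] τ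
    on-top r {P} {Q} {R} σ {c} {f} {τ} {t} e p =
      case (subst (λ s → choose s P Q R ∶ join σ c f ⇓[ t ] τ)
                  (sym (trans (cong top (lookup-join r σ c f)) e)) p)

    realise : ∀ {P σ h σ′} → Run P σ h σ′ → ∀ c f → ∃[ t ] compile P ∶ join σ (h ++ c) f ⇓[ t ] join σ′ c f
    realise ε c f = _ , skip
    realise (push {mask} {b} {σ}) c f = _ , pushes mask b σ
    realise (pop {r} {false} {σ = σ} e) c f = _ , on-top r σ (cong top e) (pops r σ)
    realise (pop {r} {true}  {σ = σ} e) c f = _ , on-top r σ (cong top e) (pops r σ)
    realise (empty {r} {σ} e) c f = _ , on-top r σ (cong top e) skip
    realise (_⨟_ {h = h} {h′} p q) c f rewrite ++-assoc h h′ c =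
      _ , proj₂ (realise p (h′ ++ c) f) ⍮ proj₂ (realise q c f)
    realise (this {σ = σ} p) c f = _ , case (pops-choice σ ⍮ proj₂ (realise p c f))
    realise (that {σ = σ} p) c f = _ , case (pops-choice σ ⍮ proj₂ (realise p c f))
    realise (done {σ = σ}) c f = _ , stop refl ⍮ case (pops-choice σ)
    realise (more {σ = σ} {h = h} {h′} p q) c f rewrite ++-assoc h h′ c with realise q c f
    ... | _ , (w ⍮ x) = _ , loop refl (pops-choice σ ⍮ proj₂ (realise p (h′ ++ c) f)) w ⍮ x

    record Outcome (P : Cmd (4 + m)) (σ : Stacks (suc m)) (c f : Bits)
                   (bound : Bits → ℕ) (Reached : Stacks (suc m) → Bits → Bits → Set) : Set where
      constructor outcome
      field
        {time}    : ℕ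
        final     : Stacks (suc m)
        used      : Bits
        {rest}    : Bits
        {failure} : Bits
        runs      : P ∶ join σ c f ⇓[ time ] join final rest failure
        consumed  : c ≡ used ++ rest
        in-time   : time ≤ bound used
        reached   : failure ≡ [] → f ≡ [] × Reached final used rest

    private
      seq-bound : ∀ {t t′ k k′} (u u′ : Bits) → t ≤ k * suc (length u) → t′ ≤ k′ * suc (length u′) →
                  t + t′ ≤ (k + k′) * suc (length (u ++ u′))
      seq-bound {t} {t′} {k} {k′} u u′ p q = begin
        t + t′                                                  ≤⟨ +-mono-≤ p q ⟩
        k * suc (length u) + k′ * suc (length u′)               ≤⟨ +-mono-≤ (*-monoʳ-≤ k (s≤s (m≤m+n _ (length u′)))) (*-monoʳ-≤ k′ (s≤s (m≤n+m _ (length u)))) ⟩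
        k * suc (length u + length u′) + k′ * suc (length u + length u′) ≡⟨ *-distribʳ-+ _ k k′ ⟨
        (k + k′) * suc (length u + length u′)                   ≡⟨ cong (λ z → (k + k′) * suc z) (length-++ u) ⟨
        (k + k′) * suc (length (u ++ u′))                       ∎
        where open ≤-Reasoning

      small : ∀ {t k} u → t ≤ k → t ≤ k * suc u
      small {k = k} u p = ≤-trans p (m≤m*n k (suc u))

      refuse : ∀ {A : Set} {f : Bits} → _≡_ {A = Bits} (true ∷ f) [] → A
      refuse ()

    explore : ∀ P σ c f → Outcome (compile P) σ c f (λ u → rate P * suc (length u)) (λ σ′ u _ → Run P σ u σ′)

    explore-while : ∀ P k σ c f → length c ≤ k →
      Outcome (while C isTrue (pop C ⍮ compile P)) σ c f (λ u → (2 + rate P) * length u + 1)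
        (λ σ′ u c′ → ∀ {h σ″} → Run (star P) σ′ h σ″ → Run (star P) σ (u ++ h) σ″)
    explore-while P k σ [] f _ = outcome σ [] (stop refl) refl (m≤n+m 1 ((2 + rate P) * 0)) λ e → e , λ r → r
    explore-while P k σ (false ∷ c) f _ = outcome σ [] (stop refl) refl (m≤n+m 1 ((2 + rate P) * 0)) λ e → e , λ r → r
    explore-while P (suc k) σ (true ∷ c) f (s≤s len) with explore P σ c f
    ... | outcome {t₁} σ₁ u₁ {c₁} p refl b₁ ok₁ with explore-while P k σ₁ c₁ _
            (≤-trans (≤-trans (m≤n+m (length c₁) (length u₁)) (≤-reflexive (sym (length-++ u₁)))) len)
    ... | outcome {t₂} σ₂ u₂ {c₂} q refl b₂ ok₂ =
      outcome σ₂ (true ∷ u₁ ++ u₂) (loop refl (pops-choice σ ⍮ p) q)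
        (cong (true ∷_) (sym (++-assoc u₁ u₂ c₂)))
        bound
        λ e → let e₁ , r₂ = ok₂ e ; e₀ , r₁ = ok₁ e₁ in
              e₀ , λ {h} r → subst (λ z → Run (star P) σ (true ∷ z) _) (sym (++-assoc u₁ u₂ h)) (more r₁ (r₂ r))
      where
      open ≤-Reasoning
      R = rate P
      bound : 1 + (1 + t₁ + t₂) ≤ (2 + R) * suc (length (u₁ ++ u₂)) + 1
      bound = begin
        1 + (1 + t₁ + t₂) ≤⟨ s≤s (s≤s (+-mono-≤ b₁ b₂)) ⟩
        2 + (R * suc (length u₁) + ((2 + R) * length u₂ + 1)) ≡⟨ +-assoc 2 (R * suc (length u₁)) ((2 + R) * length u₂ + 1) ⟨
        2 + R * suc (length u₁) + ((2 + R) * length u₂ + 1)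
          ≤⟨ +-monoˡ-≤ ((2 + R) * length u₂ + 1) (+-monoˡ-≤ (R * suc (length u₁)) (m≤m*n 2 (suc (length u₁)))) ⟩
        2 * suc (length u₁) + R * suc (length u₁) + ((2 + R) * length u₂ + 1)
          ≡⟨ cong (_+ ((2 + R) * length u₂ + 1)) (*-distribʳ-+ (suc (length u₁)) 2 R) ⟨
        (2 + R) * suc (length u₁) + ((2 + R) * length u₂ + 1) ≡⟨ +-assoc ((2 + R) * suc (length u₁)) ((2 + R) * length u₂) 1 ⟨
        (2 + R) * suc (length u₁) + (2 + R) * length u₂ + 1 ≡⟨ cong (_+ 1) (*-distribˡ-+ (2 + R) (suc (length u₁)) (length u₂)) ⟨
        (2 + R) * suc (length u₁ + length u₂) + 1 ≡⟨ cong (λ z → (2 + R) * suc z + 1) (length-++ u₁) ⟨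
        (2 + R) * suc (length (u₁ ++ u₂)) + 1 ∎

    explore ε σ c f = outcome σ [] skip refl ≤-refl λ e → e , ε
    explore (push mask b) σ c f = outcome _ [] (pushes mask b σ) refl ≤-refl λ e → e , push
    explore (pop r b) σ c f = go b (lookup σ r) refl
      where
      go : ∀ b s → lookup σ r ≡ s → Outcome (compile (pop r b)) σ c f (λ u → 3 * suc (length u)) (λ σ′ u _ → Run (pop r b) σ u σ′)
      go false []          e = outcome σ [] (on-top r σ (cong top e) (fails σ)) refl ≤-refl refuse
      go false (false ∷ _) e = outcome _ [] (on-top r σ (cong top e) (pops r σ)) refl (n≤1+n 2) λ z → z , pop e
      go false (true ∷ _)  e = outcome σ [] (on-top r σ (cong top e) (fails σ)) refl ≤-refl refuse
      go true  []          e = outcome σ [] (on-top r σ (cong top e) (fails σ)) refl ≤-refl refuse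
      go true  (false ∷ _) e = outcome σ [] (on-top r σ (cong top e) (fails σ)) refl ≤-refl refuse
      go true  (true ∷ _)  e = outcome _ [] (on-top r σ (cong top e) (pops r σ)) refl (n≤1+n 2) λ z → z , pop e
    explore (empty r) σ c f with lookup σ r in e
    ... | []        = outcome σ [] (on-top r σ (cong top e) skip) refl (n≤1+n 2) λ z → z , empty e
    ... | false ∷ _ = outcome σ [] (on-top r σ (cong top e) (fails σ)) refl ≤-refl refuse
    ... | true ∷ _  = outcome σ [] (on-top r σ (cong top e) (fails σ)) refl ≤-refl refuse
    explore (P ⨟ Q) σ c f with explore P σ c f
    ... | outcome σ₁ u₁ {c₁} {f₁} p refl b₁ ok₁ with explore Q σ₁ c₁ f₁
    ... | outcome σ₂ u₂ q refl b₂ ok₂ =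
      outcome σ₂ (u₁ ++ u₂) (p ⍮ q) (sym (++-assoc u₁ u₂ _)) (seq-bound {k = rate P} {rate Q} u₁ u₂ b₁ b₂)
        λ e → let e₁ , r₂ = ok₂ e ; e₀ , r₁ = ok₁ e₁ in e₀ , r₁ ⨟ r₂
    explore (P ∣ Q) σ [] f = outcome σ [] (case (fails σ)) refl (small {k = rate (P ∣ Q)} 0 (m≤m+n 3 _)) refuse
    explore (P ∣ Q) σ (true ∷ c) f with explore P σ c f
    ... | outcome {t} σ′ u p refl b ok = outcome σ′ (true ∷ u) (case (pops-choice σ ⍮ p)) refl
      (≤-trans (+-mono-≤ {2} {3 * suc (suc (length u))} (small (suc (length u)) (n≤1+n 2)) (≤-trans b (*-mono-≤ (m≤m+n (rate P) (rate Q)) (n≤1+n _))))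
               (≤-reflexive (sym (*-distribʳ-+ (suc (suc (length u))) 3 (rate P + rate Q)))))
      λ e → proj₁ (ok e) , this (proj₂ (ok e))
    explore (P ∣ Q) σ (false ∷ c) f with explore Q σ c f
    ... | outcome {t} σ′ u p refl b ok = outcome σ′ (false ∷ u) (case (pops-choice σ ⍮ p)) refl
      (≤-trans (+-mono-≤ {2} {3 * suc (suc (length u))} (small (suc (length u)) (n≤1+n 2)) (≤-trans b (*-mono-≤ (m≤n+m (rate Q) (rate P)) (n≤1+n _))))
               (≤-reflexive (sym (*-distribʳ-+ (suc (suc (length u))) 3 (rate P + rate Q)))))
      λ e → proj₁ (ok e) , that (proj₂ (ok e))
    explore (star P) σ c f with explore-while P (length c) σ c f ≤-refl
    ... | outcome {t} σ′ u {c′} {f′} w refl b ok = finish c′ w ok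
      where
      bound : ∀ v {s} → length u ≤ v → s ≤ 3 → t + s ≤ (4 + rate P) * suc v
      bound v {s} l d = begin
        t + s                              ≤⟨ +-mono-≤ b d ⟩
        (2 + rate P) * length u + 1 + 3    ≡⟨ +-assoc ((2 + rate P) * length u) 1 3 ⟩
        (2 + rate P) * length u + 4        ≤⟨ +-mono-≤ (*-mono-≤ (s≤s (s≤s (m≤n+m (rate P) 2))) l) (m≤m+n 4 (rate P)) ⟩
        (4 + rate P) * v + (4 + rate P)    ≡⟨ +-comm ((4 + rate P) * v) _ ⟩
        (4 + rate P) + (4 + rate P) * v    ≡⟨ *-suc (4 + rate P) v ⟨
        (4 + rate P) * suc v               ∎
        where open ≤-Reasoning
      finish : ∀ c′ → while C isTrue (pop C ⍮ compile P) ∶ join σ (u ++ c′) f ⇓[ t ] join σ′ c′ f′ →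
        (f′ ≡ [] → f ≡ [] × (∀ {h σ″} → Run (star P) σ′ h σ″ → Run (star P) σ (u ++ h) σ″)) →
        Outcome (compile (star P)) σ (u ++ c′) f (λ u → (4 + rate P) * suc (length u)) (λ σ′ u _ → Run (star P) σ u σ′)
      finish []          w ok = outcome σ′ u (w ⍮ case (fails σ′)) refl (bound (length u) ≤-refl ≤-refl) refuse
      finish (false ∷ c) w ok = outcome σ′ (u ++ false ∷ []) (w ⍮ case (pops-choice σ′)) (sym (++-assoc u (false ∷ []) c))
        (bound _ (≤-trans (m≤m+n (length u) 1) (≤-reflexive (sym (length-++ u)))) (s≤s (s≤s z≤n)))
        λ e → proj₁ (ok e) , proj₂ (ok e) done
      finish (true ∷ c)  w ok = outcome σ′ u (w ⍮ case (fails σ′)) refl (bound (length u) ≤-refl ≤-refl) refuse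

  guess⇒InNP : ∀ {m} (L : Language) (P : NProg (suc m)) p →
    (∀ x {h σ} → Run P (x ∷ Vec.replicate m []) h σ → L x) →
    (∀ x → L x → ∃[ h ] ∃[ σ ] length h ≤ ⟦ p ⟧ (length x) × Run P (x ∷ Vec.replicate m []) h σ) →
    InNP L
  guess⇒InNP {m} L P p sound complete =
    verify , polyTime program ((con (rate P) ⊗ (con 1 ⊕ var)) ⊕ con 3) runs , p , λ x → mk⇔ (to x) (from x)
    where
    program : Cmd (2 + suc (suc m))
    program = compile P ⍮
      case (suc (suc (suc zero))) (push (false ∷ false ∷ true ∷ false ∷ Vec.replicate m false) true) skip skip

    answer : Bits → Bits
    answer []      = true ∷ []
    answer (_ ∷ _) = []

    explored : ∀ x c → _
    explored x c = explore P (x ∷ Vec.replicate m []) c []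

    verify : Vec Bits 2 → Bits
    verify (x ∷ c ∷ []) = answer (Outcome.failure (explored x c))

    runs : ∀ xs → ∃[ t ] ∃[ σ ] t ≤ rate P * suc (size xs) + 3 ×
           program ∶ initial-stacks program xs ⇓[ t ] σ × lookup σ (suc (suc zero)) ≡ verify xs
    runs (x ∷ c ∷ []) with explore P (x ∷ Vec.replicate m []) c []
    ... | outcome {t} σ u {r} {f} run refl b _ = finish f run
      where
      bound : ∀ {s} → s ≤ 3 → t + s ≤ rate P * suc (length x + (length (u ++ r) + 0)) + 3
      bound s≤3 = +-mono-≤ (≤-trans b (*-monoʳ-≤ (rate P) (s≤s (≤-trans (m≤m+n (length u) (length r))
        (≤-trans (≤-reflexive (sym (length-++ u))) (≤-trans (m≤m+n _ 0) (m≤n+m _ (length x)))))))) s≤3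
      finish : ∀ f → compile P ∶ join (x ∷ Vec.replicate m []) (u ++ r) [] ⇓[ t ] join σ r f → ∃[ t ] ∃[ σ ] t ≤ _ ×
           program ∶ initial-stacks program (x ∷ (u ++ r) ∷ []) ⇓[ t ] σ × lookup σ (suc (suc zero)) ≡ answer f
      finish []          run = _ , _ , bound ≤-refl , run ⍮ case push , refl
      finish (false ∷ _) run = _ , _ , bound (s≤s (s≤s z≤n)) , run ⍮ case skip , refl
      finish (true ∷ _)  run = _ , _ , bound (s≤s (s≤s z≤n)) , run ⍮ case skip , refl

    to : ∀ x → L x → ∃[ c ] length c ≤ ⟦ p ⟧ (length x) × verify (x ∷ c ∷ []) ≡ true ∷ []
    to x l with complete x l
    ... | h , σ , len , run = h , len , cong answer (no-failure (explored x h))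
      where
      no-failure : (o : Outcome (compile P) (x ∷ Vec.replicate m []) h [] _ _) → Outcome.failure o ≡ []
      no-failure o = cong (λ τ → lookup τ (suc (suc (suc zero))))
        (⇓-deterministic (Outcome.runs o)
          (subst (λ h′ → compile P ∶ join (x ∷ Vec.replicate m []) h′ [] ⇓[ proj₁ (realise run [] []) ] join σ [] []) (++-identityʳ h)
            (proj₂ (realise run [] []))))

    from : ∀ x → ∃[ c ] length c ≤ ⟦ p ⟧ (length x) × verify (x ∷ c ∷ []) ≡ true ∷ [] → L x
    from x (c , _ , eq) = sound x (proj₂ (Outcome.reached o (accepted (Outcome.failure o) eq)))
      where
      o = explored x c
      accepted : ∀ f → answer f ≡ true ∷ [] → f ≡ []
      accepted [] _ = refl

module LoopPrograms where

  open StackPrograms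
  open import Data.Vec.Base using (updateAt)
  open import Data.List.Properties using (length-reverse)

  infixr 5 _⍮_

  data Gen (k : ℕ) : Set where
    skip : Gen k
    push : Fin k → Bool → Gen k
    pop  : Fin k → Gen k
    _⍮_  : Gen k → Gen k → Gen k
    case : Fin k → Gen k → Gen k → Gen k → Gen k
    for  : Gen k → Gen k → Gen k

  module _ {k : ℕ} where

    exec  : Gen k → Bits → Stacks k → Stacks k
    execs : Gen k → Gen k → Bits → Bits → Stacks k → Stacks k
    exec skip           x μ = μ
    exec (push r b)     x μ = updateAt μ r (b ∷_)
    exec (pop r)        x μ = popAt r μ
    exec (P ⍮ Q)        x μ = exec Q x (exec P x μ)
    exec (case r P Q R) x μ = choose (top (lookup μ r)) (exec P x μ) (exec Q x μ) (exec R x μ)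
    exec (for P Q)      x μ = execs P Q x x μ
    execs P Q x []          μ = μ
    execs P Q x (false ∷ y) μ = execs P Q x y (exec P x μ)
    execs P Q x (true ∷ y)  μ = execs P Q x y (exec Q x μ)

    depth : Gen k → ℕ
    depth (P ⍮ Q)        = depth P ⊔ depth Q
    depth (case _ P Q R) = depth P ⊔ (depth Q ⊔ depth R)
    depth (for P Q)      = suc (depth P ⊔ depth Q)
    depth _              = 0

    cost : Gen k → Poly
    cost skip           = con 1
    cost (push _ _)     = con 2
    cost (pop _)        = con 1
    cost (P ⍮ Q)        = cost P ⊕ cost Q
    cost (case _ P Q R) = con 1 ⊕ (cost P ⊕ (cost Q ⊕ cost R))
    cost (for P Q)      = ((con 15 ⊕ (cost P ⊕ cost Q)) ⊗ var) ⊕ con 3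

  unit : ∀ {n} → Fin n → Vec Bool n
  unit r = Vec.replicate _ false [ r ]≔ true

  pushAll-unit : ∀ {n} (r : Fin n) b σ → pushAll (unit r) b σ ≡ updateAt σ r (b ∷_)
  pushAll-unit zero    b (s ∷ σ) = cong (_ ∷_) (none σ)
    where
    none : ∀ {n} (σ : Stacks n) → pushAll (Vec.replicate n false) b σ ≡ σ
    none []      = refl
    none (s ∷ σ) = cong (s ∷_) (none σ)
  pushAll-unit (suc r) b (s ∷ σ) = cong (s ∷_) (pushAll-unit r b σ)

  updateAt-++ˡ : ∀ {A : Set} {m n} (xs : Vec A m) (ys : Vec A n) i f →
                 updateAt (xs Vec.++ ys) (i ↑ˡ n) f ≡ updateAt xs i f Vec.++ ys
  updateAt-++ˡ (x ∷ xs) ys zero    f = refl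
  updateAt-++ˡ (x ∷ xs) ys (suc i) f = cong (x ∷_) (updateAt-++ˡ xs ys i f)

  updateAt-++ʳ : ∀ {A : Set} {m n} (xs : Vec A m) (ys : Vec A n) i f →
                 updateAt (xs Vec.++ ys) (m ↑ʳ i) f ≡ xs Vec.++ updateAt ys i f
  updateAt-++ʳ []       ys i f = refl
  updateAt-++ʳ (x ∷ xs) ys i f = cong (x ∷_) (updateAt-++ʳ xs ys i f)

  -- Besides the stacks of the program there are the input, a scratch stack, and
  -- for each nesting depth the part of the input that a loop has yet to read.
  module Compilation (k D : ℕ) where

    N : ℕ
    N = suc (k + suc D)

    layout : Bits → Stacks k → Bits → Stacks D → Stacks N
    layout x μ s φ = x ∷ μ Vec.++ (s ∷ φ)

    data Place : Set where
      input scratch : Place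
      stack         : Fin k → Place
      unread        : Fin D → Place

    at : Place → Fin N
    at input      = zero
    at scratch    = suc (k ↑ʳ zero)
    at (stack r)  = suc (r ↑ˡ suc D)
    at (unread d) = suc (k ↑ʳ suc d)

    nonempty : Test
    nonempty nothing  = false
    nonempty (just _) = true

    drain : Place → (Bool → Cmd N) → Cmd N
    drain p P = while (at p) nonempty (case (at p) skip (pop (at p) ⍮ P false) (pop (at p) ⍮ P true))

    put : Place → Bool → Cmd N
    put p b = push (unit (at p)) b

    compile : ∀ P → depth P ≤ D → Cmd N
    compile skip d           = skip
    compile (push r b) d     = put (stack r) b
    compile (pop r) d        = pop (at (stack r))
    compile (P ⍮ Q) d        = compile P (m⊔n≤o⇒m≤o (depth P) _ d) ⍮ compile Q (m⊔n≤o⇒n≤o (depth P) _ d)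
    compile (case r P Q R) d =
      let e = m⊔n≤o⇒n≤o (depth P) _ d in
      case (at (stack r)) (compile P (m⊔n≤o⇒m≤o (depth P) _ d))
        (compile Q (m⊔n≤o⇒m≤o (depth Q) _ e)) (compile R (m⊔n≤o⇒n≤o (depth Q) _ e))
    compile (for P Q) d =
      drain input (put scratch) ⍮
      drain scratch (λ b → put input b ⍮ put (unread (fromℕ< d)) b) ⍮
      drain (unread (fromℕ< d)) (λ b → if b then compile Q (m⊔n≤o⇒n≤o (depth P) _ (<⇒≤ d))
                                            else compile P (m⊔n≤o⇒m≤o (depth P) _ (<⇒≤ d)))

    drains : ∀ {A : Set} {p P} (σ : Bits → A → Stacks N) (f : Bool → A → A) n →
      (∀ y a → lookup (σ y a) (at p) ≡ y) →
      (∀ b y a → popAt (at p) (σ (b ∷ y) a) ≡ σ y a) →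
      (∀ b y a → ∃[ t ] t ≤ n × P b ∶ σ y a ⇓[ t ] σ y (f b a)) →
      ∀ y a → ∃[ t ] t ≤ (3 + n) * length y + 1 × drain p P ∶ σ y a ⇓[ t ] σ [] (List.foldl (λ a b → f b a) a y)
    drains σ f n e u h [] a = 1 , m≤n+m 1 ((3 + n) * 0) , stop (cong (nonempty ∘′ top) (e [] a))
    drains {p = p} {P} σ f n e u h (b ∷ y) a =
      let t , t≤ , r = h b y a
          t′ , t′≤ , r′ = drains σ f n e u h y (f b a)
      in _ , bound t≤ t′≤ , loop (cong (nonempty ∘′ top) (e (b ∷ y) a)) (body b r) r′
      where
      bound : ∀ {t t′} → t ≤ n → t′ ≤ (3 + n) * length y + 1 → suc (suc (suc t) + t′) ≤ (3 + n) * suc (length y) + 1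
      bound {t} {t′} p q = begin
        3 + t + t′                             ≤⟨ +-mono-≤ (+-monoʳ-≤ 3 p) q ⟩
        (3 + n) + ((3 + n) * length y + 1)     ≡⟨ +-assoc (3 + n) _ 1 ⟨
        (3 + n) + (3 + n) * length y + 1       ≡⟨ cong (_+ 1) (*-suc (3 + n) (length y)) ⟨
        (3 + n) * suc (length y) + 1           ∎
        where open ≤-Reasoning
      pops : ∀ b → pop (at p) ∶ σ (b ∷ y) a ⇓[ 1 ] σ y a
      pops b = subst (pop (at p) ∶ σ (b ∷ y) a ⇓[ 1 ]_) (u b y a) pop
      body : ∀ b {t} → P b ∶ σ y a ⇓[ t ] σ y (f b a) →
             case (at p) skip (pop (at p) ⍮ P false) (pop (at p) ⍮ P true) ∶ σ (b ∷ y) a ⇓[ suc (suc t) ] σ y (f b a)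
      body b r = case (subst (λ s → choose s skip (pop (at p) ⍮ P false) (pop (at p) ⍮ P true) ∶ _ ⇓[ _ ] _)
                       (sym (cong top (e (b ∷ y) a))) (branch b r))
        where
        branch : ∀ b {t} → P b ∶ σ y a ⇓[ t ] σ y (f b a) →
          choose (just b) skip (pop (at p) ⍮ P false) (pop (at p) ⍮ P true) ∶ σ (b ∷ y) a ⇓[ suc t ] σ y (f b a)
        branch false r = pops false ⍮ r
        branch true  r = pops true ⍮ r

    module _ {x : Bits} {μ : Stacks k} {s : Bits} {φ : Stacks D} where

      update-stack : ∀ r f → updateAt (layout x μ s φ) (at (stack r)) f ≡ layout x (updateAt μ r f) s φ
      update-stack r f = cong (x ∷_) (updateAt-++ˡ μ (s ∷ φ) r f)

      update-scratch : ∀ f → updateAt (layout x μ s φ) (at scratch) f ≡ layout x μ (f s) φ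
      update-scratch f = cong (x ∷_) (updateAt-++ʳ μ (s ∷ φ) zero f)

      update-unread : ∀ d f → updateAt (layout x μ s φ) (at (unread d)) f ≡ layout x μ s (updateAt φ d f)
      update-unread d f = cong (x ∷_) (updateAt-++ʳ μ (s ∷ φ) (suc d) f)

      puts : ∀ {σ} p b → updateAt (layout x μ s φ) (at p) (b ∷_) ≡ σ → put p b ∶ layout x μ s φ ⇓[ 2 ] σ
      puts p b refl = subst (put p b ∶ layout x μ s φ ⇓[ 2 ]_) (pushAll-unit (at p) b (layout x μ s φ)) push

    set-updateAt : ∀ d y (φ : Stacks D) f → updateAt (φ [ d ]≔ y) d f ≡ φ [ d ]≔ f y
    set-updateAt d y φ f = updateAt-updateAt d φ

    Fresh : ℕ → Stacks D → Set
    Fresh d φ = ∀ i → toℕ i < d → lookup φ i ≡ []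

    private

      foldl-pair : ∀ (y z w : Bits) → List.foldl {A = Bits × Bits} (λ a b → b ∷ proj₁ a , b ∷ proj₂ a) (z , w) y
                   ≡ (y ʳ++ z , y ʳ++ w)
      foldl-pair []      z w = refl
      foldl-pair (b ∷ y) z w = foldl-pair y (b ∷ z) (b ∷ w)

      reverse-twice : ∀ (y : Bits) → (y ʳ++ []) ʳ++ [] ≡ y
      reverse-twice y = trans (ʳ++-ʳ++ y) (++-identityʳ y)

    runs : ∀ P d {x μ φ} → Fresh (depth P) φ →
           ∃[ t ] t ≤ ⟦ cost P ⟧ (length x) × compile P d ∶ layout x μ [] φ ⇓[ t ] layout x (exec P x μ) [] φ
    runs skip d _ = _ , ≤-refl , skip
    runs (push r b) d _ = _ , ≤-refl , puts (stack r) b (update-stack r _)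
    runs (pop r) d {x} {μ} {φ} _ = _ , ≤-refl , subst (pop (at (stack r)) ∶ layout x μ [] φ ⇓[ 1 ]_) (update-stack r _) pop
    runs (P ⍮ Q) d {x} {μ} fresh =
      let t , t≤ , p = runs P (m⊔n≤o⇒m≤o (depth P) _ d) (λ i i< → fresh i (m≤n⇒m≤n⊔o (depth Q) i<))
          t′ , t′≤ , q = runs Q (m⊔n≤o⇒n≤o (depth P) _ d) (λ i i< → fresh i (m≤n⇒m≤o⊔n (depth P) i<))
      in _ , +-mono-≤ t≤ t′≤ , (p ⍮ q)
    runs (case r P Q R) d {x} {μ} {φ} fresh =
      let e = m⊔n≤o⇒n≤o (depth P) _ d
          t , t≤ , p = runs P (m⊔n≤o⇒m≤o (depth P) _ d) {x} {μ} (λ i i< → fresh i (m≤n⇒m≤n⊔o (depth Q ⊔ depth R) i<))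
          t′ , t′≤ , q = runs Q (m⊔n≤o⇒m≤o (depth Q) _ e) {x} {μ} (λ i i< → fresh i (m≤n⇒m≤o⊔n (depth P) (m≤n⇒m≤n⊔o (depth R) i<)))
          t″ , t″≤ , r′ = runs R (m⊔n≤o⇒n≤o (depth Q) _ e) {x} {μ} (λ i i< → fresh i (m≤n⇒m≤o⊔n (depth P) (m≤n⇒m≤o⊔n (depth Q) i<)))
          a = ⟦ cost P ⟧ (length x)
          b = ⟦ cost Q ⟧ (length x)
          c = ⟦ cost R ⟧ (length x)
          u , u≤ , v = branch {B = a + (b + c)} (top (lookup μ r))
                         (t , ≤-trans t≤ (m≤m+n a (b + c)) , p)
                         (t′ , ≤-trans t′≤ (≤-trans (m≤m+n b c) (m≤n+m (b + c) a)) , q)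
                         (t″ , ≤-trans t″≤ (≤-trans (m≤n+m c b) (m≤n+m (b + c) a)) , r′)
      in _ , s≤s u≤ ,
         case (subst (λ s → choose s _ _ _ ∶ layout x μ [] φ ⇓[ u ] layout x (exec (case r P Q R) x μ) [] φ) (sym (cong top (lookup-++ˡ μ ([] ∷ φ) r))) v)
      where
      branch : ∀ {B} s {P Q R : Cmd N} {p q r} →
        ∃[ t ] t ≤ B × P ∶ layout x μ [] φ ⇓[ t ] layout x p [] φ →
        ∃[ t ] t ≤ B × Q ∶ layout x μ [] φ ⇓[ t ] layout x q [] φ →
        ∃[ t ] t ≤ B × R ∶ layout x μ [] φ ⇓[ t ] layout x r [] φ →
        ∃[ t ] t ≤ B × choose s P Q R ∶ layout x μ [] φ ⇓[ t ] layout x (choose s p q r) [] φ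
      branch nothing      h _ _ = h
      branch (just false) _ h _ = h
      branch (just true)  _ _ h = h
    runs (for P Q) d {x} {μ} {φ} fresh =
      let t₁ , t₁≤ , r₁ = phase₁
          t₂ , t₂≤ , r₂ = phase₂
          t₃ , t₃≤ , r₃ = phase₃
      in _ , ≤-trans (+-mono-≤ t₁≤ (+-mono-≤ t₂≤ t₃≤)) (≤-reflexive (arith (length x) (a + b))) , r₁ ⍮ r₂ ⍮ r₃
      where
      f = fromℕ< d
      a = ⟦ cost P ⟧ (length x)
      b = ⟦ cost Q ⟧ (length x)
      arith : ∀ n c → ((3 + 2) * n + 1) + (((3 + 4) * n + 1) + ((3 + c) * n + 1)) ≡ (15 + c) * n + 3
      arith = solve-∀
      φ-fresh : φ [ f ]≔ [] ≡ φ
      φ-fresh = updateAt-id-local f φ (sym (fresh f (≤-reflexive (cong suc (toℕ-fromℕ< d)))))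
      phase₁ : ∃[ t ] t ≤ (3 + 2) * length x + 1 ×
               drain input (put scratch) ∶ layout x μ [] φ ⇓[ t ] layout [] μ (x ʳ++ []) φ
      phase₁ = drains {p = input} (λ y s → layout y μ s φ) (λ b s → b ∷ s) 2 (λ _ _ → refl) (λ _ _ _ → refl)
                 (λ b y s → 2 , ≤-refl , puts scratch b (update-scratch _)) x []
      phase₂ : ∃[ t ] t ≤ (3 + 4) * length x + 1 ×
               drain scratch (λ b → put input b ⍮ put (unread f) b) ∶ layout [] μ (x ʳ++ []) φ ⇓[ t ] layout x μ [] (φ [ f ]≔ x)
      phase₂ =
        let t , t≤ , r = drains {p = scratch} (λ y a → layout (proj₁ a) μ y (φ [ f ]≔ proj₂ a)) (λ b a → b ∷ proj₁ a , b ∷ proj₂ a) 4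
                           (λ y a → lookup-++ʳ μ (y ∷ _) zero) (λ _ _ _ → update-scratch _)
                           (λ b y a → 4 , ≤-refl , puts input b refl ⍮ puts (unread f) b (trans (update-unread f _) (cong (layout _ μ y) (set-updateAt f _ φ _))))
                           (x ʳ++ []) ([] , [])
        in t , subst (λ n → t ≤ 7 * n + 1) (length-reverse x) t≤ ,
           subst₂ (λ σ τ → drain scratch (λ b → put input b ⍮ put (unread f) b) ∶ layout [] μ (x ʳ++ []) σ ⇓[ t ] τ)
             φ-fresh
             (trans (cong (λ a → layout (proj₁ a) μ [] (φ [ f ]≔ proj₂ a)) (foldl-pair (x ʳ++ []) [] []))
                    (cong (λ z → layout z μ [] (φ [ f ]≔ z)) (reverse-twice x)))
             r
      Body : Bool → Cmd N
      Body b = if b then compile Q (m⊔n≤o⇒n≤o (depth P) _ (<⇒≤ d)) else compile P (m⊔n≤o⇒m≤o (depth P) _ (<⇒≤ d))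
      body : ∀ b → Stacks k → Stacks k
      body false = exec P x
      body true  = exec Q x
      still-fresh : ∀ {y} e → e ≤ depth P ⊔ depth Q → Fresh e (φ [ f ]≔ y)
      still-fresh e e≤ i i< =
        trans (lookup∘updateAt′ i f (λ { refl → <-irrefl (toℕ-fromℕ< d) (≤-trans i< e≤) }) φ)
              (fresh i (m≤n⇒m≤1+n (≤-trans i< e≤)))
      body-runs : ∀ b′ y μ → ∃[ t ] t ≤ a + b × Body b′ ∶ layout x μ [] (φ [ f ]≔ y) ⇓[ t ] layout x (body b′ μ) [] (φ [ f ]≔ y)
      body-runs false y μ = let t , t≤ , r = runs P _ (still-fresh _ (m≤m⊔n _ _)) in t , ≤-trans t≤ (m≤m+n a b) , r
      body-runs true  y μ = let t , t≤ , r = runs Q _ (still-fresh _ (m≤n⊔m _ _)) in t , ≤-trans t≤ (m≤n+m b a) , r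
      foldl-execs : ∀ y μ → List.foldl (λ μ b → body b μ) μ y ≡ execs P Q x y μ
      foldl-execs []          μ = refl
      foldl-execs (false ∷ y) μ = foldl-execs y _
      foldl-execs (true ∷ y)  μ = foldl-execs y _
      phase₃ : ∃[ t ] t ≤ (3 + (a + b)) * length x + 1 ×
               drain (unread f) Body ∶ layout x μ [] (φ [ f ]≔ x) ⇓[ t ] layout x (execs P Q x x μ) [] φ
      phase₃ =
        let t , t≤ , r = drains {p = unread f} (λ y μ → layout x μ [] (φ [ f ]≔ y)) body (a + b)
                           (λ y μ → trans (lookup-++ʳ μ ([] ∷ (φ [ f ]≔ y)) (suc f)) (lookup∘updateAt f φ))
                           (λ b y μ → trans (update-unread f _) (cong (layout x μ []) (set-updateAt f _ φ _)))
                           body-runs x μ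
        in t , t≤ , subst (drain (unread f) Body ∶ layout x μ [] (φ [ f ]≔ x) ⇓[ t ]_)
                      (cong₂ (λ μ φ → layout x μ [] φ) (foldl-execs x μ) φ-fresh) r

  generates⇒PolyTime : ∀ {k} (P : Gen (suc k)) →
    PolyTime {1} (λ xs → Vec.head (exec P (Vec.head xs) (Vec.replicate (suc k) [])))
  generates⇒PolyTime {k} P = polyTime (compile P ≤-refl) (cost P) go
    where
    open Compilation (suc k) (depth P)
    replicate-++ : ∀ m n → Vec.replicate {A = Bits} m [] Vec.++ Vec.replicate n [] ≡ Vec.replicate (m + n) []
    replicate-++ zero    n = refl
    replicate-++ (suc m) n = cong ([] ∷_) (replicate-++ m n)
    head-++ : ∀ {m n} (μ : Stacks (suc m)) {ν : Stacks n} → lookup (μ Vec.++ ν) zero ≡ Vec.head μ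
    head-++ (_ ∷ _) = refl
    go : ∀ xs → ∃[ t ] ∃[ σ ] t ≤ ⟦ cost P ⟧ (size xs) ×
         compile P ≤-refl ∶ initial-stacks (compile P ≤-refl) xs ⇓[ t ] σ ×
         lookup σ (suc zero) ≡ Vec.head (exec P (Vec.head xs) (Vec.replicate (suc k) []))
    go (x ∷ []) =
      let t , t≤ , r = runs P ≤-refl {x} {Vec.replicate (suc k) []} {Vec.replicate (depth P) []} (λ i _ → lookup-replicate i [])
      in t , layout x (exec P x (Vec.replicate (suc k) [])) [] (Vec.replicate (depth P) []) ,
         ≤-trans t≤ (≤-reflexive (cong ⟦ cost P ⟧ (sym (+-identityʳ (length x))))) ,
         subst (λ σ → compile P ≤-refl ∶ x ∷ σ ⇓[ t ] layout x (exec P x (Vec.replicate (suc k) [])) [] (Vec.replicate (depth P) [])) (replicate-++ (suc k) (suc (depth P))) r ,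
         head-++ (exec P x (Vec.replicate (suc k) []))

module Selections where

  open import Data.Fin.Subset using (_∈_)
  open import Data.Fin.Properties using (_≟_)

  module N = Sum ℕ.+-0-commutativeMonoid
  module Q = Sum ℚ.+-0-commutativeMonoid

  ∑ : ∀ {n} → (Fin n → ℕ) → ℕ
  ∑ = N.sum

  infix 8 _∙_

  _∙_ : Bool → ℕ → ℕ
  b ∙ x = if b then x else 0

  ∑-mono : ∀ {n} {f g : Fin n → ℕ} → (∀ i → f i ≤ g i) → ∑ f ≤ ∑ g
  ∑-mono {zero}  h = z≤n
  ∑-mono {suc n} h = ℕ.+-mono-≤ (h zero) (∑-mono (h ∘ suc))

  prefix-sum : ∀ {A : Set} {_⊞_ : A → A → A} {0# : A} → (∀ x → 0# ⊞ x ≡ x) →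
    ∀ {k n} (k≤n : k ≤ n) (f : Fin n → A) →
    Vector.foldr _⊞_ 0# {k} (λ t → f (inject≤ t k≤n)) ≡ Vector.foldr _⊞_ 0# {n} (λ t → if toℕ t <ᵇ k then f t else 0#)
  prefix-sum id {zero}  {zero}  k≤n f = refl
  prefix-sum id {zero}  {suc n} k≤n f = trans (prefix-sum id {zero} {n} z≤n (f ∘ suc)) (sym (id _))
  prefix-sum {_⊞_ = _⊞_} id {suc k} {suc n} (s≤s k≤n) f = cong (f zero ⊞_) (prefix-sum id k≤n (f ∘ suc))

  ι : ℕ → ℚ
  ι k = ℤ.+ k ℚ./ 1

  ι-≃ : ∀ k → toℚᵘ (ι k) ℚᵘ.≃ mkℚᵘ (ℤ.+ k) 0
  ι-≃ k = ℚ.toℚᵘ-fromℚᵘ (mkℚᵘ (ℤ.+ k) 0)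

  ι-+ : ∀ a b → ι (a + b) ≡ ι a ℚ.+ ι b
  ι-+ a b = ℚ.toℚᵘ-injective (begin
    toℚᵘ (ι (a + b))                    ≈⟨ ι-≃ (a + b) ⟩
    mkℚᵘ (ℤ.+ (a + b)) 0                  ≈⟨ *≡* (cong (ℤ._* ℤ.+ 1) (sym (cong₂ ℤ._+_ (ℤ.*-identityʳ (ℤ.+ a)) (ℤ.*-identityʳ (ℤ.+ b))))) ⟩
    mkℚᵘ (ℤ.+ a) 0 ℚᵘ.+ mkℚᵘ (ℤ.+ b) 0      ≈⟨ ℚᵘ.+-cong (ι-≃ a) (ι-≃ b) ⟨
    toℚᵘ (ι a) ℚᵘ.+ toℚᵘ (ι b)          ≈⟨ ℚ.toℚᵘ-homo-+ (ι a) (ι b) ⟨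
    toℚᵘ (ι a ℚ.+ ι b)                  ∎)
    where open import Relation.Binary.Reasoning.Setoid ℚᵘ.≃-setoid

  ι-cancel-< : ∀ {a b} → ι a ℚ.< ι b → a < b
  ι-cancel-< {a} {b} p with ℚᵘ.<-respˡ-≃ (ι-≃ a) (ℚᵘ.<-respʳ-≃ (ι-≃ b) (ℚ.toℚᵘ-mono-< p))
  ... | *<* q rewrite ℤ.*-identityʳ (ℤ.+ a) | ℤ.*-identityʳ (ℤ.+ b) = ℤ.drop‿+<+ q

  ι-mono-≤ : ∀ {a b} → a ≤ b → ι a ℚ.≤ ι b
  ι-mono-≤ {a} {b} p = ℚ.toℚᵘ-cancel-≤ (ℚᵘ.≤-respˡ-≃ (ℚᵘ.≃-sym (ι-≃ a)) (ℚᵘ.≤-respʳ-≃ (ℚᵘ.≃-sym (ι-≃ b))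
    (*≤* (subst₂ ℤ._≤_ (sym (ℤ.*-identityʳ (ℤ.+ a))) (sym (ℤ.*-identityʳ (ℤ.+ b))) (ℤ.+≤+ p)))))

  ι-∑ : ∀ {n} (f : Fin n → ℕ) → ι (∑ f) ≡ Q.sum (ι ∘ f)
  ι-∑ {zero}  f = refl
  ι-∑ {suc n} f = trans (ι-+ (f zero) _) (cong (ι (f zero) ℚ.+_) (ι-∑ (f ∘ suc)))

  seq-sum : ∀ {n} (f : Fin n → ℝ) k → seq (sumᴿ f) k ≡ Q.sum (λ i → seq (f i) k)
  seq-sum {zero}  f k = refl
  seq-sum {suc n} f k = cong (seq (f zero) k ℚ.+_) (seq-sum (f ∘ suc) k)

  Q-mono : ∀ {n} {f g : Fin n → ℚ} → (∀ i → f i ℚ.≤ g i) → Q.sum f ℚ.≤ Q.sum g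
  Q-mono {zero}  h = ℚ.≤-refl
  Q-mono {suc n} h = ℚ.+-mono-≤ (h zero) (Q-mono (h ∘ suc))

  infixr 8 _∙ℚ_

  _∙ℚ_ : Bool → ℚ → ℚ
  b ∙ℚ x = if b then x else 0ℚ

  ∙ℚ-sum : ∀ b {n} (f : Fin n → ℚ) → Q.sum (λ i → b ∙ℚ f i) ≡ b ∙ℚ Q.sum f
  ∙ℚ-sum true  f     = refl
  ∙ℚ-sum false {n} f = Q.sum-replicate-zero n

  open Mult ℚ.+-0-monoid using () renaming (_×_ to _·_; ×-assocˡ to ·-assocˡ; ×-homo-+ to ·-homo-+; ×-congˡ to ·-congˡ; ×-congʳ to ·-congʳ)

  p≤q+p : ∀ {p q} → 0ℚ ℚ.≤ q → p ℚ.≤ q ℚ.+ p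
  p≤q+p {p} 0≤q = ℚ.≤-trans (ℚ.≤-reflexive (sym (ℚ.+-identityˡ p))) (ℚ.+-monoˡ-≤ p 0≤q)

  p≤p+q : ∀ p {q} → 0ℚ ℚ.≤ q → p ℚ.≤ p ℚ.+ q
  p≤p+q p 0≤q = ℚ.≤-trans (ℚ.≤-reflexive (sym (ℚ.+-identityʳ p))) (ℚ.+-monoʳ-≤ p 0≤q)

  +-nonneg : ∀ {p q} → 0ℚ ℚ.≤ p → 0ℚ ℚ.≤ q → 0ℚ ℚ.≤ p ℚ.+ q
  +-nonneg 0≤p 0≤q = ℚ.≤-trans 0≤q (p≤q+p 0≤p)

  ·-nonneg : ∀ k {p} → 0ℚ ℚ.≤ p → 0ℚ ℚ.≤ k · p
  ·-nonneg zero    0≤p = ℚ.≤-refl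
  ·-nonneg (suc k) 0≤p = +-nonneg 0≤p (·-nonneg k 0≤p)

  sum-nonneg : ∀ {n} (f : Fin n → ℚ) → (∀ i → 0ℚ ℚ.≤ f i) → 0ℚ ℚ.≤ Q.sum f
  sum-nonneg {zero}  f h = ℚ.≤-refl
  sum-nonneg {suc n} f h = +-nonneg (h zero) (sum-nonneg (f ∘ suc) (h ∘ suc))

  sum-+-const : ∀ {n} (f : Fin n → ℚ) c → Q.sum (λ i → f i ℚ.+ c) ≡ Q.sum f ℚ.+ n · c
  sum-+-const {n} f c = trans (Q.∑-distrib-+ f (λ _ → c)) (cong (Q.sum f ℚ.+_) (Q.sum-replicate n))

  fraction : ∀ k → ∃[ ε ] 0ℚ ℚ.< ε × suc k · ε ≡ 1ℚ
  fraction k = ℚ.1/ r , ℚ.positive⁻¹ (ℚ.1/ r) {{ℚ.1/pos⇒pos r}} ,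
    trans (cong (suc k ·_) (sym (ℚ.*-identityˡ (ℚ.1/ r))))
          (trans (sym (S.×-assoc-* (suc k) 1ℚ (ℚ.1/ r))) (ℚ.*-inverseʳ r))
    where
    module S = SemiringMult (CommutativeRing.semiring ℚ.+-*-commutativeRing)
    r : ℚ
    r = suc k · 1ℚ
    instance
      r-pos : ℚ.Positive r
      r-pos = ℚ.positive (ℚ.<-≤-trans (ℚ.positive⁻¹ 1ℚ) (p≤p+q 1ℚ (·-nonneg k (ℚ.<⇒≤ (ℚ.positive⁻¹ 1ℚ)))))
      r-nonzero : ℚ.NonZero r
      r-nonzero = ℚ.pos⇒nonZero r

  -- In every instance, the errors ε add up to a multiple of ε that is
  -- independent of the values.
  approximate-cut : ∀ {n T} (x : Fin n → Fin T → ℚ) (w : Fin n → ℕ) (m : Fin T → ℕ)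
    (S : Fin n → Bool) (P : Fin T → Bool) (d : Fin n → ℕ) {ε} → 0ℚ ℚ.< ε →
    (∀ i t → 0ℚ ℚ.< x i t ℚ.+ ε) →
    (∀ t → Q.sum (λ i → x i t) ℚ.< ι (m t) ℚ.+ ε) →
    (∀ i → S i ≡ true → ι (w i) ℚ.< Q.sum (λ t → (toℕ t <ᵇ d i) ∙ℚ x i t) ℚ.+ ε) →
    (∀ i t → S i ≡ true → (toℕ t <ᵇ d i) ≡ true → P t ≡ true ⊎ x i t ℚ.< 0ℚ ℚ.+ ε) →
    ι (∑ λ i → S i ∙ w i) ℚ.≤ ι (∑ λ t → P t ∙ m t) ℚ.+ (T * suc n + (n * (T * 2) + n)) · ε
  approximate-cut {n} {T} x w m S P d {ε} 0<ε nonneg supplied served cover = begin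
    ι (∑ λ i → S i ∙ w i)
      ≡⟨ ι-∑ (λ i → S i ∙ w i) ⟩
    Q.sum (λ i → ι (S i ∙ w i))
      ≤⟨ Q-mono each ⟩
    Q.sum (λ i → Q.sum (λ t → P t ∙ℚ y i t ℚ.+ 2 · ε) ℚ.+ ε)
      ≡⟨ sum-+-const (λ i → Q.sum (λ t → P t ∙ℚ y i t ℚ.+ 2 · ε)) ε ⟩
    Q.sum (λ i → Q.sum (λ t → P t ∙ℚ y i t ℚ.+ 2 · ε)) ℚ.+ n · ε
      ≡⟨ cong (ℚ._+ n · ε) (Q.sum-cong-≗ (λ i → sum-+-const (λ t → P t ∙ℚ y i t) (2 · ε))) ⟩
    Q.sum (λ i → Q.sum (λ t → P t ∙ℚ y i t) ℚ.+ T · (2 · ε)) ℚ.+ n · ε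
      ≡⟨ cong (ℚ._+ n · ε) (sum-+-const (λ i → Q.sum (λ t → P t ∙ℚ y i t)) (T · (2 · ε))) ⟩
    (Q.sum (λ i → Q.sum (λ t → P t ∙ℚ y i t)) ℚ.+ n · (T · (2 · ε))) ℚ.+ n · ε
      ≡⟨ cong (λ z → (z ℚ.+ n · (T · (2 · ε))) ℚ.+ n · ε) (Q.∑-comm (λ i t → P t ∙ℚ y i t)) ⟩
    (Q.sum (λ t → Q.sum (λ i → P t ∙ℚ y i t)) ℚ.+ n · (T · (2 · ε))) ℚ.+ n · ε
      ≤⟨ ℚ.+-monoˡ-≤ (n · ε) (ℚ.+-monoˡ-≤ (n · (T · (2 · ε))) (Q-mono column)) ⟩
    (Q.sum (λ t → ι (P t ∙ m t) ℚ.+ suc n · ε) ℚ.+ n · (T · (2 · ε))) ℚ.+ n · ε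
      ≡⟨ cong (λ z → (z ℚ.+ n · (T · (2 · ε))) ℚ.+ n · ε) (trans (sum-+-const (λ t → ι (P t ∙ m t)) (suc n · ε)) (cong (ℚ._+ T · (suc n · ε)) (sym (ι-∑ (λ t → P t ∙ m t))))) ⟩
    ((M ℚ.+ T · (suc n · ε)) ℚ.+ n · (T · (2 · ε))) ℚ.+ n · ε
      ≡⟨ cong₂ (λ a b → ((M ℚ.+ a) ℚ.+ b) ℚ.+ n · ε) (·-assocˡ ε T (suc n)) (trans (cong (n ·_) (·-assocˡ ε T 2)) (·-assocˡ ε n (T * 2))) ⟩
    ((M ℚ.+ (T * suc n) · ε) ℚ.+ (n * (T * 2)) · ε) ℚ.+ n · ε
      ≡⟨ trans (cong (ℚ._+ n · ε) (ℚ.+-assoc M _ _)) (ℚ.+-assoc M _ _) ⟩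
    M ℚ.+ (((T * suc n) · ε ℚ.+ (n * (T * 2)) · ε) ℚ.+ n · ε)
      ≡⟨ cong (M ℚ.+_) (trans (ℚ.+-assoc ((T * suc n) · ε) _ _) (trans (cong ((T * suc n) · ε ℚ.+_) (sym (·-homo-+ ε (n * (T * 2)) n))) (sym (·-homo-+ ε (T * suc n) _)))) ⟩
    M ℚ.+ (T * suc n + (n * (T * 2) + n)) · ε ∎
    where
    open ℚ.≤-Reasoning
    0≤ε = ℚ.<⇒≤ 0<ε
    M : ℚ
    M = ι (∑ λ t → P t ∙ m t)
    y : Fin n → Fin T → ℚ
    y i t = x i t ℚ.+ ε
    0≤y : ∀ i t → 0ℚ ℚ.≤ y i t
    0≤y i t = ℚ.<⇒≤ (nonneg i t)
    0≤Py : ∀ i t → 0ℚ ℚ.≤ P t ∙ℚ y i t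
    0≤Py i t with P t
    ... | true  = 0≤y i t
    ... | false = ℚ.≤-refl
    one : ∀ i t → S i ≡ true → (toℕ t <ᵇ d i) ∙ℚ x i t ℚ.≤ P t ∙ℚ y i t ℚ.+ 2 · ε
    one i t s with toℕ t <ᵇ d i in e
    ... | false = +-nonneg (0≤Py i t) (·-nonneg 2 0≤ε)
    ... | true with cover i t s e
    ...   | inj₁ p rewrite p = ℚ.≤-trans (p≤p+q (x i t) 0≤ε) (p≤p+q (y i t) (·-nonneg 2 0≤ε))
    ...   | inj₂ q = ℚ.≤-trans (ℚ.<⇒≤ q) (ℚ.+-mono-≤ (0≤Py i t) (p≤p+q ε (·-nonneg 1 0≤ε)))
    each : ∀ i → ι (S i ∙ w i) ℚ.≤ Q.sum (λ t → P t ∙ℚ y i t ℚ.+ 2 · ε) ℚ.+ ε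
    each i with S i in s
    ... | true  = ℚ.≤-trans (ℚ.<⇒≤ (served i s)) (ℚ.+-monoˡ-≤ ε (Q-mono (λ t → one i t s)))
    ... | false = +-nonneg (sum-nonneg _ λ t → +-nonneg (0≤Py i t) (·-nonneg 2 0≤ε)) 0≤ε
    column : ∀ t → Q.sum (λ i → P t ∙ℚ y i t) ℚ.≤ ι (P t ∙ m t) ℚ.+ suc n · ε
    column t rewrite ∙ℚ-sum (P t) (λ i → y i t) with P t
    ... | false = +-nonneg ℚ.≤-refl (·-nonneg (suc n) 0≤ε)
    ... | true  = begin
      Q.sum (λ i → y i t)                       ≡⟨ sum-+-const (λ i → x i t) ε ⟩
      Q.sum (λ i → x i t) ℚ.+ n · ε             ≤⟨ ℚ.+-monoˡ-≤ (n · ε) (ℚ.<⇒≤ (supplied t)) ⟩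
      (ι (m t) ℚ.+ ε) ℚ.+ n · ε                 ≡⟨ ℚ.+-assoc (ι (m t)) ε _ ⟩
      ι (m t) ℚ.+ suc n · ε                     ∎

  Eventually : (ℕ → Set) → Set
  Eventually P = ∃[ N ] ∀ k → N ≤ k → P k

  eventually-all : ∀ {n} {P : Fin n → ℕ → Set} → (∀ i → Eventually (P i)) → Eventually (λ k → ∀ i → P i k)
  eventually-all {zero}  h = 0 , λ _ _ ()
  eventually-all {suc n} {P} h =
    let N , p = h zero ; N′ , p′ = eventually-all (h ∘ suc) in
    N ⊔ N′ , λ { k le zero    → p k (ℕ.m⊔n≤o⇒m≤o N N′ le)
               ; k le (suc i) → p′ k (ℕ.m⊔n≤o⇒n≤o N N′ le) i }

  eventually-when : ∀ {A : Set} {P : ℕ → Set} → Dec A → (A → Eventually P) → Eventually (λ k → A → P k)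
  eventually-when (yes a) h = let N , p = h a in N , λ k le _ → p k le
  eventually-when (no ¬a) h = 0 , λ _ _ a → contradiction a ¬a

  module _ (I : Scheduling) where
    open Scheduling I
    open Agent
    open Feasible

    cut : ∀ {a} → Feasible I a → (S : Fin n → Bool) → (∀ i → S i ≡ true → fromNat (demand (agent i)) ≤ᴿ charge I a i) →
          (P : Fin periods → Bool) →
          (∀ i t → S i ≡ true → (toℕ t <ᵇ due (agent i)) ≡ true → P t ≡ true ⊎ t ∈ gaps (agent i)) →
          ∑ (λ i → S i ∙ demand (agent i)) ≤ ∑ (λ t → P t ∙ lookup supply t)
    cut {a} feasible S served P cover = ℕ.s≤s⁻¹ (ι-cancel-< (begin-strict
      ι (∑ λ i → S i ∙ demand (agent i))
        ≤⟨ approximate-cut (λ i t → seq (a i t) k) (demand ∘ agent) (lookup supply) S P (due ∘ agent) 0<ε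
             (λ i t → proj₂ e₁ k k₁ i t)
             (λ t → subst (ℚ._< ι (lookup supply t) ℚ.+ ε) (seq-sum (λ i → a i t) k) (proj₂ e₂ k k₂ t))
             (λ i s → subst (λ z → ι (demand (agent i)) ℚ.< z ℚ.+ ε) (trans (seq-sum (λ t → a i (inject≤ t (toℕ<n (deadline (agent i))))) k) (prefix-sum ℚ.+-identityˡ (toℕ<n (deadline (agent i))) (λ t → seq (a i t) k))) (proj₂ e₃ k k₃ i s))
             (λ i t s l → gapped (cover i t s l)) ⟩
      ι Σm ℚ.+ K · ε             <⟨ ℚ.+-monoʳ-< (ι Σm) Kε<1 ⟩
      ι Σm ℚ.+ 1ℚ                ≡⟨ ℚ.+-comm (ι Σm) 1ℚ ⟩
      ι 1 ℚ.+ ι Σm               ≡⟨ ι-+ 1 Σm ⟨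
      ι (suc Σm)                 ∎))
      where
      open ℚ.≤-Reasoning
      K = periods * suc n + (n * (periods * 2) + n)
      Σm = ∑ (λ t → P t ∙ lookup supply t)
      ε = proj₁ (fraction K)
      0<ε = proj₁ (proj₂ (fraction K))
      Kε<1 : K · ε ℚ.< 1ℚ
      Kε<1 = subst (K · ε ℚ.<_) (proj₂ (proj₂ (fraction K)))
               (subst (ℚ._< suc K · ε) (ℚ.+-identityˡ (K · ε)) (ℚ.+-monoˡ-< (K · ε) 0<ε))
      e₁ : Eventually (λ k → ∀ i t → 0ℚ ℚ.< seq (a i t) k ℚ.+ ε)
      e₁ = eventually-all λ i → eventually-all λ t → nonneg feasible i t ε 0<ε
      e₂ : Eventually (λ k → ∀ t → seq (sumᴿ (λ i → a i t)) k ℚ.< ι (lookup supply t) ℚ.+ ε)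
      e₂ = eventually-all λ t → supplied feasible t ε 0<ε
      e₃ : Eventually (λ k → ∀ i → S i ≡ true → ι (demand (agent i)) ℚ.< seq (charge I a i) k ℚ.+ ε)
      e₃ = eventually-all λ i → eventually-when (S i Bool.≟ true) λ s → served i s ε 0<ε
      e₄ : Eventually (λ k → ∀ i t → t ∈ gaps (agent i) → seq (a i t) k ℚ.< 0ℚ ℚ.+ ε)
      e₄ = eventually-all λ i → eventually-all λ t → eventually-when (t ∈? gaps (agent i)) λ g → proj₁ (gap feasible i t g) ε 0<ε
      k = (proj₁ e₁ ⊔ proj₁ e₂) ⊔ (proj₁ e₃ ⊔ proj₁ e₄)
      k₁ = ≤-trans (ℕ.m≤m⊔n (proj₁ e₁) (proj₁ e₂)) (ℕ.m≤m⊔n _ (proj₁ e₃ ⊔ proj₁ e₄))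
      k₂ = ≤-trans (ℕ.m≤n⊔m (proj₁ e₁) (proj₁ e₂)) (ℕ.m≤m⊔n _ (proj₁ e₃ ⊔ proj₁ e₄))
      k₃ = ≤-trans (ℕ.m≤m⊔n (proj₁ e₃) (proj₁ e₄)) (ℕ.m≤n⊔m (proj₁ e₁ ⊔ proj₁ e₂) _)
      k₄ = ≤-trans (ℕ.m≤n⊔m (proj₁ e₃) (proj₁ e₄)) (ℕ.m≤n⊔m (proj₁ e₁ ⊔ proj₁ e₂) _)
      gapped : ∀ {i t} → P t ≡ true ⊎ t ∈ gaps (agent i) → P t ≡ true ⊎ seq (a i t) k ℚ.< 0ℚ ℚ.+ ε
      gapped (inj₁ p) = inj₁ p
      gapped {i} {t} (inj₂ g) = inj₂ (proj₂ e₄ k k₄ i t g)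

    record Selection (V : ℤ) : Set where
      field
        selected : Fin n → Bool
        worth    : V ℤ.≤ ℤ.+ ∑ (λ i → selected i ∙ value (agent i))
        cuts     : ∀ (S : Fin n → Bool) → (∀ i → S i ≡ true → selected i ≡ true) → ∀ (P : Fin periods → Bool) →
                   (∀ i t → S i ≡ true → (toℕ t <ᵇ due (agent i)) ≡ true → P t ≡ true ⊎ t ∈ gaps (agent i)) →
                   ∑ (λ i → S i ∙ demand (agent i)) ≤ ∑ (λ t → P t ∙ lookup supply t)

    achievable⇒selection : ∀ {V} → Achievable (I , V) → Selection V
    achievable⇒selection (a , feasible , total , (u , obtains , refl) , V≤) = record
      { selected = sel
      ; worth    = subst (λ z → _ ℤ.≤ ℤ.+ z) (N.sum-cong-≗ (λ i → val (obtains i))) V≤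
      ; cuts     = cuts′
      }
      where
      is-met : ∀ {i x} → Obtains I a i x → Bool
      is-met (met _)   = true
      is-met (unmet _) = false
      sel : Fin n → Bool
      sel i = is-met (obtains i)
      val : ∀ {i x} (o : Obtains I a i x) → x ≡ is-met o ∙ value (agent i)
      val (met _)   = refl
      val (unmet _) = refl
      meets : ∀ {i x} (o : Obtains I a i x) → is-met o ≡ true → fromNat (demand (agent i)) ≤ᴿ charge I a i
      meets (met p) _ = p

      cuts′ : ∀ (S : Fin n → Bool) → (∀ i → S i ≡ true → sel i ≡ true) → ∀ (P : Fin periods → Bool) →
              (∀ i t → S i ≡ true → (toℕ t <ᵇ due (agent i)) ≡ true → P t ≡ true ⊎ t ∈ gaps (agent i)) →
              ∑ (λ i → S i ∙ demand (agent i)) ≤ ∑ (λ t → P t ∙ lookup supply t)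
      cuts′ S S⊆ P cover = cut feasible S (λ i s → meets (obtains i) (S⊆ i s)) P cover

    charged : (Fin n → Fin periods → ℕ) → Fin n → ℕ
    charged b i = ∑ (λ t → (toℕ t <ᵇ due (agent i)) ∙ b i t)

    integral⇒achievable : ∀ {V} (b : Fin n → Fin periods → ℕ) →
      (∀ t → ∑ (λ i → b i t) ≤ lookup supply t) →
      (∀ i t → t ∈ gaps (agent i) → b i t ≡ 0) →
      V ℤ.≤ ℤ.+ ∑ (λ i → does (demand (agent i) ℕ.≤? charged b i) ∙ value (agent i)) →
      Achievable (I , V)
    integral⇒achievable b supplied gap V≤ = a , record
      { nonneg   = λ i t → constant-≤ 0ᴿ (a i t) {0} {b i t} z≤n (λ _ → refl) (λ _ → refl)
      ; supplied = λ t → constant-≤ (sumᴿ (λ i → a i t)) (fromNat (lookup supply t)) (supplied t) (λ k → trans (seq-sum (λ i → fromNat (b i t)) k) (sym (ι-∑ (λ i → b i t)))) (λ _ → refl)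
      ; gap      = λ i t g → constant-≤ (a i t) 0ᴿ {b i t} {0} (ℕ.≤-reflexive (gap i t g)) (λ _ → refl) (λ _ → refl) ,
                             constant-≤ 0ᴿ (a i t) {0} {b i t} z≤n (λ _ → refl) (λ _ → refl)
      } , _ , (_ , obtains , refl) , V≤
      where
      a : Allocation I
      a i t = fromNat (b i t)
      constant-≤ : ∀ x y {p q} → p ≤ q → (∀ k → seq x k ≡ ι p) → (∀ k → seq y k ≡ ι q) → x ≤ᴿ y
      constant-≤ x y p≤q ex ey ε 0<ε = 0 , λ k _ → ℚ.≤-<-trans (ℚ.≤-trans (ℚ.≤-reflexive (ex k)) (ℚ.≤-trans (ι-mono-≤ p≤q) (ℚ.≤-reflexive (sym (ey k)))))
        (subst (ℚ._< seq y k ℚ.+ ε) (ℚ.+-identityʳ (seq y k)) (ℚ.+-monoʳ-< (seq y k) 0<ε))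
      seq-charge : ∀ i k → seq (charge I a i) k ≡ ι (charged b i)
      seq-charge i k = trans (seq-sum (λ t → a i (inject≤ t (toℕ<n (deadline (agent i))))) k) (trans (sym (ι-∑ (λ t → b i (inject≤ t (toℕ<n (deadline (agent i)))))))
        (cong ι (prefix-sum ℕ.+-identityˡ (toℕ<n (deadline (agent i))) (b i))))
      obtained : ∀ i (d : Dec (demand (agent i) ≤ charged b i)) → Obtains I a i (does d ∙ value (agent i))
      obtained i (yes p) = met (constant-≤ (fromNat (demand (agent i))) (charge I a i) p (λ _ → refl) (seq-charge i))
      obtained i (no ¬p) = unmet λ h → let N , q = h 1ℚ (ℚ.positive⁻¹ 1ℚ) in
        ¬p (ℕ.s≤s⁻¹ (ι-cancel-< (ℚ.<-≤-trans (q N ≤-refl) (ℚ.≤-reflexive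
          (trans (cong (ℚ._+ 1ℚ) (seq-charge i N)) (trans (ℚ.+-comm (ι (charged b i)) 1ℚ) (sym (ι-+ 1 (charged b i)))))))))
      obtains : ∀ i → Obtains I a i (does (demand (agent i) ℕ.≤? charged b i) ∙ value (agent i))
      obtains i = obtained i (demand (agent i) ℕ.≤? charged b i)

module Transportation where

  open Selections
  open import Data.Vec.Functional using (updateAt)
  open import Data.Fin.Properties using (_≟_)

  ∑-updateAt-suc : ∀ {n} (f : Fin n → ℕ) i → ∑ (updateAt f i suc) ≡ suc (∑ f)
  ∑-updateAt-suc f zero    = refl
  ∑-updateAt-suc f (suc i) = trans (cong (f zero +_) (∑-updateAt-suc (f ∘ suc) i)) (ℕ.+-suc (f zero) _)

  +-swap : ∀ x y z → x + (y + z) ≡ y + (x + z)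
  +-swap x y z = trans (sym (ℕ.+-assoc x y z)) (trans (cong (_+ z) (ℕ.+-comm x y)) (ℕ.+-assoc y x z))

  ∑-decrement : ∀ {n} (X : Fin n → Bool) (f : Fin n → ℕ) i → 0 < f i →
                ∑ (λ j → X j ∙ f j) ≡ X i ∙ 1 + ∑ (λ j → X j ∙ updateAt f i pred j)
  ∑-decrement X f zero 0<f with X zero | f zero | 0<f
  ... | true  | suc k | _ = refl
  ... | false | _     | _ = refl
  ∑-decrement X f (suc i) 0<f =
    trans (cong (X zero ∙ f zero +_) (∑-decrement (X ∘ suc) (f ∘ suc) i 0<f))
          (+-swap (X zero ∙ f zero) (X (suc i) ∙ 1) (∑ λ j → X (suc j) ∙ updateAt (f ∘ suc) i pred j))

  ∑-insert : ∀ {n} (X : Fin n → Bool) (f : Fin n → ℕ) i → X i ≡ false →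
             ∑ (λ j → updateAt X i (λ _ → true) j ∙ f j) ≡ f i + ∑ (λ j → X j ∙ f j)
  ∑-insert X f zero    e = cong (λ b → f zero + (b ∙ f zero + ∑ (λ j → X (suc j) ∙ f (suc j)))) (sym e)
  ∑-insert X f (suc i) e =
    trans (cong (X zero ∙ f zero +_) (∑-insert (X ∘ suc) (f ∘ suc) i e))
          (+-swap (X zero ∙ f zero) (f (suc i)) (∑ λ j → X (suc j) ∙ f (suc j)))

  ≤-∑ : ∀ {n} (f : Fin n → ℕ) i → f i ≤ ∑ f
  ≤-∑ f zero    = ℕ.m≤m+n (f zero) _
  ≤-∑ f (suc i) = ≤-trans (≤-∑ (f ∘ suc) i) (ℕ.m≤n+m _ (f zero))

  ∑-modular : ∀ {n} (X Y : Fin n → Bool) (f : Fin n → ℕ) →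
    ∑ (λ i → (X i ∨ Y i) ∙ f i) + ∑ (λ i → (X i ∧ Y i) ∙ f i) ≡ ∑ (λ i → X i ∙ f i) + ∑ (λ i → Y i ∙ f i)
  ∑-modular X Y f = trans (sym (N.∑-distrib-+ (λ i → (X i ∨ Y i) ∙ f i) (λ i → (X i ∧ Y i) ∙ f i)))
    (trans (N.sum-cong-≗ λ i → pointwise (X i) (Y i) (f i)) (N.∑-distrib-+ (λ i → X i ∙ f i) (λ i → Y i ∙ f i)))
    where
    pointwise : ∀ a b x → (a ∨ b) ∙ x + (a ∧ b) ∙ x ≡ a ∙ x + b ∙ x
    pointwise true  true  x = refl
    pointwise true  false x = refl
    pointwise false b     x = ℕ.+-identityʳ (b ∙ x)

  ∑-positive : ∀ {n} (f : Fin n → ℕ) → 0 < ∑ f → ∃[ i ] 0 < f i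
  ∑-positive {suc n} f h with f zero in e
  ... | suc k = zero , subst (0 <_) (sym e) (s≤s z≤n)
  ... | zero  = let i , p = ∑-positive (f ∘ suc) h in suc i , p

  ≤⇒∙ : ∀ {a b : Bool} x → (a ≡ true → b ≡ true ⊎ x ≡ 0) → a ∙ x ≤ b ∙ x
  ≤⇒∙ {false} x h = z≤n
  ≤⇒∙ {true}  x h with h refl
  ... | inj₁ refl = ≤-refl
  ... | inj₂ refl = z≤n

  module Transport {n T : ℕ} (E : Fin n → Fin T → Bool) where

    adjacent? : ∀ (X : Fin n → Bool) t → Dec (∃[ i ] X i ≡ true × E i t ≡ true)
    adjacent? X t = any? λ i → (X i Bool.≟ true) ×-dec (E i t Bool.≟ true)

    neighbours : (Fin n → Bool) → Fin T → Bool
    neighbours X t = does (adjacent? X t)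

    neighbours-true : ∀ X {i t} → X i ≡ true → E i t ≡ true → neighbours X t ≡ true
    neighbours-true X {t = t} x e = dec-true (adjacent? X t) (_ , x , e)

    neighbours-inv : ∀ X t → neighbours X t ≡ true → ∃[ i ] X i ≡ true × E i t ≡ true
    neighbours-inv X t h with adjacent? X t | h
    ... | yes p | _ = p

    weight : (Fin n → ℕ) → (Fin n → Bool) → ℕ
    weight w X = ∑ (λ i → X i ∙ w i)

    capacity : (Fin T → ℕ) → (Fin n → Bool) → ℕ
    capacity m X = ∑ (λ t → neighbours X t ∙ m t)

    Cuts : (Fin n → ℕ) → (Fin T → ℕ) → Set
    Cuts w m = ∀ X → weight w X ≤ capacity m X

    record Flow (w : Fin n → ℕ) (m : Fin T → ℕ) : Set where
      field
        flow     : Fin n → Fin T → ℕ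
        along    : ∀ i t → E i t ≡ false → flow i t ≡ 0
        received : ∀ i → ∑ (flow i) ≡ w i
        sent     : ∀ t → ∑ (λ i → flow i t) ≤ m t

    open Flow

    cuts-or-violation : ∀ w m → Cuts w m ⊎ ∃[ X ] capacity m X < weight w X
    cuts-or-violation w m with anySubset? (λ X → capacity m (lookup X) ℕ.<? weight w (lookup X))
    ... | yes (X , p) = inj₂ (lookup X , p)
    ... | no none = inj₁ λ X → subst₂ _≤_
        (N.sum-cong-≗ λ i → cong (_∙ w i) (lookup∘tabulate X i))
        (N.sum-cong-≗ λ t → cong (_∙ m t) (same X t))
        (ℕ.≮⇒≥ λ p → none (Vec.tabulate X , p))
      where
      bool-ext : ∀ {a b} → (a ≡ true → b ≡ true) → (b ≡ true → a ≡ true) → a ≡ b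
      bool-ext {true}  {b}     f g = sym (f refl)
      bool-ext {false} {false} f g = refl
      bool-ext {false} {true}  f g = g refl
      same : ∀ X t → neighbours (lookup (Vec.tabulate X)) t ≡ neighbours X t
      same X t = bool-ext
        (λ h → let i , x , e = neighbours-inv (lookup (Vec.tabulate X)) t h in neighbours-true X (trans (sym (lookup∘tabulate X i)) x) e)
        (λ h → let i , x , e = neighbours-inv X t h in neighbours-true (lookup (Vec.tabulate X)) (trans (lookup∘tabulate X i) x) e)

    -- If no unit of the demand of i can be routed, then every usable period of i
    -- is a neighbour of a tight set that avoids i. Tight sets are closed under
    -- unions, which gives a tight set whose neighbourhood does not grow when i
    -- is added.
    module _ (w : Fin n → ℕ) (m : Fin T → ℕ) (cuts : Cuts w m) (i : Fin n) (0<w : 0 < w i) where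

      Usable : Fin T → Set
      Usable t = E i t ≡ true × 0 < m t

      Routable : Fin T → Set
      Routable t = Usable t × Cuts (updateAt w i pred) (updateAt m t pred)

      record Blocking (P : Fin T → Set) : Set where
        field
          set    : Fin n → Bool
          avoids : set i ≡ false
          tight  : weight w set ≡ capacity m set
          covers : ∀ t → P t → Usable t → neighbours set t ≡ true

      open Blocking

      none-blocking : Blocking (λ _ → ⊥)
      none-blocking = record { set = λ _ → false ; avoids = refl ; tight = trans (zeros n) (sym (trans (N.sum-cong-≗ empty) (zeros T))) ; covers = λ _ () }
        where
        zeros : ∀ k → ∑ {k} (λ _ → 0) ≡ 0
        zeros k = N.sum-replicate-zero k
        empty : ∀ t → neighbours (λ _ → false) t ∙ m t ≡ 0
        empty t with neighbours (λ _ → false) t in e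
        ... | false = refl
        ... | true with () ← proj₁ (proj₂ (neighbours-inv (λ _ → false) t e))

      union-blocking : ∀ {P R} → Blocking P → Blocking R → Blocking (λ t → P t ⊎ R t)
      union-blocking A B = record
        { set    = U
        ; avoids = cong₂ _∨_ (avoids A) (avoids B)
        ; tight  = ℕ.≤-antisym (cuts U) (ℕ.+-cancelʳ-≤ (weight w I) _ _ (begin
            capacity m U + weight w I     ≤⟨ ℕ.+-monoʳ-≤ _ (cuts I) ⟩
            capacity m U + capacity m I   ≤⟨ ℕ.+-mono-≤ (∑-mono λ t → ≤⇒∙ (m t) (in-union t)) (∑-mono λ t → ≤⇒∙ (m t) (in-both t)) ⟩
            ∑ (λ t → (neighbours X t ∨ neighbours Y t) ∙ m t) + ∑ (λ t → (neighbours X t ∧ neighbours Y t) ∙ m t)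
                                          ≡⟨ ∑-modular (neighbours X) (neighbours Y) m ⟩
            capacity m X + capacity m Y   ≡⟨ cong₂ _+_ (tight A) (tight B) ⟨
            weight w X + weight w Y       ≡⟨ ∑-modular X Y w ⟨
            weight w U + weight w I       ∎))
        ; covers = λ { t (inj₁ p) u → ∨ˡ t (covers A t p u) ; t (inj₂ p) u → ∨ʳ t (covers B t p u) }
        }
        where
        open ℕ.≤-Reasoning
        X = set A
        Y = set B
        U I : Fin n → Bool
        U j = X j ∨ Y j
        I j = X j ∧ Y j
        or : ∀ a {b} → a ∨ b ≡ true → a ≡ true ⊎ b ≡ true
        or true  _ = inj₁ refl
        or false p = inj₂ p
        and : ∀ a {b} → a ∧ b ≡ true → a ≡ true × b ≡ true
        and true p = refl , p
        orˡ : ∀ {a} b → a ≡ true → a ∨ b ≡ true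
        orˡ b refl = refl
        orʳ : ∀ a {b} → b ≡ true → a ∨ b ≡ true
        orʳ true  refl = refl
        orʳ false refl = refl
        ∨ˡ : ∀ t → neighbours X t ≡ true → neighbours U t ≡ true
        ∨ˡ t h = let j , x , e = neighbours-inv X t h in neighbours-true U (orˡ (Y j) x) e
        ∨ʳ : ∀ t → neighbours Y t ≡ true → neighbours U t ≡ true
        ∨ʳ t h = let j , x , e = neighbours-inv Y t h in neighbours-true U (orʳ (X j) x) e
        in-union : ∀ t → neighbours U t ≡ true → neighbours X t ∨ neighbours Y t ≡ true ⊎ m t ≡ 0
        in-union t h with neighbours-inv U t h
        ... | j , u , e with or (X j) u
        ...   | inj₁ x = inj₁ (orˡ _ (neighbours-true X x e))
        ...   | inj₂ y = inj₁ (orʳ _ (neighbours-true Y y e))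
        in-both : ∀ t → neighbours I t ≡ true → neighbours X t ∧ neighbours Y t ≡ true ⊎ m t ≡ 0
        in-both t h with neighbours-inv I t h
        ... | j , u , e with and (X j) u
        ...   | x , y = inj₁ (cong₂ _∧_ (neighbours-true X x e) (neighbours-true Y y e))

      violation-blocking : ∀ t → Usable t → ∃[ X ] capacity (updateAt m t pred) X < weight (updateAt w i pred) X →
                           Blocking (_≡ t)
      violation-blocking t (e , 0<m) (X , v) = record
        { set    = X
        ; avoids = proj₁ facts
        ; tight  = ℕ.≤-antisym (cuts X) (begin
            capacity m X                          ≡⟨ ∑-decrement (neighbours X) m t 0<m ⟩
            neighbours X t ∙ 1 + m′               ≡⟨ cong (λ b → b ∙ 1 + m′) (proj₂ facts) ⟩
            suc m′                                ≤⟨ v ⟩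
            w′                                    ≡⟨ cong (λ b → b ∙ 1 + w′) (proj₁ facts) ⟨
            X i ∙ 1 + w′                          ≡⟨ ∑-decrement X w i 0<w ⟨
            weight w X                            ∎)
        ; covers = λ { _ refl _ → proj₂ facts }
        }
        where
        open ℕ.≤-Reasoning
        m′ = capacity (updateAt m t pred) X
        w′ = weight (updateAt w i pred) X
        decremented : X i ∙ 1 + w′ ≤ neighbours X t ∙ 1 + m′
        decremented = subst₂ _≤_ (∑-decrement X w i 0<w) (∑-decrement (neighbours X) m t 0<m) (cuts X)
        facts : X i ≡ false × neighbours X t ≡ true
        facts with X i | neighbours X t | decremented
        ... | false | true  | _ = refl , refl
        ... | true  | true  | s≤s h = contradiction v (ℕ.≤⇒≯ h)
        ... | true  | false | h = contradiction v (ℕ.≤⇒≯ (≤-trans (ℕ.n≤1+n w′) h))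
        ... | false | false | h = contradiction v (ℕ.≤⇒≯ h)

      search : ∀ {k} (f : Fin k → Fin T) → (∃[ t ] Routable t) ⊎ Blocking (λ t → ∃[ j ] t ≡ f j)
      search {zero} f = inj₂ (record { set = set none-blocking ; avoids = avoids none-blocking ; tight = tight none-blocking
                                   ; covers = λ { _ (() , _) } })
      search {suc k} f with search (f ∘ suc) | (E i (f zero) Bool.≟ true) ×-dec (0 ℕ.<? m (f zero))
      ... | inj₁ r | _ = inj₁ r
      ... | inj₂ B | no ¬u = inj₂ (record { set = set B ; avoids = avoids B ; tight = tight B ; covers =
              λ { t (zero , refl) u → contradiction u ¬u ; t (suc j , p) u → covers B t (j , p) u } })
      ... | inj₂ B | yes u with cuts-or-violation (updateAt w i pred) (updateAt m (f zero) pred)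
      ...   | inj₁ c = inj₁ (f zero , u , c)
      ...   | inj₂ v = inj₂ (record { set = set A ; avoids = avoids A ; tight = tight A ; covers =
                λ { t (zero , p) → covers A t (inj₁ p) ; t (suc j , p) → covers A t (inj₂ (j , p)) } })
        where A = union-blocking (violation-blocking (f zero) u v) B

      routable : ∃[ t ] Routable t
      routable with search (λ t → t)
      ... | inj₁ r = r
      ... | inj₂ B = contradiction (cuts Y) (ℕ.<⇒≱ (begin-strict
        capacity m Y                ≤⟨ ∑-mono (λ t → ≤⇒∙ (m t) (no-growth t)) ⟩
        capacity m X                ≡⟨ tight B ⟨
        weight w X                  <⟨ ℕ.m<n+m (weight w X) 0<w ⟩
        w i + weight w X            ≡⟨ ∑-insert X w i (avoids B) ⟨
        weight w Y                  ∎))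
        where
        open ℕ.≤-Reasoning
        X = set B
        Y : Fin n → Bool
        Y = updateAt X i (λ _ → true)
        no-growth : ∀ t → neighbours Y t ≡ true → neighbours X t ≡ true ⊎ m t ≡ 0
        no-growth t h with neighbours-inv Y t h
        ... | j , y , e with j ≟ i
        ...   | no j≢i = inj₁ (neighbours-true X (trans (sym (updateAt-minimal j i X j≢i)) y) e)
        ...   | yes refl with m t in mt
        ...     | zero  = inj₂ refl
        ...     | suc _ = inj₁ (covers B t (t , refl) (e , subst (0 <_) (sym mt) (s≤s z≤n)))

    route : ∀ k w m → ∑ w ≡ k → Cuts w m → Flow w m
    route zero w m eq cuts = record
      { flow     = λ _ _ → 0
      ; along    = λ _ _ _ → refl
      ; received = λ i → trans (N.sum-replicate-zero T) (sym (ℕ.n≤0⇒n≡0 (subst (w i ≤_) eq (≤-∑ w i))))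
      ; sent     = λ t → subst (_≤ m t) (sym (N.sum-replicate-zero n)) z≤n
      }
    route (suc k) w m eq cuts with ∑-positive w (subst (0 <_) (sym eq) (s≤s z≤n))
    ... | i , 0<w with routable w m cuts i 0<w
    ...   | t , (e , 0<m) , cuts′ = record
      { flow     = extended
      ; along    = along′
      ; received = received′
      ; sent     = sent′
      }
      where
      w-k : ∑ (updateAt w i pred) ≡ k
      w-k = ℕ.suc-injective (trans (sym (∑-decrement (λ _ → true) w i 0<w)) eq)
      F = route k (updateAt w i pred) (updateAt m t pred) w-k cuts′
      extended : Fin n → Fin T → ℕ
      extended = updateAt (flow F) i (λ r → updateAt r t suc)
      suc∘pred : ∀ {x} → 0 < x → suc (pred x) ≡ x
      suc∘pred (s≤s _) = refl
      along′ : ∀ j s → E j s ≡ false → extended j s ≡ 0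
      along′ j s e′ with j ≟ i
      ... | no j≢i = trans (cong (λ r → r s) (updateAt-minimal j i (flow F) j≢i)) (along F j s e′)
      ... | yes refl with s ≟ t
      ...   | no s≢t = trans (cong (λ r → r s) (updateAt-updates i (flow F))) (trans (updateAt-minimal s t _ s≢t) (along F j s e′))
      ...   | yes refl with () ← trans (sym e) e′
      received′ : ∀ j → ∑ (extended j) ≡ w j
      received′ j with j ≟ i
      ... | no j≢i = trans (cong ∑ (updateAt-minimal j i (flow F) j≢i)) (trans (received F j) (updateAt-minimal j i w j≢i))
      ... | yes refl = trans (cong ∑ (updateAt-updates i (flow F))) (trans (∑-updateAt-suc (flow F i) t)
                         (trans (cong suc (trans (received F i) (updateAt-updates i w))) (suc∘pred 0<w)))
      sent′ : ∀ s → ∑ (λ j → extended j s) ≤ m s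
      sent′ s with s ≟ t
      ... | no s≢t = ≤-trans (ℕ.≤-reflexive (N.sum-cong-≗ column)) (≤-trans (sent F s) (ℕ.≤-reflexive (updateAt-minimal s t m s≢t)))
        where
        column : ∀ j → extended j s ≡ flow F j s
        column j with j ≟ i
        ... | no j≢i = cong (λ r → r s) (updateAt-minimal j i (flow F) j≢i)
        ... | yes refl = trans (cong (λ r → r s) (updateAt-updates i (flow F))) (updateAt-minimal s t _ s≢t)
      ... | yes refl = ≤-trans (ℕ.≤-reflexive (trans (N.sum-cong-≗ column) (∑-updateAt-suc (λ j → flow F j t) i)))
                         (≤-trans (s≤s (≤-trans (sent F t) (ℕ.≤-reflexive (updateAt-updates t m)))) (ℕ.≤-reflexive (suc∘pred 0<m)))
        where
        column : ∀ j → extended j t ≡ updateAt (λ j → flow F j t) i suc j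
        column j with j ≟ i
        ... | no j≢i = trans (cong (λ r → r t) (updateAt-minimal j i (flow F) j≢i)) (sym (updateAt-minimal j i (λ j → flow F j t) j≢i))
        ... | yes refl = trans (cong (λ r → r t) (updateAt-updates i (flow F)))
                           (trans (updateAt-updates t (flow F i)) (sym (updateAt-updates i (λ j → flow F j t))))

module Encodings where

  open import Data.Nat.Binary.Base using (fromℕ)

  -- Bijective base 2, least significant digit first; false is 1 and true is 2.
  val : Bits → ℕ
  val []           = 0
  val (false ∷ ds) = suc (2 * val ds)
  val (true ∷ ds)  = 2 * suc (val ds)

  numeral : Bits → Bits
  numeral []       = false ∷ []
  numeral (d ∷ ds) = true ∷ d ∷ numeral ds

  digitsᵇ : ℕᵇ → Bits
  digitsᵇ ℕᵇ.zero  = []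
  digitsᵇ 2[1+ b ] = true ∷ digitsᵇ b
  digitsᵇ 1+[2 b ] = false ∷ digitsᵇ b

  binary : Bits → ℕᵇ
  binary []           = ℕᵇ.zero
  binary (false ∷ ds) = 1+[2 binary ds ]
  binary (true ∷ ds)  = 2[1+ binary ds ]

  binary-digits : ∀ b → binary (digitsᵇ b) ≡ b
  binary-digits ℕᵇ.zero  = refl
  binary-digits 2[1+ b ] = cong 2[1+_] (binary-digits b)
  binary-digits 1+[2 b ] = cong 1+[2_] (binary-digits b)

  digits-binary : ∀ ds → digitsᵇ (binary ds) ≡ ds
  digits-binary []           = refl
  digits-binary (false ∷ ds) = cong (false ∷_) (digits-binary ds)
  digits-binary (true ∷ ds)  = cong (true ∷_) (digits-binary ds)

  val-toℕ : ∀ ds → val ds ≡ ℕᵇ.toℕ (binary ds)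
  val-toℕ []           = refl
  val-toℕ (false ∷ ds) = cong (λ v → suc (2 * v)) (val-toℕ ds)
  val-toℕ (true ∷ ds)  = cong (λ v → 2 * suc v) (val-toℕ ds)

  digits : ℕ → Bits
  digits n = digitsᵇ (fromℕ n)

  val-digits : ∀ n → val (digits n) ≡ n
  val-digits n = trans (val-toℕ (digits n)) (trans (cong ℕᵇ.toℕ (binary-digits (fromℕ n))) (ℕᵇ.toℕ-fromℕ n))

  digits-val : ∀ ds → digits (val ds) ≡ ds
  digits-val ds = trans (cong digits (val-toℕ ds)) (trans (cong digitsᵇ (ℕᵇ.fromℕ-toℕ (binary ds))) (digits-binary ds))

  encodeℕ-numeral : ∀ n → encodeℕ n ≡ numeral (digits n)
  encodeℕ-numeral n = go (fromℕ n)
    where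
    go : ∀ b → encodeℕᵇ b ≡ numeral (digitsᵇ b)
    go ℕᵇ.zero  = refl
    go 2[1+ b ] = cong (λ w → true ∷ true ∷ w) (go b)
    go 1+[2 b ] = cong (λ w → true ∷ false ∷ w) (go b)

  encodeℕ-val : ∀ ds → encodeℕ (val ds) ≡ numeral ds
  encodeℕ-val ds = trans (encodeℕ-numeral (val ds)) (cong numeral (digits-val ds))

  numeral-prefix : ∀ ds es {x y} → numeral ds ++ x ≡ numeral es ++ y → ds ≡ es × x ≡ y
  numeral-prefix []       []       refl = refl , refl
  numeral-prefix (d ∷ ds) (e ∷ es) eq with ∷-injective (proj₂ (∷-injective eq))
  ... | refl , eq′ with numeral-prefix ds es eq′
  ...   | refl , p = refl , p

  encodeℕ-prefix : ∀ m n {x y} → encodeℕ m ++ x ≡ encodeℕ n ++ y → m ≡ n × x ≡ y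
  encodeℕ-prefix m n eq rewrite encodeℕ-numeral m | encodeℕ-numeral n
    with numeral-prefix (digits m) (digits n) eq
  ... | e , p = trans (sym (val-digits m)) (trans (cong val e) (val-digits n)) , p

  encodeℤ-injective : ∀ V W → encodeℤ V ≡ encodeℤ W → V ≡ W
  encodeℤ-injective (ℤ.+ m)     (ℤ.+ n)     eq =
    cong ℤ.+_ (proj₁ (encodeℕ-prefix m n (cong (_++ []) (proj₂ (∷-injective eq)))))
  encodeℤ-injective ℤ.-[1+ m ] ℤ.-[1+ n ] eq =
    cong ℤ.-[1+_] (proj₁ (encodeℕ-prefix m n (cong (_++ []) (proj₂ (∷-injective eq)))))

  toList-prefix : ∀ {n} (u v : Vec Bool n) {x y} → Vec.toList u ++ x ≡ Vec.toList v ++ y → u ≡ v × x ≡ y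
  toList-prefix []      []      eq = refl , eq
  toList-prefix (a ∷ u) (b ∷ v) eq with ∷-injective eq
  ... | refl , eq′ with toList-prefix u v eq′
  ...   | refl , p = refl , p

  concatMap-prefix : ∀ {A : Set} {f : A → Bits} → (∀ a b {x y} → f a ++ x ≡ f b ++ y → a ≡ b × x ≡ y) →
    ∀ {n} (u v : Vec A n) {x y} → List.concatMap f (Vec.toList u) ++ x ≡ List.concatMap f (Vec.toList v) ++ y →
    u ≡ v × x ≡ y
  concatMap-prefix pre []      []      eq = refl , eq
  concatMap-prefix {f = f} pre (a ∷ u) (b ∷ v) {x} {y} eq
    with pre a b (trans (sym (++-assoc (f a) _ x)) (trans eq (++-assoc (f b) _ y)))
  ... | refl , eq′ with concatMap-prefix pre u v eq′
  ...   | refl , p = refl , p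

  agent-≡ : ∀ {T} {A B : Agent T} → Agent.value A ≡ Agent.value B → Agent.deadline A ≡ Agent.deadline B →
            Agent.demand A ≡ Agent.demand B → Agent.gaps A ≡ Agent.gaps B → A ≡ B
  agent-≡ {A = A} {B} refl refl refl refl
    with ≤-irrelevant (Agent.value>0 A) (Agent.value>0 B) | ≤-irrelevant (Agent.demand>0 A) (Agent.demand>0 B)
  ... | refl | refl = refl

  encodeAgent-prefix : ∀ {T} (A B : Agent T) {x y} → encodeAgent A ++ x ≡ encodeAgent B ++ y → A ≡ B × x ≡ y
  encodeAgent-prefix A B {x} {y} eq =
    let v , eq₁ = encodeℕ-prefix A.value B.value (trans (sym (split A)) (trans eq (split B)))
        d , eq₂ = encodeℕ-prefix A.due B.due eq₁
        w , eq₃ = encodeℕ-prefix A.demand B.demand eq₂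
        g , p   = toList-prefix A.gaps B.gaps eq₃
    in agent-≡ v (toℕ-injective (suc-injective d)) w g , p
    where
    module A = Agent A
    module B = Agent B
    split : ∀ {T} (C : Agent T) {z} → encodeAgent C ++ z ≡
      encodeℕ (Agent.value C) ++ encodeℕ (Agent.due C) ++ encodeℕ (Agent.demand C) ++ Vec.toList (Agent.gaps C) ++ z
    split C {z} = trans (++-assoc (encodeℕ value) _ z) (cong (encodeℕ value ++_)
      (trans (++-assoc (encodeℕ due) _ z) (cong (encodeℕ due ++_) (++-assoc (encodeℕ demand) _ z))))
      where open Agent C

  encodeInstance-injective : ∀ I J → encodeInstance I ≡ encodeInstance J → I ≡ J
  encodeInstance-injective (I , V) (J , W) eq
    with encodeℕ-prefix (Scheduling.periods I) (Scheduling.periods J) eq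
  ... | refl , eq₁ with concatMap-prefix encodeℕ-prefix (Scheduling.supply I) (Scheduling.supply J) eq₁
  ... | refl , eq₂ with encodeℕ-prefix (Scheduling.n I) (Scheduling.n J) eq₂
  ... | refl , eq₃ with concatMap-prefix encodeAgent-prefix (Scheduling.agents I) (Scheduling.agents J) eq₃
  ... | refl , eq₄ with encodeℤ-injective V W eq₄ | ≤-irrelevant (Scheduling.periods≥1 I) (Scheduling.periods≥1 J)
  ... | refl | refl = refl

module NumeralPrograms where

  open StackPrograms
  open GuessingPrograms
  open Encodings

  data Choice : ℕ → ℕ → Set where
    done : Choice 0 0
    keep : ∀ {j k} → Choice j k → Choice (suc j) (suc k)
    drop : ∀ {j k} → Choice j k → Choice j (suc k)

  place : ∀ {j k} → Choice j k → Fin j → Fin k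
  place (keep θ) zero    = zero
  place (keep θ) (suc r) = suc (place θ r)
  place (drop θ) r       = suc (place θ r)

  spread : ∀ {j k} → Choice j k → Vec Bool j → Vec Bool k
  spread done     []      = []
  spread (keep θ) (b ∷ m) = b ∷ spread θ m
  spread (drop θ) m       = false ∷ spread θ m

  gather : ∀ {j k} → Choice j k → Stacks k → Stacks j
  gather done     []      = []
  gather (keep θ) (s ∷ σ) = s ∷ gather θ σ
  gather (drop θ) (s ∷ σ) = gather θ σ

  scatter : ∀ {j k} → Choice j k → Stacks j → Stacks k → Stacks k
  scatter done     []      []      = []
  scatter (keep θ) (s ∷ τ) (_ ∷ σ) = s ∷ scatter θ τ σ
  scatter (drop θ) τ       (s ∷ σ) = s ∷ scatter θ τ σ

  on : ∀ {j k} → Choice j k → NProg j → NProg k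
  on θ ε             = ε
  on θ (push mask b) = push (spread θ mask) b
  on θ (pop r b)     = pop (place θ r) b
  on θ (empty r)     = empty (place θ r)
  on θ (P ⨟ Q)       = on θ P ⨟ on θ Q
  on θ (P ∣ Q)       = on θ P ∣ on θ Q
  on θ (star P)      = star (on θ P)

  module _ where

    gather-scatter : ∀ {j k} (θ : Choice j k) τ σ → gather θ (scatter θ τ σ) ≡ τ
    gather-scatter done     []      []      = refl
    gather-scatter (keep θ) (s ∷ τ) (_ ∷ σ) = cong (s ∷_) (gather-scatter θ τ σ)
    gather-scatter (drop θ) τ       (_ ∷ σ) = gather-scatter θ τ σ

    scatter-scatter : ∀ {j k} (θ : Choice j k) τ τ′ σ → scatter θ τ (scatter θ τ′ σ) ≡ scatter θ τ σ
    scatter-scatter done     []      []       []      = refl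
    scatter-scatter (keep θ) (s ∷ τ) (_ ∷ τ′) (_ ∷ σ) = cong (s ∷_) (scatter-scatter θ τ τ′ σ)
    scatter-scatter (drop θ) τ       τ′       (s ∷ σ) = cong (s ∷_) (scatter-scatter θ τ τ′ σ)

    scatter-gather : ∀ {j k} (θ : Choice j k) σ → scatter θ (gather θ σ) σ ≡ σ
    scatter-gather done     []      = refl
    scatter-gather (keep θ) (s ∷ σ) = cong (s ∷_) (scatter-gather θ σ)
    scatter-gather (drop θ) (s ∷ σ) = cong (s ∷_) (scatter-gather θ σ)

    lookup-gather : ∀ {j k} (θ : Choice j k) r σ → lookup (gather θ σ) r ≡ lookup σ (place θ r)
    lookup-gather (keep θ) zero    (s ∷ σ) = refl
    lookup-gather (keep θ) (suc r) (s ∷ σ) = lookup-gather θ r σ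
    lookup-gather (drop θ) r       (s ∷ σ) = lookup-gather θ r σ

    scatter-pop : ∀ {j k} (θ : Choice j k) r σ → scatter θ (popAt r (gather θ σ)) σ ≡ popAt (place θ r) σ
    scatter-pop (keep θ) zero    (s ∷ σ) = cong (_ ∷_) (scatter-gather θ σ)
    scatter-pop (keep θ) (suc r) (s ∷ σ) = cong (s ∷_) (scatter-pop θ r σ)
    scatter-pop (drop θ) r       (s ∷ σ) = cong (s ∷_) (scatter-pop θ r σ)

    scatter-push : ∀ {j k} (θ : Choice j k) mask b σ → scatter θ (pushAll mask b (gather θ σ)) σ ≡ pushAll (spread θ mask) b σ
    scatter-push done     []         b []      = refl
    scatter-push (keep θ) (m ∷ mask) b (s ∷ σ) = cong (_ ∷_) (scatter-push θ mask b σ)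
    scatter-push (drop θ) mask       b (s ∷ σ) = cong (s ∷_) (scatter-push θ mask b σ)

  frame⁺ : ∀ {j k} (θ : Choice j k) {P h τ} σ → Run P (gather θ σ) h τ → Run (on θ P) σ h (scatter θ τ σ)
  frame⁺ θ {P} σ run = go run refl
    where
    go : ∀ {P σ₀ h τ σ} → Run P σ₀ h τ → σ₀ ≡ gather θ σ → Run (on θ P) σ h (scatter θ τ σ)
    go {σ = σ} ε refl = subst (Run ε σ []) (sym (scatter-gather θ σ)) ε
    go {σ = σ} (push {mask} {b}) refl = subst (Run _ σ []) (sym (scatter-push θ mask b σ)) push
    go {σ = σ} (pop {r} e) refl = subst (Run _ σ []) (sym (scatter-pop θ r σ)) (pop (trans (sym (lookup-gather θ r σ)) e))
    go {σ = σ} (empty {r} e) refl = subst (Run _ σ []) (sym (scatter-gather θ σ)) (empty (trans (sym (lookup-gather θ r σ)) e))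
    go {τ = τ} {σ} (_⨟_ {σ′ = σ₁} p q) refl = subst (Run _ σ _) (scatter-scatter θ τ σ₁ σ)
      (go p refl ⨟ go q (sym (gather-scatter θ σ₁ σ)))
    go (this p) e = this (go p e)
    go (that p) e = that (go p e)
    go {σ = σ} done refl = subst (Run _ σ _) (sym (scatter-gather θ σ)) done
    go {τ = τ} {σ} (more {σ′ = σ₁} p q) refl = subst (Run _ σ _) (scatter-scatter θ τ σ₁ σ)
      (more (go p refl) (go q (sym (gather-scatter θ σ₁ σ))))

  frame⁻ : ∀ {j k} (θ : Choice j k) P {σ h σ′} → Run (on θ P) σ h σ′ →
           ∃[ τ ] Run P (gather θ σ) h τ × σ′ ≡ scatter θ τ σ
  frame⁻ θ ε {σ} ε = _ , ε , sym (scatter-gather θ σ)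
  frame⁻ θ (push mask b) {σ} push = _ , push , sym (scatter-push θ mask b σ)
  frame⁻ θ (pop r b) {σ} (pop e) = _ , pop (trans (lookup-gather θ r σ) e) , sym (scatter-pop θ r σ)
  frame⁻ θ (empty r) {σ} (empty e) = _ , empty (trans (lookup-gather θ r σ) e) , sym (scatter-gather θ σ)
  frame⁻ θ (P ⨟ Q) {σ} (p ⨟ q) with frame⁻ θ P p
  ... | τ , p′ , refl with frame⁻ θ Q q
  ... | τ′ , q′ , refl = τ′ , p′ ⨟ subst (λ z → Run Q z _ τ′) (gather-scatter θ τ σ) q′ , scatter-scatter θ τ′ τ σ
  frame⁻ θ (P ∣ Q) (this p) with frame⁻ θ P p
  ... | τ , p′ , e = τ , this p′ , e
  frame⁻ θ (P ∣ Q) (that q) with frame⁻ θ Q q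
  ... | τ , q′ , e = τ , that q′ , e
  frame⁻ θ (star P) {σ} done = _ , done , sym (scatter-gather θ σ)
  frame⁻ θ (star P) {σ} (more p q) with frame⁻ θ P p
  ... | τ , p′ , refl with frame⁻ θ (star P) q
  ... | τ′ , q′ , refl = τ′ , more p′ (subst (λ z → Run (star P) z _ τ′) (gather-scatter θ τ σ) q′) , scatter-scatter θ τ′ τ σ

  infix 3 _∶_↝[_]_

  record _∶_↝[_]_ {k} (P : NProg k) (σ : Stacks k) (n : ℕ) (σ′ : Stacks k) : Set where
    constructor ⟪_,_,_⟫
    field
      choices : Bits
      few     : length choices ≤ n
      run     : Run P σ choices σ′

  module _ {k : ℕ} where

    infixr 5 _⨟⁺_

    _⨟⁺_ : ∀ {P Q : NProg k} {σ σ′ σ″ m n} → P ∶ σ ↝[ m ] σ′ → Q ∶ σ′ ↝[ n ] σ″ → P ⨟ Q ∶ σ ↝[ m + n ] σ″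
    ⟪ h , l , p ⟫ ⨟⁺ ⟪ h′ , l′ , q ⟫ = ⟪ h ++ h′ , ≤-trans (≤-reflexive (length-++ h)) (+-mono-≤ l l′) , p ⨟ q ⟫

    this⁺ : ∀ {P Q : NProg k} {σ σ′ n} → P ∶ σ ↝[ n ] σ′ → P ∣ Q ∶ σ ↝[ suc n ] σ′
    this⁺ ⟪ h , l , p ⟫ = ⟪ true ∷ h , s≤s l , this p ⟫

    that⁺ : ∀ {P Q : NProg k} {σ σ′ n} → Q ∶ σ ↝[ n ] σ′ → P ∣ Q ∶ σ ↝[ suc n ] σ′
    that⁺ ⟪ h , l , p ⟫ = ⟪ false ∷ h , s≤s l , that p ⟫

    done⁺ : ∀ {P : NProg k} {σ} → star P ∶ σ ↝[ 1 ] σ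
    done⁺ = ⟪ _ , ≤-refl , done ⟫

    more⁺ : ∀ {P : NProg k} {σ σ′ σ″ m n} → P ∶ σ ↝[ m ] σ′ → star P ∶ σ′ ↝[ n ] σ″ → star P ∶ σ ↝[ suc (m + n) ] σ″
    more⁺ ⟪ h , l , p ⟫ ⟪ h′ , l′ , q ⟫ = ⟪ true ∷ h ++ h′ , s≤s (≤-trans (≤-reflexive (length-++ h)) (+-mono-≤ l l′)) , more p q ⟫

    pop⁺ : ∀ {r b bs} {σ : Stacks k} → lookup σ r ≡ b ∷ bs → pop r b ∶ σ ↝[ 0 ] popAt r σ
    pop⁺ e = ⟪ [] , z≤n , pop e ⟫

    push⁺ : ∀ {mask b} {σ : Stacks k} → push mask b ∶ σ ↝[ 0 ] pushAll mask b σ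
    push⁺ = ⟪ [] , z≤n , push ⟫

    empty⁺ : ∀ {r} {σ : Stacks k} → lookup σ r ≡ [] → empty r ∶ σ ↝[ 0 ] σ
    empty⁺ e = ⟪ [] , z≤n , empty e ⟫

    within : ∀ {P : NProg k} {σ σ′ m n} → m ≤ n → P ∶ σ ↝[ m ] σ′ → P ∶ σ ↝[ n ] σ′
    within m≤n ⟪ h , l , p ⟫ = ⟪ h , ≤-trans l m≤n , p ⟫

    ends : ∀ {P : NProg k} {σ σ′ σ″ n} → σ′ ≡ σ″ → P ∶ σ ↝[ n ] σ′ → P ∶ σ ↝[ n ] σ″
    ends refl p = p

    snoc⁺ : ∀ {P : NProg k} {σ σ′ σ″ m n} → star P ∶ σ ↝[ m ] σ′ → P ∶ σ′ ↝[ n ] σ″ → star P ∶ σ ↝[ m + suc n ] σ″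
    snoc⁺ {P} {σ″ = σ″} {m} {n} ⟪ h , l , p ⟫ q = within (+-monoˡ-≤ (suc n) l) (go p q)
      where
      go : ∀ {σ h σ′} → Run (star P) σ h σ′ → P ∶ σ′ ↝[ n ] σ″ → star P ∶ σ ↝[ length h + suc n ] σ″
      go done q = within (≤-reflexive (cong suc (+-comm n 1))) (more⁺ q done⁺)
      go (more {h = h} {h′} p r) q = within
        (≤-reflexive (cong suc (trans (sym (+-assoc (length h) (length h′) (suc n))) (cong (_+ suc n) (sym (length-++ h))))))
        (more⁺ ⟪ h , ≤-refl , p ⟫ (go r q))

    prepend⁺ : ∀ {P Q : NProg k} {σ σ′ σ″ m n} → P ∶ σ ↝[ m ] σ′ → star P ⨟ Q ∶ σ′ ↝[ n ] σ″ → star P ⨟ Q ∶ σ ↝[ suc (m + n) ] σ″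
    prepend⁺ {m = m} ⟪ h , l , p ⟫ ⟪ _ , l′ , (_⨟_ {h = h₁} {h₂} q r) ⟫ = ⟪ _ , s≤s bound , more p q ⨟ r ⟫
      where
      bound : length ((h ++ h₁) ++ h₂) ≤ m + _
      bound rewrite ++-assoc h h₁ h₂ | length-++ h {h₁ ++ h₂} = +-mono-≤ l l′

  frame↝ : ∀ {j k} (θ : Choice j k) {P n τ} σ → P ∶ gather θ σ ↝[ n ] τ → on θ P ∶ σ ↝[ n ] scatter θ τ σ
  frame↝ θ σ ⟪ h , l , p ⟫ = ⟪ h , l , frame⁺ θ σ p ⟫

  marks : ℕ → Bits
  marks n = replicate n true

  guess : ∀ {k} → Vec Bool k → NProg k
  guess mask = push mask false ⨟ star ((push mask false ∣ push mask true) ⨟ push mask true)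

  pushWord : ∀ {k} → Vec Bool k → Bits → Stacks k → Stacks k
  pushWord mask w = zipWith (λ m s → if m then w ++ s else s) mask

  pushWord-push : ∀ {k} (mask : Vec Bool k) b w σ → pushAll mask b (pushWord mask w σ) ≡ pushWord mask (b ∷ w) σ
  pushWord-push []             b w []      = refl
  pushWord-push (true ∷ mask)  b w (s ∷ σ) = cong (_ ∷_) (pushWord-push mask b w σ)
  pushWord-push (false ∷ mask) b w (s ∷ σ) = cong (_ ∷_) (pushWord-push mask b w σ)

  pushWord-one : ∀ {k} (mask : Vec Bool k) b σ → pushAll mask b σ ≡ pushWord mask (b ∷ []) σ
  pushWord-one []             b []      = refl
  pushWord-one (true ∷ mask)  b (s ∷ σ) = cong (_ ∷_) (pushWord-one mask b σ)
  pushWord-one (false ∷ mask) b (s ∷ σ) = cong (_ ∷_) (pushWord-one mask b σ)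

  guess⁻ : ∀ {k} (mask : Vec Bool k) {σ h σ′} → Run (guess mask) σ h σ′ → ∃[ n ] σ′ ≡ pushWord mask (encodeℕ n) σ
  guess⁻ mask {σ} (push ⨟ l) = let ds , e = go [] l (pushWord-one mask false σ)
                                  in val ds , trans e (cong (λ w → pushWord mask w σ) (sym (encodeℕ-val ds)))
    where
    go : ∀ ds {τ h σ′} → Run (star ((push mask false ∣ push mask true) ⨟ push mask true)) τ h σ′ →
         τ ≡ pushWord mask (numeral ds) σ → ∃[ es ] σ′ ≡ pushWord mask (numeral es) σ
    go ds done e = ds , e
    go ds (more (this push ⨟ push) l) refl = go (false ∷ ds) l
      (trans (cong (pushAll mask true) (pushWord-push mask false (numeral ds) σ)) (pushWord-push mask true (false ∷ numeral ds) σ))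
    go ds (more (that push ⨟ push) l) refl = go (true ∷ ds) l
      (trans (cong (pushAll mask true) (pushWord-push mask true (numeral ds) σ)) (pushWord-push mask true (true ∷ numeral ds) σ))

  size₂ : ℕ → ℕ
  size₂ n = length (encodeℕ n)

  guess⁺ : ∀ {k} (mask : Vec Bool k) n σ → guess mask ∶ σ ↝[ size₂ n ] pushWord mask (encodeℕ n) σ
  guess⁺ mask n σ = subst (λ w → guess mask ∶ σ ↝[ length w ] pushWord mask w σ) (sym (encodeℕ-numeral n)) (build (digits n))
    where
    Loop = (push mask false ∣ push mask true) ⨟ push mask true
    -- The digits are guessed from the most significant one on, so the loop is
    -- extended at its end.
    loops : ∀ ds → star Loop ∶ pushWord mask (false ∷ []) σ ↝[ 1 + 2 * length ds ] pushWord mask (numeral ds) σ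
    loops []       = done⁺
    loops (d ∷ ds) = within (≤-reflexive (arith (length ds))) (snoc⁺ (loops ds) (digit d))
      where
      arith : ∀ l → (1 + 2 * l) + 2 ≡ 1 + 2 * suc l
      arith = solve-∀
      digit : ∀ d → Loop ∶ pushWord mask (numeral ds) σ ↝[ 1 ] pushWord mask (numeral (d ∷ ds)) σ
      digit false = ends (trans (cong (pushAll mask true) (pushWord-push mask false (numeral ds) σ)) (pushWord-push mask true (false ∷ numeral ds) σ))
                      (this⁺ push⁺ ⨟⁺ push⁺)
      digit true  = ends (trans (cong (pushAll mask true) (pushWord-push mask true (numeral ds) σ)) (pushWord-push mask true (true ∷ numeral ds) σ))
                      (that⁺ push⁺ ⨟⁺ push⁺)
    length-numeral : ∀ ds → 1 + 2 * length ds ≡ length (numeral ds)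
    length-numeral []       = refl
    length-numeral (d ∷ ds) = trans (arith (length ds)) (cong (λ n → suc (suc n)) (length-numeral ds))
      where
      arith : ∀ l → 1 + 2 * suc l ≡ 2 + (1 + 2 * l)
      arith = solve-∀
    build : ∀ ds → guess mask ∶ σ ↝[ length (numeral ds) ] pushWord mask (numeral ds) σ
    build ds = within (≤-reflexive (length-numeral ds))
      (subst (λ τ → push mask false ∶ σ ↝[ 0 ] τ) (pushWord-one mask false σ) push⁺ ⨟⁺ loops ds)

  private
    pattern 0F = zero
    pattern 1F = suc zero
    pattern 2F = suc (suc zero)
    pattern 3F = suc (suc (suc zero))

  match : NProg 2
  match = star (pop 0F true ⨟ pop 1F true ⨟ (pop 0F false ⨟ pop 1F false ∣ pop 0F true ⨟ pop 1F true)) ⨟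
          pop 0F false ⨟ pop 1F false

  match⁻ : ∀ n {x m h σ} → Run match (x ∷ (encodeℕ n ++ m) ∷ []) h σ → ∃[ x′ ] x ≡ encodeℕ n ++ x′ × σ ≡ x′ ∷ m ∷ []
  match⁻ n run rewrite encodeℕ-numeral n = go (digits n) run
    where
    go : ∀ ds {x m h σ} → Run match (x ∷ (numeral ds ++ m) ∷ []) h σ → ∃[ x′ ] x ≡ numeral ds ++ x′ × σ ≡ x′ ∷ m ∷ []
    go []       (done ⨟ pop refl ⨟ pop refl) = _ , refl , refl
    go []       (more (pop refl ⨟ pop () ⨟ _) _ ⨟ _)
    go (d ∷ ds) (done ⨟ pop refl ⨟ pop ())
    go (false ∷ ds) (more (pop refl ⨟ pop refl ⨟ this (pop refl ⨟ pop refl)) l ⨟ r) with go ds (l ⨟ r)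
    ... | x′ , refl , refl = x′ , refl , refl
    go (false ∷ ds) (more (pop refl ⨟ pop refl ⨟ that (pop refl ⨟ pop ())) _ ⨟ _)
    go (true ∷ ds) (more (pop refl ⨟ pop refl ⨟ this (pop refl ⨟ pop ())) _ ⨟ _)
    go (true ∷ ds) (more (pop refl ⨟ pop refl ⨟ that (pop refl ⨟ pop refl)) l ⨟ r) with go ds (l ⨟ r)
    ... | x′ , refl , refl = x′ , refl , refl

  match⁺ : ∀ n {x m} → match ∶ (encodeℕ n ++ x) ∷ (encodeℕ n ++ m) ∷ [] ↝[ size₂ n ] x ∷ m ∷ []
  match⁺ n {x} {m} rewrite encodeℕ-numeral n = go (digits n)
    where
    go : ∀ ds → match ∶ (numeral ds ++ x) ∷ (numeral ds ++ m) ∷ [] ↝[ length (numeral ds) ] x ∷ m ∷ []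
    go []       = done⁺ ⨟⁺ pop⁺ refl ⨟⁺ pop⁺ refl
    go (d ∷ ds) with go ds
    ... | ⟪ _ , l , (_⨟_ {h = h} {h′} p q) ⟫ = digit d
      where
      digit : ∀ d → match ∶ (numeral (d ∷ ds) ++ x) ∷ (numeral (d ∷ ds) ++ m) ∷ [] ↝[ 2 + length (numeral ds) ] x ∷ m ∷ []
      digit false = within (s≤s (s≤s (≤-trans (≤-reflexive (sym (length-++ h))) l)))
        (more⁺ (pop⁺ refl ⨟⁺ pop⁺ refl ⨟⁺ this⁺ (pop⁺ refl ⨟⁺ pop⁺ refl)) ⟪ h , ≤-refl , p ⟫ ⨟⁺ ⟪ h′ , ≤-refl , q ⟫)
      digit true  = within (s≤s (s≤s (≤-trans (≤-reflexive (sym (length-++ h))) l)))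
        (more⁺ (pop⁺ refl ⨟⁺ pop⁺ refl ⨟⁺ that⁺ (pop⁺ refl ⨟⁺ pop⁺ refl)) ⟪ h , ≤-refl , p ⟫ ⨟⁺ ⟪ h′ , ≤-refl , q ⟫)

  halve : NProg 2
  halve = star (pop 0F true ⨟ pop 0F true ⨟ push (false ∷ true ∷ []) true) ⨟ empty 0F ⨟
          star (pop 1F true ⨟ push (true ∷ false ∷ []) true) ⨟ empty 1F

  halve⁻ : ∀ k {h σ} → Run halve (marks k ∷ [] ∷ []) h σ → ∃[ n ] k ≡ 2 * n × σ ≡ marks n ∷ [] ∷ []
  halve⁻ k (l ⨟ empty e ⨟ l′ ⨟ empty e′) = let n , p , q = first k 0 l e l′ e′ in n , trans (sym (+-identityʳ k)) p , q
    where
    second : ∀ n u {h σ} → Run (star (pop 1F true ⨟ push (true ∷ false ∷ []) true)) (marks u ∷ marks n ∷ []) h σ →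
             lookup σ 1F ≡ [] → σ ≡ marks (n + u) ∷ [] ∷ []
    second zero    u done e = refl
    second zero    u (more (pop () ⨟ _) _) e
    second (suc n) u (more (pop refl ⨟ push) l) e =
      trans (second n (suc u) l e) (cong (λ z → marks z ∷ [] ∷ []) (+-suc n u))
    first : ∀ k u {h h′ σ σ′} → Run (star (pop 0F true ⨟ pop 0F true ⨟ push (false ∷ true ∷ []) true)) (marks k ∷ marks u ∷ []) h σ →
            lookup σ 0F ≡ [] → Run (star (pop 1F true ⨟ push (true ∷ false ∷ []) true)) σ h′ σ′ →
            lookup σ′ 1F ≡ [] → ∃[ n ] k + 2 * u ≡ 2 * n × σ′ ≡ marks n ∷ [] ∷ []
    first zero u done e l e′ = u , refl , trans (second u 0 l e′) (cong (λ z → marks z ∷ [] ∷ []) (+-identityʳ u))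
    first zero u (more (pop () ⨟ _) _) e l e′
    first (suc zero) u (more (pop refl ⨟ pop () ⨟ _) _) e l e′
    first (suc (suc k)) u (more (pop refl ⨟ pop refl ⨟ push) l₁) e l e′ with first k (suc u) l₁ e l e′
    ... | n , p , q = n , trans (arith k u) p , q
      where
      arith : ∀ k u → suc (suc k) + 2 * u ≡ k + 2 * suc u
      arith = solve-∀

  halve⁺ : ∀ n → halve ∶ marks (2 * n) ∷ [] ∷ [] ↝[ 2 * n + 2 ] marks n ∷ [] ∷ []
  halve⁺ n = within (≤-reflexive (arith n))
    (ends (cong (λ z → [] ∷ marks z ∷ []) (+-identityʳ n)) (first n 0) ⨟⁺ empty⁺ refl ⨟⁺
     ends (cong (λ z → marks z ∷ [] ∷ []) (+-identityʳ n)) (second n 0) ⨟⁺ empty⁺ refl)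
    where
    arith : ∀ n → suc n + (0 + (suc n + 0)) ≡ 2 * n + 2
    arith = solve-∀
    first : ∀ n u → star (pop 0F true ⨟ pop 0F true ⨟ push (false ∷ true ∷ []) true) ∶ marks (2 * n) ∷ marks u ∷ [] ↝[ suc n ] [] ∷ marks (n + u) ∷ []
    first zero    u = done⁺
    first (suc n) u rewrite +-suc n (n + 0) =
      more⁺ (pop⁺ refl ⨟⁺ pop⁺ refl ⨟⁺ push⁺)
        (ends (cong (λ z → [] ∷ marks z ∷ []) (+-suc n u)) (first n (suc u)))
    second : ∀ n u → star (pop 1F true ⨟ push (true ∷ false ∷ []) true) ∶ marks u ∷ marks n ∷ [] ↝[ suc n ] marks (n + u) ∷ [] ∷ []
    second zero    u = done⁺
    second (suc n) u = more⁺ (pop⁺ refl ⨟⁺ push⁺)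
      (ends (cong (λ z → marks z ∷ [] ∷ []) (+-suc n u)) (second n (suc u)))

  digit : Bool → ℕ
  digit false = 1
  digit true  = 2

  low : Bits → ℕ
  low []      = 0
  low (d ∷ _) = digit d

  rest : Bits → Bits
  rest []       = []
  rest (_ ∷ ds) = ds

  val-∷ : ∀ d ds → val (d ∷ ds) ≡ digit d + 2 * val ds
  val-∷ false ds = refl
  val-∷ true  ds = *-suc 2 (val ds)

  val-split : ∀ ds → val ds ≡ low ds + 2 * val (rest ds)
  val-split []       = refl
  val-split (d ∷ ds) = val-∷ d ds

  low≤2 : ∀ ds → low ds ≤ 2
  low≤2 []          = z≤n
  low≤2 (false ∷ _) = s≤s z≤n
  low≤2 (true ∷ _)  = ≤-refl

  -- The value of the lowest digit is added to the marks; a finished numeral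
  -- supplies the digit 0.
  read : NProg 2
  read = (pop 0F false ⨟ push (true ∷ false ∷ []) false)
       ∣ (pop 0F true ⨟ ((pop 0F false ⨟ push (false ∷ true ∷ []) true)
                       ∣ (pop 0F true ⨟ push (false ∷ true ∷ []) true ⨟ push (false ∷ true ∷ []) true)))

  read⁻ : ∀ ds {x k h σ} → Run read ((numeral ds ++ x) ∷ marks k ∷ []) h σ →
          σ ≡ (numeral (rest ds) ++ x) ∷ marks (low ds + k) ∷ []
  read⁻ []           (this (pop refl ⨟ push)) = refl
  read⁻ []           (that (pop () ⨟ _))
  read⁻ (d ∷ ds)     (this (pop () ⨟ _))
  read⁻ (false ∷ ds) (that (pop refl ⨟ this (pop refl ⨟ push))) = refl
  read⁻ (false ∷ ds) (that (pop refl ⨟ that (pop () ⨟ _)))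
  read⁻ (true ∷ ds)  (that (pop refl ⨟ that (pop refl ⨟ push ⨟ push))) = refl
  read⁻ (true ∷ ds)  (that (pop refl ⨟ this (pop () ⨟ _)))

  read⁺ : ∀ ds {x k} → read ∶ (numeral ds ++ x) ∷ marks k ∷ [] ↝[ 2 ] (numeral (rest ds) ++ x) ∷ marks (low ds + k) ∷ []
  read⁺ []           = within (s≤s z≤n) (this⁺ (pop⁺ refl ⨟⁺ push⁺))
  read⁺ (false ∷ ds) = that⁺ (pop⁺ refl ⨟⁺ this⁺ (pop⁺ refl ⨟⁺ push⁺))
  read⁺ (true ∷ ds)  = that⁺ (pop⁺ refl ⨟⁺ that⁺ (pop⁺ refl ⨟⁺ push⁺ ⨟⁺ push⁺))

  takeDigit : NProg 2
  takeDigit = pop 0F true ⨟ ((pop 0F false ⨟ pop 1F true) ∣ (pop 0F true ⨟ pop 1F true ⨟ pop 1F true))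

  takeDigit⁻ : ∀ k {x h σ} → Run takeDigit (x ∷ marks k ∷ []) h σ →
               ∃[ d ] ∃[ y ] ∃[ j ] x ≡ true ∷ d ∷ y × k ≡ digit d + j × σ ≡ y ∷ marks j ∷ []
  takeDigit⁻ (suc k)       (pop refl ⨟ this (pop refl ⨟ pop refl)) = false , _ , k , refl , refl , refl
  takeDigit⁻ zero          (pop refl ⨟ this (pop refl ⨟ pop ()))
  takeDigit⁻ (suc (suc k)) (pop refl ⨟ that (pop refl ⨟ pop refl ⨟ pop refl)) = true , _ , k , refl , refl , refl
  takeDigit⁻ (suc zero)    (pop refl ⨟ that (pop refl ⨟ pop refl ⨟ pop ()))
  takeDigit⁻ zero          (pop refl ⨟ that (pop refl ⨟ pop () ⨟ _))

  takeDigit⁺ : ∀ d {x k} → takeDigit ∶ (true ∷ d ∷ x) ∷ marks (digit d + k) ∷ [] ↝[ 1 ] x ∷ marks k ∷ []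
  takeDigit⁺ false = pop⁺ refl ⨟⁺ this⁺ (pop⁺ refl ⨟⁺ pop⁺ refl)
  takeDigit⁺ true  = pop⁺ refl ⨟⁺ that⁺ (pop⁺ refl ⨟⁺ pop⁺ refl ⨟⁺ pop⁺ refl)

  draw : NProg 2
  draw = (pop 0F false ⨟ push (true ∷ false ∷ []) false) ∣ takeDigit

  draw⁻ : ∀ ds k {x h σ} → Run draw ((numeral ds ++ x) ∷ marks k ∷ []) h σ →
          ∃[ j ] k ≡ low ds + j × σ ≡ (numeral (rest ds) ++ x) ∷ marks j ∷ []
  draw⁻ []       k (this (pop refl ⨟ push)) = k , refl , refl
  draw⁻ (d ∷ ds) k (this (pop () ⨟ _))
  draw⁻ ds       k (that run) with takeDigit⁻ k run
  draw⁻ (d ∷ ds) k (that run) | _ , _ , j , refl , e , e′ = j , e , e′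

  draw⁺ : ∀ ds {x k} → draw ∶ (numeral ds ++ x) ∷ marks (low ds + k) ∷ [] ↝[ 2 ] (numeral (rest ds) ++ x) ∷ marks k ∷ []
  draw⁺ []       = within (s≤s z≤n) (this⁺ (pop⁺ refl ⨟⁺ push⁺))
  draw⁺ (d ∷ ds) = that⁺ (takeDigit⁺ d)

  -- Counts a numeral on the first stack out in marks on the second one.
  unary : NProg 4
  unary = star (push (false ∷ true ∷ true ∷ false ∷ []) true) ⨟
          star (on (keep (drop (keep (drop done)))) takeDigit ⨟ on (drop (drop (keep (keep done)))) halve) ⨟
          pop 0F false ⨟ empty 2F

  unary⁻ : ∀ {x h σ} → Run unary (x ∷ [] ∷ [] ∷ [] ∷ []) h σ →
           ∃[ n ] ∃[ y ] x ≡ encodeℕ n ++ y × σ ≡ y ∷ marks n ∷ [] ∷ [] ∷ []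
  unary⁻ (l ⨟ r) with guesses 0 l
    where
    guesses : ∀ k {x h σ} → Run (star (push (false ∷ true ∷ true ∷ false ∷ []) true)) (x ∷ marks k ∷ marks k ∷ [] ∷ []) h σ →
              ∃[ n ] σ ≡ x ∷ marks n ∷ marks n ∷ [] ∷ []
    guesses k done          = k , refl
    guesses k (more push l) = guesses (suc k) l
  ... | n , refl with r
  ... | l′ ⨟ r′ with counts n l′ r′
    where
    counts : ∀ k {x h h′ σ τ} → Run (star (on (keep (drop (keep (drop done)))) takeDigit ⨟ on (drop (drop (keep (keep done)))) halve))
               (x ∷ marks n ∷ marks k ∷ [] ∷ []) h τ → Run (pop 0F false ⨟ empty 2F) τ h′ σ →
             ∃[ ds ] ∃[ y ] x ≡ numeral ds ++ y × val ds ≡ k × σ ≡ y ∷ marks n ∷ [] ∷ [] ∷ []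
    counts zero    done (pop refl ⨟ empty e) = [] , _ , refl , refl , refl
    counts (suc k) done (pop refl ⨟ empty ())
    counts k (more (t ⨟ u) l) r with frame⁻ (keep (drop (keep (drop done)))) takeDigit t
    ... | τ , t′ , refl with takeDigit⁻ k t′
    ... | d , y , j , refl , refl , refl with frame⁻ (drop (drop (keep (keep done)))) halve u
    ... | τ′ , u′ , refl with halve⁻ j u′
    ... | i , refl , refl with counts i l r
    ... | ds , z , refl , refl , refl = d ∷ ds , z , refl , val-∷ d ds , refl
  ... | ds , y , refl , refl , refl = val ds , y , cong (_++ y) (sym (encodeℕ-val ds)) , refl

  unary⁺ : ∀ n {x} → unary ∶ (encodeℕ n ++ x) ∷ [] ∷ [] ∷ [] ∷ [] ↝[ suc n + (size₂ n * (4 + n)) ] x ∷ marks n ∷ [] ∷ [] ∷ []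
  unary⁺ n {x} rewrite encodeℕ-numeral n =
    ends (cong (λ z → (numeral (digits n) ++ x) ∷ marks z ∷ marks z ∷ [] ∷ []) (trans (+-identityʳ n) (sym (val-digits n)))) (guesses n 0) ⨟⁺
    ends (cong (λ z → x ∷ marks z ∷ [] ∷ [] ∷ []) (val-digits n)) (counts (digits n) (val (digits n)) (≤-reflexive (val-digits n)))
    where
    guesses : ∀ k u {x} → star (push (false ∷ true ∷ true ∷ false ∷ []) true) ∶ x ∷ marks u ∷ marks u ∷ [] ∷ [] ↝[ suc k ] x ∷ marks (k + u) ∷ marks (k + u) ∷ [] ∷ []
    guesses zero    u = done⁺
    guesses (suc k) u {x} = more⁺ push⁺ (ends (cong (λ z → x ∷ marks z ∷ marks z ∷ [] ∷ []) (+-suc k u)) (guesses k (suc u)))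
    counts : ∀ ds u → val ds ≤ n → star (on (keep (drop (keep (drop done)))) takeDigit ⨟ on (drop (drop (keep (keep done)))) halve) ⨟ pop 0F false ⨟ empty 2F
             ∶ (numeral ds ++ x) ∷ marks u ∷ marks (val ds) ∷ [] ∷ [] ↝[ length (numeral ds) * (4 + n) ] x ∷ marks u ∷ [] ∷ [] ∷ []
    counts []       u _ = within (s≤s z≤n) (done⁺ ⨟⁺ pop⁺ refl ⨟⁺ empty⁺ refl)
    counts (d ∷ ds) u le rewrite val-∷ d ds with counts ds u (≤-trans (m≤m+n (val ds) _) (≤-trans (m≤n+m (2 * val ds) (digit d)) le))
    ... | ⟪ _ , b , (_⨟_ {h = h} {h′} p q) ⟫ = within (bound b)
      (more⁺ (frame↝ (keep (drop (keep (drop done)))) _ (takeDigit⁺ d) ⨟⁺ frame↝ (drop (drop (keep (keep done)))) _ (halve⁺ (val ds)))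
             ⟪ h , ≤-refl , p ⟫ ⨟⁺ ⟪ h′ , ≤-refl , q ⟫)
      where
      bound : length (h ++ h′) ≤ length (numeral ds) * (4 + n) →
              suc (1 + (2 * val ds + 2) + length h) + length h′ ≤ length (numeral (d ∷ ds)) * (4 + n)
      bound b = begin
        suc (1 + (2 * val ds + 2) + length h) + length h′ ≡⟨ arith (2 * val ds) (length h) (length h′) ⟩
        (4 + 2 * val ds) + (length h + length h′)         ≤⟨ +-mono-≤ (+-monoʳ-≤ 4 (≤-trans (m≤n+m (2 * val ds) (digit d)) le)) (≤-trans (≤-reflexive (sym (length-++ h))) b) ⟩
        (4 + n) + length (numeral ds) * (4 + n)           ≤⟨ m≤n+m _ (4 + n) ⟩
        length (numeral (d ∷ ds)) * (4 + n)               ∎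
        where
        open ≤-Reasoning
        arith : ∀ a b c → suc (1 + (a + 2) + b) + c ≡ (4 + a) + (b + c)
        arith = solve-∀

  addDigits : NProg 5
  addDigits =
    on (keep (drop (drop (keep (drop done))))) read ⨟ on (drop (keep (drop (keep (drop done))))) read ⨟
    on (drop (drop (keep (keep (drop done))))) draw ⨟ on (drop (drop (drop (keep (keep done))))) halve

  -- Checks that the numerals on the first two stacks add up to the one on the
  -- third stack; the fourth stack holds the carry.
  add : NProg 5
  add = star addDigits ⨟ pop 0F false ⨟ pop 1F false ⨟ pop 2F false ⨟ empty 3F

  Adds : NProg 5 → Set
  Adds P = ∀ as bs cs k {x y z h σ} →
    Run P ((numeral as ++ x) ∷ (numeral bs ++ y) ∷ (numeral cs ++ z) ∷ marks k ∷ [] ∷ []) h σ →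
    ∃[ i ] low bs + (low as + k) ≡ low cs + 2 * i ×
      σ ≡ (numeral (rest as) ++ x) ∷ (numeral (rest bs) ++ y) ∷ (numeral (rest cs) ++ z) ∷ marks i ∷ [] ∷ []

  addDigits⁻ : Adds addDigits
  addDigits⁻ as bs cs k {x} {y} {z} (r₁ ⨟ r₂ ⨟ d ⨟ l)
    with frame⁻ (keep (drop (drop (keep (drop done))))) read r₁
  ... | τ₁ , r₁′ , refl with read⁻ as {x} {k} r₁′
  ... | refl with frame⁻ (drop (keep (drop (keep (drop done))))) read r₂
  ... | τ₂ , r₂′ , refl with read⁻ bs {y} {low as + k} r₂′
  ... | refl with frame⁻ (drop (drop (keep (keep (drop done))))) draw d
  ... | τ₃ , d′ , refl with draw⁻ cs (low bs + (low as + k)) {z} d′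
  ... | j , e , refl with frame⁻ (drop (drop (drop (keep (keep done))))) halve l
  ... | τ₄ , l′ , refl with halve⁻ j l′
  ... | i , refl , refl = i , e , refl

  add⁻ : ∀ a b c {x y z h σ} → Run add ((encodeℕ a ++ x) ∷ (encodeℕ b ++ y) ∷ (encodeℕ c ++ z) ∷ [] ∷ [] ∷ []) h σ →
         a + b ≡ c × σ ≡ x ∷ y ∷ z ∷ [] ∷ [] ∷ []
  add⁻ a b c (l ⨟ t) rewrite encodeℕ-numeral a | encodeℕ-numeral b | encodeℕ-numeral c =
    let e , e′ = go addDigits⁻ (digits a) (digits b) (digits c) 0 l t
    in trans (sym (+-identityʳ (a + b))) (trans (cong₂ (λ u v → u + v + 0) (sym (val-digits a)) (sym (val-digits b))) (trans e (val-digits c))) , e′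
    where
    arith : ∀ a b k a′ b′ → (a + 2 * a′) + (b + 2 * b′) + k ≡ (b + (a + k)) + 2 * (a′ + b′)
    arith = solve-∀
    arith′ : ∀ c i w → c + 2 * i + 2 * w ≡ c + 2 * (w + i)
    arith′ = solve-∀
    combine : ∀ as bs cs k i → low bs + (low as + k) ≡ low cs + 2 * i → val (rest as) + val (rest bs) + i ≡ val (rest cs) →
              val as + val bs + k ≡ val cs
    combine as bs cs k i e e′ = begin
      val as + val bs + k                                    ≡⟨ cong₂ (λ u v → u + v + k) (val-split as) (val-split bs) ⟩
      (low as + 2 * val (rest as)) + (low bs + 2 * val (rest bs)) + k ≡⟨ arith (low as) (low bs) k (val (rest as)) (val (rest bs)) ⟩
      (low bs + (low as + k)) + 2 * (val (rest as) + val (rest bs))   ≡⟨ cong (_+ 2 * (val (rest as) + val (rest bs))) e ⟩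
      low cs + 2 * i + 2 * (val (rest as) + val (rest bs))            ≡⟨ arith′ (low cs) i (val (rest as) + val (rest bs)) ⟩
      low cs + 2 * (val (rest as) + val (rest bs) + i)                ≡⟨ cong (λ v → low cs + 2 * v) e′ ⟩
      low cs + 2 * val (rest cs)                                      ≡⟨ val-split cs ⟨
      val cs ∎
      where open ≡-Reasoning
    go : ∀ {P} → Adds P → ∀ as bs cs k {x y z h h′ τ σ} →
         Run (star P) ((numeral as ++ x) ∷ (numeral bs ++ y) ∷ (numeral cs ++ z) ∷ marks k ∷ [] ∷ []) h τ →
         Run (pop 0F false ⨟ pop 1F false ⨟ pop 2F false ⨟ empty 3F) τ h′ σ →
         val as + val bs + k ≡ val cs × σ ≡ x ∷ y ∷ z ∷ [] ∷ [] ∷ []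
    go adds []       []       []       zero    done (pop refl ⨟ pop refl ⨟ pop refl ⨟ empty refl) = refl , refl
    go adds []       []       []       (suc k) done (pop refl ⨟ pop refl ⨟ pop refl ⨟ empty ())
    go adds (_ ∷ _)  _        _        k       done (pop () ⨟ _)
    go adds []       (_ ∷ _)  _        k       done (pop refl ⨟ pop () ⨟ _)
    go adds []       []       (_ ∷ _)  k       done (pop refl ⨟ pop refl ⨟ pop () ⨟ _)
    go adds as bs cs k (more p s) t with adds as bs cs k p
    ... | i , e , refl with go adds (rest as) (rest bs) (rest cs) i s t
    ... | e′ , e″ = combine as bs cs k i e e′ , e″

  add⁺ : ∀ a b {x y z} → add ∶ (encodeℕ a ++ x) ∷ (encodeℕ b ++ y) ∷ (encodeℕ (a + b) ++ z) ∷ [] ∷ [] ∷ [] ↝[ 15 * size₂ (a + b) ] x ∷ y ∷ z ∷ [] ∷ [] ∷ []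
  add⁺ a b {x} {y} {z} rewrite encodeℕ-numeral a | encodeℕ-numeral b | encodeℕ-numeral (a + b) =
    go (digits (a + b)) (digits a) (digits b) 0 z≤n
      (trans (+-identityʳ _) (trans (cong₂ _+_ (val-digits a) (val-digits b)) (sym (val-digits (a + b)))))
    where
    arith : ∀ a b k a′ b′ → (a + 2 * a′) + (b + 2 * b′) + k ≡ (b + (a + k)) + 2 * (a′ + b′)
    arith = solve-∀
    arith′ : ∀ c i w → c + 2 * (w + i) ≡ (c + 2 * i) + 2 * w
    arith′ = solve-∀
    low-zero : ∀ ds → low ds ≡ 0 → val ds ≡ 0
    low-zero [] _ = refl
    low-zero (false ∷ _) ()
    low-zero (true ∷ _) ()
    val-zero : ∀ ds → val ds ≡ 0 → ds ≡ []
    val-zero [] _ = refl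
    val-zero (false ∷ _) ()
    val-zero (true ∷ _) ()
    -- The sum of the lowest digits and the carry is the digit of the result plus
    -- twice the next carry.
    carry : ∀ as bs d cs k → val as + val bs + k ≡ val (d ∷ cs) →
            ∃[ i ] low bs + (low as + k) ≡ digit d + 2 * i × val (rest as) + val (rest bs) + i ≡ val cs
    carry as bs d cs k e with ≤-<-connex (val (rest as) + val (rest bs)) (val cs)
    ... | inj₁ w≤v = val cs ∸ w , +-cancelʳ-≡ (2 * w) _ _ (trans e′ (trans (cong (λ v → digit d + 2 * v) (sym (m+[n∸m]≡n w≤v))) (arith′ (digit d) _ w))) , m+[n∸m]≡n w≤v
      where
      w = val (rest as) + val (rest bs)
      e′ : (low bs + (low as + k)) + 2 * w ≡ digit d + 2 * val cs
      e′ = trans (sym (arith (low as) (low bs) k (val (rest as)) (val (rest bs))))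
             (trans (sym (cong₂ (λ u v → u + v + k) (val-split as) (val-split bs))) (trans e (val-∷ d cs)))
    ... | inj₂ v<w = contradiction v<w (≤⇒≯ (≤-trans (≤-reflexive w≡0) z≤n))
      where
      w = val (rest as) + val (rest bs)
      e′ : (low bs + (low as + k)) + 2 * w ≡ digit d + 2 * val cs
      e′ = trans (sym (arith (low as) (low bs) k (val (rest as)) (val (rest bs))))
             (trans (sym (cong₂ (λ u v → u + v + k) (val-split as) (val-split bs))) (trans e (val-∷ d cs)))
      t≡0 : low bs + (low as + k) ≡ 0
      t≡0 = n≤0⇒n≡0 (+-cancelʳ-≤ (2 * w) _ _ (≤-trans (≤-reflexive e′)
        (≤-trans (+-monoˡ-≤ (2 * val cs) (low≤2 (d ∷ []))) (≤-trans (≤-reflexive (sym (*-suc 2 (val cs)))) (*-monoʳ-≤ 2 v<w)))))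
      rest-zero : ∀ ds → low ds ≡ 0 → val (rest ds) ≡ 0
      rest-zero ds l = m+n≡0⇒m≡0 (val (rest ds)) (m+n≡0⇒n≡0 (low ds) (trans (sym (val-split ds)) (low-zero ds l)))
      w≡0 : w ≡ 0
      w≡0 = cong₂ _+_ (rest-zero as (m+n≡0⇒m≡0 (low as) (m+n≡0⇒n≡0 (low bs) t≡0))) (rest-zero bs (m+n≡0⇒m≡0 (low bs) t≡0))
    small : ∀ as bs d {k i} → k ≤ 3 → low bs + (low as + k) ≡ digit d + 2 * i → i ≤ 3
    small as bs d {k} {i} k≤3 e = s≤s⁻¹ (*-cancelˡ-< 2 i 4 (s≤s (≤-trans (m≤n+m (2 * i) (digit d))
      (≤-trans (≤-reflexive (sym e)) (+-mono-≤ (low≤2 bs) (+-mono-≤ (low≤2 as) k≤3))))))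
    go : ∀ cs as bs k → k ≤ 3 → val as + val bs + k ≡ val cs →
         add ∶ (numeral as ++ x) ∷ (numeral bs ++ y) ∷ (numeral cs ++ z) ∷ marks k ∷ [] ∷ [] ↝[ 15 * length (numeral cs) ] x ∷ y ∷ z ∷ [] ∷ [] ∷ []
    go [] as bs k _ e
      with val-zero as (m+n≡0⇒m≡0 (val as) (m+n≡0⇒m≡0 (val as + val bs) e))
         | val-zero bs (m+n≡0⇒n≡0 (val as) (m+n≡0⇒m≡0 (val as + val bs) e))
         | m+n≡0⇒n≡0 (val as + val bs) e
    ... | refl | refl | refl = within (s≤s z≤n) (done⁺ ⨟⁺ pop⁺ refl ⨟⁺ pop⁺ refl ⨟⁺ pop⁺ refl ⨟⁺ empty⁺ refl)
    go (d ∷ cs) as bs k k≤3 e with carry as bs d cs k e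
    ... | i , e₁ , e₂ with go cs (rest as) (rest bs) i (small as bs d k≤3 e₁) e₂
    ... | ⟪ _ , b , (_⨟_ {h = h} {h′} p q) ⟫ = within bound
      (more⁺ (frame↝ (keep (drop (drop (keep (drop done))))) _ (read⁺ as) ⨟⁺
              frame↝ (drop (keep (drop (keep (drop done))))) _ (read⁺ bs) ⨟⁺
              subst (λ u → on (drop (drop (keep (keep (drop done))))) draw ∶ A ∷ B ∷ C ∷ marks u ∷ [] ∷ [] ↝[ 2 ] A ∷ B ∷ C′ ∷ marks (2 * i) ∷ [] ∷ []) (sym e₁)
                (frame↝ (drop (drop (keep (keep (drop done))))) (A ∷ B ∷ C ∷ marks (digit d + 2 * i) ∷ [] ∷ []) (draw⁺ (d ∷ cs))) ⨟⁺
              frame↝ (drop (drop (drop (keep (keep done))))) (A ∷ B ∷ C′ ∷ marks (2 * i) ∷ [] ∷ []) (halve⁺ i))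
             ⟪ h , ≤-refl , p ⟫ ⨟⁺ ⟪ h′ , ≤-refl , q ⟫)
      where
      A = numeral (rest as) ++ x
      B = numeral (rest bs) ++ y
      C = numeral (d ∷ cs) ++ z
      C′ = numeral cs ++ z
      arith″ : ∀ i h h′ → suc (2 + (2 + (2 + (2 * i + 2))) + h) + h′ ≡ (9 + 2 * i) + (h + h′)
      arith″ = solve-∀
      bound : suc (2 + (2 + (2 + (2 * i + 2))) + length h) + length h′ ≤ 15 * length (numeral (d ∷ cs))
      bound = begin
        suc (2 + (2 + (2 + (2 * i + 2))) + length h) + length h′ ≡⟨ arith″ i (length h) (length h′) ⟩
        (9 + 2 * i) + (length h + length h′) ≤⟨ +-mono-≤ (+-monoʳ-≤ 9 (*-monoʳ-≤ 2 (small as bs d {k} {i} k≤3 e₁))) (≤-trans (≤-reflexive (sym (length-++ h))) b) ⟩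
        15 + 15 * length (numeral cs)       ≡⟨ *-suc 15 (length (numeral cs)) ⟨
        15 * suc (length (numeral cs))      ≤⟨ *-monoʳ-≤ 15 (n≤1+n (suc (length (numeral cs)))) ⟩
        15 * length (numeral (d ∷ cs))      ∎
        where open ≤-Reasoning

module VerifierSoundness where

  open StackPrograms hiding (step)
  open GuessingPrograms
  open Encodings
  open NumeralPrograms
  open import Data.Fin.Properties using (_≟_)

  nums : List ℕ → Bits
  nums = concatMap encodeℕ

  encodeℕ-∷ : ∀ n → ∃[ b ] ∃[ w ] encodeℕ n ≡ b ∷ w
  encodeℕ-∷ n rewrite encodeℕ-numeral n with digits n
  ... | []    = false , [] , refl
  ... | d ∷ _ = true , _ , refl

  encodeℕ-false : ∀ n {x y} → encodeℕ n ++ x ≡ false ∷ y → n ≡ 0 × x ≡ y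
  encodeℕ-false n {x} {y} e = encodeℕ-prefix n 0 {x} {y} e

  encodeℕ-true : ∀ n {x y} → encodeℕ n ++ x ≡ true ∷ y → 0 < n
  encodeℕ-true (suc n) e = s≤s z≤n

  encodeℕ-positive : ∀ {n} → 0 < n → ∃[ w ] encodeℕ n ≡ true ∷ w
  encodeℕ-positive {n} 0<n with digits n | encodeℕ-numeral n | val-digits n
  ... | []    | _ | e = contradiction 0<n (≤⇒≯ (≤-reflexive (sym e)))
  ... | d ∷ _ | e | _ = _ , e

  nums-[] : ∀ l → nums l ≡ [] → l ≡ []
  nums-[] [] _ = refl
  nums-[] (n ∷ l) e with encodeℕ-∷ n
  ... | b , w , e′ rewrite e′ with () ← e

  pushWord-[] : ∀ {k} (mask : Vec Bool k) σ → pushWord mask [] σ ≡ σ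
  pushWord-[] []             []      = refl
  pushWord-[] (true ∷ mask)  (s ∷ σ) = cong (s ∷_) (pushWord-[] mask σ)
  pushWord-[] (false ∷ mask) (s ∷ σ) = cong (s ∷_) (pushWord-[] mask σ)

  pushWord-++ : ∀ {k} (mask : Vec Bool k) u w σ → pushWord mask u (pushWord mask w σ) ≡ pushWord mask (u ++ w) σ
  pushWord-++ []             u w []      = refl
  pushWord-++ (true ∷ mask)  u w (s ∷ σ) = cong₂ _∷_ (sym (++-assoc u w s)) (pushWord-++ mask u w σ)
  pushWord-++ (false ∷ mask) u w (s ∷ σ) = cong (s ∷_) (pushWord-++ mask u w σ)

  guesses⁻ : ∀ {k} (mask : Vec Bool k) {σ h σ′} → Run (star (guess mask)) σ h σ′ → ∃[ l ] σ′ ≡ pushWord mask (nums l) σ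
  guesses⁻ mask {σ} run = go [] run (sym (pushWord-[] mask σ))
    where
    go : ∀ l {τ h σ′} → Run (star (guess mask)) τ h σ′ → τ ≡ pushWord mask (nums l) σ → ∃[ l ] σ′ ≡ pushWord mask (nums l) σ
    go l done e = l , e
    go l (more g r) refl with guess⁻ mask g
    ... | n , refl = go (n ∷ l) r (pushWord-++ mask (encodeℕ n) (nums l) σ)

  add-nums⁻ : ∀ a bs cs {x h σ} → Run add ((encodeℕ a ++ x) ∷ nums bs ∷ nums cs ∷ [] ∷ [] ∷ []) h σ →
              ∃[ b ] ∃[ bs′ ] ∃[ cs′ ] bs ≡ b ∷ bs′ × cs ≡ a + b ∷ cs′ × σ ≡ x ∷ nums bs′ ∷ nums cs′ ∷ [] ∷ [] ∷ []
  add-nums⁻ a [] cs (done ⨟ pop e ⨟ pop () ⨟ _)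
  add-nums⁻ a [] cs (more (r₁ ⨟ r₂ ⨟ _) _ ⨟ _) with frame⁻ (keep (drop (drop (keep (drop done))))) read r₁
  ... | _ ∷ _ ∷ [] , _ , refl with frame⁻ (drop (keep (drop (keep (drop done))))) read r₂
  ...   | _ , this (pop () ⨟ _) , _
  ...   | _ , that (pop () ⨟ _) , _
  add-nums⁻ a (b ∷ bs) [] (done ⨟ pop e ⨟ pop _ ⨟ pop () ⨟ _)
  add-nums⁻ a (b ∷ bs) [] (more (r₁ ⨟ r₂ ⨟ r₃ ⨟ _) _ ⨟ _) with frame⁻ (keep (drop (drop (keep (drop done))))) read r₁
  ... | _ ∷ _ ∷ [] , _ , refl with frame⁻ (drop (keep (drop (keep (drop done))))) read r₂
  ... | _ ∷ _ ∷ [] , _ , refl with frame⁻ (drop (drop (keep (keep (drop done))))) draw r₃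
  ...   | _ , this (pop () ⨟ _) , _
  ...   | _ , that (pop () ⨟ _) , _
  add-nums⁻ a (b ∷ bs) (c ∷ cs) run with add⁻ a b c run
  ... | refl , refl = b , bs , cs , refl , refl , refl

  Reg : Set
  Reg = Fin 18

  -- Each stack whose name ends in q holds the numerals of the following stack
  -- without the first one.
  X T₁ T₂ n₁ D M A₁ Sq S₁ A₂ Wq W₁ Y Rq R₁ Z K K₂ : Reg
  X  = # 0
  T₁ = # 1
  T₂ = # 2
  n₁ = # 3
  D  = # 4
  M  = # 5
  A₁ = # 6
  Sq = # 7
  S₁ = # 8
  A₂ = # 9
  Wq = # 10
  W₁ = # 11
  Y  = # 12
  Rq = # 13
  R₁ = # 14
  Z  = # 15
  K  = # 16
  K₂ = # 17

  only : List Reg → Vec Bool 18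
  only rs = Vec.tabulate λ r → List.foldr (λ s b → does (r ≟ s) ∨ b) false rs

  count : ∀ {k} → Vec Bool k → ℕ
  count []          = 0
  count (true ∷ m)  = suc (count m)
  count (false ∷ m) = count m

  pick : ∀ {k} (m : Vec Bool k) → Choice (count m) k
  pick []          = done
  pick (true ∷ m)  = keep (pick m)
  pick (false ∷ m) = drop (pick m)

  put : List Reg → Bool → NProg 18
  put rs = push (only rs)

  guessOn : List Reg → NProg 18
  guessOn rs = guess (only rs)

  refill : NProg 18
  refill = empty T₁ ⨟ star (pop T₂ true ⨟ put (T₁ ∷ []) true) ⨟ empty T₂

  matchInput : NProg 18
  matchInput = on (pick (only (X ∷ M ∷ []))) match

  -- The summands are what an agent takes in a period and what is left of the
  -- supply; what it takes and what it still lacks afterwards; its value and the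
  -- value obtained by the agents after it.
  supplyStep demandStep valueStep : NProg 18
  supplyStep = on (pick (only (A₁ ∷ Sq ∷ S₁ ∷ K ∷ K₂ ∷ []))) add
  demandStep = on (pick (only (A₂ ∷ Wq ∷ W₁ ∷ K ∷ K₂ ∷ []))) add
  valueStep  = on (pick (only (Y ∷ Rq ∷ R₁ ∷ K ∷ K₂ ∷ []))) add

  earlyWith : NProg 18 → NProg 18 → NProg 18
  earlyWith P Q = star (pop D true ⨟ pop T₁ true ⨟ put (T₂ ∷ []) true ⨟
                        (pop X false ⨟ guessOn (A₁ ∷ A₂ ∷ []) ∣ pop X true ⨟ put (A₁ ∷ A₂ ∷ []) false) ⨟ P ⨟ Q)

  lateWith : NProg 18 → NProg 18 → Bool → NProg 18
  lateWith P Q true  = ε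
  lateWith P Q false = star (pop T₁ true ⨟ put (T₂ ∷ []) true ⨟ (pop X false ∣ pop X true) ⨟ put (A₁ ∷ A₂ ∷ []) false ⨟ P ⨟ Q)

  early : NProg 18
  early = earlyWith supplyStep demandStep

  late : Bool → NProg 18
  late = lateWith supplyStep demandStep

  close : NProg 18
  close = refill ⨟ pop W₁ false ⨟ empty W₁ ⨟ empty Wq

  nonzero : NProg 1
  nonzero = pop zero true ⨟ push (true ∷ []) true

  limit : Bool → NProg 1
  limit true  = pop zero true ⨟ ((pop zero false ⨟ (pop zero false ∣ pop zero true ⨟ pop zero false ⨟ pop zero false))
                               ∣ pop zero true ⨟ pop zero false)
  limit false = star (pop zero false ∣ pop zero true) ⨟ empty zero

  valueGuess : Bool → NProg 18
  valueGuess true  = guessOn (M ∷ Y ∷ [])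
  valueGuess false = guessOn (M ∷ []) ⨟ put (Y ∷ []) false

  demandGuess : Bool → NProg 18
  demandGuess true  = guessOn (M ∷ W₁ ∷ K ∷ [])
  demandGuess false = guessOn (M ∷ K ∷ []) ⨟ put (W₁ ∷ []) false

  agentWith : (restricted served : Bool) → NProg 18 → NProg 18 → NProg 18
  agentWith b s P Q =
    valueGuess s ⨟ on (pick (only (M ∷ []))) nonzero ⨟ matchInput ⨟ valueStep ⨟
    on (pick (only (X ∷ D ∷ K ∷ K₂ ∷ []))) unary ⨟ on (pick (only (D ∷ []))) nonzero ⨟
    star (guessOn (Wq ∷ W₁ ∷ [])) ⨟ demandGuess s ⨟ on (pick (only (M ∷ []))) nonzero ⨟ on (pick (only (K ∷ []))) (limit b) ⨟ matchInput ⨟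
    P ⨟ Q

  agentProgram : (restricted served : Bool) → NProg 18
  agentProgram b s = agentWith b s early (empty D ⨟ late b ⨟ close)

  supplyProgram : NProg 18
  supplyProgram =
    on (pick (only (X ∷ T₁ ∷ K ∷ K₂ ∷ []))) unary ⨟ on (pick (only (T₁ ∷ []))) nonzero ⨟
    star (guessOn (Sq ∷ S₁ ∷ [])) ⨟ star (guessOn (M ∷ S₁ ∷ [])) ⨟
    star (pop T₁ true ⨟ put (T₂ ∷ []) true ⨟ matchInput) ⨟ empty M ⨟ refill

  agentsWith : NProg 18 → NProg 18 → NProg 18
  agentsWith P Q =
    on (pick (only (X ∷ n₁ ∷ K ∷ K₂ ∷ []))) unary ⨟
    star (guessOn (Rq ∷ R₁ ∷ [])) ⨟ guessOn (R₁ ∷ Z ∷ []) ⨟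
    star (pop n₁ true ⨟ (P ∣ Q)) ⨟ empty n₁ ⨟
    pop R₁ false ⨟ empty R₁ ⨟ empty Rq

  agentsProgram : Bool → NProg 18
  agentsProgram b = agentsWith (agentProgram b true) (agentProgram b false)

  targetProgram : NProg 18
  targetProgram =
    ( pop X true ⨟ guessOn (M ∷ A₂ ∷ []) ⨟ matchInput ⨟ guessOn (Wq ∷ []) ⨟ on (pick (only (A₂ ∷ Wq ∷ Z ∷ K ∷ K₂ ∷ []))) add
    ∣ pop X false ⨟ guessOn (M ∷ []) ⨟ matchInput ) ⨟
    empty X

  program : Bool → NProg 18
  program b = supplyProgram ⨟ agentsProgram b ⨟ targetProgram

  mem : (x t t′ n d sq s wq w y rq r z : Bits) → Stacks 18
  mem x t t′ n d sq s wq w y rq r z =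
    x ∷ t ∷ t′ ∷ n ∷ d ∷ [] ∷ [] ∷ sq ∷ s ∷ [] ∷ wq ∷ w ∷ y ∷ rq ∷ r ∷ z ∷ [] ∷ [] ∷ []

  -- An agent with the given number of usable periods and the given remaining
  -- demand turns the supplies ms into ms′.
  data Periods (restricted : Bool) : ∀ {t} → ℕ → ℕ → Vec ℕ t → Vec Bool t → Vec ℕ t → Set where
    end  : Periods restricted 0 0 [] [] []
    taken : ∀ {t d w m} {ms ms′ : Vec ℕ t} {gs} a → Periods restricted d w ms gs ms′ →
           Periods restricted (suc d) (a + w) (a + m ∷ ms) (false ∷ gs) (m ∷ ms′)
    paused : ∀ {t d w m} {ms ms′ : Vec ℕ t} {gs} → Periods restricted d w ms gs ms′ →
           Periods restricted (suc d) w (m ∷ ms) (true ∷ gs) (m ∷ ms′)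
    beyond : ∀ {t w m g} {ms ms′ : Vec ℕ t} {gs} → restricted ≡ false → Periods restricted 0 w ms gs ms′ →
           Periods restricted 0 w (m ∷ ms) (g ∷ gs) (m ∷ ms′)

  chosen : Bool → ℕ → ℕ
  chosen s k = if s then k else 0

  data Serve (restricted : Bool) {t} : ∀ {n} → Vec (Agent t) n → Vec ℕ t → ℕ → Set where
    []    : ∀ {ms} → Serve restricted [] ms 0
    serve : ∀ s {n} {A : Agent t} {As : Vec (Agent t) n} {ms ms′ r} →
            (restricted ≡ true → Agent.demand A ≤ 3) →
            Periods restricted (Agent.due A) (chosen s (Agent.demand A)) ms (Agent.gaps A) ms′ →
            Serve restricted As ms′ r → Serve restricted (A ∷ As) ms (chosen s (Agent.value A) + r)

  Certified : Bool → Scheduling × ℤ → Set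
  Certified b (I , V) = ∃[ r ] Serve b (Scheduling.agents I) (Scheduling.supply I) r × V ℤ.≤ ℤ.+ r

  refill⁻ : ∀ t′ {x t n d sq s wq w y rq r z h σ} → Run refill (mem x t (marks t′) n d sq s wq w y rq r z) h σ →
            t ≡ [] × σ ≡ mem x (marks t′) [] n d sq s wq w y rq r z
  refill⁻ t′ (empty refl ⨟ l ⨟ empty e) = refl , go t′ 0 l e
    where
    go : ∀ j i {x n d sq s wq w y rq r z h σ} → Run (star (pop T₂ true ⨟ put (T₁ ∷ []) true)) (mem x (marks i) (marks j) n d sq s wq w y rq r z) h σ →
         lookup σ T₂ ≡ [] → σ ≡ mem x (marks (i + j)) [] n d sq s wq w y rq r z
    go zero    i done e rewrite +-identityʳ i = refl
    go zero    i (more (pop () ⨟ _) _) e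
    go (suc j) i done ()
    go (suc j) i (more (pop refl ⨟ push) l) e rewrite +-suc i j = go j (suc i) l e

  matchInput⁻ : ∀ k {x t t′ n d sq s wq w y rq r z u v h σ} →
    Run matchInput (x ∷ t ∷ t′ ∷ n ∷ d ∷ (encodeℕ k ++ v) ∷ [] ∷ sq ∷ s ∷ u ∷ wq ∷ w ∷ y ∷ rq ∷ r ∷ z ∷ [] ∷ [] ∷ []) h σ →
    ∃[ x′ ] x ≡ encodeℕ k ++ x′ × σ ≡ x′ ∷ t ∷ t′ ∷ n ∷ d ∷ v ∷ [] ∷ sq ∷ s ∷ u ∷ wq ∷ w ∷ y ∷ rq ∷ r ∷ z ∷ [] ∷ [] ∷ []
  matchInput⁻ k run with frame⁻ (pick (only (X ∷ M ∷ []))) match run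
  ... | τ , run′ , refl with match⁻ k run′
  ...   | x′ , refl , refl = x′ , refl , refl

  record Scan (b : Bool) (t t′ d w : ℕ) (x : Bits) (sq s : List ℕ) (n y rq r z : Bits) (σ : Stacks 18) : Set where
    constructor scan
    field
      {ms ms′} : Vec ℕ t
      {gs}     : Vec Bool t
      x′       : Bits
      sq′ s′   : List ℕ
      periods  : Periods b d w ms gs ms′
      x≡       : x ≡ toList gs ++ x′
      s≡       : s ≡ toList ms ++ s′
      sq≡      : sq ≡ toList ms′ ++ sq′
      σ≡       : σ ≡ mem x′ (marks (t + t′)) [] n [] (nums sq′) (nums s′) [] [] y rq r z

  -- The programs P and Q stay abstract below in order to keep the terms small.
  Steps : NProg 18 → NProg 18 → Set
  Steps P Q = ∀ a {u} → u ≡ encodeℕ a ++ [] → ∀ {x t t′ n d y rq r z h h′ τ σ} sq s q ws →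
    Run P (x ∷ t ∷ t′ ∷ n ∷ d ∷ [] ∷ u ∷ nums sq ∷ nums s ∷ u ∷ nums q ∷ nums ws ∷ y ∷ rq ∷ r ∷ z ∷ [] ∷ [] ∷ []) h τ →
    Run Q τ h′ σ →
    ∃[ m ] ∃[ sq′ ] ∃[ s′ ] ∃[ w ] ∃[ q′ ] ∃[ ws′ ] sq ≡ m ∷ sq′ × s ≡ a + m ∷ s′ × q ≡ w ∷ q′ × ws ≡ a + w ∷ ws′ ×
      σ ≡ mem x t t′ n d (nums sq′) (nums s′) (nums q′) (nums ws′) y rq r z

  steps⁻ : Steps supplyStep demandStep
  steps⁻ a refl sq s q ws p₁ p₂
    with frame⁻ (pick (only (A₁ ∷ Sq ∷ S₁ ∷ K ∷ K₂ ∷ []))) add p₁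
  ... | τ₁ , p₁′ , refl with add-nums⁻ a sq s p₁′
  ... | m , sq′ , s′ , refl , refl , refl
    with frame⁻ (pick (only (A₂ ∷ Wq ∷ W₁ ∷ K ∷ K₂ ∷ []))) add p₂
  ... | τ₂ , p₂′ , refl with add-nums⁻ a q ws p₂′
  ... | w , q′ , ws′ , refl , refl , refl = m , sq′ , s′ , w , q′ , ws′ , refl , refl , refl , refl , refl

  close⁻ : ∀ t′ w q {x t n sq s y rq r z h σ} →
    Run close (mem x t (marks t′) n [] (nums sq) (nums s) (nums q) (nums (w ∷ q)) y rq r z) h σ →
    t ≡ [] × w ≡ 0 × σ ≡ mem x (marks t′) [] n [] (nums sq) (nums s) [] [] y rq r z
  close⁻ t′ w q (f ⨟ pop e ⨟ empty e₁ ⨟ empty e₂) with refill⁻ t′ f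
  ... | refl , refl with encodeℕ-false w {nums q} e
  ... | refl , refl with nums-[] q e₂
  ... | refl = refl , refl , refl

  marks-[] : ∀ t → marks t ≡ [] → t ≡ 0
  marks-[] zero _ = refl

  module _ {P Q : NProg 18} (steps : Steps P Q) where

    late⁻ : ∀ t t′ w q sq s {x n y rq r z h h′ τ σ} →
      Run (lateWith P Q false) (mem x (marks t) (marks t′) n [] (nums sq) (nums s) (nums q) (nums (w ∷ q)) y rq r z) h τ →
      Run close τ h′ σ → Scan false t t′ 0 w x sq s n y rq r z σ
    late⁻ t t′ w q sq s done c with close⁻ t′ w q {sq = sq} {s} c
    ... | e , refl , refl with marks-[] t e
    ... | refl = scan _ sq s end refl refl refl refl
    late⁻ zero t′ w q sq s (more (pop () ⨟ _) _) c
    late⁻ (suc t) t′ w q sq s (more (pop refl ⨟ push ⨟ this (pop refl) ⨟ push ⨟ p₁ ⨟ p₂) l) c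
      with steps 0 refl sq s q (w ∷ q) p₁ p₂
    ... | m , sq′ , s′ , w′ , q′ , ws′ , refl , refl , refl , refl , refl with late⁻ t (suc t′) w′ q′ sq′ s′ l c
    ... | scan x′ sq″ s″ p refl refl refl refl rewrite +-suc t t′ = scan x′ sq″ s″ (beyond refl p) refl refl refl refl
    late⁻ (suc t) t′ w q sq s (more (pop refl ⨟ push ⨟ that (pop refl) ⨟ push ⨟ p₁ ⨟ p₂) l) c
      with steps 0 refl sq s q (w ∷ q) p₁ p₂
    ... | m , sq′ , s′ , w′ , q′ , ws′ , refl , refl , refl , refl , refl with late⁻ t (suc t′) w′ q′ sq′ s′ l c
    ... | scan x′ sq″ s″ p refl refl refl refl rewrite +-suc t t′ = scan x′ sq″ s″ (beyond refl p) refl refl refl refl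

    early⁻ : ∀ b t t′ d w q sq s {x n y rq r z h h′ τ σ} →
      Run (earlyWith P Q) (mem x (marks t) (marks t′) n (marks d) (nums sq) (nums s) (nums q) (nums (w ∷ q)) y rq r z) h τ →
      Run (empty D ⨟ lateWith P Q b ⨟ close) τ h′ σ → Scan b t t′ d w x sq s n y rq r z σ
    early⁻ false t t′ d w q sq s done (empty e ⨟ l ⨟ c) with marks-[] d e
    ... | refl = late⁻ t t′ w q sq s l c
    early⁻ true t t′ d w q sq s done (empty e ⨟ ε ⨟ c) with marks-[] d e
    ... | refl with close⁻ t′ w q {sq = sq} {s} c
    ... | e′ , refl , refl with marks-[] t e′
    ... | refl = scan _ sq s end refl refl refl refl
    early⁻ b t t′ zero w q sq s (more (pop () ⨟ _) _) c
    early⁻ b zero t′ (suc d) w q sq s (more (pop refl ⨟ pop () ⨟ _) _) c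
    early⁻ b (suc t) t′ (suc d) w q sq s (more (pop refl ⨟ pop refl ⨟ push ⨟ this (pop refl ⨟ g) ⨟ p₁ ⨟ p₂) l) c
      with guess⁻ (only (A₁ ∷ A₂ ∷ [])) g
    ... | a , refl with steps a refl sq s q (w ∷ q) p₁ p₂
    ... | m , sq′ , s′ , w′ , q′ , ws′ , refl , refl , refl , refl , refl with early⁻ b t (suc t′) d w′ q′ sq′ s′ l c
    ... | scan x′ sq″ s″ p refl refl refl refl rewrite +-suc t t′ = scan x′ sq″ s″ (taken a p) refl refl refl refl
    early⁻ b (suc t) t′ (suc d) w q sq s (more (pop refl ⨟ pop refl ⨟ push ⨟ that (pop refl ⨟ push) ⨟ p₁ ⨟ p₂) l) c
      with steps 0 refl sq s q (w ∷ q) p₁ p₂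
    ... | m , sq′ , s′ , w′ , q′ , ws′ , refl , refl , refl , refl , refl with early⁻ b t (suc t′) d w′ q′ sq′ s′ l c
    ... | scan x′ sq″ s″ p refl refl refl refl rewrite +-suc t t′ = scan x′ sq″ s″ (paused p) refl refl refl refl

  nonzero⁻ : ∀ {c h σ} → Run nonzero (c ∷ []) h σ → ∃[ w ] c ≡ true ∷ w × σ ≡ c ∷ []
  nonzero⁻ (pop refl ⨟ push) = _ , refl , refl

  limit⁻ : ∀ b k {h σ} → Run (limit b) ((encodeℕ k ++ []) ∷ []) h σ → (b ≡ true → k ≤ 3) × σ ≡ [] ∷ []
  limit⁻ false k (l ⨟ empty e) = (λ ()) , go l e
    where
    go : ∀ {σ₀ h σ} → Run (star (pop zero false ∣ pop zero true)) σ₀ h σ → lookup σ zero ≡ [] → σ ≡ [] ∷ []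
    go {_ ∷ []} done refl = refl
    go (more _ l) e = go l e
  limit⁻ true k run rewrite ++-identityʳ (encodeℕ k) | encodeℕ-numeral k =
    let p , q = go (digits k) run in (λ _ → subst (_≤ 3) (val-digits k) p) , q
    where
    go : ∀ ds {h σ} → Run (limit true) (numeral ds ∷ []) h σ → val ds ≤ 3 × σ ≡ [] ∷ []
    go [] (pop () ⨟ _)
    go (false ∷ []) (pop refl ⨟ this (pop refl ⨟ this (pop refl))) = s≤s z≤n , refl
    go (false ∷ []) (pop refl ⨟ this (pop refl ⨟ that (pop () ⨟ _)))
    go (false ∷ []) (pop refl ⨟ that (pop () ⨟ _))
    go (true ∷ []) (pop refl ⨟ this (pop () ⨟ _))
    go (true ∷ []) (pop refl ⨟ that (pop refl ⨟ pop refl)) = s≤s (s≤s z≤n) , refl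
    go (false ∷ d ∷ ds) (pop refl ⨟ this (pop refl ⨟ this (pop ())))
    go (false ∷ false ∷ []) (pop refl ⨟ this (pop refl ⨟ that (pop refl ⨟ pop refl ⨟ pop refl))) = ≤-refl , refl
    go (false ∷ false ∷ _ ∷ _) (pop refl ⨟ this (pop refl ⨟ that (pop refl ⨟ pop refl ⨟ pop ())))
    go (false ∷ true ∷ _) (pop refl ⨟ this (pop refl ⨟ that (pop refl ⨟ pop () ⨟ _)))
    go (false ∷ d ∷ ds) (pop refl ⨟ that (pop () ⨟ _))
    go (true ∷ d ∷ ds) (pop refl ⨟ this (pop () ⨟ _))
    go (true ∷ d ∷ ds) (pop refl ⨟ that (pop refl ⨟ pop ()))

  value⁻ : ∀ s {x t n sq s₁ rq r z h σ} → Run (valueGuess s) (mem x t [] n [] sq s₁ [] [] [] rq r z) h σ →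
           ∃[ v ] σ ≡ x ∷ t ∷ [] ∷ n ∷ [] ∷ (encodeℕ v ++ []) ∷ [] ∷ sq ∷ s₁ ∷ [] ∷ [] ∷ [] ∷ (encodeℕ (chosen s v) ++ []) ∷ rq ∷ r ∷ z ∷ [] ∷ [] ∷ []
  value⁻ true g with guess⁻ (only (M ∷ Y ∷ [])) g
  ... | v , refl = v , refl
  value⁻ false (g ⨟ push) with guess⁻ (only (M ∷ [])) g
  ... | v , refl = v , refl

  demanded⁻ : ∀ s q {x t n d sq s₁ rq r z h σ} → Run (demandGuess s) (mem x t [] n d sq s₁ (nums q) (nums q) [] rq r z) h σ →
              ∃[ w ] σ ≡ x ∷ t ∷ [] ∷ n ∷ d ∷ (encodeℕ w ++ []) ∷ [] ∷ sq ∷ s₁ ∷ [] ∷ nums q ∷ nums (chosen s w ∷ q) ∷ [] ∷ rq ∷ r ∷ z ∷ (encodeℕ w ++ []) ∷ [] ∷ []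
  demanded⁻ true q g with guess⁻ (only (M ∷ W₁ ∷ K ∷ [])) g
  ... | w , refl = w , refl
  demanded⁻ false q (g ⨟ push) with guess⁻ (only (M ∷ K ∷ [])) g
  ... | w , refl = w , refl

  record AgentScan (b s : Bool) (t : ℕ) (x : Bits) (sq s₁ : List ℕ) (n : Bits) (rq : List ℕ) (r : ℕ) (z : Bits) (σ : Stacks 18) : Set where
    constructor agent-scan
    field
      agent   : Agent t
      {ms ms′} : Vec ℕ t
      x′      : Bits
      sq′ s′  : List ℕ
      r′      : ℕ
      rq′     : List ℕ
      limited : b ≡ true → Agent.demand agent ≤ 3
      periods : Periods b (Agent.due agent) (chosen s (Agent.demand agent)) ms (Agent.gaps agent) ms′
      x≡      : x ≡ encodeAgent agent ++ x′
      s≡      : s₁ ≡ toList ms ++ s′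
      sq≡     : sq ≡ toList ms′ ++ sq′
      r≡      : r ≡ chosen s (Agent.value agent) + r′
      rq≡     : rq ≡ r′ ∷ rq′
      σ≡      : σ ≡ mem x′ (marks t) [] n [] (nums sq′) (nums s′) [] [] [] (nums rq′) (nums (r′ ∷ rq′)) z

  periods-due : ∀ {b t d w} {ms : Vec ℕ t} {gs ms′} → Periods b d w ms gs ms′ → d ≤ t
  periods-due end          = z≤n
  periods-due (taken a p)  = s≤s (periods-due p)
  periods-due (paused p)   = s≤s (periods-due p)
  periods-due (beyond _ p) = z≤n

  encodeAgent-++ : ∀ {t} (A : Agent t) {x} → encodeAgent A ++ x ≡
    encodeℕ (Agent.value A) ++ encodeℕ (Agent.due A) ++ encodeℕ (Agent.demand A) ++ toList (Agent.gaps A) ++ x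
  encodeAgent-++ A {x} = trans (++-assoc (encodeℕ value) _ x) (cong (encodeℕ value ++_)
      (trans (++-assoc (encodeℕ due) _ x) (cong (encodeℕ due ++_) (++-assoc (encodeℕ demand) _ x))))
    where open Agent A

  deadline-at : ∀ d {t} → 0 < d → d ≤ t → ∃[ f ] suc (toℕ {t} f) ≡ d
  deadline-at (suc d) _ d<t = fromℕ< d<t , cong suc (toℕ-fromℕ< d<t)

  marks-true : ∀ d {w} → marks d ≡ true ∷ w → 0 < d
  marks-true (suc d) _ = s≤s z≤n

  record Front (s : Bool) (x t n sq s₁ : Bits) (rq : List ℕ) (r : ℕ) (z : Bits) (σ : Stacks 18) : Set where
    constructor front
    field
      v d r′ : ℕ
      rq′    : List ℕ
      x′     : Bits
      v>0    : 0 < v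
      d>0    : 0 < d
      x≡     : x ≡ encodeℕ v ++ encodeℕ d ++ x′
      rq≡    : rq ≡ r′ ∷ rq′
      r≡     : r ≡ chosen s v + r′
      σ≡     : σ ≡ mem x′ t [] n (marks d) sq s₁ [] [] [] (nums rq′) (nums (r′ ∷ rq′)) z

  front⁻ : ∀ s rq r {x t n sq s₁ z h₁ τ₁ h₂ τ₂ h₃ τ₃ h₄ τ₄ h₅ τ₅ h₆ σ} →
    Run (valueGuess s) (mem x t [] n [] sq s₁ [] [] [] (nums rq) (nums (r ∷ rq)) z) h₁ τ₁ →
    Run (on (pick (only (M ∷ []))) nonzero) τ₁ h₂ τ₂ → Run matchInput τ₂ h₃ τ₃ → Run valueStep τ₃ h₄ τ₄ →
    Run (on (pick (only (X ∷ D ∷ K ∷ K₂ ∷ []))) unary) τ₄ h₅ τ₅ → Run (on (pick (only (D ∷ []))) nonzero) τ₅ h₆ σ →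
    Front s x t n sq s₁ rq r z σ
  front⁻ s rq r p₁ p₂ p₃ p₄ p₅ p₆
    with value⁻ s p₁
  ... | v , refl with frame⁻ (pick (only (M ∷ []))) nonzero p₂
  ... | _ , p₂′ , refl with nonzero⁻ p₂′
  ... | _ , v≡ , refl with matchInput⁻ v p₃
  ... | x₁ , refl , refl with frame⁻ (pick (only (Y ∷ Rq ∷ R₁ ∷ K ∷ K₂ ∷ []))) add p₄
  ... | _ , p₄′ , refl with add-nums⁻ (chosen s v) rq (r ∷ rq) p₄′
  ... | r′ , rq′ , _ , refl , refl , refl with frame⁻ (pick (only (X ∷ D ∷ K ∷ K₂ ∷ []))) unary p₅
  ... | _ , p₅′ , refl with unary⁻ p₅′
  ... | d , x₂ , refl , refl with frame⁻ (pick (only (D ∷ []))) nonzero p₆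
  ... | _ , p₆′ , refl with nonzero⁻ p₆′
  ... | _ , d≡ , refl = front v d r′ rq′ x₂ (encodeℕ-true v v≡) (marks-true d d≡) refl refl refl refl

  record Back (b s : Bool) (x t n d sq s₁ rq r z : Bits) (σ : Stacks 18) : Set where
    constructor back
    field
      w    : ℕ
      q    : List ℕ
      x′   : Bits
      w>0  : 0 < w
      lim  : b ≡ true → w ≤ 3
      x≡   : x ≡ encodeℕ w ++ x′
      σ≡   : σ ≡ mem x′ t [] n d sq s₁ (nums q) (nums (chosen s w ∷ q)) [] rq r z

  back⁻ : ∀ b s {x t n d sq s₁ rq r z h₁ τ₁ h₂ τ₂ h₃ τ₃ h₄ τ₄ h₅ σ} →
    Run (star (guessOn (Wq ∷ W₁ ∷ []))) (mem x t [] n d sq s₁ [] [] [] rq r z) h₁ τ₁ →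
    Run (demandGuess s) τ₁ h₂ τ₂ → Run (on (pick (only (M ∷ []))) nonzero) τ₂ h₃ τ₃ →
    Run (on (pick (only (K ∷ []))) (limit b)) τ₃ h₄ τ₄ → Run matchInput τ₄ h₅ σ → Back b s x t n d sq s₁ rq r z σ
  back⁻ b s p₁ p₂ p₃ p₄ p₅
    with guesses⁻ (only (Wq ∷ W₁ ∷ [])) p₁
  ... | q , refl rewrite ++-identityʳ (nums q) with demanded⁻ s q p₂
  ... | w , refl with frame⁻ (pick (only (M ∷ []))) nonzero p₃
  ... | _ , p₃′ , refl with nonzero⁻ p₃′
  ... | _ , w≡ , refl with frame⁻ (pick (only (K ∷ []))) (limit b) p₄
  ... | _ , p₄′ , refl with limit⁻ b w p₄′
  ... | lim , refl with matchInput⁻ w p₅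
  ... | x′ , refl , refl = back w q x′ (encodeℕ-true w w≡) lim refl refl

  agentWith⁻ : ∀ {P Q} b s t →
    (∀ t′ d w q sq s {x n y rq r z h h′ τ σ} →
      Run P (mem x (marks t) (marks t′) n (marks d) (nums sq) (nums s) (nums q) (nums (w ∷ q)) y rq r z) h τ →
      Run Q τ h′ σ → Scan b t t′ d w x sq s n y rq r z σ) →
    ∀ sq s₁ rq r {x n z h σ} →
    Run (agentWith b s P Q) (mem x (marks t) [] n [] (nums sq) (nums s₁) [] [] [] (nums rq) (nums (r ∷ rq)) z) h σ →
    AgentScan b s t x sq s₁ n rq r z σ
  agentWith⁻ b s t scan⁻ sq s₁ rq r (p₁ ⨟ p₂ ⨟ p₃ ⨟ p₄ ⨟ p₅ ⨟ p₆ ⨟ p₇ ⨟ p₈ ⨟ p₉ ⨟ p₁₀ ⨟ p₁₁ ⨟ p₁₂ ⨟ p₁₃)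
    with front⁻ s rq r p₁ p₂ p₃ p₄ p₅ p₆
  ... | front v d r′ rq′ x₂ v>0 d>0 refl refl refl refl with back⁻ b s p₇ p₈ p₉ p₁₀ p₁₁
  ... | back w q₀ x₃ w>0 lim refl refl with scan⁻ 0 d (chosen s w) q₀ sq s₁ p₁₂ p₁₃
  ... | scan {gs = gs} x₄ sq′ s′ ps refl refl refl refl =
        let f , due≡ = deadline-at d d>0 (periods-due ps)
            A = record { value = v ; value>0 = v>0 ; deadline = f ; demand = w ; demand>0 = w>0 ; gaps = gs }
        in agent-scan A x₄ sq′ s′ r′ rq′ lim
          (subst (λ d → Periods b d (chosen s w) _ gs _) (sym due≡) ps)
          (trans (cong (λ d → encodeℕ v ++ encodeℕ d ++ encodeℕ w ++ toList gs ++ x₄) (sym due≡)) (sym (encodeAgent-++ A)))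
          refl refl refl refl (cong (λ t → mem x₄ (marks t) [] _ [] (nums sq′) (nums s′) [] [] [] _ _ _) (+-identityʳ t))

  agent⁻ : ∀ b s t sq s₁ rq r {x n z h σ} →
    Run (agentProgram b s) (mem x (marks t) [] n [] (nums sq) (nums s₁) [] [] [] (nums rq) (nums (r ∷ rq)) z) h σ →
    AgentScan b s t x sq s₁ n rq r z σ
  agent⁻ b s t = agentWith⁻ b s t (early⁻ steps⁻ b t)

module VerifierParsing where

  open StackPrograms hiding (step)
  open GuessingPrograms
  open Encodings
  open NumeralPrograms
  open VerifierSoundness

  match-nums⁻ : ∀ l {x h σ} → Run match (x ∷ nums l ∷ []) h σ →
                ∃[ k ] ∃[ l′ ] ∃[ x′ ] l ≡ k ∷ l′ × x ≡ encodeℕ k ++ x′ × σ ≡ x′ ∷ nums l′ ∷ []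
  match-nums⁻ [] (done ⨟ pop _ ⨟ pop ())
  match-nums⁻ [] (more (pop _ ⨟ pop () ⨟ _) _ ⨟ _)
  match-nums⁻ (k ∷ l) run with match⁻ k run
  ... | x′ , refl , refl = k , l , x′ , refl , refl , refl

  matchSupplies⁻ : ∀ t t′ l sq {x s h h′ τ σ} →
    Run (star (pop T₁ true ⨟ put (T₂ ∷ []) true ⨟ matchInput))
        (x ∷ marks t ∷ marks t′ ∷ [] ∷ [] ∷ nums l ∷ [] ∷ nums sq ∷ s ∷ [] ∷ [] ∷ [] ∷ [] ∷ [] ∷ [] ∷ [] ∷ [] ∷ [] ∷ []) h τ →
    lookup τ M ≡ [] → Run refill τ h′ σ →
    ∃[ ms ] ∃[ x′ ] x ≡ nums (toList {n = t} ms) ++ x′ × l ≡ toList ms ×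
      σ ≡ mem x′ (marks (t + t′)) [] [] [] (nums sq) s [] [] [] [] [] []
  matchSupplies⁻ t t′ l sq done e r with nums-[] l e
  ... | refl with refill⁻ t′ r
  ... | t≡ , refl with marks-[] t t≡
  ... | refl = [] , _ , refl , refl , refl
  matchSupplies⁻ zero t′ l sq (more (pop () ⨟ _) _) e r
  matchSupplies⁻ (suc t) t′ l sq (more (pop refl ⨟ push ⨟ m) p) e r with frame⁻ (pick (only (X ∷ M ∷ []))) match m
  ... | _ , m′ , refl with match-nums⁻ l m′
  ... | k , l′ , x′ , refl , refl , refl with matchSupplies⁻ t (suc t′) l′ sq p e r
  ... | ms , x″ , refl , refl , refl rewrite +-suc t t′ =
    k ∷ ms , x″ , sym (++-assoc (encodeℕ k) _ x″) , refl , refl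

  supply⁻ : ∀ {x h σ} → Run supplyProgram (x ∷ Vec.replicate 17 []) h σ →
    ∃[ t ] ∃[ ms ] ∃[ sq ] ∃[ x′ ] 0 < t × x ≡ encodeℕ t ++ nums (toList {n = t} ms) ++ x′ ×
      σ ≡ mem x′ (marks t) [] [] [] (nums sq) (nums (toList ms ++ sq)) [] [] [] [] [] []
  supply⁻ (p₁ ⨟ p₂ ⨟ p₃ ⨟ p₄ ⨟ p₅ ⨟ empty e ⨟ p₆)
    with frame⁻ (pick (only (X ∷ T₁ ∷ K ∷ K₂ ∷ []))) unary p₁
  ... | _ , p₁′ , refl with unary⁻ p₁′
  ... | t , x₁ , refl , refl with frame⁻ (pick (only (T₁ ∷ []))) nonzero p₂
  ... | _ , p₂′ , refl with nonzero⁻ p₂′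
  ... | _ , t≡ , refl with guesses⁻ (only (Sq ∷ S₁ ∷ [])) p₃
  ... | sq , refl with guesses⁻ (only (M ∷ S₁ ∷ [])) p₄
  ... | l , refl rewrite ++-identityʳ (nums sq) | ++-identityʳ (nums l) with matchSupplies⁻ t 0 l sq p₅ e p₆
  ... | ms , x′ , refl , refl , refl = t , ms , sq , x′ , marks-true t t≡ , refl ,
    cong₂ (λ u v → mem x′ (marks u) [] [] [] (nums sq) v [] [] [] [] [] []) (+-identityʳ t) (sym (concatMap-++ encodeℕ (toList ms) sq))

  toList-split : ∀ {A : Set} {n} (u v : Vec A n) {x y : List A} → toList u ++ x ≡ toList v ++ y → u ≡ v × x ≡ y
  toList-split []      []      eq = refl , eq
  toList-split (a ∷ u) (b ∷ v) eq with ∷-injective eq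
  ... | refl , eq′ with toList-split u v eq′
  ...   | refl , p = refl , p

  module _ {b : Bool} {t : ℕ} where

    Scans : Bool → NProg 18 → Set
    Scans s P = ∀ sq s₁ rq r {x n z h σ} →
      Run P (mem x (marks t) [] n [] (nums sq) (nums s₁) [] [] [] (nums rq) (nums (r ∷ rq)) z) h σ → AgentScan b s t x sq s₁ n rq r z σ

    serve⁻ : ∀ {P Q} → Scans true P → Scans false Q → ∀ n (ms : Vec ℕ t) sq rq r {x z h h′ τ σ} →
      Run (star (pop n₁ true ⨟ (P ∣ Q)))
          (mem x (marks t) [] (marks n) [] (nums sq) (nums (toList ms ++ sq)) [] [] [] (nums rq) (nums (r ∷ rq)) z) h τ →
      lookup τ n₁ ≡ [] → Run (pop R₁ false ⨟ empty R₁ ⨟ empty Rq) τ h′ σ →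
      ∃[ As ] ∃[ x′ ] ∃[ s ] ∃[ s′ ] Serve b {t} {n} As ms r × x ≡ concatMap encodeAgent (toList As) ++ x′ ×
        σ ≡ mem x′ (marks t) [] [] [] s s′ [] [] [] [] [] z
    first⁻ : ∀ {P Q} → Scans true P → Scans false Q → ∀ s n (ms : Vec ℕ t) sq rq r {x z h h′ τ₀ τ σ} →
      AgentScan b s t x sq (toList ms ++ sq) (marks n) rq r z τ₀ → Run (star (pop n₁ true ⨟ (P ∣ Q))) τ₀ h τ →
      lookup τ n₁ ≡ [] → Run (pop R₁ false ⨟ empty R₁ ⨟ empty Rq) τ h′ σ →
      ∃[ As ] ∃[ x′ ] ∃[ s ] ∃[ s′ ] Serve b {t} {suc n} As ms r × x ≡ concatMap encodeAgent (toList As) ++ x′ ×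
        σ ≡ mem x′ (marks t) [] [] [] s s′ [] [] [] [] [] z
    serve⁻ P⁻ Q⁻ n ms sq rq r done e (pop f ⨟ empty f₁ ⨟ empty f₂) with marks-[] n e | encodeℕ-false r {nums rq} f
    ... | refl | refl , refl with nums-[] rq f₂
    ... | refl = [] , _ , _ , _ , [] , refl , refl
    serve⁻ P⁻ Q⁻ zero ms sq rq r (more (pop () ⨟ _) _) e f
    serve⁻ P⁻ Q⁻ (suc n) ms sq rq r (more (pop refl ⨟ this a) p) e f = first⁻ P⁻ Q⁻ true n ms sq rq r (P⁻ sq (toList ms ++ sq) rq r a) p e f
    serve⁻ P⁻ Q⁻ (suc n) ms sq rq r (more (pop refl ⨟ that a) p) e f = first⁻ P⁻ Q⁻ false n ms sq rq r (Q⁻ sq (toList ms ++ sq) rq r a) p e f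
    first⁻ P⁻ Q⁻ s₀ n ms sq rq r (agent-scan A {ms₀} {ms′} x′ sq′ s′ r′ rq′ lim ps refl s≡ refl refl refl refl) p e f with toList-split ms ms₀ s≡
    ... | refl , refl with serve⁻ P⁻ Q⁻ n ms′ sq′ rq′ r′ p e f
    ... | As , x″ , s , s″ , sv , refl , refl =
      A ∷ As , x″ , s , s″ , serve s₀ lim ps sv , sym (++-assoc (encodeAgent A) _ x″) , refl

  agentsWith⁻ : ∀ {b t P Q} → Scans {b} {t} true P → Scans {b} {t} false Q → ∀ (ms : Vec ℕ t) sq {x h σ} →
    Run (agentsWith P Q) (mem x (marks t) [] [] [] (nums sq) (nums (toList ms ++ sq)) [] [] [] [] [] []) h σ →
    ∃[ n ] ∃[ As ] ∃[ r ] ∃[ x′ ] ∃[ s ] ∃[ s′ ] Serve b {t} {n} As ms r × x ≡ encodeℕ n ++ concatMap encodeAgent (toList As) ++ x′ ×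
      σ ≡ mem x′ (marks t) [] [] [] s s′ [] [] [] [] [] (encodeℕ r)
  agentsWith⁻ {b} {t} P⁻ Q⁻ ms sq (p₁ ⨟ p₂ ⨟ p₃ ⨟ p₄ ⨟ empty e ⨟ p₅)
    with frame⁻ (pick (only (X ∷ n₁ ∷ K ∷ K₂ ∷ []))) unary p₁
  ... | _ , p₁′ , refl with unary⁻ p₁′
  ... | n , x₁ , refl , refl with guesses⁻ (only (Rq ∷ R₁ ∷ [])) p₂
  ... | rq , refl rewrite ++-identityʳ (nums rq) with guess⁻ (only (R₁ ∷ Z ∷ [])) p₃
  ... | r , refl with serve⁻ P⁻ Q⁻ n ms sq rq r p₄ e p₅
  ... | As , x′ , s , s′ , sv , refl , refl = n , As , r , x′ , s , s′ , sv , refl ,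
    cong (mem x′ (marks t) [] [] [] s s′ [] [] [] [] []) (++-identityʳ (encodeℕ r))

  target⁻ : ∀ r {x t s s′ h σ} → Run targetProgram (mem x t [] [] [] s s′ [] [] [] [] [] (encodeℕ r)) h σ →
            ∃[ V ] x ≡ encodeℤ V × V ℤ.≤ ℤ.+ r
  target⁻ r (this (pop refl ⨟ g ⨟ m ⨟ g′ ⨟ a) ⨟ empty e)
    with guess⁻ (only (M ∷ A₂ ∷ [])) g
  ... | k , refl with matchInput⁻ k m
  ... | x′ , refl , refl with guess⁻ (only (Wq ∷ [])) g′
  ... | i , refl with frame⁻ (pick (only (A₂ ∷ Wq ∷ Z ∷ K ∷ K₂ ∷ []))) add a
  ... | τ , a′ , refl with add⁻ k i r (subst (λ z → Run add (_ ∷ _ ∷ z ∷ [] ∷ [] ∷ []) _ τ) (sym (++-identityʳ (encodeℕ r))) a′)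
  ... | refl , refl with e
  ... | refl = ℤ.+ k , cong (true ∷_) (++-identityʳ (encodeℕ k)) , ℤ.+≤+ (m≤m+n k i)
  target⁻ r (that (pop refl ⨟ g ⨟ m) ⨟ empty e)
    with guess⁻ (only (M ∷ [])) g
  ... | k , refl with matchInput⁻ k m
  ... | x′ , refl , refl with e
  ... | refl = ℤ.-[1+ k ] , cong (false ∷_) (++-identityʳ (encodeℕ k)) , ℤ.-≤+

  programs⁻ : ∀ {b P Q x h σ} → (∀ t → Scans {b} {t} true P) → (∀ t → Scans {b} {t} false Q) →
    Run (supplyProgram ⨟ agentsWith P Q ⨟ targetProgram) (x ∷ Vec.replicate 17 []) h σ → ∃[ I ] encodeInstance I ≡ x × Certified b I
  programs⁻ P⁻ Q⁻ (p₁ ⨟ p₂ ⨟ p₃) with supply⁻ p₁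
  ... | t , ms , sq , x₁ , 0<t , refl , refl with agentsWith⁻ (P⁻ t) (Q⁻ t) ms sq p₂
  ... | n , As , r , x₂ , s , s′ , sv , refl , refl with target⁻ r p₃
  ... | V , refl , V≤ =
    (record { periods = t ; periods≥1 = 0<t ; supply = ms ; n = n ; agents = As } , V) , refl , r , sv , V≤

  program⁻ : ∀ b {x h σ} → Run (program b) (x ∷ Vec.replicate 17 []) h σ →
             ∃[ I ] encodeInstance I ≡ x × Certified b I
  program⁻ b = programs⁻ (agent⁻ b true) (agent⁻ b false)

module ProgramCosts where

  open StackPrograms hiding (step)
  open GuessingPrograms
  open Encodings
  open NumeralPrograms
  open VerifierSoundness

  shorter⇒smaller : ∀ ds es → length ds < length es → val ds < val es
  shorter⇒smaller [] (false ∷ es) _ = s≤s z≤n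
  shorter⇒smaller [] (true ∷ es)  _ = s≤s z≤n
  shorter⇒smaller (d ∷ ds) (e ∷ es) (s≤s l) = begin-strict
    val (d ∷ ds)              ≡⟨ val-∷ d ds ⟩
    digit d + 2 * val ds      ≤⟨ +-monoˡ-≤ _ (low≤2 (d ∷ [])) ⟩
    2 + 2 * val ds            ≡⟨ *-suc 2 (val ds) ⟨
    2 * suc (val ds)          ≤⟨ *-monoʳ-≤ 2 (shorter⇒smaller ds es l) ⟩
    2 * val es                <⟨ m<n+m _ (digit-positive e) ⟩
    digit e + 2 * val es      ≡⟨ val-∷ e es ⟨
    val (e ∷ es)              ∎
    where
    open ≤-Reasoning
    digit-positive : ∀ d → 0 < digit d
    digit-positive false = s≤s z≤n
    digit-positive true  = s≤s z≤n

  length-numeral : ∀ ds → length (numeral ds) ≡ 1 + 2 * length ds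
  length-numeral []       = refl
  length-numeral (d ∷ ds) = trans (cong (λ n → suc (suc n)) (length-numeral ds)) (cong suc (sym (*-suc 2 (length ds))))

  size₂-digits : ∀ k → size₂ k ≡ 1 + 2 * length (digits k)
  size₂-digits k = trans (cong length (encodeℕ-numeral k)) (length-numeral (digits k))

  size₂-mono : ∀ {k l} → k ≤ l → size₂ k ≤ size₂ l
  size₂-mono {k} {l} k≤l = ≤-trans (≤-reflexive (size₂-digits k)) (≤-trans (s≤s (*-monoʳ-≤ 2
    (≮⇒≥ λ p → <⇒≱ (shorter⇒smaller (digits l) (digits k) p) (≤-trans (≤-reflexive (val-digits k)) (≤-trans k≤l (≤-reflexive (sym (val-digits l))))))))
    (≤-reflexive (sym (size₂-digits l))))

  size₂-positive : ∀ k → 1 ≤ size₂ k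
  size₂-positive k = ≤-trans (s≤s z≤n) (≤-reflexive (sym (size₂-digits k)))

  Fits : ℕ → ℕ → Set
  Fits B k = size₂ k ≤ B

  fits-≤ : ∀ {B k l} → k ≤ l → Fits B l → Fits B k
  fits-≤ k≤l f = ≤-trans (size₂-mono k≤l) f

  guesses⁺ : ∀ {k} B (mask : Vec Bool k) l σ → All (Fits B) l →
             star (guess mask) ∶ σ ↝[ 1 + length l * suc B ] pushWord mask (nums l) σ
  guesses⁺ B mask []      σ []      = ends (sym (pushWord-[] mask σ)) done⁺
  guesses⁺ B mask (n ∷ l) σ (f ∷ fs) = ends (pushWord-++ mask (encodeℕ n) (nums l) σ)
    (within (≤-trans (+-monoʳ-≤ (1 + length l * suc B) (s≤s f)) (≤-reflexive (cong suc (+-comm (length l * suc B) (suc B)))))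
      (snoc⁺ (guesses⁺ B mask l σ fs) (guess⁺ mask n (pushWord mask (nums l) σ))))

  refill⁺ : ∀ t′ {x n d sq s wq w y rq r z} →
    refill ∶ mem x [] (marks t′) n d sq s wq w y rq r z ↝[ suc t′ ] mem x (marks t′) [] n d sq s wq w y rq r z
  refill⁺ t′ = within (≤-reflexive (+-identityʳ (suc t′))) (empty⁺ refl ⨟⁺ go t′ 0 ⨟⁺ empty⁺ refl)
    where
    go : ∀ j i {x n d sq s wq w y rq r z} → star (pop T₂ true ⨟ put (T₁ ∷ []) true) ∶ mem x (marks i) (marks j) n d sq s wq w y rq r z ↝[ suc j ]
         mem x (marks (i + j)) [] n d sq s wq w y rq r z
    go zero    i rewrite +-identityʳ i = done⁺
    go (suc j) i rewrite +-suc i j = more⁺ (pop⁺ refl ⨟⁺ push⁺) (go j (suc i))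

  steps⁺ : ∀ B a m w {x t t′ n d sq s q ws y rq r z} → Fits B (a + m) → Fits B (a + w) →
    supplyStep ⨟ demandStep ∶
      x ∷ t ∷ t′ ∷ n ∷ d ∷ [] ∷ (encodeℕ a ++ []) ∷ (encodeℕ m ++ sq) ∷ (encodeℕ (a + m) ++ s) ∷ (encodeℕ a ++ []) ∷
        (encodeℕ w ++ q) ∷ (encodeℕ (a + w) ++ ws) ∷ y ∷ rq ∷ r ∷ z ∷ [] ∷ [] ∷ []
      ↝[ 15 * B + 15 * B ] mem x t t′ n d sq s q ws y rq r z
  steps⁺ B a m w {x} {t} {t′} {n} {d} {sq} {s} {q} {ws} {y} {rq} {r} {z} f g =
    within (*-monoʳ-≤ 15 f) (frame↝ (pick (only (A₁ ∷ Sq ∷ S₁ ∷ K ∷ K₂ ∷ [])))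
      (x ∷ t ∷ t′ ∷ n ∷ d ∷ [] ∷ (encodeℕ a ++ []) ∷ (encodeℕ m ++ sq) ∷ (encodeℕ (a + m) ++ s) ∷ (encodeℕ a ++ []) ∷
        (encodeℕ w ++ q) ∷ (encodeℕ (a + w) ++ ws) ∷ y ∷ rq ∷ r ∷ z ∷ [] ∷ [] ∷ []) (add⁺ a m)) ⨟⁺
    within (*-monoʳ-≤ 15 g) (frame↝ (pick (only (A₂ ∷ Wq ∷ W₁ ∷ K ∷ K₂ ∷ [])))
      (x ∷ t ∷ t′ ∷ n ∷ d ∷ [] ∷ [] ∷ sq ∷ s ∷ (encodeℕ a ++ []) ∷
        (encodeℕ w ++ q) ∷ (encodeℕ (a + w) ++ ws) ∷ y ∷ rq ∷ r ∷ z ∷ [] ∷ [] ∷ []) (add⁺ a w))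

  lacking : ∀ {b t d w} {ms : Vec ℕ t} {gs ms′} → Periods b d w ms gs ms′ → List ℕ
  lacking end                    = []
  lacking (taken {w = w} a p)    = w ∷ lacking p
  lacking (paused {w = w} p)     = w ∷ lacking p
  lacking (beyond {w = w} _ p)   = w ∷ lacking p

  length-lacking : ∀ {b t d w} {ms : Vec ℕ t} {gs ms′} (p : Periods b d w ms gs ms′) → length (lacking p) ≡ t
  length-lacking end          = refl
  length-lacking (taken a p)  = cong suc (length-lacking p)
  length-lacking (paused p)   = cong suc (length-lacking p)
  length-lacking (beyond _ p) = cong suc (length-lacking p)

  fits-lacking : ∀ {B b t d w} {ms : Vec ℕ t} {gs ms′} (p : Periods b d w ms gs ms′) → Fits B w → All (Fits B) (lacking p)
  fits-lacking end          f = []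
  fits-lacking {B} (taken {w = w} a p) f = fits-≤ {B} (m≤n+m w a) f ∷ fits-lacking p (fits-≤ {B} (m≤n+m w a) f)
  fits-lacking (paused p)   f = f ∷ fits-lacking p f
  fits-lacking (beyond _ p) f = f ∷ fits-lacking p f

  fits-after : ∀ {B b t d w} {ms : Vec ℕ t} {gs ms′} → Periods b d w ms gs ms′ → All (Fits B) (toList ms) → All (Fits B) (toList ms′)
  fits-after end fs = []
  fits-after {B} (taken {m = m} a p) (f ∷ fs) = fits-≤ {B} (m≤n+m m a) f ∷ fits-after p fs
  fits-after (paused p)   (f ∷ fs) = f ∷ fits-after p fs
  fits-after (beyond _ p) (f ∷ fs) = f ∷ fits-after p fs

  ε⁺ : ∀ {k} {σ : Stacks k} → ε ∶ σ ↝[ 0 ] σ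
  ε⁺ = ⟪ [] , z≤n , ε ⟫

  module Scanning (B : ℕ) (1≤B : 1 ≤ B) where

    rate₁ : ℕ
    rate₁ = 33 * B

    private
      step-cost : ∀ {c} → c ≤ suc B → ∀ k → suc (c + (15 * B + 15 * B) + k) ≤ rate₁ + k
      step-cost {c} c≤ k = +-monoˡ-≤ k (begin
        suc (c + (15 * B + 15 * B))     ≤⟨ s≤s (+-monoˡ-≤ (15 * B + 15 * B) c≤) ⟩
        2 + B + (15 * B + 15 * B)       ≤⟨ +-monoˡ-≤ _ (+-monoˡ-≤ B (*-monoʳ-≤ 2 1≤B)) ⟩
        2 * B + B + (15 * B + 15 * B)   ≡⟨ arith B ⟩
        33 * B                          ∎)
        where
        open ≤-Reasoning
        arith : ∀ b → 2 * b + b + (15 * b + 15 * b) ≡ 33 * b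
        arith = solve-∀

    close⁺ : ∀ t′ {x n sq s y rq r z} →
      close ∶ mem x [] (marks t′) n [] sq s [] (nums (0 ∷ [])) y rq r z ↝[ suc t′ + 0 ] mem x (marks t′) [] n [] sq s [] [] y rq r z
    close⁺ t′ = refill⁺ t′ ⨟⁺ pop⁺ refl ⨟⁺ empty⁺ refl ⨟⁺ empty⁺ refl

    late⁺ : ∀ {t w} {ms ms′ : Vec ℕ t} {gs} (p : Periods false 0 w ms gs ms′) t′ {x n sq s y rq r z} →
      All (Fits B) (toList ms) → Fits B w →
      late false ⨟ close ∶
        mem (toList gs ++ x) (marks t) (marks t′) n [] (nums (toList ms′ ++ sq)) (nums (toList ms ++ s)) (nums (lacking p)) (nums (w ∷ lacking p)) y rq r z
        ↝[ t * rate₁ + (2 + (t + t′)) ] mem x (marks (t + t′)) [] n [] (nums sq) (nums s) [] [] y rq r z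
    late⁺ end t′ fs f = within (≤-reflexive (cong (λ z → suc (suc z)) (+-identityʳ t′))) (done⁺ ⨟⁺ close⁺ t′)
    late⁺ {suc t} (beyond {w = w} {m} {g} {ms} {ms′} {gs} refl p) t′ {x} {n} {sq} {s} {y} {rq} {r} {z} (f′ ∷ fs) f =
      subst (λ k → late false ⨟ close ∶ σ ↝[ suc t * rate₁ + (2 + k) ] mem x (marks k) [] n [] (nums sq) (nums s) [] [] y rq r z) (+-suc t t′)
      (within (≤-trans (step-cost (s≤s z≤n) (t * rate₁ + (2 + (t + suc t′)))) (≤-reflexive (sym (+-assoc rate₁ (t * rate₁) _))))
      (prepend⁺ (pop⁺ refl ⨟⁺ push⁺ ⨟⁺ bit g ⨟⁺ push⁺ ⨟⁺ steps⁺ B 0 m w f′ f) (late⁺ p (suc t′) fs f)))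
      where
      σ : Stacks 18
      σ = mem (g ∷ toList gs ++ x) (marks (suc t)) (marks t′) n [] (nums (m ∷ toList ms′ ++ sq)) (nums (m ∷ toList ms ++ s)) (nums (w ∷ lacking p)) (nums (w ∷ w ∷ lacking p)) y rq r z
      bit : ∀ g {x t t′ n d sq s wq w y rq r z} → (pop X false ∣ pop X true) ∶ mem (g ∷ x) t t′ n d sq s wq w y rq r z ↝[ 1 ] mem x t t′ n d sq s wq w y rq r z
      bit false = this⁺ (pop⁺ refl)
      bit true  = that⁺ (pop⁺ refl)

    early⁺ : ∀ b {t d w} {ms ms′ : Vec ℕ t} {gs} (p : Periods b d w ms gs ms′) t′ {x n sq s y rq r z} →
      All (Fits B) (toList ms) → Fits B w →
      early ⨟ empty D ⨟ late b ⨟ close ∶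
        mem (toList gs ++ x) (marks t) (marks t′) n (marks d) (nums (toList ms′ ++ sq)) (nums (toList ms ++ s)) (nums (lacking p)) (nums (w ∷ lacking p)) y rq r z
        ↝[ t * rate₁ + (3 + (t + t′)) ] mem x (marks (t + t′)) [] n [] (nums sq) (nums s) [] [] y rq r z
    early⁺ true end t′ fs f = within {m = 1 + (suc t′ + 0)} {n = 3 + t′} (s≤s (≤-trans (≤-reflexive (+-identityʳ (suc t′))) (n≤1+n (suc t′))))
      (done⁺ ⨟⁺ empty⁺ refl ⨟⁺ ε⁺ ⨟⁺ close⁺ t′)
    early⁺ false {t} p@end t′ {sq = sq} {s} fs f = done⁺ ⨟⁺ empty⁺ refl ⨟⁺ late⁺ p t′ {sq = sq} {s} fs f
    early⁺ false {t} p@(beyond refl _) t′ {sq = sq} {s} fs f = within (≤-reflexive (sym (+-suc (t * rate₁) (2 + (t + t′))))) (done⁺ ⨟⁺ empty⁺ refl ⨟⁺ late⁺ p t′ {sq = sq} {s} fs f)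
    early⁺ b {suc t} (taken {d = d} {w} {m} {ms} {ms′} {gs} a p) t′ {x} {n} {sq} {s} {y} {rq} {r} {z} (f′ ∷ fs) f =
      subst (λ k → early ⨟ empty D ⨟ late b ⨟ close ∶ σ ↝[ suc t * rate₁ + (3 + k) ] mem x (marks k) [] n [] (nums sq) (nums s) [] [] y rq r z) (+-suc t t′)
      (within (≤-trans (step-cost (s≤s (fits-≤ {B} (m≤m+n a m) f′)) (t * rate₁ + (3 + (t + suc t′)))) (≤-reflexive (sym (+-assoc rate₁ (t * rate₁) _))))
      (prepend⁺ (pop⁺ refl ⨟⁺ pop⁺ refl ⨟⁺ push⁺ ⨟⁺ this⁺ (pop⁺ refl ⨟⁺ guess⁺ (only (A₁ ∷ A₂ ∷ [])) a _) ⨟⁺ steps⁺ B a m w f′ f)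
                (early⁺ b p (suc t′) fs (fits-≤ {B} (m≤n+m w a) f))))
      where
      σ : Stacks 18
      σ = mem (false ∷ toList gs ++ x) (marks (suc t)) (marks t′) n (marks (suc d)) (nums (m ∷ toList ms′ ++ sq)) (nums (a + m ∷ toList ms ++ s)) (nums (w ∷ lacking p)) (nums (a + w ∷ w ∷ lacking p)) y rq r z
    early⁺ b {suc t} (paused {d = d} {w} {m} {ms} {ms′} {gs} p) t′ {x} {n} {sq} {s} {y} {rq} {r} {z} (f′ ∷ fs) f =
      subst (λ k → early ⨟ empty D ⨟ late b ⨟ close ∶ σ ↝[ suc t * rate₁ + (3 + k) ] mem x (marks k) [] n [] (nums sq) (nums s) [] [] y rq r z) (+-suc t t′)
      (within (≤-trans (step-cost (s≤s z≤n) (t * rate₁ + (3 + (t + suc t′)))) (≤-reflexive (sym (+-assoc rate₁ (t * rate₁) _))))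
      (prepend⁺ (pop⁺ refl ⨟⁺ pop⁺ refl ⨟⁺ push⁺ ⨟⁺ that⁺ (pop⁺ refl ⨟⁺ push⁺) ⨟⁺ steps⁺ B 0 m w f′ f)
                (early⁺ b p (suc t′) fs f)))
      where
      σ : Stacks 18
      σ = mem (true ∷ toList gs ++ x) (marks (suc t)) (marks t′) n (marks (suc d)) (nums (m ∷ toList ms′ ++ sq)) (nums (m ∷ toList ms ++ s)) (nums (w ∷ lacking p)) (nums (w ∷ w ∷ lacking p)) y rq r z

module VerifierCompleteness where

  open StackPrograms hiding (step)
  open GuessingPrograms
  open Encodings
  open NumeralPrograms
  open VerifierSoundness
  open ProgramCosts

  nonzero⁺ : ∀ {c w} → c ≡ true ∷ w → nonzero ∶ c ∷ [] ↝[ 0 ] c ∷ []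
  nonzero⁺ refl = pop⁺ refl ⨟⁺ push⁺

  limit⁺ : ∀ b k → (b ≡ true → k ≤ 3) → 0 < k → limit b ∶ (encodeℕ k ++ []) ∷ [] ↝[ 3 + 2 * size₂ k ] [] ∷ []
  limit⁺ true 1 h _ = within (s≤s (s≤s z≤n)) (pop⁺ refl ⨟⁺ this⁺ (pop⁺ refl ⨟⁺ this⁺ (pop⁺ refl)))
  limit⁺ true 2 h _ = within (s≤s z≤n) (pop⁺ refl ⨟⁺ that⁺ (pop⁺ refl ⨟⁺ pop⁺ refl))
  limit⁺ true 3 h _ = within (s≤s (s≤s z≤n)) (pop⁺ refl ⨟⁺ this⁺ (pop⁺ refl ⨟⁺ that⁺ (pop⁺ refl ⨟⁺ pop⁺ refl ⨟⁺ pop⁺ refl)))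
  limit⁺ true (suc (suc (suc (suc k)))) h _ with h refl
  ... | s≤s (s≤s (s≤s ()))
  limit⁺ false k h _ rewrite ++-identityʳ (encodeℕ k) = within (≤-trans (≤-reflexive (+-identityʳ (1 + 2 * size₂ k))) (m≤n+m (1 + 2 * size₂ k) 2)) (go (encodeℕ k) ⨟⁺ empty⁺ refl)
    where
    go : ∀ w → star (pop zero false ∣ pop zero true) ∶ w ∷ [] ↝[ 1 + 2 * length w ] [] ∷ []
    go []          = done⁺
    go (false ∷ w) = within (≤-reflexive (cong suc (sym (*-suc 2 (length w))))) (more⁺ (this⁺ (pop⁺ refl)) (go w))
    go (true ∷ w)  = within (≤-reflexive (cong suc (sym (*-suc 2 (length w))))) (more⁺ (that⁺ (pop⁺ refl)) (go w))

  valueGuess⁺ : ∀ s v {x t n sq s₁ rq r z} → valueGuess s ∶ mem x t [] n [] sq s₁ [] [] [] rq r z ↝[ size₂ v + 0 ]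
    (x ∷ t ∷ [] ∷ n ∷ [] ∷ (encodeℕ v ++ []) ∷ [] ∷ sq ∷ s₁ ∷ [] ∷ [] ∷ [] ∷ (encodeℕ (chosen s v) ++ []) ∷ rq ∷ r ∷ z ∷ [] ∷ [] ∷ [])
  valueGuess⁺ true  v = within (m≤m+n _ 0) (guess⁺ (only (M ∷ Y ∷ [])) v _)
  valueGuess⁺ false v = guess⁺ (only (M ∷ [])) v _ ⨟⁺ push⁺

  demandGuess⁺ : ∀ s w q {x t n d sq s₁ rq r z} → demandGuess s ∶ mem x t [] n d sq s₁ (nums q) (nums q) [] rq r z ↝[ size₂ w + 0 ]
    (x ∷ t ∷ [] ∷ n ∷ d ∷ (encodeℕ w ++ []) ∷ [] ∷ sq ∷ s₁ ∷ [] ∷ nums q ∷ nums (chosen s w ∷ q) ∷ [] ∷ rq ∷ r ∷ z ∷ (encodeℕ w ++ []) ∷ [] ∷ [])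
  demandGuess⁺ true  w q = within (m≤m+n _ 0) (guess⁺ (only (M ∷ W₁ ∷ K ∷ [])) w _)
  demandGuess⁺ false w q = guess⁺ (only (M ∷ K ∷ [])) w _ ⨟⁺ push⁺

  chosen≤ : ∀ s k → chosen s k ≤ k
  chosen≤ true  k = ≤-refl
  chosen≤ false k = z≤n

  positive-numeral : ∀ {n} → 0 < n → ∃[ w ] encodeℕ n ++ [] ≡ true ∷ w
  positive-numeral {n} 0<n = let w , e = encodeℕ-positive 0<n in w , trans (++-identityʳ (encodeℕ n)) e

  positive-marks : ∀ {n} → 0 < n → ∃[ w ] marks n ≡ true ∷ w
  positive-marks (s≤s _) = _ , refl

  module Checking (B : ℕ) (1≤B : 1 ≤ B) where

    open Scanning B 1≤B

    Q : ℕ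
    Q = B * B

    B≤Q : B ≤ Q
    B≤Q = ≤-trans (≤-reflexive (sym (*-identityʳ B))) (*-monoʳ-≤ B 1≤B)

    1≤Q : 1 ≤ Q
    1≤Q = ≤-trans 1≤B B≤Q

    unary-cost : ∀ k → Fits B k → k ≤ B → suc k + size₂ k * (4 + k) ≤ 7 * Q
    unary-cost k f k≤B = begin
      suc k + size₂ k * (4 + k)    ≤⟨ +-mono-≤ (s≤s k≤B) (*-mono-≤ f (+-monoʳ-≤ 4 k≤B)) ⟩
      1 + B + B * (4 + B)          ≡⟨ arith₁ B ⟩
      1 + 5 * B + B * B            ≤⟨ +-monoˡ-≤ Q (+-mono-≤ 1≤Q (*-monoʳ-≤ 5 B≤Q)) ⟩
      Q + 5 * Q + Q                ≡⟨ arith₂ Q ⟩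
      7 * Q                        ∎
      where
      open ≤-Reasoning
      arith₁ : ∀ b → 1 + b + b * (4 + b) ≡ 1 + 5 * b + b * b
      arith₁ = solve-∀
      arith₂ : ∀ q → q + 5 * q + q ≡ 7 * q
      arith₂ = solve-∀

    list-cost : ∀ k → k ≤ B → 1 + k * suc B ≤ 3 * Q
    list-cost k k≤B = begin
      1 + k * suc B    ≤⟨ s≤s (*-monoˡ-≤ (suc B) k≤B) ⟩
      1 + B * suc B    ≡⟨ cong suc (*-suc B B) ⟩
      1 + (B + Q)      ≤⟨ +-mono-≤ 1≤Q (+-monoˡ-≤ Q B≤Q) ⟩
      Q + (Q + Q)      ≡⟨ arith Q ⟩
      3 * Q            ∎
      where
      open ≤-Reasoning
      arith : ∀ q → q + (q + q) ≡ 3 * q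
      arith = solve-∀

    small-cost : ∀ {k} → k ≤ B → k + 0 ≤ 1 * Q
    small-cost {k} k≤B = ≤-trans (≤-reflexive (+-identityʳ k)) (≤-trans k≤B (≤-trans B≤Q (m≤m+n Q 0)))

    Fits′ : ℕ → Set
    Fits′ = Fits B

    Served : Bool → (Bool → NProg 18) → Set
    Served b P = ∀ s {t n′} (A : Agent t) {ms ms′} (ps : Periods b (Agent.due A) (chosen s (Agent.demand A)) ms (Agent.gaps A) ms′) r′ →
      (b ≡ true → Agent.demand A ≤ 3) → t ≤ B → Fits′ (Agent.value A) → Fits′ (Agent.due A) → Fits′ (Agent.demand A) →
      All Fits′ (toList ms) → Fits′ (chosen s (Agent.value A) + r′) → ∀ {x sq s₁ rq z} →
      P s ∶
        mem (encodeAgent A ++ x) (marks t) [] n′ [] (nums (toList ms′ ++ sq)) (nums (toList ms ++ s₁)) [] [] [] (nums (r′ ∷ rq)) (nums (chosen s (Agent.value A) + r′ ∷ r′ ∷ rq)) z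
        ↝[ 71 * Q ] mem x (marks t) [] n′ [] (nums sq) (nums s₁) [] [] [] (nums rq) (nums (r′ ∷ rq)) z

    agent⁺ : ∀ b → Served b (agentProgram b)
    agent⁺ b s {t} {n′} A {ms} {ms′} ps r′ lim t≤B fv fd fw fms fr {x} {sq} {s₁} {rq} {z} rewrite encodeAgent-++ A {x} = within
      (≤-reflexive (arith Q))
      (within (small-cost fv) (valueGuess⁺ s v) ⨟⁺
       frame↝ (pick (only (M ∷ []))) (X₀ ∷ t̂ ∷ [] ∷ n′ ∷ [] ∷ v̂ ∷ [] ∷ Sq₀ ∷ S₀ ∷ [] ∷ [] ∷ [] ∷ ŷ ∷ Rq₀ ∷ R₀ ∷ z ∷ [] ∷ [] ∷ []) (nonzero⁺ (proj₂ (positive-numeral (Agent.value>0 A)))) ⨟⁺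
       within fv′ (frame↝ (pick (only (X ∷ M ∷ []))) (X₀ ∷ t̂ ∷ [] ∷ n′ ∷ [] ∷ v̂ ∷ [] ∷ Sq₀ ∷ S₀ ∷ [] ∷ [] ∷ [] ∷ ŷ ∷ Rq₀ ∷ R₀ ∷ z ∷ [] ∷ [] ∷ []) (match⁺ v)) ⨟⁺
       within (*-monoʳ-≤ 15 (≤-trans fr B≤Q)) (frame↝ (pick (only (Y ∷ Rq ∷ R₁ ∷ K ∷ K₂ ∷ []))) (X₁ ∷ t̂ ∷ [] ∷ n′ ∷ [] ∷ [] ∷ [] ∷ Sq₀ ∷ S₀ ∷ [] ∷ [] ∷ [] ∷ ŷ ∷ Rq₀ ∷ R₀ ∷ z ∷ [] ∷ [] ∷ []) (add⁺ (chosen s v) r′)) ⨟⁺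
       within (unary-cost d fd (≤-trans (periods-due ps) t≤B)) (frame↝ (pick (only (X ∷ D ∷ K ∷ K₂ ∷ []))) (X₁ ∷ t̂ ∷ [] ∷ n′ ∷ [] ∷ [] ∷ [] ∷ Sq₀ ∷ S₀ ∷ [] ∷ [] ∷ [] ∷ [] ∷ Rq₁ ∷ Rq₀ ∷ z ∷ [] ∷ [] ∷ []) (unary⁺ d)) ⨟⁺
       frame↝ (pick (only (D ∷ []))) (mem X₂ t̂ [] n′ (marks d) Sq₀ S₀ [] [] [] Rq₁ Rq₀ z) (nonzero⁺ (proj₂ (positive-marks {d} (s≤s z≤n)))) ⨟⁺
       ends (cong₂ (λ u v → mem X₂ t̂ [] n′ (marks d) Sq₀ S₀ u v [] Rq₁ Rq₀ z) (++-identityʳ (nums q)) (++-identityʳ (nums q)))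
         (within (list-cost (length q) (≤-trans (≤-reflexive (length-lacking ps)) t≤B))
           (guesses⁺ B (only (Wq ∷ W₁ ∷ [])) q (mem X₂ t̂ [] n′ (marks d) Sq₀ S₀ [] [] [] Rq₁ Rq₀ z) (fits-lacking ps (fits-≤ {B} (chosen≤ s w) fw)))) ⨟⁺
       within (small-cost fw) (demandGuess⁺ s w q) ⨟⁺
       frame↝ (pick (only (M ∷ []))) (X₂ ∷ t̂ ∷ [] ∷ n′ ∷ marks d ∷ ŵ ∷ [] ∷ Sq₀ ∷ S₀ ∷ [] ∷ nums q ∷ nums (chosen s w ∷ q) ∷ [] ∷ Rq₁ ∷ Rq₀ ∷ z ∷ ŵ ∷ [] ∷ []) (nonzero⁺ (proj₂ (positive-numeral (Agent.demand>0 A)))) ⨟⁺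
       within limit-cost (frame↝ (pick (only (K ∷ []))) (X₂ ∷ t̂ ∷ [] ∷ n′ ∷ marks d ∷ ŵ ∷ [] ∷ Sq₀ ∷ S₀ ∷ [] ∷ nums q ∷ nums (chosen s w ∷ q) ∷ [] ∷ Rq₁ ∷ Rq₀ ∷ z ∷ ŵ ∷ [] ∷ []) (limit⁺ b w lim (Agent.demand>0 A))) ⨟⁺
       within fw′ (frame↝ (pick (only (X ∷ M ∷ []))) (X₂ ∷ t̂ ∷ [] ∷ n′ ∷ marks d ∷ ŵ ∷ [] ∷ Sq₀ ∷ S₀ ∷ [] ∷ nums q ∷ nums (chosen s w ∷ q) ∷ [] ∷ Rq₁ ∷ Rq₀ ∷ z ∷ [] ∷ [] ∷ []) (match⁺ w)) ⨟⁺
       ends (cong (λ k → mem x (marks k) [] n′ [] (nums sq) (nums s₁) [] [] [] Rq₁ Rq₀ z) (+-identityʳ t))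
         (within scan-cost (early⁺ b ps 0 {sq = sq} {s₁} fms (fits-≤ {B} (chosen≤ s w) fw))))
      where
      open Agent A renaming (value to v; due to d; demand to w; gaps to gs)
      q = lacking ps
      t̂ = marks t
      v̂ = encodeℕ v ++ []
      ŷ = encodeℕ (chosen s v) ++ []
      ŵ = encodeℕ w ++ []
      X₂ = encodeℕ w ++ toList gs ++ x
      X₁ = encodeℕ d ++ X₂
      X₀ = encodeℕ v ++ X₁
      Sq₀ = nums (toList ms′ ++ sq)
      S₀ = nums (toList ms ++ s₁)
      Rq₁ = nums rq
      Rq₀ = nums (r′ ∷ rq)
      R₀ = nums (chosen s v + r′ ∷ r′ ∷ rq)
      arith : ∀ q → 1 * q + (0 + (1 * q + (15 * q + (7 * q + (0 + (3 * q + (1 * q + (0 + (5 * q + (1 * q + 37 * q)))))))))) ≡ 71 * q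
      arith = solve-∀
      fv′ : size₂ v ≤ 1 * Q
      fv′ = ≤-trans (m≤m+n _ 0) (small-cost fv)
      fw′ : size₂ w ≤ 1 * Q
      fw′ = ≤-trans (m≤m+n _ 0) (small-cost fw)
      limit-cost : 3 + 2 * size₂ w ≤ 5 * Q
      limit-cost = ≤-trans (+-mono-≤ (*-monoʳ-≤ 3 1≤Q) (*-monoʳ-≤ 2 (≤-trans fw B≤Q))) (≤-reflexive (sym (*-distribʳ-+ Q 3 2)))
      scan-cost : t * (33 * B) + (3 + (t + 0)) ≤ 37 * Q
      scan-cost = begin
        t * (33 * B) + (3 + (t + 0))  ≤⟨ +-mono-≤ (*-monoˡ-≤ (33 * B) t≤B) (+-mono-≤ (*-monoʳ-≤ 3 1≤Q) (small-cost t≤B)) ⟩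
        B * (33 * B) + (3 * Q + 1 * Q) ≡⟨ cong (_+ (3 * Q + 1 * Q)) (arith′ B) ⟩
        33 * Q + (3 * Q + 1 * Q)     ≡⟨ arith″ Q ⟩
        37 * Q                        ∎
        where
        open ≤-Reasoning
        arith′ : ∀ b → b * (33 * b) ≡ 33 * (b * b)
        arith′ = solve-∀
        arith″ : ∀ q → 33 * q + (3 * q + 1 * q) ≡ 37 * q
        arith″ = solve-∀

    supplies : ∀ {b t n r} {As : Vec (Agent t) n} {ms} → Serve b As ms r → List ℕ
    supplies []                        = []
    supplies (serve s {ms′ = ms′} _ _ sv) = toList ms′ ++ supplies sv

    totals : ∀ {b t n r} {As : Vec (Agent t) n} {ms} → Serve b As ms r → List ℕ
    totals []                      = []
    totals (serve s {r = r} _ _ sv) = r ∷ totals sv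

    fits-supplies : ∀ {b t n r} {As : Vec (Agent t) n} {ms} (sv : Serve b As ms r) → All Fits′ (toList ms) → All Fits′ (supplies sv)
    fits-supplies []                fs = []
    fits-supplies (serve s _ ps sv) fs = All.++⁺ (fits-after {B} ps fs) (fits-supplies sv (fits-after {B} ps fs))

    length-toList : ∀ {A : Set} {t} (v : Vec A t) → length (toList v) ≡ t
    length-toList []      = refl
    length-toList (_ ∷ v) = cong suc (length-toList v)

    length-supplies : ∀ {b t n r} {As : Vec (Agent t) n} {ms} (sv : Serve b As ms r) → length (supplies sv) ≡ n * t
    length-supplies [] = refl
    length-supplies (serve s {ms′ = ms′} _ _ sv) = trans (length-++ (toList ms′)) (cong₂ _+_ (length-toList ms′) (length-supplies sv))

    fits-totals : ∀ {b t n r} {As : Vec (Agent t) n} {ms} (sv : Serve b As ms r) → Fits′ r → All Fits′ (totals sv)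
    fits-totals []                f = []
    fits-totals (serve s {A = A} {r = r} _ _ sv) f = f′ ∷ fits-totals sv f′
      where f′ = fits-≤ {B} (m≤n+m r (chosen s (Agent.value A))) f

    length-totals : ∀ {b t n r} {As : Vec (Agent t) n} {ms} (sv : Serve b As ms r) → length (totals sv) ≡ n
    length-totals []               = refl
    length-totals (serve s _ _ sv) = cong suc (length-totals sv)

    FitsAgent : ∀ {t} → Agent t → Set
    FitsAgent A = Fits′ (Agent.value A) × Fits′ (Agent.due A) × Fits′ (Agent.demand A)

    leftover : ∀ {b t n r} {As : Vec (Agent t) n} {ms} → Serve b As ms r → List ℕ
    leftover {ms = ms} []     = toList ms ++ []
    leftover (serve s _ _ sv) = leftover sv

    either⁺ : ∀ {P : Bool → NProg 18} s {σ σ′ k} → P s ∶ σ ↝[ k ] σ′ → (P true ∣ P false) ∶ σ ↝[ suc k ] σ′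
    either⁺ true  = this⁺
    either⁺ false = that⁺

    serve⁺ : ∀ {b} {P : Bool → NProg 18} → Served b P → ∀ {t n r} {As : Vec (Agent t) n} {ms} (sv : Serve b As ms r) → t ≤ B →
      All FitsAgent (toList As) → All Fits′ (toList ms) → Fits′ r → ∀ {x z} →
      star (pop n₁ true ⨟ (P true ∣ P false)) ∶
        mem (concatMap encodeAgent (toList As) ++ x) (marks t) [] (marks n) [] (nums (supplies sv)) (nums (toList ms ++ supplies sv)) [] [] [] (nums (totals sv)) (nums (r ∷ totals sv)) z
        ↝[ 1 + n * (73 * Q) ] mem x (marks t) [] [] [] [] (nums (leftover sv)) [] [] [] [] (nums (0 ∷ [])) z
    serve⁺ P⁺ [] t≤B _ _ _ = done⁺
    serve⁺ {P = P} P⁺ {t} (serve s {n} {A} {As} {ms} {ms′} {r} lim ps sv) t≤B ((fv , fd , fw) ∷ fAs) fms fr {x} {z}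
      rewrite ++-assoc (encodeAgent A) (concatMap encodeAgent (toList As)) x = within bound
        (more⁺ (pop⁺ refl ⨟⁺ either⁺ {P} s (P⁺ s A ps r lim t≤B fv fd fw fms fr
                 {concatMap encodeAgent (toList As) ++ x} {supplies sv} {toList ms′ ++ supplies sv} {totals sv} {z}))
               (serve⁺ {P = P} P⁺ sv t≤B fAs (fits-after {B} ps fms) (fits-≤ {B} (m≤n+m r (chosen s (Agent.value A))) fr)))
      where
      bound : suc (suc (71 * Q) + (1 + n * (73 * Q))) ≤ 1 + (73 * Q + n * (73 * Q))
      bound = s≤s (≤-trans (≤-reflexive (arith (71 * Q) (n * (73 * Q)))) (+-monoˡ-≤ (n * (73 * Q)) (≤-trans (+-monoˡ-≤ (71 * Q) (*-monoʳ-≤ 2 1≤Q)) (≤-reflexive (sym (*-distribʳ-+ Q 2 71))))))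
        where
        arith : ∀ a b → suc a + (1 + b) ≡ 2 + a + b
        arith = solve-∀

    supplyLoop⁺ : ∀ {t} (ms : Vec ℕ t) t′ → All Fits′ (toList ms) → ∀ {x sq s} →
      star (pop T₁ true ⨟ put (T₂ ∷ []) true ⨟ matchInput) ∶
        (nums (toList ms) ++ x) ∷ marks t ∷ marks t′ ∷ [] ∷ [] ∷ nums (toList ms) ∷ [] ∷ sq ∷ s ∷ [] ∷ [] ∷ [] ∷ [] ∷ [] ∷ [] ∷ [] ∷ [] ∷ [] ∷ []
        ↝[ 1 + t * suc B ] mem x [] (marks (t + t′)) [] [] sq s [] [] [] [] [] []
    supplyLoop⁺ []       t′ []       = done⁺
    supplyLoop⁺ {suc t} (m ∷ ms) t′ (f ∷ fs) {x} {sq} {s} rewrite ++-assoc (encodeℕ m) (nums (toList ms)) x =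
      ends (cong (λ k → mem x [] (marks k) [] [] sq s [] [] [] [] [] []) (+-suc t t′))
        (within (s≤s (≤-trans (≤-reflexive (+-suc B (t * suc B))) ≤-refl))
          (more⁺ (pop⁺ refl ⨟⁺ push⁺ ⨟⁺ within f (frame↝ (pick (only (X ∷ M ∷ [])))
            ((encodeℕ m ++ nums (toList ms) ++ x) ∷ marks t ∷ marks (suc t′) ∷ [] ∷ [] ∷ nums (m ∷ toList ms) ∷ [] ∷ sq ∷ s ∷ [] ∷ [] ∷ [] ∷ [] ∷ [] ∷ [] ∷ [] ∷ [] ∷ [] ∷ []) (match⁺ m)))
            (supplyLoop⁺ ms (suc t′) fs)))

    supply⁺ : ∀ {t} (ms : Vec ℕ t) l k → 0 < t → t ≤ B → Fits′ t → All Fits′ (toList ms) → All Fits′ l → length l ≤ k * B → ∀ {x} →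
      supplyProgram ∶ (encodeℕ t ++ nums (toList ms) ++ x) ∷ Vec.replicate 17 [] ↝[ (16 + 3 * k) * Q ]
        mem x (marks t) [] [] [] (nums l) (nums (toList ms ++ l)) [] [] [] [] [] []
    supply⁺ {t} ms l k 0<t t≤B ft fms fl len {x} = within bound
      (within (unary-cost t ft t≤B) (frame↝ (pick (only (X ∷ T₁ ∷ K ∷ K₂ ∷ []))) ((encodeℕ t ++ nums (toList ms) ++ x) ∷ Vec.replicate 17 []) (unary⁺ t)) ⨟⁺
       frame↝ (pick (only (T₁ ∷ []))) (mem X₁ (marks t) [] [] [] [] [] [] [] [] [] [] []) (nonzero⁺ (proj₂ (positive-marks 0<t))) ⨟⁺
       ends (cong₂ (λ u v → mem X₁ (marks t) [] [] [] u v [] [] [] [] [] []) (++-identityʳ (nums l)) (++-identityʳ (nums l)))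
         (guesses⁺ B (only (Sq ∷ S₁ ∷ [])) l (mem X₁ (marks t) [] [] [] [] [] [] [] [] [] [] []) fl) ⨟⁺
       ends (cong₂ (λ u v → X₁ ∷ marks t ∷ [] ∷ [] ∷ [] ∷ u ∷ [] ∷ nums l ∷ v ∷ [] ∷ [] ∷ [] ∷ [] ∷ [] ∷ [] ∷ [] ∷ [] ∷ [] ∷ [])
               (++-identityʳ (nums (toList ms))) (sym (concatMap-++ encodeℕ (toList ms) l)))
         (within (≤-trans (≤-reflexive (cong (λ j → 1 + j * suc B) (length-toList ms))) (list-cost t t≤B))
           (guesses⁺ B (only (M ∷ S₁ ∷ [])) (toList ms) (mem X₁ (marks t) [] [] [] (nums l) (nums l) [] [] [] [] [] []) fms)) ⨟⁺
       ends (cong (λ j → mem x [] (marks j) [] [] (nums l) (nums (toList ms ++ l)) [] [] [] [] [] []) (+-identityʳ t))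
         (within (list-cost t t≤B) (supplyLoop⁺ ms 0 fms)) ⨟⁺
       empty⁺ refl ⨟⁺ within (≤-trans (+-mono-≤ 1≤Q (≤-trans t≤B B≤Q)) (≤-reflexive (arith₀ Q))) (refill⁺ t))
      where
      X₁ = nums (toList ms) ++ x
      arith₀ : ∀ q → q + q ≡ 2 * q
      arith₀ = solve-∀
      arith₁ : ∀ b k → 1 + k * b * suc b ≡ 1 + (k * b + k * (b * b))
      arith₁ = solve-∀
      arith₂ : ∀ q k → 7 * q + (0 + (q + (k * q + k * q) + (3 * q + (3 * q + (0 + 2 * q))))) ≡ (16 + 2 * k) * q
      arith₂ = solve-∀
      guess-cost : 1 + length l * suc B ≤ Q + (k * Q + k * Q)
      guess-cost = begin
        1 + length l * suc B         ≤⟨ s≤s (*-monoˡ-≤ (suc B) len) ⟩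
        1 + k * B * suc B            ≡⟨ arith₁ B k ⟩
        1 + (k * B + k * (B * B))    ≤⟨ +-mono-≤ 1≤Q (+-monoˡ-≤ (k * Q) (*-monoʳ-≤ k B≤Q)) ⟩
        Q + (k * Q + k * Q)          ∎
        where open ≤-Reasoning
      bound : 7 * Q + (0 + (1 + length l * suc B + (3 * Q + (3 * Q + (0 + 2 * Q))))) ≤ (16 + 3 * k) * Q
      bound = ≤-trans (+-monoʳ-≤ (7 * Q) (+-monoˡ-≤ (3 * Q + (3 * Q + (0 + 2 * Q))) guess-cost))
        (≤-trans (≤-reflexive (arith₂ Q k)) (*-monoˡ-≤ Q (+-monoʳ-≤ 16 (*-monoˡ-≤ k (n≤1+n 2)))))

    agents⁺ : ∀ b {t n r} {As : Vec (Agent t) n} {ms} (sv : Serve b As ms r) → t ≤ B → n ≤ B → Fits′ n →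
      All FitsAgent (toList As) → All Fits′ (toList ms) → Fits′ r → ∀ {x} →
      agentsProgram b ∶ mem (encodeℕ n ++ concatMap encodeAgent (toList As) ++ x) (marks t) [] [] [] (nums (supplies sv)) (nums (toList ms ++ supplies sv)) [] [] [] [] [] []
        ↝[ (12 + n * 73) * Q ] mem x (marks t) [] [] [] [] (nums (leftover sv)) [] [] [] [] [] (encodeℕ r)
    agents⁺ b {t} {n} {r} {As} {ms} sv t≤B n≤B fn fAs fms fr {x} = within bound
      (within (unary-cost n fn n≤B) (frame↝ (pick (only (X ∷ n₁ ∷ K ∷ K₂ ∷ []))) (mem (encodeℕ n ++ X₁) (marks t) [] [] [] Sq₀ S₀ [] [] [] [] [] []) (unary⁺ n)) ⨟⁺
       ends (cong₂ (λ u v → mem X₁ (marks t) [] (marks n) [] Sq₀ S₀ [] [] [] u v []) (++-identityʳ (nums (totals sv))) (++-identityʳ (nums (totals sv))))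
         (within (≤-trans (≤-reflexive (cong (λ j → 1 + j * suc B) (length-totals sv))) (list-cost n n≤B))
           (guesses⁺ B (only (Rq ∷ R₁ ∷ [])) (totals sv) (mem X₁ (marks t) [] (marks n) [] Sq₀ S₀ [] [] [] [] [] []) (fits-totals sv fr))) ⨟⁺
       ends (cong (mem X₁ (marks t) [] (marks n) [] Sq₀ S₀ [] [] [] (nums (totals sv)) (nums (r ∷ totals sv))) (++-identityʳ (encodeℕ r)))
         (within (≤-trans fr B≤Q) (guess⁺ (only (R₁ ∷ Z ∷ [])) r (mem X₁ (marks t) [] (marks n) [] Sq₀ S₀ [] [] [] (nums (totals sv)) (nums (totals sv)) []))) ⨟⁺
       serve⁺ (agent⁺ b) sv t≤B fAs fms fr ⨟⁺ empty⁺ refl ⨟⁺ pop⁺ refl ⨟⁺ empty⁺ refl ⨟⁺ empty⁺ refl)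
      where
      X₁ = concatMap encodeAgent (toList As) ++ x
      Sq₀ = nums (supplies sv)
      S₀ = nums (toList ms ++ supplies sv)
      arith : ∀ q n → 7 * q + (3 * q + (q + ((q + n * (73 * q)) + 0))) ≡ (12 + n * 73) * q
      arith = solve-∀
      bound : 7 * Q + (3 * Q + (Q + ((1 + n * (73 * Q)) + 0))) ≤ (12 + n * 73) * Q
      bound = ≤-trans (+-monoʳ-≤ (7 * Q) (+-monoʳ-≤ (3 * Q) (+-monoʳ-≤ Q (+-monoˡ-≤ 0 (+-monoˡ-≤ (n * (73 * Q)) 1≤Q))))) (≤-reflexive (arith Q n))

    unused : ℤ → ℕ → Bits
    unused (ℤ.+ _)    r = []
    unused ℤ.-[1+ _ ] r = encodeℕ r

    target⁺ : ∀ V r → V ℤ.≤ ℤ.+ r → Fits′ r → Fits′ ℤ.∣ V ∣ → ∀ {t s s′} →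
      targetProgram ∶ mem (encodeℤ V) t [] [] [] s s′ [] [] [] [] [] (encodeℕ r) ↝[ 19 * Q ] mem [] t [] [] [] s s′ [] [] [] [] [] (unused V r)
    target⁺ (ℤ.+ k) r (ℤ.+≤+ k≤r) fr fV {t} {s} {s′} =
      subst₂ (λ u v → targetProgram ∶ mem (true ∷ u) t [] [] [] s s′ [] [] [] [] [] (encodeℕ v) ↝[ 19 * Q ] mem [] t [] [] [] s s′ [] [] [] [] [] [])
        (++-identityʳ (encodeℕ k)) (m+[n∸m]≡n k≤r)
        (within bound
          (this⁺ (pop⁺ refl ⨟⁺ within fV′ (guess⁺ (only (M ∷ A₂ ∷ [])) k _) ⨟⁺
            within fV′ (frame↝ (pick (only (X ∷ M ∷ []))) ((encodeℕ k ++ []) ∷ t ∷ [] ∷ [] ∷ [] ∷ (encodeℕ k ++ []) ∷ [] ∷ s ∷ s′ ∷ (encodeℕ k ++ []) ∷ [] ∷ [] ∷ [] ∷ [] ∷ [] ∷ encodeℕ (k + i) ∷ [] ∷ [] ∷ []) (match⁺ k)) ⨟⁺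
            within (≤-trans (fits-≤ {B} (m∸n≤m r k) fr) B≤Q) (guess⁺ (only (Wq ∷ [])) i _) ⨟⁺
            within (*-monoʳ-≤ 15 (≤-trans (fits-≤ {B} (≤-reflexive (m+[n∸m]≡n k≤r)) fr) B≤Q))
              (frame↝ (pick (only (A₂ ∷ Wq ∷ Z ∷ K ∷ K₂ ∷ []))) ([] ∷ t ∷ [] ∷ [] ∷ [] ∷ [] ∷ [] ∷ s ∷ s′ ∷ (encodeℕ k ++ []) ∷ (encodeℕ i ++ []) ∷ [] ∷ [] ∷ [] ∷ [] ∷ encodeℕ (k + i) ∷ [] ∷ [] ∷ [])
                (subst (λ z → add ∶ (encodeℕ k ++ []) ∷ (encodeℕ i ++ []) ∷ z ∷ [] ∷ [] ∷ [] ↝[ 15 * size₂ (k + i) ] [] ∷ [] ∷ [] ∷ [] ∷ [] ∷ []) (++-identityʳ (encodeℕ (k + i))) (add⁺ k i)))) ⨟⁺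
           empty⁺ refl))
      where
      i = r ∸ k
      fV′ : size₂ k ≤ Q
      fV′ = ≤-trans fV B≤Q
      bound : suc (Q + (Q + (Q + 15 * Q))) + 0 ≤ 19 * Q
      bound = ≤-trans (≤-reflexive (+-identityʳ _)) (≤-trans (+-monoˡ-≤ (Q + (Q + (Q + 15 * Q))) 1≤Q) (≤-reflexive (arith Q)))
        where
        arith : ∀ q → q + (q + (q + (q + 15 * q))) ≡ 19 * q
        arith = solve-∀
    target⁺ ℤ.-[1+ k ] r V≤r fr fV {t} {s} {s′} =
      subst (λ u → targetProgram ∶ mem (false ∷ u) t [] [] [] s s′ [] [] [] [] [] (encodeℕ r) ↝[ 19 * Q ] mem [] t [] [] [] s s′ [] [] [] [] [] (encodeℕ r))
        (++-identityʳ (encodeℕ k))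
        (within bound
          (that⁺ (pop⁺ refl ⨟⁺ within fV′ (guess⁺ (only (M ∷ [])) k _) ⨟⁺
            within fV′ (frame↝ (pick (only (X ∷ M ∷ []))) ((encodeℕ k ++ []) ∷ t ∷ [] ∷ [] ∷ [] ∷ (encodeℕ k ++ []) ∷ [] ∷ s ∷ s′ ∷ [] ∷ [] ∷ [] ∷ [] ∷ [] ∷ [] ∷ encodeℕ r ∷ [] ∷ [] ∷ []) (match⁺ k))) ⨟⁺
           empty⁺ refl))
      where
      fV′ : size₂ k ≤ Q
      fV′ = ≤-trans (fits-≤ {B} (n≤1+n k) fV) B≤Q
      bound : suc (Q + Q) + 0 ≤ 19 * Q
      bound = ≤-trans (≤-reflexive (+-identityʳ _)) (≤-trans (+-monoˡ-≤ (Q + Q) 1≤Q) (≤-trans (≤-reflexive (arith Q)) (*-monoˡ-≤ Q (m≤m+n 3 16))))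
        where
        arith : ∀ q → q + (q + q) ≡ 3 * q
        arith = solve-∀

    program⁺ : ∀ b I V {r} (sv : Serve b (Scheduling.agents I) (Scheduling.supply I) r) → V ℤ.≤ ℤ.+ r →
      Scheduling.periods I ≤ B → Fits′ (Scheduling.periods I) → Scheduling.n I ≤ B → Fits′ (Scheduling.n I) →
      All FitsAgent (toList (Scheduling.agents I)) → All Fits′ (toList (Scheduling.supply I)) → Fits′ r → Fits′ ℤ.∣ V ∣ →
      ∃[ σ ] program b ∶ encodeInstance (I , V) ∷ Vec.replicate 17 [] ↝[ 123 * B * (B * B) ] σ
    program⁺ b I V {r} sv V≤r t≤B ft n≤B fn fAs fms fr fV = _ , within bound
      (supply⁺ supply (supplies sv) n periods≥1 t≤B ft fms (fits-supplies sv fms)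
         (≤-trans (≤-reflexive (length-supplies sv)) (*-monoʳ-≤ n t≤B)) ⨟⁺
       agents⁺ b sv t≤B n≤B fn fAs fms fr ⨟⁺ target⁺ V r V≤r fr fV)
      where
      open Scheduling I
      arith : ∀ n q → (16 + 3 * n) * q + ((12 + n * 73) * q + 19 * q) ≡ (47 + 76 * n) * q
      arith = solve-∀
      bound : (16 + 3 * n) * Q + ((12 + n * 73) * Q + 19 * Q) ≤ 123 * B * Q
      bound = ≤-trans (≤-reflexive (arith n Q)) (*-monoˡ-≤ Q (≤-trans (+-mono-≤ (*-monoʳ-≤ 47 1≤B) (*-monoʳ-≤ 76 n≤B)) (≤-reflexive (sym (*-distribʳ-+ B 47 76)))))

  power-bound : ∀ k → suc k ≤ 2 ^ size₂ k
  power-bound k = subst₂ (λ u v → suc u ≤ 2 ^ v) (val-digits k) (cong length (sym (encodeℕ-numeral k))) (go (digits k))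
    where
    go : ∀ ds → suc (val ds) ≤ 2 ^ length (numeral ds)
    go []       = s≤s z≤n
    go (d ∷ ds) = begin
      suc (val (d ∷ ds))              ≡⟨ cong suc (val-∷ d ds) ⟩
      suc (digit d + 2 * val ds)      ≤⟨ +-mono-≤ (s≤s (low≤2 (d ∷ []))) (*-monoˡ-≤ (val ds) (m≤m+n 2 2)) ⟩
      3 + 4 * val ds                  ≤⟨ n≤1+n _ ⟩
      4 + 4 * val ds                  ≡⟨ *-suc 4 (val ds) ⟨
      4 * suc (val ds)                ≤⟨ *-monoʳ-≤ 4 (go ds) ⟩
      4 * 2 ^ length (numeral ds)     ≡⟨ *-assoc 2 2 (2 ^ length (numeral ds)) ⟩
      2 ^ length (numeral (d ∷ ds))   ∎
      where open ≤-Reasoning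

  size₂-log : ∀ k L → suc k ≤ 2 ^ L → size₂ k ≤ 1 + 2 * L
  size₂-log k L le = ≤-trans (≤-reflexive (size₂-digits k)) (s≤s (*-monoʳ-≤ 2 short))
    where
    go : ∀ ds → 2 ^ length ds ≤ suc (val ds)
    go []       = ≤-refl
    go (d ∷ ds) = begin
      2 * 2 ^ length ds              ≤⟨ *-monoʳ-≤ 2 (go ds) ⟩
      2 * suc (val ds)               ≡⟨ *-suc 2 (val ds) ⟩
      2 + 2 * val ds                 ≤⟨ +-monoˡ-≤ (2 * val ds) (positive d) ⟩
      suc (digit d) + 2 * val ds     ≡⟨ cong suc (val-∷ d ds) ⟨
      suc (val (d ∷ ds))             ∎
      where
      open ≤-Reasoning
      positive : ∀ d → 2 ≤ suc (digit d)
      positive false = ≤-refl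
      positive true  = n≤1+n 2
    short : length (digits k) ≤ L
    short = ≮⇒≥ λ p → <⇒≱ (^-monoʳ-< 2 (s≤s (s≤s z≤n)) p) (≤-trans (go (digits k)) (≤-trans (≤-reflexive (cong suc (val-digits k))) le))

  ++-lengthˡ : ∀ (u v : Bits) → length u ≤ length (u ++ v)
  ++-lengthˡ u v = ≤-trans (m≤m+n (length u) (length v)) (≤-reflexive (sym (length-++ u)))

  ++-lengthʳ : ∀ (u v : Bits) → length v ≤ length (u ++ v)
  ++-lengthʳ u v = ≤-trans (m≤n+m (length v) (length u)) (≤-reflexive (sym (length-++ u)))

  concatMap-length : ∀ {A : Set} (f : A → Bits) → (∀ a → 1 ≤ length (f a)) → ∀ {n} (v : Vec A n) → n ≤ length (concatMap f (toList v))
  concatMap-length f pos []      = z≤n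
  concatMap-length f pos (a ∷ v) = ≤-trans (+-mono-≤ (pos a) (concatMap-length f pos v)) (≤-reflexive (sym (length-++ (f a))))

  concatMap-all : ∀ {A : Set} (f : A → Bits) {n} (v : Vec A n) → All (λ a → length (f a) ≤ length (concatMap f (toList v))) (toList v)
  concatMap-all f []      = []
  concatMap-all f (a ∷ v) = ++-lengthˡ (f a) _ ∷ All.map (λ p → ≤-trans p (++-lengthʳ (f a) _)) (concatMap-all f v)

  serve-bound : ∀ {b t n r} {As : Vec (Agent t) n} {ms} → Serve b As ms r → suc r ≤ 2 ^ length (concatMap encodeAgent (toList As))
  serve-bound [] = ≤-refl
  serve-bound (serve s {A = A} {As} {r = r} _ _ sv) = begin
    suc (chosen s v + r)                                ≤⟨ s≤s (+-monoˡ-≤ r (chosen≤ s v)) ⟩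
    suc (v + r)                                         ≤⟨ s≤s (+-monoʳ-≤ v (≤-trans (m≤m+n r (v * r)) (≤-refl))) ⟩
    suc (v + (r + v * r))                               ≡⟨ arith v r ⟩
    suc v * suc r                                       ≤⟨ *-mono-≤ (≤-trans (power-bound v) (^-monoʳ-≤ 2 (++-lengthˡ (encodeℕ v) _))) (serve-bound sv) ⟩
    2 ^ length (encodeAgent A) * 2 ^ length (concatMap encodeAgent (toList As)) ≡⟨ ^-distribˡ-+-* 2 (length (encodeAgent A)) _ ⟨
    2 ^ (length (encodeAgent A) + length (concatMap encodeAgent (toList As)))   ≡⟨ cong (2 ^_) (length-++ (encodeAgent A)) ⟨
    2 ^ length (concatMap encodeAgent (toList (A ∷ As))) ∎
    where
    open ≤-Reasoning
    v = Agent.value A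
    arith : ∀ v r → suc (v + (r + v * r)) ≡ suc v * suc r
    arith = solve-∀

  certified⇒run : ∀ b IV → Certified b IV →
    let L = length (encodeInstance IV) in
    ∃[ σ ] program b ∶ encodeInstance IV ∷ Vec.replicate 17 [] ↝[ 123 * suc (2 * L) * (suc (2 * L) * suc (2 * L)) ] σ
  certified⇒run b IV@(I , V) (r , sv , V≤r) = C.program⁺ b I V sv V≤r
    (up (≤-trans (concatMap-length encodeℕ size₂-positive supply) (≤-trans (++-lengthˡ S _) in-S)))
    (up (++-lengthˡ (encodeℕ periods) _))
    (up (≤-trans (concatMap-length encodeAgent (λ A → ≤-trans (size₂-positive (Agent.value A)) (++-lengthˡ (encodeℕ (Agent.value A)) _)) agents) (≤-trans (++-lengthˡ As _) in-A)))
    (up (≤-trans (++-lengthˡ (encodeℕ n) _) in-n))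
    (All.map (λ {A} p → fits-agent A (≤-trans p (≤-trans (++-lengthˡ As _) in-A))) (concatMap-all encodeAgent agents))
    (All.map (λ p → up (≤-trans p (≤-trans (++-lengthˡ S _) in-S))) (concatMap-all encodeℕ supply))
    (size₂-log r L (≤-trans (serve-bound sv) (^-monoʳ-≤ 2 (≤-trans (++-lengthˡ As _) in-A))))
    (fits-V V (≤-trans (++-lengthʳ As _) in-A))
    where
    open Scheduling I
    L = length (encodeInstance IV)
    module C = Checking (suc (2 * L)) (s≤s z≤n)
    S = nums (toList supply)
    As = concatMap encodeAgent (toList agents)
    up : ∀ {k} → k ≤ L → k ≤ suc (2 * L)
    up k≤L = ≤-trans k≤L (≤-trans (m≤m+n L (L + 0)) (n≤1+n _))
    in-S : length (S ++ encodeℕ n ++ As ++ encodeℤ V) ≤ L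
    in-S = ++-lengthʳ (encodeℕ periods) _
    in-n : length (encodeℕ n ++ As ++ encodeℤ V) ≤ L
    in-n = ≤-trans (++-lengthʳ S _) in-S
    in-A : length (As ++ encodeℤ V) ≤ L
    in-A = ≤-trans (++-lengthʳ (encodeℕ n) _) in-n
    fits-agent : ∀ A → length (encodeAgent A) ≤ L → C.FitsAgent A
    fits-agent A p =
      up (≤-trans (++-lengthˡ (encodeℕ value) _) p) ,
      up (≤-trans (++-lengthˡ (encodeℕ due) _) (≤-trans (++-lengthʳ (encodeℕ value) _) p)) ,
      up (≤-trans (++-lengthˡ (encodeℕ demand) _) (≤-trans (++-lengthʳ (encodeℕ due) _) (≤-trans (++-lengthʳ (encodeℕ value) _) p)))
      where open Agent A
    fits-V : ∀ V → length (encodeℤ V) ≤ L → size₂ ℤ.∣ V ∣ ≤ suc (2 * L)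
    fits-V (ℤ.+ k) p = up (≤-trans (n≤1+n _) p)
    fits-V ℤ.-[1+ k ] p = size₂-log (suc k) L (begin
      2 + k                    ≤⟨ s≤s (≤-trans (power-bound k) ≤-refl) ⟩
      suc (2 ^ size₂ k)        ≤⟨ +-monoˡ-≤ (2 ^ size₂ k) (m^n>0 2 (size₂ k)) ⟩
      2 ^ size₂ k + 2 ^ size₂ k ≡⟨ cong (2 ^ size₂ k +_) (+-identityʳ _) ⟨
      2 ^ suc (size₂ k)        ≤⟨ ^-monoʳ-≤ 2 p ⟩
      2 ^ L                    ∎)
      where open ≤-Reasoning

module Membership where

  open StackPrograms hiding (step)
  open GuessingPrograms
  open NumeralPrograms
  open VerifierSoundness
  open VerifierParsing
  open VerifierCompleteness
  open Selections
  open Transportation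
  open import Data.Fin.Subset using (_∈_)

  Class : Bool → Scheduling × ℤ → Set
  Class false I = AllInstances I
  Class true  I = DemandsAtMost 3 I × DeadlinesAtEnd I

  amounts : ∀ {b t d w} {ms : Vec ℕ t} {gs ms′} → Periods b d w ms gs ms′ → Fin t → ℕ
  amounts (taken a p)  zero    = a
  amounts (taken a p)  (suc j) = amounts p j
  amounts (paused p)   zero    = 0
  amounts (paused p)   (suc j) = amounts p j
  amounts (beyond _ p) zero    = 0
  amounts (beyond _ p) (suc j) = amounts p j

  amounts-supply : ∀ {b t d w} {ms : Vec ℕ t} {gs ms′} (p : Periods b d w ms gs ms′) j →
                   lookup ms j ≡ amounts p j + lookup ms′ j
  amounts-supply (taken a p)  zero    = refl
  amounts-supply (taken a p)  (suc j) = amounts-supply p j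
  amounts-supply (paused p)   zero    = refl
  amounts-supply (paused p)   (suc j) = amounts-supply p j
  amounts-supply (beyond _ p) zero    = refl
  amounts-supply (beyond _ p) (suc j) = amounts-supply p j

  amounts-gap : ∀ {b t d w} {ms : Vec ℕ t} {gs ms′} (p : Periods b d w ms gs ms′) j →
                lookup gs j ≡ true → amounts p j ≡ 0
  amounts-gap (taken a p)  (suc j) g = amounts-gap p j g
  amounts-gap (paused p)   zero    g = refl
  amounts-gap (paused p)   (suc j) g = amounts-gap p j g
  amounts-gap (beyond _ p) zero    g = refl
  amounts-gap (beyond _ p) (suc j) g = amounts-gap p j g

  amounts-demand : ∀ {b t d w} {ms : Vec ℕ t} {gs ms′} (p : Periods b d w ms gs ms′) →
                   ∑ (λ j → (toℕ j <ᵇ d) ∙ amounts p j) ≡ w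
  amounts-demand end                  = refl
  amounts-demand (taken a p)          = cong (a +_) (amounts-demand p)
  amounts-demand (paused p)           = amounts-demand p
  amounts-demand (beyond _ p)         = amounts-demand p

  allocation : ∀ {b t n r} {As : Vec (Agent t) n} {ms} → Serve b As ms r → Fin n → Fin t → ℕ
  allocation (serve s _ ps sv) zero    = amounts ps
  allocation (serve s _ ps sv) (suc i) = allocation sv i

  allocation-supply : ∀ {b t n r} {As : Vec (Agent t) n} {ms} (sv : Serve b As ms r) j →
                      ∑ (λ i → allocation sv i j) ≤ lookup ms j
  allocation-supply []                j = z≤n
  allocation-supply (serve s _ ps sv) j =
    ≤-trans (+-monoʳ-≤ (amounts ps j) (allocation-supply sv j)) (≤-reflexive (sym (amounts-supply ps j)))

  allocation-gap : ∀ {b t n r} {As : Vec (Agent t) n} {ms} (sv : Serve b As ms r) i j →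
                   lookup (Agent.gaps (lookup As i)) j ≡ true → allocation sv i j ≡ 0
  allocation-gap (serve s _ ps sv) zero    j = amounts-gap ps j
  allocation-gap (serve s _ ps sv) (suc i) j = allocation-gap sv i j

  allocation-worth : ∀ {b t n r} {As : Vec (Agent t) n} {ms} (sv : Serve b As ms r) →
    r ≤ ∑ (λ i → does (Agent.demand (lookup As i) ≤? ∑ (λ j → (toℕ j <ᵇ Agent.due (lookup As i)) ∙ allocation sv i j)) ∙ Agent.value (lookup As i))
  allocation-worth [] = z≤n
  allocation-worth (serve s {A = A} _ ps sv) = +-mono-≤ (first s ps) (allocation-worth sv)
    where
    first : ∀ s {ms ms′} (ps : Periods _ (Agent.due A) (chosen s (Agent.demand A)) ms (Agent.gaps A) ms′) →
      chosen s (Agent.value A) ≤ does (Agent.demand A ≤? ∑ (λ j → (toℕ j <ᵇ Agent.due A) ∙ amounts ps j)) ∙ Agent.value A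
    first false ps = z≤n
    first true  ps = holds (Agent.demand A ≤? ∑ (λ j → (toℕ j <ᵇ Agent.due A) ∙ amounts ps j)) (≤-reflexive (sym (amounts-demand ps)))
      where
      holds : ∀ {P : Set} (d : Dec P) → P → Agent.value A ≤ does d ∙ Agent.value A
      holds (yes _) p = ≤-refl
      holds (no ¬p) p = contradiction p ¬p

  periods-at-end : ∀ {b t d w} {ms : Vec ℕ t} {gs ms′} → Periods b d w ms gs ms′ → b ≡ true → d ≡ t
  periods-at-end end           e = refl
  periods-at-end (taken a p)   e = cong suc (periods-at-end p e)
  periods-at-end (paused p)    e = cong suc (periods-at-end p e)
  periods-at-end (beyond e′ p) e with () ← trans (sym e′) e

  serve-class : ∀ {t n r} {As : Vec (Agent t) n} {ms} → Serve true As ms r → ∀ i →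
                Agent.demand (lookup As i) ≤ 3 × Agent.due (lookup As i) ≡ t
  serve-class (serve s lim ps sv) zero    = lim refl , periods-at-end ps refl
  serve-class (serve s lim ps sv) (suc i) = serve-class sv i

  certified⇒class : ∀ b I → Certified b I → Class b I
  certified⇒class false I _            = tt
  certified⇒class true  I (_ , sv , _) = (λ i → proj₁ (serve-class sv i)) , (λ i → proj₂ (serve-class sv i))

  certified⇒achievable : ∀ b I → Certified b I → Achievable I
  certified⇒achievable b (I , V) (r , sv , V≤r) = integral⇒achievable I (allocation sv) (allocation-supply sv)
    (λ i j g → allocation-gap sv i j ([]=⇒lookup g))
    (ℤ.≤-trans V≤r (ℤ.+≤+ (allocation-worth sv)))

  periods-from : ∀ b {t} d (ms : Vec ℕ t) gs (row : Fin t → ℕ) → d ≤ t → (b ≡ true → d ≡ t) →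
    (∀ j → row j ≤ lookup ms j) → (∀ j → (toℕ j <ᵇ d) ∧ not (lookup gs j) ≡ false → row j ≡ 0) →
    ∃[ ms′ ] Periods b d (∑ row) ms gs ms′ × (∀ j → lookup ms j ≡ row j + lookup ms′ j)
  periods-from b zero    []       []       row _ at-end _ _ = [] , end , λ ()
  periods-from false zero (m ∷ ms) (g ∷ gs) row _ at-end fits blocked
    with periods-from false zero ms gs (row ∘ suc) z≤n (λ ()) (fits ∘ suc) (blocked ∘ suc)
  ... | ms′ , ps , eq rewrite blocked zero refl = m ∷ ms′ , beyond refl ps , λ { zero → cong (_+ m) (sym (blocked zero refl)) ; (suc j) → eq j }
  periods-from true zero (m ∷ ms) (g ∷ gs) row _ at-end fits blocked with () ← at-end refl
  periods-from b (suc d) (m ∷ ms) (true ∷ gs) row (s≤s d≤t) at-end fits blocked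
    with periods-from b d ms gs (row ∘ suc) d≤t (suc-injective ∘ at-end) (fits ∘ suc) (blocked ∘ suc)
  ... | ms′ , ps , eq rewrite blocked zero refl = m ∷ ms′ , paused ps , λ { zero → cong (_+ m) (sym (blocked zero refl)) ; (suc j) → eq j }
  periods-from b (suc d) (m ∷ ms) (false ∷ gs) row (s≤s d≤t) at-end fits blocked
    with periods-from b d ms gs (row ∘ suc) d≤t (suc-injective ∘ at-end) (fits ∘ suc) (blocked ∘ suc)
  ... | ms′ , ps , eq = m ∸ row zero ∷ ms′ ,
    subst (λ k → Periods b (suc d) (∑ row) (k ∷ ms) (false ∷ gs) (m ∸ row zero ∷ ms′)) (m+[n∸m]≡n (fits zero)) (taken (row zero) ps) ,
    λ { zero → sym (m+[n∸m]≡n (fits zero)) ; (suc j) → eq j }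

  serve-from : ∀ b {t n} (As : Vec (Agent t) n) (ms : Vec ℕ t) (sel : Fin n → Bool) (f : Fin n → Fin t → ℕ) →
    (b ≡ true → ∀ i → Agent.demand (lookup As i) ≤ 3 × Agent.due (lookup As i) ≡ t) →
    (∀ i → ∑ (f i) ≡ sel i ∙ Agent.demand (lookup As i)) →
    (∀ j → ∑ (λ i → f i j) ≤ lookup ms j) →
    (∀ i j → (toℕ j <ᵇ Agent.due (lookup As i)) ∧ not (lookup (Agent.gaps (lookup As i)) j) ≡ false → f i j ≡ 0) →
    Serve b As ms (∑ λ i → sel i ∙ Agent.value (lookup As i))
  serve-from b []       ms sel f cl rows cols blocked = []
  serve-from b (A ∷ As) ms sel f cl rows cols blocked
    with periods-from b (Agent.due A) ms (Agent.gaps A) (f zero) (toℕ<n (Agent.deadline A)) (λ e → proj₂ (cl e zero))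
           (λ j → ≤-trans (m≤m+n (f zero j) _) (cols j)) (blocked zero)
    where open import Data.Fin.Properties using (toℕ<n)
  ... | ms′ , ps , eq = serve (sel zero) (λ e → proj₁ (cl e zero))
    (subst (λ w → Periods b (Agent.due A) w ms (Agent.gaps A) ms′) (rows zero) ps)
    (serve-from b As ms′ (sel ∘ suc) (f ∘ suc) (λ e i → cl e (suc i)) (rows ∘ suc)
      (λ j → +-cancelˡ-≤ (f zero j) _ _ (≤-trans (cols j) (≤-reflexive (eq j)))) (blocked ∘ suc))

  achievable⇒certified : ∀ b I → Class b I → Achievable I → Certified b I
  achievable⇒certified b (I , V) cl ach = _ , serve-from b agents supply selected (Flow.flow F) (class b cl)
    (Flow.received F) (Flow.sent F) (Flow.along F) , worth
    where
    open Scheduling I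
    open Selection (achievable⇒selection I ach)
    usable : Fin n → Fin periods → Bool
    usable i j = (toℕ j <ᵇ Agent.due (agent i)) ∧ not (lookup (Agent.gaps (agent i)) j)
    open Transport usable
    w : Fin n → ℕ
    w i = selected i ∙ Agent.demand (agent i)
    class : ∀ b → Class b (I , V) → b ≡ true → ∀ i → Agent.demand (agent i) ≤ 3 × Agent.due (agent i) ≡ periods
    class true (p , q) _ i = p i , q i
    and-sel : ∀ a s x → (a ∧ s) ∙ x ≡ a ∙ (s ∙ x)
    and-sel true  s x = refl
    and-sel false s x = refl
    and-true : ∀ {a s} → a ∧ s ≡ true → a ≡ true × s ≡ true
    and-true {true} {true} _ = refl , refl
    covered : ∀ X i j → X i ∧ selected i ≡ true → (toℕ j <ᵇ Agent.due (agent i)) ≡ true →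
              neighbours X j ≡ true ⊎ j ∈ Agent.gaps (agent i)
    covered X i j s d with lookup (Agent.gaps (agent i)) j in g
    ... | true  = inj₂ (lookup⇒[]= j _ g)
    ... | false = inj₁ (neighbours-true X (proj₁ (and-true s)) (cong₂ (λ a b → a ∧ not b) d g))
    flow-cuts : Cuts w (lookup supply)
    flow-cuts X = ≤-trans (≤-reflexive (sym (N.sum-cong-≗ λ i → and-sel (X i) (selected i) (Agent.demand (agent i)))))
      (cuts (λ i → X i ∧ selected i) (λ i s → proj₂ (and-true {X i} s)) (neighbours X) (covered X))
    F : Flow w (lookup supply)
    F = route (∑ w) w (lookup supply) refl flow-cuts

  membership : ∀ b → InNP (language ChargeSchedulingWithGaps (Class b))
  membership b = guess⇒InNP _ (program b) cubic sound complete
    where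
    linear cubic : Poly
    linear = con 1 ⊕ (con 2 ⊗ var)
    cubic = (con 123 ⊗ linear) ⊗ (linear ⊗ linear)
    sound : ∀ x {h σ} → Run (program b) (x ∷ Vec.replicate 17 []) h σ → language ChargeSchedulingWithGaps (Class b) x
    sound x run = let I , e , c = program⁻ b run in I , e , certified⇒class b I c , certified⇒achievable b I c
    complete : ∀ x → language ChargeSchedulingWithGaps (Class b) x →
               ∃[ h ] ∃[ σ ] length h ≤ ⟦ cubic ⟧ (length x) × Run (program b) (x ∷ Vec.replicate 17 []) h σ
    complete _ (I , refl , cl , ach) =
      let σ , ⟪ h , l , r ⟫ = certified⇒run b I (achievable⇒certified b I cl ach) in h , σ , l , r

module CellularAutomata where

  open import Data.List.Membership.Propositional using (_∈_)
  open import Data.Fin.Base using (join; combine)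

  record Finite (A : Set) : Set where
    field
      card          : ℕ
      index         : A → Fin card
      element       : Fin card → A
      element-index : ∀ a → element (index a) ≡ a
      index-element : ∀ i → index (element i) ≡ i

    infix 4 _≟_
    opaque
      _≟_ : DecidableEquality A
      a ≟ b = map′ (λ e → trans (sym (element-index a)) (trans (cong element e) (element-index b))) (cong index)
                   (index a Fin.≟ index b)

    opaque
      elements : List A
      elements = List.tabulate element

      elements-unique : Unique elements
      elements-unique = Unique.tabulate⁺ λ {i} {j} e → trans (sym (index-element i)) (trans (cong index e) (index-element j))

      ∈-elements : ∀ a → a ∈ elements
      ∈-elements a = subst (_∈ elements) (element-index a) (∈-tabulate⁺ (index a))

  module _ where
    open Finite

    finite-Bool : Finite Bool
    finite-Bool = record
      { card = 2
      ; index = λ { false → zero ; true → suc zero }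
      ; element = λ { zero → false ; (suc zero) → true }
      ; element-index = λ { false → refl ; true → refl }
      ; index-element = λ { zero → refl ; (suc zero) → refl }
      }

    finite-Fin : ∀ n → Finite (Fin n)
    finite-Fin n = record { card = n ; index = λ i → i ; element = λ i → i ; element-index = λ _ → refl ; index-element = λ _ → refl }

    finite-Symbol : Finite Symbol
    finite-Symbol = record
      { card = 3
      ; index = λ { nothing → zero ; (just false) → suc zero ; (just true) → suc (suc zero) }
      ; element = λ { zero → nothing ; (suc zero) → just false ; (suc (suc zero)) → just true }
      ; element-index = λ { nothing → refl ; (just false) → refl ; (just true) → refl }
      ; index-element = λ { zero → refl ; (suc zero) → refl ; (suc (suc zero)) → refl }
      }

    finite-⊎ : ∀ {A B} → Finite A → Finite B → Finite (A ⊎ B)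
    finite-⊎ {A} {B} F G = record
      { card = card F + card G
      ; index = ix
      ; element = λ i → el (splitAt (card F) i)
      ; element-index = λ { (inj₁ a) → trans (cong el (splitAt-join (card F) (card G) (inj₁ (index F a)))) (cong inj₁ (element-index F a))
                          ; (inj₂ b) → trans (cong el (splitAt-join (card F) (card G) (inj₂ (index G b)))) (cong inj₂ (element-index G b)) }
      ; index-element = λ i → trans (ix-el (splitAt (card F) i)) (join-splitAt (card F) (card G) i)
      }
      where
      ix : A ⊎ B → Fin (card F + card G)
      ix (inj₁ a) = join (card F) (card G) (inj₁ (index F a))
      ix (inj₂ b) = join (card F) (card G) (inj₂ (index G b))
      el : Fin (card F) ⊎ Fin (card G) → A ⊎ B
      el (inj₁ i) = inj₁ (element F i)
      el (inj₂ j) = inj₂ (element G j)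
      ix-el : ∀ z → ix (el z) ≡ join (card F) (card G) z
      ix-el (inj₁ i) = cong (λ i → join (card F) (card G) (inj₁ i)) (index-element F i)
      ix-el (inj₂ j) = cong (λ j → join (card F) (card G) (inj₂ j)) (index-element G j)

    finite-× : ∀ {A B} → Finite A → Finite B → Finite (A × B)
    finite-× {A} {B} F G = record
      { card = card F * card G
      ; index = λ { (a , b) → combine (index F a) (index G b) }
      ; element = λ i → el (remQuot (card G) i)
      ; element-index = λ { (a , b) → trans (cong el (remQuot-combine (index F a) (index G b))) (cong₂ _,_ (element-index F a) (element-index G b)) }
      ; index-element = λ i → trans (cong₂ combine (index-element F _) (index-element G _)) (combine-remQuot {card F} (card G) i)
      }
      where
      el : Fin (card F) × Fin (card G) → A × B
      el (i , j) = element F i , element G j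

    finite-Vec : ∀ {A} → Finite A → ∀ n → Finite (Vec A n)
    finite-Vec F zero = record { card = 1 ; index = λ _ → zero ; element = λ _ → [] ; element-index = λ { [] → refl } ; index-element = λ { zero → refl } }
    finite-Vec {A} F (suc n) = record
      { card = card G
      ; index = index G ∘ uncons
      ; element = λ i → cons (element G i)
      ; element-index = λ { (a ∷ v) → cong cons (element-index G (a , v)) }
      ; index-element = index-element G
      }
      where
      G = finite-× F (finite-Vec F n)
      cons : A × Vec A n → Vec A (suc n)
      cons (a , v) = a ∷ v
      uncons : Vec A (suc n) → A × Vec A n
      uncons (a ∷ v) = a , v

  -- A cellular automaton whose cells also see cell 0 of their row. Cell 0 is
  -- marked, and does not see its left neighbour.
  record Automaton (Γ : Set) : Set where
    field
      marked : Γ → Bool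
      next   : Γ → Γ → Γ → Γ → Γ
      marked-next : ∀ k l s r → marked (next k l s r) ≡ marked s
      next-left   : ∀ k l l′ s r → marked s ≡ true → next k l s r ≡ next k l′ s r

    record Run : Set where
      field
        row       : ℕ → ℕ → Γ
        evolves   : ∀ s i → row (suc s) i ≡ next (row s 0) (row s (i ∸ 1)) (row s i) (row s (suc i))
        first     : marked (row 0 0) ≡ true
        others    : ∀ i → marked (row 0 (suc i)) ≡ false

      marked₀ : ∀ s → marked (row s 0) ≡ true
      marked₀ zero    = first
      marked₀ (suc s) = trans (cong marked (evolves s 0)) (trans (marked-next _ _ _ _) (marked₀ s))

      unmarked : ∀ s i → marked (row s (suc i)) ≡ false
      unmarked zero    i = others i
      unmarked (suc s) i = trans (cong marked (evolves s (suc i))) (trans (marked-next _ _ _ _) (unmarked s i))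

  -- A tile shows cell 0 of a row, a cell, and its two neighbours. The rows are
  -- laid out one after the other, so that tiles at distance W are on top of each
  -- other. The right end of a row is not constrained: an error that starts
  -- there moves by one cell per row.
  module Tiles {Γ : Set} (finite : Finite Γ) (A : Automaton Γ) where

    open Finite finite using (_≟_)
    open Automaton A

    Tile : Set
    Tile = (Γ × Γ) × (Γ × Γ)

    broad left mid right : Tile → Γ
    broad ((k , l) , (s , r)) = k
    left  ((k , l) , (s , r)) = l
    mid   ((k , l) , (s , r)) = s
    right ((k , l) , (s , r)) = r

    zeroth : Tile → Γ
    zeroth t = if marked (mid t) then mid t else broad t

    Beside Above : Tile → Tile → Set
    Beside t t′ = broad t′ ≡ zeroth t × left t′ ≡ mid t × mid t′ ≡ right t
    Above t t′ = mid t′ ≡ next (zeroth t) (left t) (mid t) (right t)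

    beside? : ∀ t t′ → Dec (Beside t t′)
    beside? t t′ = (broad t′ ≟ zeroth t) ×-dec ((left t′ ≟ mid t) ×-dec (mid t′ ≟ right t))

    beside above : Tile → Tile → Bool
    beside t t′ = marked (mid t′) ∨ does (beside? t t′)
    above t t′ = does (mid t′ ≟ next (zeroth t) (left t) (mid t) (right t))

    does-true : ∀ {P : Set} (d : Dec P) → does d ≡ true → P
    does-true (yes p) _ = p

    module _ (R : Run) where
      open Run R

      tile : ℕ → ℕ → Tile
      tile s i = (row s 0 , row s (i ∸ 1)) , (row s i , row s (suc i))

      zeroth-tile : ∀ s i → zeroth (tile s i) ≡ row s 0
      zeroth-tile s zero    rewrite marked₀ s    = refl
      zeroth-tile s (suc i) rewrite unmarked s i = refl

      beside-tile : ∀ s i → beside (tile s i) (tile s (suc i)) ≡ true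
      beside-tile s i = trans (cong (marked (row s (suc i)) ∨_) (dec-true (beside? (tile s i) (tile s (suc i))) (sym (zeroth-tile s i) , refl , refl))) (∨-zeroʳ (marked (row s (suc i))))

      beside-wrap : ∀ s i → beside (tile s i) (tile (suc s) 0) ≡ true
      beside-wrap s i rewrite marked₀ (suc s) = refl

      above-tile : ∀ s i → above (tile s i) (tile (suc s) i) ≡ true
      above-tile s i = dec-true (_ ≟ _) (trans (evolves s i) (cong (λ k → next k (row s (i ∸ 1)) (row s i) (row s (suc i))) (sym (zeroth-tile s i))))

      module Forced (W S : ℕ) (θ : ℕ → Tile)
        (bs : ∀ u → suc u < S * W → beside (θ u) (θ (suc u)) ≡ true)
        (ab : ∀ u → u + W < S * W → above (θ u) (θ (u + W)) ≡ true)
        (bottom : ∀ i → i < W → mid (θ i) ≡ row 0 i)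
        where

        private
          in-row : ∀ {s i} → s < S → i < W → s * W + i < S * W
          in-row {s} {i} s<S i<W = begin-strict
            s * W + i    <⟨ +-monoʳ-< (s * W) i<W ⟩
            s * W + W    ≡⟨ +-comm (s * W) W ⟩
            suc s * W    ≤⟨ *-monoˡ-≤ W s<S ⟩
            S * W        ∎
            where open ≤-Reasoning

          up : ∀ s i → s * W + i + W ≡ suc s * W + i
          up s i = trans (+-comm (s * W + i) W) (sym (+-assoc W (s * W) i))

          Right : ℕ → Set
          Right s = ∀ i → s + i < W → mid (θ (s * W + i)) ≡ row s i

          bound : ∀ s {i} → s + i < W → i < W
          bound s {i} l = ≤-<-trans (m≤n+m i s) l

          next-to : ∀ s → s < S → Right s → ∀ i → s + suc i < W → Beside (θ (s * W + i)) (θ (s * W + suc i))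
          next-to s s<S R i l = does-true (beside? t t′) (trans (cong (_∨ does (beside? t t′)) (sym unmarked′)) h)
            where
            t t′ : Tile
            t  = θ (s * W + i)
            t′ = θ (s * W + suc i)
            unmarked′ : marked (mid t′) ≡ false
            unmarked′ = trans (cong marked (R (suc i) l)) (unmarked s i)
            h : marked (mid t′) ∨ does (beside? t t′) ≡ true
            h = subst (λ u → beside t (θ u) ≡ true) (sym (+-suc (s * W) i))
                  (bs (s * W + i) (subst (_< S * W) (+-suc (s * W) i) (in-row s<S (bound s l))))

          zeroth-row : ∀ s → s < S → Right s → ∀ i → s + i < W → zeroth (θ (s * W + i)) ≡ row s 0
          zeroth-row s s<S R zero l with R zero l
          ... | e rewrite e | marked₀ s = refl
          zeroth-row s s<S R (suc i) l =
            trans (cong (λ b → if b then mid t′ else broad t′) (trans (cong marked (R (suc i) l)) (unmarked s i)))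
                  (trans (proj₁ (next-to s s<S R i l)) (zeroth-row s s<S R i (<⇒≤ (subst (_< W) (+-suc s i) l))))
            where
            t′ : Tile
            t′ = θ (s * W + suc i)

          right-row : ∀ s → s < S → Right s → ∀ i → s + suc i < W → right (θ (s * W + i)) ≡ row s (suc i)
          right-row s s<S R i l = trans (sym (proj₂ (proj₂ (next-to s s<S R i l)))) (R (suc i) l)

          next-row : ∀ s → s < S → Right s → ∀ i → s + suc i < W →
            next (zeroth (θ (s * W + i))) (left (θ (s * W + i))) (mid (θ (s * W + i))) (right (θ (s * W + i))) ≡ row (suc s) i
          next-row s s<S R i l
            rewrite zeroth-row s s<S R i (<⇒≤ (subst (_< W) (+-suc s i) l)) | R i (<⇒≤ (subst (_< W) (+-suc s i) l)) | right-row s s<S R i l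
            = trans (lefts i l) (sym (evolves s i))
            where
            lefts : ∀ i → s + suc i < W → next (row s 0) (left (θ (s * W + i))) (row s i) (row s (suc i))
                                        ≡ next (row s 0) (row s (i ∸ 1)) (row s i) (row s (suc i))
            lefts zero    l = next-left _ _ _ _ _ (marked₀ s)
            lefts (suc i) l = cong (λ z → next (row s 0) z (row s (suc i)) (row s (suc (suc i))))
              (trans (proj₁ (proj₂ (next-to s s<S R i l₁))) (R i (<⇒≤ (subst (_< W) (+-suc s i) l₁))))
              where
              l₁ : s + suc i < W
              l₁ = <⇒≤ (subst (_< W) (+-suc s (suc i)) l)

        forced : ∀ s → s < S → ∀ i → s + i < W → mid (θ (s * W + i)) ≡ row s i
        forced zero    s<S i l = bottom i l
        forced (suc s) s<S i l = trans (cong (mid ∘ θ) (sym (up s i)))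
          (trans (does-true (_ ≟ _) (ab (s * W + i) (subst (_< S * W) (sym (up s i)) (in-row s<S (bound (suc s) l)))))
                 (next-row s (<⇒≤ s<S) (forced s (<⇒≤ s<S)) i (subst (_< W) (sym (+-suc s i)) l)))

        forced-right : ∀ s → s < S → ∀ i → s + suc i < W → right (θ (s * W + i)) ≡ row s (suc i)
        forced-right s s<S = right-row s s<S (forced s s<S)

module MachineAutomata where

  open Defs using () renaming (step to stepᴹ; next to continue; left to go-left; right to go-right; stay to go-stay)
  open CellularAutomata

  nth : List Symbol → ℕ → Symbol
  nth []       _       = nothing
  nth (s ∷ l) zero    = s
  nth (s ∷ l) (suc j) = nth l j

  bit : Bits → ℕ → Symbol
  bit w = nth (List.map just w)

  cells : ℕ → Tape → Symbol × Symbol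
  cells j (tape l _ r) = nth l j , nth r j

  -- The cells after a move, given the cells one closer to the head and one
  -- further away.
  moved : Symbol × Move → (near same far : Symbol × Symbol) → Symbol × Symbol
  moved (_ , go-stay)  near same far = same
  moved (_ , go-left)  near same far = proj₁ far , proj₂ near
  moved (_ , go-right) near same far = proj₁ near , proj₂ far

  new-head : Symbol × Move → Symbol × Symbol → Symbol
  new-head (w , go-stay)  near = w
  new-head (w , go-left)  near = proj₁ near
  new-head (w , go-right) near = proj₂ near

  module Simulation (M : Machine 2) where
    open Machine M

    head-moved : ∀ a t → head (act M a t) ≡ new-head a (cells 0 t)
    head-moved (w , go-stay)  (tape l s r)             = refl
    head-moved (w , go-left)  (tape [] s r)            = refl
    head-moved (w , go-left)  (tape (_ ∷ _) s r)       = refl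
    head-moved (w , go-right) (tape l s [])            = refl
    head-moved (w , go-right) (tape l s (_ ∷ _))       = refl

    cells-moved₀ : ∀ a t → cells 0 (act M a t) ≡ moved a (proj₁ a , proj₁ a) (cells 0 t) (cells 1 t)
    cells-moved₀ (w , go-stay)  (tape l s r)             = refl
    cells-moved₀ (w , go-left)  (tape [] s r)            = refl
    cells-moved₀ (w , go-left)  (tape (_ ∷ _) s r)       = refl
    cells-moved₀ (w , go-right) (tape l s [])            = refl
    cells-moved₀ (w , go-right) (tape l s (_ ∷ _))       = refl

    cells-moved : ∀ a j t → cells (suc j) (act M a t) ≡ moved a (cells j t) (cells (suc j) t) (cells (suc (suc j)) t)
    cells-moved (w , go-stay)  j (tape l s r)             = refl
    cells-moved (w , go-left)  j (tape [] s r)            = refl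
    cells-moved (w , go-left)  j (tape (_ ∷ _) s r)       = refl
    cells-moved (w , go-right) j (tape l s [])            = refl
    cells-moved (w , go-right) j (tape l s (_ ∷ _))       = refl

    Heads Cells Γ : Set
    Heads = Fin states × Vec Symbol tapes
    Cells = Vec (Symbol × Symbol) tapes
    Γ = Heads ⊎ Cells

    opaque
      finite-Γ : Finite Γ
      finite-Γ = finite-⊎ (finite-× (finite-Fin states) (finite-Vec finite-Symbol tapes))
                          (finite-Vec (finite-× finite-Symbol finite-Symbol) tapes)

    open Finite finite-Γ using (_≟_)

    cells-of : Vec (Symbol × Move) tapes → Γ → Cells
    cells-of as (inj₁ _) = Vec.map (λ a → proj₁ a , proj₁ a) as
    cells-of as (inj₂ v) = v

    moves : ∀ {k} → Vec (Symbol × Move) k → (near same far : Vec (Symbol × Symbol) k) → Vec (Symbol × Symbol) k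
    moves []       []       []       []       = []
    moves (a ∷ as) (n ∷ ns) (h ∷ hs) (f ∷ fs) = moved a n h f ∷ moves as ns hs fs

    -- Cell 0 of a row holds the state and the scanned symbols, and cell j + 1
    -- the cells at distance j from them.
    update : Maybe (Fin states × Vec (Symbol × Move) tapes) → Γ → Γ → Γ → Γ
    update nothing         l s        r = s
    update (just (q , as)) l (inj₁ _) r = inj₁ (q , Vec.zipWith new-head as (cells-of as r))
    update (just (q , as)) l (inj₂ v) r = inj₂ (moves as (cells-of as l) v (cells-of as r))

    successor : Γ → Γ → Γ → Γ → Γ
    successor (inj₁ (q , σ)) l s r = update (δ q σ) l s r
    successor (inj₂ _)       l s r = s

    is-heads : Γ → Bool
    is-heads (inj₁ _) = true
    is-heads (inj₂ _) = false

    automaton : Automaton Γ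
    automaton = record { marked = is-heads ; next = successor ; marked-next = marks ; next-left = lefts }
      where
      marks : ∀ k l s r → is-heads (successor k l s r) ≡ is-heads s
      marks (inj₂ _) l s r = refl
      marks (inj₁ (q , σ)) l s r with δ q σ
      ... | nothing = refl
      marks (inj₁ (q , σ)) l (inj₁ _) r | just _ = refl
      marks (inj₁ (q , σ)) l (inj₂ _) r | just _ = refl
      lefts : ∀ k l l′ s r → is-heads s ≡ true → successor k l s r ≡ successor k l′ s r
      lefts (inj₂ _) l l′ s r _ = refl
      lefts (inj₁ (q , σ)) l l′ (inj₁ _) r _ with δ q σ
      ... | nothing = refl
      ... | just _  = refl

    configRow : Config M → ℕ → Γ
    configRow (config q ts) zero    = inj₁ (q , Vec.map head ts)
    configRow (config q ts) (suc j) = inj₂ (Vec.map (cells j) ts)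

    advance : Config M → Config M
    advance c = Maybe.maybe′ (λ d → d) c (stepᴹ M c)

    configRow-advance : ∀ c i → configRow (advance c) i ≡
      successor (configRow c 0) (configRow c (i ∸ 1)) (configRow c i) (configRow c (suc i))
    configRow-advance (config q ts) i with δ q (Vec.map head ts)
    ... | nothing = refl
    configRow-advance (config q ts) zero | just (q′ , as) = cong (λ v → inj₁ (q′ , v)) (go as ts)
      where
      go : ∀ {k} (as : Vec (Symbol × Move) k) ts → Vec.map head (Vec.zipWith (act M) as ts) ≡ Vec.zipWith new-head as (Vec.map (cells 0) ts)
      go []       []       = refl
      go (a ∷ as) (t ∷ ts) = cong₂ _∷_ (head-moved a t) (go as ts)
    configRow-advance (config q ts) (suc zero) | just (q′ , as) = cong inj₂ (go as ts)
      where
      go : ∀ {k} (as : Vec (Symbol × Move) k) ts → Vec.map (cells 0) (Vec.zipWith (act M) as ts) ≡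
           moves as (Vec.map (λ a → proj₁ a , proj₁ a) as) (Vec.map (cells 0) ts) (Vec.map (cells 1) ts)
      go []       []       = refl
      go (a ∷ as) (t ∷ ts) = cong₂ _∷_ (cells-moved₀ a t) (go as ts)
    configRow-advance (config q ts) (suc (suc j)) | just (q′ , as) = cong inj₂ (go as ts)
      where
      go : ∀ {k} (as : Vec (Symbol × Move) k) ts → Vec.map (cells (suc j)) (Vec.zipWith (act M) as ts) ≡
           moves as (Vec.map (cells j) ts) (Vec.map (cells (suc j)) ts) (Vec.map (cells (suc (suc j))) ts)
      go []       []       = refl
      go (a ∷ as) (t ∷ ts) = cong₂ _∷_ (cells-moved a j t) (go as ts)

    configAt : Config M → ℕ → Config M
    configAt c zero    = c
    configAt c (suc s) = advance (configAt c s)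

    configAt-advance : ∀ c s → configAt (advance c) s ≡ configAt c (suc s)
    configAt-advance c zero    = refl
    configAt-advance c (suc s) = cong advance (configAt-advance c s)

    halts⇒configAt : ∀ {t c d} → HaltsIn M t c d → ∀ s → t ≤ s → configAt c s ≡ d
    halts⇒configAt (halted e) zero    _ = refl
    halts⇒configAt {c = c} (halted e) (suc s) _ =
      trans (cong advance (halts⇒configAt (halted e) s z≤n)) (cong (Maybe.maybe′ (λ d → d) c) e)
    halts⇒configAt {c = c} (continue e h) (suc s) (s≤s t≤s) =
      trans (sym (configAt-advance c s)) (trans (cong (λ m → configAt (Maybe.maybe′ (λ d → d) c m) s) e) (halts⇒configAt h s t≤s))

    run : Config M → Automaton.Run automaton
    run c = record
      { row = λ s → configRow (configAt c s)
      ; evolves = λ s i → configRow-advance (configAt c s) i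
      ; first = refl
      ; others = λ _ → refl
      }

    input cert : Γ → Symbol
    input (inj₁ (_ , s ∷ _))       = s
    input (inj₂ ((_ , s) ∷ _))     = s
    cert (inj₁ (_ , _ ∷ s ∷ _))    = s
    cert (inj₂ (_ ∷ (_ , s) ∷ _))  = s

    initialCell : Bool → Symbol → Symbol → Γ
    initialCell true  a b = inj₁ (start , a ∷ b ∷ Vec.replicate (suc work) nothing)
    initialCell false a b = inj₂ ((nothing , a) ∷ (nothing , b) ∷ Vec.replicate (suc work) (nothing , nothing))

    isZero : ℕ → Bool
    isZero zero    = true
    isZero (suc _) = false

    initial-row : ∀ x c i → configRow (initial M (x ∷ c ∷ [])) i ≡ initialCell (isZero i) (bit x i) (bit c i)
    initial-row x c zero = cong₂ (λ a v → inj₁ (start , a ∷ v)) (top x) (cong₂ _∷_ (top c) (blanks (suc work)))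
      where
      top : ∀ w → head (load w) ≡ bit w 0
      top []      = refl
      top (_ ∷ _) = refl
      blanks : ∀ n → Vec.map head (Vec.replicate n blankTape) ≡ Vec.replicate n nothing
      blanks zero    = refl
      blanks (suc n) = cong (nothing ∷_) (blanks n)
    initial-row x c (suc j) = cong₂ (λ a v → inj₂ (a ∷ v)) (rest x) (cong₂ _∷_ (rest c) (blanks (suc work)))
      where
      rest : ∀ w → cells j (load w) ≡ (nothing , bit w (suc j))
      rest []      = refl
      rest (_ ∷ _) = refl
      blanks : ∀ n → Vec.map (cells j) (Vec.replicate n blankTape) ≡ Vec.replicate n (nothing , nothing)
      blanks zero    = refl
      blanks (suc n) = cong (_ ∷_) (blanks n)

    isInitial : Γ → Bool
    isInitial γ = does (γ ≟ initialCell (is-heads γ) (input γ) (cert γ))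

    isTrue isBlank : Symbol → Bool
    isTrue (just true) = true
    isTrue _           = false
    isBlank nothing  = true
    isBlank (just _) = false

    accepts : Γ → Γ → Bool
    accepts (inj₁ (_ , σ)) (inj₂ v) = isTrue (lookup σ (2 ↑ʳ zero)) ∧ isBlank (proj₂ (lookup v (2 ↑ʳ zero)))
    accepts _              _        = false

    accepts⇔output : ∀ c → (accepts (configRow c 0) (configRow c 1) ≡ true → output M c ≡ true ∷ []) ×
                            (output M c ≡ true ∷ [] → accepts (configRow c 0) (configRow c 1) ≡ true)
    accepts⇔output (config q ts)
      rewrite lookup-map {n = tapes} (2 ↑ʳ zero) head ts | lookup-map {n = tapes} (2 ↑ʳ zero) (cells 0) ts = go (lookup ts (2 ↑ʳ zero))
      where
      go : ∀ t → (isTrue (head t) ∧ isBlank (proj₂ (cells 0 t)) ≡ true → contents t ≡ true ∷ []) ×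
                 (contents t ≡ true ∷ [] → isTrue (head t) ∧ isBlank (proj₂ (cells 0 t)) ≡ true)
      go (tape l nothing r)                 = (λ ()) , λ ()
      go (tape l (just false) r)            = (λ ()) , λ ()
      go (tape l (just true) [])            = (λ _ → refl) , λ _ → refl
      go (tape l (just true) (nothing ∷ r)) = (λ _ → refl) , λ _ → refl
      go (tape l (just true) (just _ ∷ r))  = (λ ()) , λ ()

module TilingSystems where

  open MachineAutomata

  poly-mono : ∀ p {m n} → m ≤ n → ⟦ p ⟧ m ≤ ⟦ p ⟧ n
  poly-mono (con k) m≤n = ≤-refl
  poly-mono var     m≤n = m≤n
  poly-mono (p ⊕ q) m≤n = +-mono-≤ (poly-mono p m≤n) (poly-mono q m≤n)
  poly-mono (p ⊗ q) m≤n = *-mono-≤ (poly-mono p m≤n) (poly-mono q m≤n)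

  compose : Poly → Poly → Poly
  compose (con k) r = con k
  compose var     r = r
  compose (p ⊕ q) r = compose p r ⊕ compose q r
  compose (p ⊗ q) r = compose p r ⊗ compose q r

  compose-⟦⟧ : ∀ p r n → ⟦ compose p r ⟧ n ≡ ⟦ p ⟧ (⟦ r ⟧ n)
  compose-⟦⟧ (con k) r n = refl
  compose-⟦⟧ var     r n = refl
  compose-⟦⟧ (p ⊕ q) r n = cong₂ _+_ (compose-⟦⟧ p r n) (compose-⟦⟧ q r n)
  compose-⟦⟧ (p ⊗ q) r n = cong₂ _*_ (compose-⟦⟧ p r n) (compose-⟦⟧ q r n)

  -- Words that are easy to print for a given input.
  data Piece : Set where
    times   : Poly → Bool → Piece
    onInput : (Bool → Bool) → Piece

  piece : Piece → Bits → Bits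
  piece (times p b)  x = replicate (⟦ p ⟧ (length x)) b
  piece (onInput f)  x = map f x

  Word : Set
  Word = List Piece

  word : Word → Bits → Bits
  word ps x = concatMap (λ p → piece p x) ps

  at : Bits → ℕ → Bool
  at []      _       = false
  at (b ∷ w) zero    = b
  at (b ∷ w) (suc i) = at w i

  record TilingSystem : Set where
    field
      tiles  : ℕ
      H V    : Fin tiles → Fin tiles → Bool
      time   : Poly
      extra  : Poly
      signs  : Fin 5 → Fin tiles → Word

    height : Poly
    height = con 1 ⊕ time

    width : Poly
    width = con 1 ⊕ extra

    area : ℕ → ℕ
    area n = ⟦ height ⟧ n * ⟦ width ⟧ n

    field
      signs-length : ∀ j a x → length (word (signs j a) x) ≡ area (length x) + ⟦ width ⟧ (length x)

    record Solution (x : Bits) (θ : ℕ → Fin tiles) : Set where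
      field
        horizontal : ∀ u → suc u < area (length x) → H (θ u) (θ (suc u)) ≡ true
        vertical   : ∀ u → u + ⟦ width ⟧ (length x) < area (length x) → V (θ u) (θ (u + ⟦ width ⟧ (length x))) ≡ true
        signed     : ∀ j u → u < area (length x) → at (word (signs j (θ u)) x) u ≡ true

  at-++ˡ : ∀ u v {i} → i < length u → at (u ++ v) i ≡ at u i
  at-++ˡ (b ∷ u) v {zero}  _       = refl
  at-++ˡ (b ∷ u) v {suc i} (s≤s l) = at-++ˡ u v l

  at-++ʳ : ∀ u v i → at (u ++ v) (length u + i) ≡ at v i
  at-++ʳ []      v i = refl
  at-++ʳ (b ∷ u) v i = at-++ʳ u v i

  at-replicate : ∀ n b {i} → i < n → at (replicate n b) i ≡ b
  at-replicate (suc n) b {zero}  _       = refl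
  at-replicate (suc n) b {suc i} (s≤s l) = at-replicate n b l

  at-map : ∀ f x {i} b → bit x i ≡ just b → at (map f x) i ≡ f b
  at-map f (b ∷ x) {zero}  _ refl = refl
  at-map f (b ∷ x) {suc i} c e    = at-map f x c e

  bit-just : ∀ x {i} → i < length x → ∃[ b ] bit x i ≡ just b
  bit-just (b ∷ x) {zero}  _       = b , refl
  bit-just (b ∷ x) {suc i} (s≤s l) = bit-just x l

  bit-nothing : ∀ x {i} → length x ≤ i → bit x i ≡ nothing
  bit-nothing []      _       = refl
  bit-nothing (b ∷ x) (s≤s l) = bit-nothing x l

module CookLevinTilings where

  open CellularAutomata
  open MachineAutomata
  open TilingSystems

  prefix : ℕ → (ℕ → Symbol) → Bits
  prefix zero    g = []
  prefix (suc k) g with g 0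
  ... | nothing = []
  ... | just b  = b ∷ prefix k (g ∘ suc)

  length-prefix : ∀ k g → length (prefix k g) ≤ k
  length-prefix zero    g = z≤n
  length-prefix (suc k) g with g 0
  ... | nothing = z≤n
  ... | just b  = s≤s (length-prefix k (g ∘ suc))

  bit-prefix : ∀ k g W → (∀ i → suc i < W → g i ≡ nothing → g (suc i) ≡ nothing) → (∀ i → k ≤ i → i < W → g i ≡ nothing) →
               ∀ i → i < W → bit (prefix k g) i ≡ g i
  bit-prefix zero    g W mono beyond i i<W = sym (beyond i z≤n i<W)
  bit-prefix (suc k) g W mono beyond i i<W with g 0 in e
  ... | nothing = sym (blank i i<W)
    where
    blank : ∀ i → i < W → g i ≡ nothing
    blank zero    _ = e
    blank (suc i) l = mono i l (blank i (<⇒≤ l))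
  bit-prefix (suc k) g W mono beyond zero i<W | just b = sym e
  bit-prefix (suc k) g (suc W) mono beyond (suc i) (s≤s i<W) | just b =
    bit-prefix k (g ∘ suc) W (λ i l → mono (suc i) (s≤s l)) (λ i l l′ → beyond (suc i) (s≤s l) (s≤s l′)) i i<W

  module Position (w : ℕ) where

    W : ℕ
    W = suc w

    row-of col-of : ℕ → ℕ
    row-of u = u / W
    col-of u = u % W

    position : ∀ u → u ≡ row-of u * W + col-of u
    position u = trans (m≡m%n+[m/n]*n u W) (+-comm (u % W) (u / W * W))

    row-unique : ∀ s {i} → i < W → row-of (s * W + i) ≡ s
    row-unique s {i} l = trans (cong (_/ W) (+-comm (s * W) i))
      (trans (+-distrib-/-∣ʳ i (divides-refl s)) (cong₂ _+_ (m<n⇒m/n≡0 l) (m*n/n≡m s W)))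

    col-unique : ∀ s {i} → i < W → col-of (s * W + i) ≡ i
    col-unique s {i} l = trans (cong (_% W) (+-comm (s * W) i)) (trans ([m+kn]%n≡m%n i s W) (m<n⇒m%n≡m l))

  module CookLevin (M : Machine 2) (pt pc : Poly) where

    open Machine M
    open Simulation M
    open Tiles finite-Γ automaton

    opaque
      finite-Tile : Finite Tile
      finite-Tile = finite-× (finite-× finite-Γ finite-Γ) (finite-× finite-Γ finite-Γ)

    open Finite finite-Tile using (card; index; element; element-index)

    time extra width height : Poly
    time   = compose pt (var ⊕ pc)
    extra  = var ⊕ (pc ⊕ (con 1 ⊕ time))
    width  = con 1 ⊕ extra
    height = con 1 ⊕ time

    sameBit : Symbol → Bool → Bool
    sameBit (just true)  b = b
    sameBit (just false) b = not b
    sameBit nothing      b = false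

    certOk : Tile → Bool
    certOk t = not (isBlank (cert (mid t))) ∨ isBlank (cert (right t))

    onBottom : Piece → Piece → Word
    onBottom p q = p ∷ q ∷ times (height ⊗ width) true ∷ []

    -- The marked cell, the input, the length of the certificate, the rest of the
    -- bottom row, and the acceptance at the start of the top row.
    sign : Fin 5 → Tile → Word
    sign zero t = onBottom (times (con 1) (is-heads (mid t))) (times extra (not (is-heads (mid t))))
    sign (suc zero) t =
      onBottom (onInput (sameBit (input (mid t)))) (times (con 1 ⊕ (pc ⊕ (con 1 ⊕ time))) (isBlank (input (mid t))))
    sign (suc (suc zero)) t =
      onBottom (times pc true) (times (con 1 ⊕ (var ⊕ (con 1 ⊕ time))) (isBlank (cert (mid t))))
    sign (suc (suc (suc zero))) t =
      onBottom (times width (isInitial (mid t) ∧ certOk t)) (times (con 0) true)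
    sign (suc (suc (suc (suc zero)))) t =
      times (time ⊗ width) true ∷ times (con 1) (accepts (mid t) (right t)) ∷ times extra true ∷ times width true ∷ []

    module Sizes (x : Bits) where

      n τ e k U : ℕ
      n = length x
      τ = ⟦ time ⟧ n
      e = ⟦ extra ⟧ n
      k = ⟦ pc ⟧ n
      U = suc τ * suc e

      e₁ e₂ : ℕ
      e₁ = suc (k + suc τ)
      e₂ = suc (n + suc τ)

      width₁ : n + e₁ ≡ suc e
      width₁ = arith n k τ
        where
        arith : ∀ n k τ → n + suc (k + suc τ) ≡ suc (n + (k + suc τ))
        arith = solve-∀

      width₂ : k + e₂ ≡ suc e
      width₂ = arith n k τ
        where
        arith : ∀ n k τ → k + suc (n + suc τ) ≡ suc (n + (k + suc τ))
        arith = solve-∀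

      Fills : Piece → Piece → Set
      Fills p q = length (piece p x) + length (piece q x) ≡ suc e

      word-onBottom : ∀ p q → word (onBottom p q) x ≡ (piece p x ++ piece q x) ++ replicate U true
      word-onBottom p q = trans (cong (λ z → piece p x ++ piece q x ++ z) (++-identityʳ (replicate U true)))
                                (sym (++-assoc (piece p x) (piece q x) (replicate U true)))

      length-pieces : ∀ p q → Fills p q → length (piece p x ++ piece q x) ≡ suc e
      length-pieces p q fills = trans (length-++ (piece p x)) fills

      length-onBottom : ∀ p q → Fills p q → length (word (onBottom p q) x) ≡ U + suc e
      length-onBottom p q fills = trans (cong length (word-onBottom p q)) (trans (length-++ (piece p x ++ piece q x))
        (trans (cong₂ _+_ (length-pieces p q fills) (length-replicate U)) (+-comm (suc e) U)))

      at-onBottom : ∀ p q → Fills p q → ∀ {u} → u < suc e → at (word (onBottom p q) x) u ≡ at (piece p x ++ piece q x) u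
      at-onBottom p q fills {u} l = trans (cong (λ w → at w u) (word-onBottom p q))
        (at-++ˡ (piece p x ++ piece q x) (replicate U true) (subst (u <_) (sym (length-pieces p q fills)) l))

      at-onBottom-above : ∀ p q → Fills p q → ∀ {u} → suc e ≤ u → u < U → at (word (onBottom p q) x) u ≡ true
      at-onBottom-above p q fills {u} l l′ = trans (cong₂ at (word-onBottom p q) (sym (m+[n∸m]≡n l)))
        (trans (cong (λ z → at ((piece p x ++ piece q x) ++ replicate U true) (z + (u ∸ suc e))) (sym (length-pieces p q fills)))
          (trans (at-++ʳ (piece p x ++ piece q x) (replicate U true) (u ∸ suc e)) (at-replicate U true (≤-<-trans (m∸n≤m u (suc e)) l′))))

      fills₀ : ∀ b b′ → Fills (times (con 1) b) (times extra b′)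
      fills₀ b b′ = cong suc (length-replicate e)

      fills₁ : ∀ f b → Fills (onInput f) (times (con 1 ⊕ (pc ⊕ (con 1 ⊕ time))) b)
      fills₁ f b = trans (cong₂ _+_ (length-map f x) (length-replicate e₁)) width₁

      fills₂ : ∀ b b′ → Fills (times pc b) (times (con 1 ⊕ (var ⊕ (con 1 ⊕ time))) b′)
      fills₂ b b′ = trans (cong₂ _+_ (length-replicate k) (length-replicate e₂)) width₂

      fills₃ : ∀ b b′ → Fills (times width b) (times (con 0) b′)
      fills₃ b b′ = trans (+-identityʳ _) (length-replicate (suc e))

      sign-length : ∀ j t → length (word (sign j t) x) ≡ U + suc e
      sign-length zero t = length-onBottom (times (con 1) (is-heads (mid (t)))) (times extra (not (is-heads (mid (t))))) (fills₀ (is-heads (mid (t))) (not (is-heads (mid (t)))))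
      sign-length (suc zero) t = length-onBottom (onInput _) (times (con 1 ⊕ (pc ⊕ (con 1 ⊕ time))) _) (fills₁ _ _)
      sign-length (suc (suc zero)) t = length-onBottom (times pc _) (times (con 1 ⊕ (var ⊕ (con 1 ⊕ time))) _) (fills₂ _ _)
      sign-length (suc (suc (suc zero))) t = length-onBottom (times width _) (times (con 0) true) (fills₃ _ true)
      sign-length (suc (suc (suc (suc zero)))) t = trans (length-++ (replicate (τ * suc e) true))
        (trans (cong₂ _+_ (length-replicate (τ * suc e)) (cong suc (trans (length-++ (replicate e true))
          (cong₂ _+_ (length-replicate e) (trans (cong length (++-identityʳ (replicate (suc e) true))) (length-replicate (suc e)))))))
          (arith τ e))
        where
        arith : ∀ τ e → τ * suc e + suc (e + suc e) ≡ suc τ * suc e + suc e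
        arith = solve-∀

    system : TilingSystem
    system = record
      { tiles = card
      ; H = λ a b → beside (element a) (element b)
      ; V = λ a b → above (element a) (element b)
      ; time = time
      ; extra = extra
      ; signs = λ j a → sign j (element a)
      ; signs-length = λ j a x → Sizes.sign-length x j (element a)
      }

    blank? : ∀ s → isBlank s ≡ true → s ≡ nothing
    blank? nothing _ = refl

    same? : ∀ s b → sameBit s b ≡ true → s ≡ just b
    same? (just true)  true  _ = refl
    same? (just false) false _ = refl

    module _ (x : Bits) where

      open Sizes x
      open Position e

      τ+1<W : suc τ < W
      τ+1<W = s≤s (≤-trans (m≤n+m (suc τ) k) (m≤n+m (k + suc τ) n))

      top<U : τ * W < U
      top<U = *-monoˡ-< W (n<1+n τ)

      module Painted (c : Bits) (short : length c ≤ k)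
        (accepted : output M (configAt (initial M (x ∷ c ∷ [])) τ) ≡ true ∷ []) where

        R : Automaton.Run automaton
        R = run (initial M (x ∷ c ∷ []))

        tileAt : ℕ → Tile
        tileAt u = tile R (row-of u) (col-of u)

        tileAt-position : ∀ s {i} → i < W → tileAt (s * W + i) ≡ tile R s i
        tileAt-position s l = cong₂ (tile R) (row-unique s l) (col-unique s l)

        beside-tileAt : ∀ u → beside (tileAt u) (tileAt (suc u)) ≡ true
        beside-tileAt u with suc (col-of u) <? W
        ... | yes l = subst (λ t → beside (tileAt u) t ≡ true)
          (sym (trans (cong tileAt (trans (cong suc (position u)) (sym (+-suc (row-of u * W) (col-of u))))) (tileAt-position (row-of u) l)))
          (beside-tile R (row-of u) (col-of u))
        ... | no ¬l = subst (λ t → beside (tileAt u) t ≡ true)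
          (sym (trans (cong tileAt (trans (cong suc (position u)) wrap)) (tileAt-position (suc (row-of u)) {0} (s≤s z≤n))))
          (beside-wrap R (row-of u) (col-of u))
          where
          last : suc (col-of u) ≡ W
          last = ≤-antisym (m%n<n u W) (≮⇒≥ ¬l)
          wrap : suc (row-of u * W + col-of u) ≡ suc (row-of u) * W + 0
          wrap = trans (sym (+-suc (row-of u * W) (col-of u))) (trans (cong (row-of u * W +_) last)
                   (trans (+-comm (row-of u * W) W) (sym (+-identityʳ _))))

        above-tileAt : ∀ u → above (tileAt u) (tileAt (u + W)) ≡ true
        above-tileAt u = subst (λ t → above (tileAt u) t ≡ true)
          (sym (trans (cong tileAt up) (tileAt-position (suc (row-of u)) (m%n<n u W))))
          (above-tile R (row-of u) (col-of u))
          where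
          up : u + W ≡ suc (row-of u) * W + col-of u
          up = trans (cong (_+ W) (position u)) (trans (+-comm _ W) (sym (+-assoc W (row-of u * W) (col-of u))))

        bottom-tile : ∀ {u} → u < W → tileAt u ≡ tile R 0 u
        bottom-tile l = tileAt-position 0 l

        bottom-mid : ∀ {u} → u < W → mid (tileAt u) ≡ initialCell (isZero u) (bit x u) (bit c u)
        bottom-mid {u} l = trans (cong mid (bottom-tile l)) (initial-row x c u)

        input-initial : ∀ z a b → input (initialCell z a b) ≡ a
        input-initial true  a b = refl
        input-initial false a b = refl

        cert-initial : ∀ z a b → cert (initialCell z a b) ≡ b
        cert-initial true  a b = refl
        cert-initial false a b = refl

        heads-initial : ∀ z a b → is-heads (initialCell z a b) ≡ z
        heads-initial true  a b = refl
        heads-initial false a b = refl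

        bit-mono : ∀ w i → not (isBlank (bit w i)) ∨ isBlank (bit w (suc i)) ≡ true
        bit-mono []      i       = refl
        bit-mono (b ∷ w) zero    = refl
        bit-mono (b ∷ w) (suc i) = bit-mono w i

        signed : ∀ j u → u < U → at (word (sign j (tileAt u)) x) u ≡ true
        signed zero u l with u <? W
        ... | no ¬l = at-onBottom-above (times (con 1) (is-heads (mid (tileAt u)))) (times extra (not (is-heads (mid (tileAt u))))) (fills₀ (is-heads (mid (tileAt u))) (not (is-heads (mid (tileAt u))))) (≮⇒≥ ¬l) l
        ... | yes l′ = trans (at-onBottom (times (con 1) (is-heads (mid (tileAt u)))) (times extra (not (is-heads (mid (tileAt u))))) (fills₀ (is-heads (mid (tileAt u))) (not (is-heads (mid (tileAt u))))) l′)
            (go u l′ (trans (cong is-heads (bottom-mid l′)) (heads-initial (isZero u) _ _)))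
          where
          go : ∀ u {b} → u < W → b ≡ isZero u → at (b ∷ replicate e (not b)) u ≡ true
          go zero    l       refl = refl
          go (suc u) (s≤s l) refl = at-replicate e true l
        signed (suc zero) u l with u <? W
        ... | no ¬l = at-onBottom-above (onInput _) (times (con 1 ⊕ (pc ⊕ (con 1 ⊕ time))) _) (fills₁ _ _) (≮⇒≥ ¬l) l
        ... | yes l′ = trans (at-onBottom (onInput _) (times (con 1 ⊕ (pc ⊕ (con 1 ⊕ time))) _) (fills₁ _ _) l′)
            (go (input (mid (tileAt u))) (trans (cong input (bottom-mid l′)) (input-initial (isZero u) _ _)))
          where
          same : ∀ b → sameBit (just b) b ≡ true
          same true  = refl
          same false = refl
          go : ∀ s → s ≡ bit x u → at (map (sameBit s) x ++ replicate e₁ (isBlank s)) u ≡ true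
          go s refl with u <? n
          ... | yes u<n = let b , eq = bit-just x u<n in
            trans (at-++ˡ (map (sameBit (bit x u)) x) _ (subst (u <_) (sym (length-map _ x)) u<n))
                  (trans (at-map _ x b eq) (trans (cong (λ s → sameBit s b) eq) (same b)))
          ... | no u≮n = trans (cong₂ at (cong (λ s → map (sameBit s) x ++ replicate e₁ (isBlank s)) (bit-nothing x (≮⇒≥ u≮n)))
                    (trans (sym (m+[n∸m]≡n (≮⇒≥ u≮n))) (cong (_+ (u ∸ n)) (sym (length-map (sameBit nothing) x)))))
              (trans (at-++ʳ (map (sameBit nothing) x) (replicate e₁ true) (u ∸ n))
                (at-replicate e₁ true (+-cancelˡ-< n _ _ (subst₂ _<_ (sym (m+[n∸m]≡n (≮⇒≥ u≮n))) (sym width₁) l′))))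
        signed (suc (suc zero)) u l with u <? W
        ... | no ¬l = at-onBottom-above (times pc true) (times (con 1 ⊕ (var ⊕ (con 1 ⊕ time))) _) (fills₂ _ _) (≮⇒≥ ¬l) l
        ... | yes l′ = trans (at-onBottom (times pc true) (times (con 1 ⊕ (var ⊕ (con 1 ⊕ time))) _) (fills₂ _ _) l′)
            (go (cert (mid (tileAt u))) (trans (cong cert (bottom-mid l′)) (cert-initial (isZero u) _ _)))
          where
          go : ∀ s → s ≡ bit c u → at (replicate k true ++ replicate e₂ (isBlank s)) u ≡ true
          go s refl with u <? k
          ... | yes u<k = trans (at-++ˡ (replicate k true) _ (subst (u <_) (sym (length-replicate k)) u<k)) (at-replicate k true u<k)
          ... | no u≮k = trans (cong₂ (λ s j → at (replicate k true ++ replicate e₂ (isBlank s)) j) (bit-nothing c (≤-trans short (≮⇒≥ u≮k)))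
                    (trans (sym (m+[n∸m]≡n (≮⇒≥ u≮k))) (cong (_+ (u ∸ k)) (sym (length-replicate k {x = true})))))
              (trans (at-++ʳ (replicate k true) (replicate e₂ true) (u ∸ k))
                (at-replicate e₂ true (+-cancelˡ-< k _ _ (subst₂ _<_ (sym (m+[n∸m]≡n (≮⇒≥ u≮k))) (sym width₂) l′))))
        signed (suc (suc (suc zero))) u l with u <? W
        ... | no ¬l = at-onBottom-above (times width _) (times (con 0) true) (fills₃ _ true) (≮⇒≥ ¬l) l
        ... | yes l′ = trans (at-onBottom (times width _) (times (con 0) true) (fills₃ _ true) l′)
            (trans (cong (λ w → at w u) (++-identityʳ (replicate W _))) (trans (at-replicate W _ l′) (cong₂ _∧_ proper ordered)))
          where
          proper : isInitial (mid (tileAt u)) ≡ true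
          proper rewrite bottom-mid l′ = dec-true (_ ≟ᵍ _) (sym (cong₃ (heads-initial z a b) (input-initial z a b) (cert-initial z a b)))
            where
            open Finite finite-Γ renaming (_≟_ to _≟ᵍ_)
            z = isZero u
            a = bit x u
            b = bit c u
            cong₃ : ∀ {z z′ a a′ b b′} → z ≡ z′ → a ≡ a′ → b ≡ b′ → initialCell z a b ≡ initialCell z′ a′ b′
            cong₃ refl refl refl = refl
          ordered : certOk (tileAt u) ≡ true
          ordered = trans (cong certOk (bottom-tile l′)) (trans (cong₂ (λ s s′ → not (isBlank s) ∨ isBlank s′)
            (trans (cong cert (initial-row x c u)) (cert-initial (isZero u) _ _)) (trans (cong cert (initial-row x c (suc u))) (cert-initial false (bit x (suc u)) (bit c (suc u)))))
            (bit-mono c u))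
        signed (suc (suc (suc (suc zero)))) u l with u <? τ * W
        ... | yes l′ = trans (at-++ˡ (replicate (τ * W) true) _ (subst (u <_) (sym (length-replicate (τ * W))) l′)) (at-replicate (τ * W) true l′)
        ... | no ¬l = trans (cong (λ j → at (replicate (τ * W) true ++ accepts (mid (tileAt u)) (right (tileAt u)) ∷ true-tail) j) split)
            (trans (at-++ʳ (replicate (τ * W) true) _ (u ∸ τ * W)) (go (u ∸ τ * W) {tileAt u} j<W (cong tileAt (sym (m+[n∸m]≡n (≮⇒≥ ¬l))))))
          where
          true-tail = replicate e true ++ replicate W true ++ []
          split : u ≡ length (replicate (τ * W) true) + (u ∸ τ * W)
          split = trans (sym (m+[n∸m]≡n (≮⇒≥ ¬l))) (cong (_+ (u ∸ τ * W)) (sym (length-replicate (τ * W))))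
          j<W : u ∸ τ * W < W
          j<W = +-cancelˡ-< (τ * W) _ _ (subst₂ _<_ (sym (m+[n∸m]≡n (≮⇒≥ ¬l))) (+-comm W (τ * W)) l)
          go : ∀ j {t} → j < W → t ≡ tileAt (τ * W + j) → at (accepts (mid t) (right t) ∷ true-tail) j ≡ true
          go zero    l refl = trans (cong (λ t → accepts (mid t) (right t)) (tileAt-position τ {0} (s≤s z≤n))) (proj₂ (accepts⇔output (configAt (initial M (x ∷ c ∷ [])) τ)) accepted)
          go (suc j) (s≤s l) _ = trans (at-++ˡ (replicate e true) _ (subst (j <_) (sym (length-replicate e)) l)) (at-replicate e true l)

        solution : TilingSystem.Solution system x (index ∘ tileAt)
        solution = record
          { horizontal = λ u _ → trans (cong₂ beside (element-index (tileAt u)) (element-index (tileAt (suc u)))) (beside-tileAt u)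
          ; vertical   = λ u _ → trans (cong₂ above (element-index (tileAt u)) (element-index (tileAt (u + W)))) (above-tileAt u)
          ; signed     = λ j u l → trans (cong (λ t → at (word (sign j t) x) u) (element-index (tileAt u))) (signed j u l)
          }

      module Read (θ : ℕ → Fin card) (sol : TilingSystem.Solution system x θ) where

        open TilingSystem.Solution sol renaming (signed to signedᶿ)

        t : ℕ → Tile
        t u = element (θ u)

        W≤U : W ≤ U
        W≤U = m≤m+n W (τ * W)

        sign-at : ∀ j u → u < W → at (word (sign j (t u)) x) u ≡ true
        sign-at j u l = signedᶿ j u (<-≤-trans l W≤U)

        heads-at : ∀ u → u < W → is-heads (mid (t u)) ≡ isZero u
        heads-at u l = go u l (trans (sym (at-onBottom (times (con 1) (is-heads (mid (t u)))) (times extra (not (is-heads (mid (t u))))) (fills₀ (is-heads (mid (t u))) (not (is-heads (mid (t u))))) l)) (sign-at zero u l))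
          where
          go : ∀ u {b} → u < W → at (b ∷ replicate e (not b)) u ≡ true → b ≡ isZero u
          go zero    l       h = h
          go (suc u) {b} (s≤s l) h with b | trans (sym (at-replicate e (not b) l)) h
          ... | false | _ = refl

        input-at : ∀ u → u < W → input (mid (t u)) ≡ bit x u
        input-at u l = go (input (mid (t u)))
            (trans (sym (at-onBottom (onInput _) (times (con 1 ⊕ (pc ⊕ (con 1 ⊕ time))) _) (fills₁ _ _) l)) (sign-at (suc zero) u l))
          where
          go : ∀ s → at (map (sameBit s) x ++ replicate e₁ (isBlank s)) u ≡ true → s ≡ bit x u
          go s h with u <? n
          ... | yes u<n = let b , eq = bit-just x u<n in trans (same? s b
            (trans (sym (at-map (sameBit s) x b eq)) (trans (sym (at-++ˡ (map (sameBit s) x) _ (subst (u <_) (sym (length-map _ x)) u<n))) h))) (sym eq)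
          ... | no u≮n = trans (blank? s (trans (sym (at-replicate e₁ (isBlank s) (+-cancelˡ-< n _ _ (subst₂ _<_ (sym (m+[n∸m]≡n (≮⇒≥ u≮n))) (sym width₁) l))))
              (trans (sym (at-++ʳ (map (sameBit s) x) _ (u ∸ n)))
                (trans (cong (at (map (sameBit s) x ++ replicate e₁ (isBlank s))) (trans (cong (_+ (u ∸ n)) (length-map (sameBit s) x)) (m+[n∸m]≡n (≮⇒≥ u≮n)))) h))))
              (sym (bit-nothing x (≮⇒≥ u≮n)))

        guessed : ℕ → Symbol
        guessed u = cert (mid (t u))

        guessed-short : ∀ u → k ≤ u → u < W → guessed u ≡ nothing
        guessed-short u k≤u l = blank? _ (trans (sym (at-replicate e₂ (isBlank (guessed u)) (+-cancelˡ-< k _ _ (subst₂ _<_ (sym (m+[n∸m]≡n k≤u)) (sym width₂) l))))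
              (trans (sym (at-++ʳ (replicate k true) _ (u ∸ k)))
                (trans (cong (at (replicate k true ++ replicate e₂ (isBlank (guessed u)))) (trans (cong (_+ (u ∸ k)) (length-replicate k)) (m+[n∸m]≡n k≤u)))
                  (trans (sym (at-onBottom (times pc true) (times (con 1 ⊕ (var ⊕ (con 1 ⊕ time))) _) (fills₂ _ _) l)) (sign-at (suc (suc zero)) u l)))))

        bottom-sign : ∀ u → u < W → isInitial (mid (t u)) ∧ certOk (t u) ≡ true
        bottom-sign u l = trans (sym (at-replicate W _ l)) (trans (cong (λ w → at w u) (sym (++-identityʳ (replicate W _))))
          (trans (sym (at-onBottom (times width _) (times (con 0) true) (fills₃ _ true) l)) (sign-at (suc (suc (suc zero))) u l)))

        and-true : ∀ {a b} → a ∧ b ≡ true → a ≡ true × b ≡ true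
        and-true {true} {true} _ = refl , refl

        mid-at : ∀ u → u < W → mid (t u) ≡ initialCell (isZero u) (bit x u) (guessed u)
        mid-at u l = trans (does-true (_ ≟ᵍ _) (proj₁ (and-true (bottom-sign u l))))
            (cong₂ (λ z a → initialCell z a (guessed u)) (heads-at u l) (input-at u l))
          where open Finite finite-Γ renaming (_≟_ to _≟ᵍ_)

        guessed-ordered : ∀ u → suc u < W → guessed u ≡ nothing → guessed (suc u) ≡ nothing
        guessed-ordered u l blank = blank? _ (trans (cong (isBlank ∘ cert) same-cell)
            (trans (sym (cong (λ s → not (isBlank s) ∨ isBlank (cert (right (t u)))) blank)) (proj₂ (and-true (bottom-sign u (<⇒≤ l))))))
          where
          same-cell : mid (t (suc u)) ≡ right (t u)
          same-cell = proj₂ (proj₂ (does-true (beside? (t u) (t (suc u)))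
            (trans (cong (_∨ does (beside? (t u) (t (suc u)))) (sym (heads-at (suc u) l))) (horizontal u (<-≤-trans l W≤U)))))

        c : Bits
        c = prefix k guessed

        c-short : length c ≤ k
        c-short = length-prefix k guessed

        R : Automaton.Run automaton
        R = run (initial M (x ∷ c ∷ []))

        open Forced R W (suc τ) t horizontal vertical
          (λ i l → trans (mid-at i l) (trans (cong (initialCell (isZero i) (bit x i)) (sym (bit-prefix k guessed W guessed-ordered guessed-short i l))) (sym (initial-row x c i))))

        accepted : output M (configAt (initial M (x ∷ c ∷ [])) τ) ≡ true ∷ []
        accepted = proj₁ (accepts⇔output (configAt (initial M (x ∷ c ∷ [])) τ))
          (trans (cong₂ accepts (sym mid-top) (sym right-top)) sign-top)
          where
          u = τ * W + 0
          mid-top : mid (t u) ≡ Automaton.Run.row R τ 0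
          mid-top = forced τ (n<1+n τ) 0 (subst (_< W) (sym (+-identityʳ τ)) (<⇒≤ τ+1<W))
          right-top : right (t u) ≡ Automaton.Run.row R τ 1
          right-top = forced-right τ (n<1+n τ) 0 (subst (_< W) (+-comm 1 τ) τ+1<W)
          sign-top : accepts (mid (t u)) (right (t u)) ≡ true
          sign-top = trans (sym (at-++ʳ (replicate (τ * W) true) _ 0))
            (trans (cong (λ j → at (word (sign (suc (suc (suc (suc zero)))) (t u)) x) (j + 0)) (length-replicate (τ * W)))
              (signedᶿ (suc (suc (suc (suc zero)))) u (subst (_< U) (sym (+-identityʳ (τ * W))) top<U)))

  cook-levin : ∀ K → InNP K → ∃[ 𝒯 ] ∀ x → K x ⇔ (∃[ θ ] TilingSystem.Solution 𝒯 x θ)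
  cook-levin K (verify , (M , pt , time-bound) , pc , spec) = CookLevin.system M pt pc , λ x → mk⇔ (to x) (from x)
    where
    open Simulation M using (configAt; halts⇒configAt)
    module CL = CookLevin M pt pc
    -- The run on a short certificate is over by the time of the top row.
    final : ∀ x c → length c ≤ ⟦ pc ⟧ (length x) → output M (configAt (initial M (x ∷ c ∷ [])) (⟦ CL.time ⟧ (length x))) ≡ verify (x ∷ c ∷ [])
    final x c short = let t , d , t≤ , halts , out = time-bound (x ∷ c ∷ []) in
      trans (cong (output M) (halts⇒configAt halts _ (≤-trans t≤ (≤-trans
        (poly-mono pt (+-monoʳ-≤ (length x) (≤-trans (≤-reflexive (+-identityʳ (length c))) short)))
        (≤-reflexive (sym (compose-⟦⟧ pt (var ⊕ pc) (length x)))))))) out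
    to : ∀ x → K x → ∃[ θ ] TilingSystem.Solution CL.system x θ
    to x kx = let c , short , v = Equivalence.to (spec x) kx in
      _ , CL.Painted.solution x c short (trans (final x c short) v)
    from : ∀ x → ∃[ θ ] TilingSystem.Solution CL.system x θ → K x
    from x (θ , sol) = Equivalence.from (spec x)
      (C.c , C.c-short , trans (sym (final x C.c C.c-short)) C.accepted)
      where module C = CL.Read x θ sol

module NamedInstances where

  open Selections
  open Transportation
  open import Data.List.Membership.Propositional using (_∈_)
  open import Data.Fin.Subset using () renaming (_∈_ to _∈ˢ_)

  sumOf : ∀ {A : Set} → (A → ℕ) → List A → ℕ
  sumOf f []       = 0
  sumOf f (x ∷ xs) = f x + sumOf f xs

  module _ {A : Set} where

    ∑-lookup : ∀ (f : A → ℕ) xs → ∑ (λ i → f (List.lookup xs i)) ≡ sumOf f xs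
    ∑-lookup f []       = refl
    ∑-lookup f (x ∷ xs) = cong (f x +_) (∑-lookup f xs)

    sumOf-mono : ∀ {f g : A → ℕ} xs → (∀ x → x ∈ xs → f x ≤ g x) → sumOf f xs ≤ sumOf g xs
    sumOf-mono []       h = z≤n
    sumOf-mono (x ∷ xs) h = +-mono-≤ (h x (here refl)) (sumOf-mono xs (λ y m → h y (there m)))

    sumOf-+ : ∀ (f g : A → ℕ) xs → sumOf (λ x → f x + g x) xs ≡ sumOf f xs + sumOf g xs
    sumOf-+ f g []       = refl
    sumOf-+ f g (x ∷ xs) = trans (cong (f x + g x +_) (sumOf-+ f g xs)) (arith (f x) (g x) _ _)
      where
      arith : ∀ a b c d → a + b + (c + d) ≡ a + c + (b + d)
      arith a b c d = trans (+-assoc a b (c + d)) (trans (cong (a +_) (+-swap b c d)) (sym (+-assoc a c (b + d))))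

    sumOf-++ : ∀ (f : A → ℕ) xs ys → sumOf f (xs ++ ys) ≡ sumOf f xs + sumOf f ys
    sumOf-++ f []       ys = refl
    sumOf-++ f (x ∷ xs) ys = trans (cong (f x +_) (sumOf-++ f xs ys)) (sym (+-assoc (f x) _ _))

    sumOf-const : ∀ c (xs : List A) → sumOf (λ _ → c) xs ≡ length xs * c
    sumOf-const c []       = refl
    sumOf-const c (x ∷ xs) = cong (c +_) (sumOf-const c xs)

    sumOf-tight : ∀ {f g : A → ℕ} xs → (∀ x → x ∈ xs → f x ≤ g x) → sumOf g xs ≤ sumOf f xs → ∀ x → x ∈ xs → g x ≤ f x
    sumOf-tight {f} {g} (x ∷ xs) h le _ (here refl) =
      +-cancelʳ-≤ (sumOf g xs) _ _ (≤-trans le (+-monoʳ-≤ (f x) (sumOf-mono xs (λ y m → h y (there m)))))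
    sumOf-tight {f} {g} (x ∷ xs) h le y (there m) =
      sumOf-tight xs (λ y m → h y (there m)) (+-cancelˡ-≤ (g x) _ _ (≤-trans le (+-monoˡ-≤ _ (h x (here refl))))) y m

    unique-lookup : ∀ {xs : List A} → Unique xs → ∀ i j → List.lookup xs i ≡ List.lookup xs j → i ≡ j
    unique-lookup (x∉ ∷ u) zero    zero    e = refl
    unique-lookup (x∉ ∷ u) zero    (suc j) e = contradiction e (All.lookup x∉ (∈-lookup j))
    unique-lookup (x∉ ∷ u) (suc i) zero    e = contradiction (sym e) (All.lookup x∉ (∈-lookup i))
    unique-lookup (x∉ ∷ u) (suc i) (suc j) e = cong suc (unique-lookup u i j e)

  ∑-one : ∀ {n} (f : Fin n → ℕ) {c} → (∀ i → f i ≤ c) → (∀ i j → 0 < f i → 0 < f j → i ≡ j) → ∑ f ≤ c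
  ∑-one {zero}  f b one = z≤n
  ∑-one {suc n} f {c} b one with f zero in e
  ... | zero  = ∑-one (f ∘ suc) (b ∘ suc) λ i j p q → suc-inj (one (suc i) (suc j) p q)
    where
    suc-inj : ∀ {n} {i j : Fin n} → Fin.suc i ≡ suc j → i ≡ j
    suc-inj refl = refl
  ... | suc k = ≤-trans (≤-reflexive (trans (cong (suc k +_) (trans (N.sum-cong-≗ rest) (N.sum-replicate-zero n))) (trans (+-identityʳ (suc k)) (sym e)))) (b zero)
    where
    rest : ∀ i → f (suc i) ≡ 0
    rest i with f (suc i) in e′
    ... | zero  = refl
    ... | suc _ with () ← one zero (suc i) (subst (0 <_) (sym e) (s≤s z≤n)) (subst (0 <_) (sym e′) (s≤s z≤n))

  bit-of : Bool → ℕ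
  bit-of b = b ∙ 1

  module Named {P A : Set} (_≟ᴾ_ : DecidableEquality P) (_≟ᴬ_ : DecidableEquality A)
    (pn : List P) (an : List A) (nonempty : 1 ≤ length pn)
    (available : P → Bool) (need : A → ℕ) (need>0 : ∀ α → 0 < need α) (usable : A → P → Bool) where

    T n : ℕ
    T = length pn
    n = length an

    period : Fin T → P
    period = List.lookup pn

    name : Fin n → A
    name = List.lookup an

    supply-of : P → ℕ
    supply-of p = bit-of (available p)

    last-period : ∃[ f ] suc (toℕ {T} f) ≡ T
    last-period = go nonempty
      where
      go : ∀ {T} → 1 ≤ T → ∃[ f ] suc (toℕ {T} f) ≡ T
      go {suc T} _ = fromℕ< (n<1+n T) , cong suc (toℕ-fromℕ< (n<1+n T))

    agent-of : A → Agent T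
    agent-of α = record
      { value = 1 ; value>0 = s≤s z≤n ; deadline = proj₁ last-period ; demand = need α ; demand>0 = need>0 α
      ; gaps = Vec.map (λ p → not (usable α p)) (Vec.fromList pn) }

    I : Scheduling
    I = record
      { periods = T ; periods≥1 = nonempty ; supply = Vec.map supply-of (Vec.fromList pn)
      ; n = n ; agents = Vec.map agent-of (Vec.fromList an) }

    open Scheduling I using (agent)

    lookup-fromList : ∀ {B : Set} (xs : List B) i → lookup (Vec.fromList xs) i ≡ List.lookup xs i
    lookup-fromList (x ∷ xs) zero    = refl
    lookup-fromList (x ∷ xs) (suc i) = lookup-fromList xs i

    agent-name : ∀ i → agent i ≡ agent-of (name i)
    agent-name i = trans (lookup-map i agent-of (Vec.fromList an)) (cong agent-of (lookup-fromList an i))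

    supply-period : ∀ t → lookup (Scheduling.supply I) t ≡ supply-of (period t)
    supply-period t = trans (lookup-map t supply-of (Vec.fromList pn)) (cong supply-of (lookup-fromList pn t))

    gap-usable : ∀ i t → lookup (Agent.gaps (agent i)) t ≡ not (usable (name i) (period t))
    gap-usable i t rewrite agent-name i =
      trans (lookup-map t (λ p → not (usable (name i) p)) (Vec.fromList pn)) (cong (λ p → not (usable (name i) p)) (lookup-fromList pn t))

    due-end : ∀ i → Agent.due (agent i) ≡ T
    due-end i rewrite agent-name i = proj₂ last-period

    in-time : ∀ i t → (toℕ t <ᵇ Agent.due (agent i)) ≡ true
    in-time i t = trans (cong (toℕ t <ᵇ_) (due-end i)) (Equivalence.to Bool.T-≡ (<⇒<ᵇ (toℕ<n {T} t)))

    module Selected {V : ℕ} (pn-unique : Unique pn) (sel : Selection I (ℤ.+ V)) where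

      open Selection sel

      Chosen : A → Set
      Chosen α = ∃[ i ] name i ≡ α × selected i ≡ true

      opaque
        chosen? : ∀ α → Dec (Chosen α)
        chosen? α = any? λ i → (name i ≟ᴬ α) ×-dec (selected i Bool.≟ true)

      chosen : A → ℕ
      chosen α = bit-of (does (chosen? α))

      enough : V ≤ sumOf chosen an
      enough = ≤-trans (ℤ.drop‿+≤+ worth) (≤-trans (∑-mono counted) (≤-reflexive (∑-lookup chosen an)))
        where
        import Data.Integer.Properties as ℤ
        counted : ∀ i → selected i ∙ Agent.value (agent i) ≤ chosen (name i)
        counted i rewrite agent-name i = ≤⇒∙ 1 λ s → inj₁ (dec-true (chosen? (name i)) (i , refl , s))

      private
        is : List A → A → Bool
        is []       α = false
        is (β ∷ αs) α = does (α ≟ᴬ β) ∨ is αs α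

        within : List P → P → Bool
        within []      p = false
        within (r ∷ ℓ) p = does (p ≟ᴾ r) ∨ within ℓ p

        is-sound : ∀ αs α → is αs α ≡ true → α ∈ αs
        is-sound (β ∷ αs) α h with α ≟ᴬ β
        ... | yes refl = here refl
        ... | no _     = there (is-sound αs α h)

        within-complete : ∀ ℓ {p} → p ∈ ℓ → within ℓ p ≡ true
        within-complete (r ∷ ℓ) {p} (here refl) rewrite dec-true (p ≟ᴾ p) refl = refl
        within-complete (r ∷ ℓ) {p} (there m) with p ≟ᴾ r
        ... | yes _ = refl
        ... | no _  = within-complete ℓ m

      demand-below : ∀ αs → Unique αs → All Chosen αs →
        sumOf need αs ≤ ∑ (λ i → (is αs (name i) ∧ selected i) ∙ need (name i))
      demand-below []       _        _              = z≤n
      demand-below (α ∷ αs) (α∉ ∷ u) ((i , refl , s) ∷ ch) = begin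
        need (name i) + sumOf need αs
          ≤⟨ +-mono-≤ (≤-trans own (≤-∑ first i)) (demand-below αs u ch) ⟩
        ∑ first + ∑ rest
          ≡⟨ N.∑-distrib-+ first rest ⟨
        ∑ (λ j → first j + rest j)
          ≤⟨ ∑-mono disjoint ⟩
        ∑ (λ j → (is (name i ∷ αs) (name j) ∧ selected j) ∙ need (name j)) ∎
        where
        open ≤-Reasoning
        first rest : Fin n → ℕ
        first j = (does (name j ≟ᴬ name i) ∧ selected j) ∙ need (name j)
        rest j = (is αs (name j) ∧ selected j) ∙ need (name j)
        own : need (name i) ≤ first i
        own rewrite dec-true (name i ≟ᴬ name i) refl | s = ≤-refl
        disjoint : ∀ j → first j + rest j ≤ (is (name i ∷ αs) (name j) ∧ selected j) ∙ need (name j)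
        disjoint j with name j ≟ᴬ name i
        ... | no _ = ≤-refl
        ... | yes e with is αs (name j) in m
        ...   | false = ≤-reflexive (+-identityʳ _)
        ...   | true  = contradiction (sym e) (All.lookup α∉ (is-sound αs (name j) m))

      supply-above : ∀ ℓ → ∑ (λ t → within ℓ (period t) ∙ supply-of (period t)) ≤ sumOf supply-of ℓ
      supply-above []      = ≤-reflexive (N.sum-replicate-zero T)
      supply-above (r ∷ ℓ) = begin
        ∑ (λ t → (does (period t ≟ᴾ r) ∨ within ℓ (period t)) ∙ supply-of (period t))
          ≤⟨ ∑-mono (λ t → split (does (period t ≟ᴾ r)) (within ℓ (period t)) (supply-of (period t))) ⟩
        ∑ (λ t → first t + within ℓ (period t) ∙ supply-of (period t))
          ≡⟨ N.∑-distrib-+ first (λ t → within ℓ (period t) ∙ supply-of (period t)) ⟩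
        ∑ first + ∑ (λ t → within ℓ (period t) ∙ supply-of (period t))
          ≤⟨ +-mono-≤ (∑-one first bounded same) (supply-above ℓ) ⟩
        supply-of r + sumOf supply-of ℓ ∎
        where
        open ≤-Reasoning
        first : Fin T → ℕ
        first t = does (period t ≟ᴾ r) ∙ supply-of (period t)
        split : ∀ a b x → (a ∨ b) ∙ x ≤ a ∙ x + b ∙ x
        split true  b x = m≤m+n x _
        split false b x = ≤-refl
        bounded : ∀ t → first t ≤ supply-of r
        bounded t with period t ≟ᴾ r
        ... | yes refl = ≤-refl
        ... | no _     = z≤n
        hit : ∀ t → 0 < first t → period t ≡ r
        hit t h with period t ≟ᴾ r
        ... | yes e = e
        same : ∀ s t → 0 < first s → 0 < first t → s ≡ t
        same s t h h′ = unique-lookup pn-unique s t (trans (hit s h) (sym (hit t h′)))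

      named-cut : ∀ αs ℓ → Unique αs → All Chosen αs → (∀ α p → α ∈ αs → usable α p ≡ true → p ∈ ℓ) →
                  sumOf need αs ≤ sumOf supply-of ℓ
      named-cut αs ℓ u ch cover = ≤-trans (demand-below αs u ch) (≤-trans (≤-reflexive (N.sum-cong-≗ λ i → cong (λ B → S i ∙ Agent.demand B) (sym (agent-name i))))
        (≤-trans (cuts S (λ i s → proj₂ (and-true s)) (within ℓ ∘ period) covered)
          (≤-trans (≤-reflexive (N.sum-cong-≗ λ t → cong (within ℓ (period t) ∙_) (supply-period t))) (supply-above ℓ))))
        where
        S : Fin n → Bool
        S i = is αs (name i) ∧ selected i
        and-true : ∀ {a b} → a ∧ b ≡ true → a ≡ true × b ≡ true
        and-true {true} {true} _ = refl , refl
        covered : ∀ i t → S i ≡ true → (toℕ t <ᵇ Agent.due (agent i)) ≡ true → within ℓ (period t) ≡ true ⊎ t ∈ˢ Agent.gaps (agent i)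
        covered i t s _ with usable (name i) (period t) in e
        ... | true  = inj₁ (within-complete ℓ (cover (name i) (period t) (is-sound αs (name i) (proj₁ (and-true s))) e))
        ... | false = inj₂ (lookup⇒[]= t _ (trans (gap-usable i t) (cong not e)))

    achieved : ∀ {V} (use : A → P → Bool) (served : A → Bool) → Unique an →
      (∀ α p → use α p ≡ true → usable α p ≡ true) →
      (∀ α β p → α ∈ an → β ∈ an → use α p ≡ true → use β p ≡ true → α ≡ β) →
      (∀ α p → α ∈ an → use α p ≡ true → available p ≡ true) →
      (∀ α → α ∈ an → served α ≡ true → need α ≤ sumOf (bit-of ∘ use α) pn) →
      V ≤ sumOf (bit-of ∘ served) an → Achievable (I , ℤ.+ V)
    achieved use served an-unique fits alone avail enough V≤ = integral⇒achievable I (λ i t → bit-of (use (name i) (period t)))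
      supplied gap (ℤ.+≤+ (≤-trans V≤ (≤-trans (≤-reflexive (sym (∑-lookup (bit-of ∘ served) an))) (∑-mono counted))))
      where
      bit≤1 : ∀ b → bit-of b ≤ 1
      bit≤1 true  = ≤-refl
      bit≤1 false = z≤n
      bit-true : ∀ {b} → 0 < bit-of b → b ≡ true
      bit-true {true} _ = refl
      supplied : ∀ t → ∑ (λ i → bit-of (use (name i) (period t))) ≤ lookup (Scheduling.supply I) t
      supplied t rewrite supply-period t with available (period t) in e
      ... | true  = ∑-one _ (λ i → bit≤1 (use (name i) (period t)))
                      λ i j h h′ → unique-lookup an-unique i j (alone (name i) (name j) (period t) (∈-lookup i) (∈-lookup j) (bit-true h) (bit-true h′))
      ... | false = ≤-reflexive (trans (N.sum-cong-≗ none) (N.sum-replicate-zero n))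
        where
        none : ∀ i → bit-of (use (name i) (period t)) ≡ 0
        none i with use (name i) (period t) in u
        ... | false = refl
        ... | true with () ← trans (sym e) (avail (name i) (period t) (∈-lookup i) u)
      gap : ∀ i t → t ∈ˢ Agent.gaps (agent i) → bit-of (use (name i) (period t)) ≡ 0
      gap i t g with use (name i) (period t) in u
      ... | false = refl
      ... | true with () ← trans (sym ([]=⇒lookup g)) (trans (gap-usable i t) (cong not (fits (name i) (period t) u)))
      charged≡ : ∀ i → charged I (λ i t → bit-of (use (name i) (period t))) i ≡ sumOf (bit-of ∘ use (name i)) pn
      charged≡ i = trans (N.sum-cong-≗ λ t → cong (_∙ bit-of (use (name i) (period t))) (in-time i t)) (∑-lookup (bit-of ∘ use (name i)) pn)
      counted : ∀ i → bit-of (served (name i)) ≤ does (Agent.demand (agent i) ≤? charged I (λ i t → bit-of (use (name i) (period t))) i) ∙ Agent.value (agent i)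
      counted i with served (name i) in s
      ... | false = z≤n
      ... | true rewrite charged≡ i | agent-name i | dec-true (need (name i) ≤? sumOf (bit-of ∘ use (name i)) pn) (enough (name i) (∈-lookup i) s) = ≤-refl

module Blueprints where

  open TilingSystems using (Word; word; at)
  open NamedInstances

  data Shift : Set where
    none one row : Shift

  -- An agent of each type sits at each of the cells 0, 1, …. Its usable periods
  -- are at its own cell, the next one, or the one above.
  record Blueprint : Set₁ where
    field
      Const Type   : Set
      _≟ᶜ_         : DecidableEquality Const
      _≟ᵗ_         : DecidableEquality Type
      consts       : List Const
      nonempty     : 1 ≤ length consts
      types        : List Type
      supply       : Const → Word
      reach        : Type → Const → Maybe Shift
      demand       : Type → ℕ
      demand>0     : ∀ τ → 0 < demand τ
      demand≤3     : ∀ τ → demand τ ≤ 3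
      time extra   : Poly
      quota        : ℕ
      quota≤       : quota ≤ length types

    area : Poly
    area = (con 1 ⊕ time) ⊗ (con 1 ⊕ extra)

    span : Poly
    span = area ⊕ (con 1 ⊕ extra)

    field
      supply-length : ∀ c x → length (word (supply c) x) ≡ ⟦ span ⟧ (length x)

    module At (x : Bits) where

      U W Y : ℕ
      U = ⟦ area ⟧ (length x)
      W = suc (⟦ extra ⟧ (length x))
      Y = ⟦ span ⟧ (length x)

      shift : Shift → ℕ
      shift none = 0
      shift one  = 1
      shift row  = W

      reached : Maybe Shift → ℕ → ℕ → Bool
      reached nothing  u p = false
      reached (just o) u p = p ≡ᵇ (u + shift o)

      periods : List (Const × ℕ)
      periods = cartesianProduct consts (upTo Y)

      agents : List (ℕ × Type)
      agents = cartesianProduct (upTo U) types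

      available : Const × ℕ → Bool
      available (c , p) = at (word (supply c) x) p

      usable : ℕ × Type → Const × ℕ → Bool
      usable (u , τ) (c , p) = reached (reach τ c) u p

      periods-nonempty : 1 ≤ length periods
      periods-nonempty = go consts nonempty
        where
        go : ∀ cs → 1 ≤ length cs → 1 ≤ length (cartesianProduct cs (upTo Y))
        go (c ∷ cs) _ = s≤s z≤n

      open Named (Product.≡-dec _≟ᶜ_ ℕ._≟_) (Product.≡-dec ℕ._≟_ _≟ᵗ_) periods agents periods-nonempty
        available (λ α → demand (proj₂ α)) (λ α → demand>0 (proj₂ α)) usable public

      problem : Scheduling × ℤ
      problem = I , ℤ.+ (U * quota)

  sumOf-map : ∀ {A B : Set} (f : B → ℕ) (g : A → B) xs → sumOf f (map g xs) ≡ sumOf (λ x → f (g x)) xs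
  sumOf-map f g []       = refl
  sumOf-map f g (x ∷ xs) = cong (f (g x) +_) (sumOf-map f g xs)

  sumOf-product : ∀ {A B : Set} (f : A × B → ℕ) xs ys → sumOf f (cartesianProduct xs ys) ≡ sumOf (λ x → sumOf (λ y → f (x , y)) ys) xs
  sumOf-product f []       ys = refl
  sumOf-product {A} {B} f (x ∷ xs) ys = trans (sumOf-++ f (map (x ,_) ys) (cartesianProduct xs ys))
      (cong₂ _+_ (sumOf-map f (x ,_) ys) (sumOf-product f xs ys))

module Gadgets where

  open Selections
  open Transportation
  open CellularAutomata
  open TilingSystems
  open NamedInstances
  open Blueprints
  open import Data.List.Membership.Propositional using (_∈_)
  open import Data.Fin.Base using (fromℕ)
  open import Data.Nat.Properties using () renaming (_≟_ to _≟ⁿ_)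

  ≡ᵇ-true : ∀ {m n} → (m ≡ᵇ n) ≡ true → m ≡ n
  ≡ᵇ-true {m} {n} h = ≡ᵇ⇒≡ m n (Equivalence.from Bool.T-≡ h)

  ≡⇒≡ᵇ-true : ∀ n → (n ≡ᵇ n) ≡ true
  ≡⇒≡ᵇ-true n = Equivalence.to Bool.T-≡ (≡⇒≡ᵇ n n refl)

  ∧-true : ∀ {a b} → a ∧ b ≡ true → a ≡ true × b ≡ true
  ∧-true {true} {true} _ = refl , refl

  module _ {A : Set} where

    ∈-remove : ∀ {x y : A} as {bs} → x ∈ as ++ y ∷ bs → x ≡ y ⊎ x ∈ as ++ bs
    ∈-remove []       (here e)  = inj₁ e
    ∈-remove []       (there m) = inj₂ m
    ∈-remove (a ∷ as) (here e)  = inj₂ (here e)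
    ∈-remove (a ∷ as) (there m) with ∈-remove as m
    ... | inj₁ e  = inj₁ e
    ... | inj₂ m′ = inj₂ (there m′)

    sumOf-remove : ∀ (f : A → ℕ) as {y bs} → sumOf f (as ++ y ∷ bs) ≡ f y + sumOf f (as ++ bs)
    sumOf-remove f []       = refl
    sumOf-remove f (a ∷ as) {y} = trans (cong (f a +_) (sumOf-remove f as)) (+-swap (f a) (f y) _)

    length-remove : ∀ (as : List A) {y bs} → length (as ++ y ∷ bs) ≡ suc (length (as ++ bs))
    length-remove []       = refl
    length-remove (a ∷ as) = cong suc (length-remove as)

    ∈⇒nonempty : ∀ {x : A} {xs} → x ∈ xs → 1 ≤ length xs
    ∈⇒nonempty (here _)  = s≤s z≤n
    ∈⇒nonempty (there _) = s≤s z≤n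

    length≤sumOf : ∀ (f : A → ℕ) ℓ xs → Unique ℓ → (∀ y → y ∈ ℓ → y ∈ xs × 1 ≤ f y) → length ℓ ≤ sumOf f xs
    length≤sumOf f []      xs _        _ = z≤n
    length≤sumOf f (y ∷ ℓ) xs (y∉ ∷ u) h with ∈-∃++ (proj₁ (h y (here refl)))
    ... | as , bs , refl = ≤-trans (+-mono-≤ (proj₂ (h y (here refl))) (length≤sumOf f ℓ (as ++ bs) u rest))
                                   (≤-reflexive (sym (sumOf-remove f as)))
      where
      rest : ∀ z → z ∈ ℓ → z ∈ as ++ bs × 1 ≤ f z
      rest z m with ∈-remove as (proj₁ (h z (there m)))
      ... | inj₁ refl = contradiction refl (All.lookup y∉ m)
      ... | inj₂ m′   = m′ , proj₂ (h z (there m))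

  module Gadget (𝒯 : TilingSystem) where

    open TilingSystem 𝒯 renaming (tiles to q)

    data Axis : Set where
      row column : Axis

    finite-Axis : Finite Axis
    finite-Axis = record
      { card = 2
      ; index = λ { row → zero ; column → suc zero }
      ; element = λ { zero → row ; (suc zero) → column }
      ; element-index = λ { row → refl ; column → refl }
      ; index-element = λ { zero → refl ; (suc zero) → refl }
      }

    -- For each cell u and tile a there is a boolean variable, true if a is at
    -- u. The roles are its occurrences: in the five sign constraints, and as
    -- the first or second member of a forbidden pair with the tile b.
    Role : Set
    Role = Fin 5 ⊎ (Axis × Bool × Fin q)

    pattern signed-by j = inj₁ j
    pattern side ρ d b  = inj₂ (ρ , d , b)

    finite-Role : Finite Role
    finite-Role = finite-⊎ (finite-Fin 5) (finite-× finite-Axis (finite-× finite-Bool (finite-Fin q)))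

    module R = Finite finite-Role

    K k-last : ℕ
    K = R.card
    k-last = 4 + 2 * (2 * q)

    role : Fin K → Role
    role = R.element

    last : Fin K
    last = fromℕ k-last

    Const : Set
    Const = Fin 1 ⊎ ((Bool × Fin q × Fin (suc K)) ⊎ ((Axis × Fin q × Fin q) ⊎ (Fin 5 × Fin q)))

    pattern spare       = inj₁ zero
    pattern chain s a n = inj₂ (inj₁ (s , a , n))
    pattern extra-const c = inj₂ (inj₂ c)
    pattern clash ρ a b = inj₂ (inj₂ (inj₁ (ρ , a , b)))
    pattern sign j a    = inj₂ (inj₂ (inj₂ (j , a)))

    opaque
     finite-Const : Finite Const
     finite-Const = finite-⊎ (finite-Fin 1) (finite-⊎ (finite-× finite-Bool (finite-× (finite-Fin q) (finite-Fin (suc K))))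
       (finite-⊎ (finite-× finite-Axis (finite-× (finite-Fin q) (finite-Fin q))) (finite-× (finite-Fin 5) (finite-Fin q))))

    module C = Finite finite-Const

    Type : Set
    Type = Fin 1 ⊎ (Bool × Fin q × Fin K)

    pattern hub         = inj₁ zero
    pattern agent s a k = inj₂ (s , a , k)

    opaque
     finite-Type : Finite Type
     finite-Type = finite-⊎ (finite-Fin 1) (finite-× finite-Bool (finite-× (finite-Fin q) (finite-Fin K)))

    pairs : List (Fin q × Fin K)
    pairs = Finite.elements (finite-× (finite-Fin q) (finite-Fin K))

    pick skip : Fin q × Fin K → Type
    pick ak = inj₂ (true , ak)
    skip ak = inj₂ (false , ak)

    types : List Type
    types = hub ∷ map pick pairs ++ map skip pairs

    sum-types : ∀ (f : Type → ℕ) → sumOf f types ≡ f hub + sumOf (λ ak → f (pick ak) + f (skip ak)) pairs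
    sum-types f = cong (f hub +_) (begin
      sumOf f (map pick pairs ++ map skip pairs)                           ≡⟨ sumOf-++ f (map pick pairs) (map skip pairs) ⟩
      sumOf f (map pick pairs) + sumOf f (map skip pairs)                  ≡⟨ cong₂ _+_ (sumOf-map f pick pairs) (sumOf-map f skip pairs) ⟩
      sumOf (λ ak → f (pick ak)) pairs + sumOf (λ ak → f (skip ak)) pairs  ≡⟨ sumOf-+ (λ ak → f (pick ak)) (λ ak → f (skip ak)) pairs ⟨
      sumOf (λ ak → f (pick ak) + f (skip ak)) pairs                       ∎)
      where open ≡-Reasoning

    along : Axis → Shift
    along row    = one
    along column = row

    allowed : Axis → Fin q → Fin q → Bool
    allowed row    = H
    allowed column = V

    Need : Set
    Need = Const × Shift

    special : Fin q → Role → List Need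
    special a (signed-by j)    = (sign j a , none) ∷ []
    special a (side ρ true b)  = if allowed ρ a b then [] else (clash ρ a b , along ρ) ∷ []
    special b (side ρ false a) = if allowed ρ a b then [] else (clash ρ a b , none) ∷ []

    -- For each occurrence of a variable either the agent pick or the agent skip
    -- is served. The chain makes the choice the same for all occurrences if the
    -- last one is picked, and the hub requires this of some tile at each cell.
    needs : Type → List Need
    needs hub             = map (λ a → chain true a (fromℕ K) , none) (allFin q)
    needs (agent true a k)  = (chain false a (inject₁ k) , none) ∷ (chain true a (inject₁ k) , none) ∷ special a (role k)
    needs (agent false a k) = (chain false a (inject₁ k) , none) ∷ (chain true a (suc k) , none) ∷ []

    demand : Type → ℕ
    demand hub           = 1
    demand (agent s a k) = length (needs (agent s a k))

    find-need : Const → List Need → Maybe Shift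
    find-need c []             = nothing
    find-need c ((d , o) ∷ ns) = if does (c C.≟ d) then just o else find-need c ns

    supply : Const → Word
    supply (sign j a) = signs j a
    supply _          = times ((height ⊗ width) ⊕ width) true ∷ []

    data Special : List Need → Set where
      nil : Special []
      one : ∀ c o → Special ((extra-const c , o) ∷ [])

    special-view : ∀ a r → Special (special a r)
    special-view a (signed-by j) = one _ _
    special-view a (side ρ true b) with allowed ρ a b
    ... | true  = nil
    ... | false = one _ _
    special-view b (side ρ false a) with allowed ρ a b
    ... | true  = nil
    ... | false = one _ _

    special-first : ∀ ρ a b → allowed ρ a b ≡ false → (clash ρ a b , along ρ) ∈ special a (side ρ true b)
    special-first ρ a b bad rewrite bad = here refl

    special-second : ∀ ρ a b → allowed ρ a b ≡ false → (clash ρ a b , none) ∈ special b (side ρ false a)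
    special-second ρ a b bad rewrite bad = here refl

    demand>0 : ∀ τ → 0 < demand τ
    demand>0 hub               = s≤s z≤n
    demand>0 (agent true a k)  = s≤s z≤n
    demand>0 (agent false a k) = s≤s z≤n

    demand≤3 : ∀ τ → demand τ ≤ 3
    demand≤3 hub               = s≤s z≤n
    demand≤3 (agent false a k) = s≤s (s≤s z≤n)
    demand≤3 (agent true a k) with special a (role k) | special-view a (role k)
    ... | _ | nil     = s≤s (s≤s z≤n)
    ... | _ | one _ _ = ≤-refl

    supply-length : ∀ c x → length (word (supply c) x) ≡ area (length x) + ⟦ width ⟧ (length x)
    supply-length c x = go c
      where
      full : length (word (times ((height ⊗ width) ⊕ width) true ∷ []) x) ≡ area (length x) + ⟦ width ⟧ (length x)
      full = trans (cong length (++-identityʳ (List.replicate (area (length x) + ⟦ width ⟧ (length x)) true)))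
                   (length-replicate (area (length x) + ⟦ width ⟧ (length x)))
      go : ∀ c → length (word (supply c) x) ≡ area (length x) + ⟦ width ⟧ (length x)
      go (inj₁ _)     = full
      go (chain _ _ _) = full
      go (clash _ _ _) = full
      go (sign j a)   = signs-length j a x

    blueprint : Blueprint
    blueprint = record
      { Const = Const ; Type = Type ; _≟ᶜ_ = C._≟_ ; _≟ᵗ_ = Finite._≟_ finite-Type
      ; consts = C.elements ; nonempty = ∈⇒nonempty (C.∈-elements spare) ; types = types
      ; supply = supply ; reach = λ τ c → find-need c (needs τ)
      ; demand = demand ; demand>0 = demand>0 ; demand≤3 = demand≤3
      ; time = time ; extra = extra ; quota = suc (length pairs)
      ; quota≤ = s≤s (≤-trans (≤-reflexive (sym (length-map pick pairs)))
          (≤-trans (m≤m+n _ _) (≤-reflexive (sym (length-++ (map pick pairs))))))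
      ; supply-length = supply-length }

    module _ (x : Bits) where

      open Blueprint.At blueprint x renaming (agents to an; periods to pn)

      place : ℕ → Need → Const × ℕ
      place u (c , o) = c , u + shift o

      needs-at : ℕ × Type → List (Const × ℕ)
      needs-at (u , τ) = map (place u) (needs τ)

      usable⇒∈ : ∀ α p → usable α p ≡ true → p ∈ needs-at α
      usable⇒∈ (u , τ) (c , p) = go (needs τ)
        where
        go : ∀ ns → reached (find-need c ns) u p ≡ true → (c , p) ∈ map (place u) ns
        go ((d , o) ∷ ns) h with c C.≟ d
        ... | yes refl = here (cong (c ,_) (≡ᵇ-true h))
        ... | no _     = there (go ns h)

      along>0 : ∀ ρ → 1 ≤ shift (along ρ)
      along>0 row    = ≤-refl
      along>0 column = s≤s z≤n

      0<U : 0 < U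
      0<U = s≤s z≤n

      pn-unique : Unique pn
      pn-unique = Unique.cartesianProduct⁺ C.elements-unique (Unique.upTo⁺ Y)

      length-needs : ∀ u τ → length (needs-at (u , τ)) ≡ length (needs τ)
      length-needs u τ = length-map (place u) (needs τ)

      bit≤1 : ∀ b → bit-of b ≤ 1
      bit≤1 true  = ≤-refl
      bit≤1 false = z≤n

      bit-true : ∀ {b} → 1 ≤ bit-of b → b ≡ true
      bit-true {true} _ = refl

      supply≤length : ∀ ℓ → sumOf supply-of ℓ ≤ length ℓ
      supply≤length ℓ = ≤-trans (sumOf-mono {g = λ _ → 1} ℓ (λ p _ → bit≤1 (available p)))
        (≤-reflexive (trans (sumOf-const 1 ℓ) (*-identityʳ (length ℓ))))

      module Sound (sel : Selection I (ℤ.+ (U * suc (length pairs)))) where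

        open Selected pn-unique sel

        Full : Type → Set
        Full τ = demand τ ≡ length (needs τ)

        conflict : ∀ u v {τ σ p} → Full τ → Full σ → Chosen (u , τ) → Chosen (v , σ) → (u , τ) ≢ (v , σ) →
                   p ∈ needs-at (u , τ) → ¬ p ∈ needs-at (v , σ)
        conflict u v {τ} {σ} {p} fτ fσ ch ch′ α≢β m m′ with ∈-∃++ m′
        ... | as , bs , e = <-irrefl refl (begin-strict
          length (needs-at (u , τ)) + length (as ++ bs)
            <⟨ +-monoʳ-< (length (needs-at (u , τ))) (n<1+n _) ⟩
          length (needs-at (u , τ)) + suc (length (as ++ bs))
            ≡⟨ cong (length (needs-at (u , τ)) +_) (trans (cong length e) (length-remove as)) ⟨
          length (needs-at (u , τ)) + length (needs-at (v , σ))
            ≡⟨ cong₂ _+_ (trans (length-needs u τ) (sym fτ)) (trans (trans (length-needs v σ) (sym fσ)) (sym (+-identityʳ _))) ⟩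
          demand τ + (demand σ + 0)
            ≤⟨ named-cut ((u , τ) ∷ (v , σ) ∷ []) (needs-at (u , τ) ++ as ++ bs) ((α≢β ∷ []) ∷ [] ∷ []) (ch ∷ ch′ ∷ []) cover ⟩
          sumOf supply-of (needs-at (u , τ) ++ as ++ bs)
            ≤⟨ supply≤length (needs-at (u , τ) ++ as ++ bs) ⟩
          length (needs-at (u , τ) ++ as ++ bs)
            ≡⟨ length-++ (needs-at (u , τ)) ⟩
          length (needs-at (u , τ)) + length (as ++ bs) ∎)
          where
          open ≤-Reasoning
          cover : ∀ α r → α ∈ (u , τ) ∷ (v , σ) ∷ [] → usable α r ≡ true → r ∈ needs-at (u , τ) ++ as ++ bs
          cover _ r (here refl) h = ∈-++⁺ˡ (usable⇒∈ (u , τ) r h)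
          cover _ r (there (here refl)) h with ∈-remove as (subst (r ∈_) e (usable⇒∈ (v , σ) r h))
          ... | inj₁ refl = ∈-++⁺ˡ m
          ... | inj₂ m″   = ∈-++⁺ʳ (needs-at (u , τ)) m″

        supplied : ∀ u {τ p} → Full τ → Chosen (u , τ) → p ∈ needs-at (u , τ) → available p ≡ true
        supplied u {τ} {p} fτ ch m = bit-true (sumOf-tight {f = supply-of} {g = λ _ → 1} (needs-at (u , τ)) (λ r _ → bit≤1 (available r)) (begin
          sumOf (λ _ → 1) (needs-at (u , τ))  ≡⟨ trans (sumOf-const 1 (needs-at (u , τ))) (*-identityʳ _) ⟩
          length (needs-at (u , τ))           ≡⟨ trans (length-needs u τ) (sym fτ) ⟩
          demand τ                            ≡⟨ +-identityʳ _ ⟨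
          demand τ + 0                        ≤⟨ named-cut ((u , τ) ∷ []) (needs-at (u , τ)) ([] ∷ []) (ch ∷ []) (λ { _ r (here refl) h → usable⇒∈ (u , τ) r h }) ⟩
          sumOf supply-of (needs-at (u , τ))  ∎) p m)
          where open ≤-Reasoning

        is-chosen : ∀ α → 1 ≤ chosen α → Chosen α
        is-chosen α h with chosen? α
        ... | yes c = c

        cell : ℕ → ℕ
        cell u = chosen (u , hub) + sumOf (λ ak → chosen (u , pick ak) + chosen (u , skip ak)) pairs

        exclusive : ∀ u ak → chosen (u , pick ak) + chosen (u , skip ak) ≤ 1
        exclusive u (a , k) with chosen? (u , agent true a k) | chosen? (u , agent false a k)
        ... | no _  | no _  = z≤n
        ... | no _  | yes _ = ≤-refl
        ... | yes _ | no _  = ≤-refl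
        ... | yes c | yes d = contradiction (here refl) (conflict u u {p = chain false a (inject₁ k) , u + 0} refl refl c d (λ ()) (here refl))

        cell≤ : ∀ u → cell u ≤ suc (length pairs)
        cell≤ u = +-mono-≤ (bit≤1 (does (chosen? (u , hub))))
          (≤-trans (sumOf-mono {g = λ _ → 1} pairs (λ ak _ → exclusive u ak)) (≤-reflexive (trans (sumOf-const 1 pairs) (*-identityʳ _))))

        cell≥ : ∀ u → u < U → suc (length pairs) ≤ cell u
        cell≥ u u<U = sumOf-tight {f = cell} {g = λ _ → suc (length pairs)} (upTo U) (λ v _ → cell≤ v) (begin
          sumOf (λ _ → suc (length pairs)) (upTo U)                  ≡⟨ trans (sumOf-const (suc (length pairs)) (upTo U)) (cong (_* suc (length pairs)) (length-upTo U)) ⟩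
          U * suc (length pairs)                                     ≤⟨ enough ⟩
          sumOf chosen an                                            ≡⟨ sumOf-product chosen (upTo U) types ⟩
          sumOf (λ u → sumOf (λ τ → chosen (u , τ)) types) (upTo U)  ≤⟨ sumOf-mono (upTo U) (λ v _ → ≤-reflexive (sum-types (λ τ → chosen (v , τ)))) ⟩
          sumOf cell (upTo U)                                        ∎) u (∈-upTo⁺ u<U)
          where open ≤-Reasoning

        hub-chosen : ∀ u → u < U → Chosen (u , hub)
        hub-chosen u u<U = is-chosen _ (+-cancelʳ-≤ (length pairs) 1 _ (≤-trans (cell≥ u u<U)
          (+-monoʳ-≤ (chosen (u , hub)) (≤-trans (sumOf-mono {g = λ _ → 1} pairs (λ ak _ → exclusive u ak))
            (≤-reflexive (trans (sumOf-const 1 pairs) (*-identityʳ _)))))))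

        one-chosen : ∀ u → u < U → ∀ a k → Chosen (u , agent true a k) ⊎ Chosen (u , agent false a k)
        one-chosen u u<U a k = split (sumOf-tight {f = λ ak → chosen (u , pick ak) + chosen (u , skip ak)} {g = λ _ → 1} pairs (λ ak _ → exclusive u ak)
            (≤-trans (≤-reflexive (trans (sumOf-const 1 pairs) (*-identityʳ _)))
              (+-cancelˡ-≤ 1 _ _ (≤-trans (cell≥ u u<U) (+-monoˡ-≤ _ (bit≤1 (does (chosen? (u , hub)))))))) (a , k) (Finite.∈-elements (finite-× (finite-Fin q) (finite-Fin K)) (a , k)))
          where
          split : 1 ≤ chosen (u , agent true a k) + chosen (u , agent false a k) → Chosen (u , agent true a k) ⊎ Chosen (u , agent false a k)
          split h with chosen? (u , agent true a k) | chosen? (u , agent false a k)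
          ... | yes c | _     = inj₁ c
          ... | no _  | yes d = inj₂ d

        last-chosen : ∀ u → u < U → ∃[ a ] Chosen (u , agent true a last)
        last-chosen u u<U with Fin.any? (λ a → chosen? (u , agent true a last))
        ... | yes c = c
        ... | no ¬c = contradiction deficit (<⇒≱ (≤-refl {suc (length (allFin q) * 2)}))
          where
          skips : List (Fin q) → List (ℕ × Type)
          skips = map (λ a → u , agent false a last)
          ends : List (Fin q) → List (Const × ℕ)
          ends = concatMap (λ a → needs-at (u , agent false a last))
          sum-skips : ∀ as → sumOf (demand ∘ proj₂) (skips as) ≡ length as * 2
          sum-skips []       = refl
          sum-skips (a ∷ as) = cong (2 +_) (sum-skips as)
          length-ends : ∀ as → length (ends as) ≡ length as * 2
          length-ends []       = refl
          length-ends (a ∷ as) = cong (2 +_) (length-ends as)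
          skips-chosen : ∀ as → All Chosen (skips as)
          skips-chosen []       = []
          skips-chosen (a ∷ as) = [ (λ c → contradiction (a , c) ¬c) , (λ d → d) ]′ (one-chosen u u<U a last) ∷ skips-chosen as
          hub∉ : ∀ as → All ((u , hub) ≢_) (skips as)
          hub∉ []       = []
          hub∉ (a ∷ as) = (λ ()) ∷ hub∉ as
          ends-∈ : ∀ {a as p} → a ∈ as → p ∈ needs-at (u , agent false a last) → p ∈ ends as
          ends-∈ (here refl) m = ∈-++⁺ˡ m
          ends-∈ {a} {b ∷ as} (there a∈) m = ∈-++⁺ʳ (needs-at (u , agent false b last)) (ends-∈ a∈ m)
          cover : ∀ α p → α ∈ (u , hub) ∷ skips (allFin q) → usable α p ≡ true → p ∈ ends (allFin q)
          cover _ p (here refl) h with ∈-map⁻ (place u) (usable⇒∈ (u , hub) p h)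
          ... | n , m , refl with ∈-map⁻ _ m
          ...   | a , m′ , refl = ends-∈ {a} m′ (there (here refl))
          cover α p (there m) h with ∈-map⁻ _ m
          ... | a , m′ , refl = ends-∈ {a} m′ (usable⇒∈ (u , agent false a last) p h)
          deficit : suc (length (allFin q) * 2) ≤ length (allFin q) * 2
          deficit = begin
            suc (length (allFin q) * 2)               ≡⟨ cong suc (sum-skips (allFin q)) ⟨
            1 + sumOf (demand ∘ proj₂) (skips (allFin q))  ≤⟨ named-cut ((u , hub) ∷ skips (allFin q)) (ends (allFin q))
                                                           (hub∉ (allFin q) ∷ Unique.map⁺ (λ { refl → refl }) (Unique.allFin⁺ q))
                                                           (hub-chosen u u<U ∷ skips-chosen (allFin q)) cover ⟩
            sumOf supply-of (ends (allFin q))         ≤⟨ supply≤length (ends (allFin q)) ⟩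
            length (ends (allFin q))                  ≡⟨ length-ends (allFin q) ⟩
            length (allFin q) * 2                     ∎
            where open ≤-Reasoning

        θ : ℕ → Fin q
        θ u with u <? U
        ... | yes u<U = proj₁ (last-chosen u u<U)
        ... | no _    = proj₁ (last-chosen 0 0<U)

        θ-last : ∀ u → u < U → Chosen (u , agent true (θ u) last)
        θ-last u l with u <? U
        ... | yes u<U = proj₂ (last-chosen u u<U)
        ... | no u≮U  = contradiction l u≮U

        picked : ∀ u → u < U → ∀ k → Chosen (u , agent true (θ u) k)
        picked u u<U = >-weakInduction (λ k → Chosen (u , agent true (θ u) k)) (θ-last u u<U) down
          where
          down : ∀ i → Chosen (u , agent true (θ u) (suc i)) → Chosen (u , agent true (θ u) (inject₁ i))
          down i c = [ (λ d → d) , (λ d → contradiction (there (here refl))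
            (conflict u u {p = chain true (θ u) (suc (inject₁ i)) , u + 0} refl refl c d (λ ()) (there (here refl)))) ]′
            (one-chosen u u<U (θ u) (inject₁ i))

        at-role : ∀ u → u < U → ∀ r n → n ∈ special (θ u) r → ∃[ k ] role k ≡ r × Chosen (u , agent true (θ u) k) × place u n ∈ needs-at (u , agent true (θ u) k)
        at-role u u<U r n m = R.index r , R.element-index r , picked u u<U (R.index r) ,
          there (there (∈-map⁺ (place u) (subst (λ r → n ∈ special (θ u) r) (sym (R.element-index r)) m)))

        respected : ∀ ρ u → u + shift (along ρ) < U → allowed ρ (θ u) (θ (u + shift (along ρ))) ≡ true
        respected ρ u l = Bool.¬-not λ bad →
          let v = u + shift (along ρ)
              a = θ u
              b = θ v
              k , _ , c , m = at-role u (≤-<-trans (m≤m+n u _) l) (side ρ true b) (clash ρ a b , along ρ) (special-first ρ a b bad)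
              k′ , _ , c′ , m′ = at-role v l (side ρ false a) (clash ρ a b , none) (special-second ρ a b bad)
          in conflict u v refl refl c c′ (λ eq → apart (cong proj₁ eq)) m
               (subst (λ p → (clash ρ a b , p) ∈ needs-at (v , agent true b k′)) (+-identityʳ v) m′)
          where
          apart : u ≢ u + shift (along ρ)
          apart eq = <-irrefl eq (<-≤-trans (n<1+n u) (≤-trans (≤-reflexive (+-comm 1 u)) (+-monoʳ-≤ u (along>0 ρ))))

        solution : Solution x θ
        solution = record
          { horizontal = λ u l → subst (λ v → H (θ u) (θ v) ≡ true) (+-comm u 1) (respected row u (subst (_< U) (+-comm 1 u) l))
          ; vertical   = λ u l → respected column u l
          ; signed     = λ j u l → let k , _ , c , m = at-role u l (signed-by j) (sign j (θ u) , none) (here refl) in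
              subst (λ p → at (word (signs j (θ u)) x) p ≡ true) (+-identityʳ u) (supplied u refl c m)
          }

        tiling : ∃[ θ ] Solution x θ
        tiling = θ , solution

      module Complete (θ : ℕ → Fin q) (sol : Solution x θ) where

        open Solution sol

        is-painted : ∀ u a → Bool
        is-painted u a = does (θ u Fin.≟ a)

        served : ℕ × Type → Bool
        served (u , inj₁ _)          = true
        served (u , agent true a k)  = is-painted u a
        served (u , agent false a k) = not (is-painted u a)

        hub-period : ℕ → Const × ℕ
        hub-period u = chain true (θ u) (fromℕ K) , u + 0

        _≟ᵖ_ : (p r : Const × ℕ) → Dec (p ≡ r)
        _≟ᵖ_ = Product.≡-dec C._≟_ _≟ⁿ_

        use : ℕ × Type → Const × ℕ → Bool
        use (u , inj₁ _)        p = does (p ≟ᵖ hub-period u)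
        use (u , agent s a k) p = served (u , agent s a k) ∧ usable (u , agent s a k) p

        data Use : ℕ × Type → Const × ℕ → Set where
          hubs   : ∀ {u a n p} → a ≡ θ u → n ≡ fromℕ K → p ≡ u + 0 → Use (u , hub) (chain true a n , p)
          link   : ∀ {u s a k n p} → s ≡ is-painted u a → n ≡ inject₁ k → p ≡ u + 0 → Use (u , agent s a k) (chain false a n , p)
          picks  : ∀ {u a k n p} → θ u ≡ a → n ≡ inject₁ k → p ≡ u + 0 → Use (u , agent true a k) (chain true a n , p)
          skips  : ∀ {u a k n p} → θ u ≢ a → n ≡ Fin.suc k → p ≡ u + 0 → Use (u , agent false a k) (chain true a n , p)
          signs′ : ∀ {u a j k p} → θ u ≡ a → role k ≡ signed-by j → p ≡ u + 0 → Use (u , agent true a k) (sign j a , p)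
          firsts : ∀ {u ρ a b k p} → θ u ≡ a → role k ≡ side ρ true b → p ≡ u + shift (along ρ) →
                   Use (u , agent true a k) (clash ρ a b , p)
          seconds : ∀ {u ρ a b k p} → θ u ≡ b → role k ≡ side ρ false a → allowed ρ a b ≡ false → p ≡ u + 0 →
                    Use (u , agent true b k) (clash ρ a b , p)

        +0-injective : ∀ {p u v} → p ≡ u + 0 → p ≡ v + 0 → u ≡ v
        +0-injective {p} {u} {v} e f = trans (sym (+-identityʳ u)) (trans (sym e) (trans f (+-identityʳ v)))

        role-injective : ∀ k k′ {r} → role k ≡ r → role k′ ≡ r → k ≡ k′
        role-injective k k′ e f = trans (sym (R.index-element k)) (trans (cong R.index (trans e (sym f))) (R.index-element k′))

        obeys : ∀ ρ u → u + shift (along ρ) < U → allowed ρ (θ u) (θ (u + shift (along ρ))) ≡ true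
        obeys row u l = subst (λ v → H (θ u) (θ v) ≡ true) (+-comm 1 u) (horizontal u (subst (_< U) (+-comm u 1) l))
        obeys column u l = vertical u l

        clash-free : ∀ {ρ u v a b p} → v < U → θ u ≡ a → p ≡ u + shift (along ρ) → θ v ≡ b → p ≡ v + 0 → allowed ρ a b ≢ false
        clash-free {ρ} {u} {v} v<U refl e refl f bad with trans (sym (+-identityʳ v)) (trans (sym f) e)
        ... | refl with () ← trans (sym bad) (obeys ρ u v<U)

        alone′ : ∀ {α β p} → proj₁ α < U → proj₁ β < U → Use α p → Use β p → α ≡ β
        alone′ _ _ (hubs _ _ e) (hubs _ _ f) = cong (_, hub) (+0-injective e f)
        alone′ _ _ (hubs {u} a n e) (picks _ n′ _) = contradiction (trans (sym n) n′) Fin.fromℕ≢inject₁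
        alone′ _ _ (hubs a _ e) (skips ¬a _ f) with refl ← +0-injective e f = contradiction (sym a) ¬a
        alone′ _ _ (link {u} s n e) (link {u′} s′ n′ f)
          with refl ← +0-injective {u = u} {u′} e f | refl ← Fin.inject₁-injective (trans (sym n) n′) = cong (λ s → u , agent s _ _) (trans s (sym s′))
        alone′ _ _ (picks _ n _) (hubs _ n′ _) = contradiction (trans (sym n′) n) Fin.fromℕ≢inject₁
        alone′ _ _ (picks _ n e) (picks _ n′ f)
          with refl ← +0-injective e f | refl ← Fin.inject₁-injective (trans (sym n) n′) = refl
        alone′ _ _ (picks a _ e) (skips ¬a _ f) with refl ← +0-injective e f = contradiction a ¬a
        alone′ _ _ (skips ¬a _ e) (hubs a _ f) with refl ← +0-injective e f = contradiction (sym a) ¬a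
        alone′ _ _ (skips ¬a _ e) (picks a _ f) with refl ← +0-injective e f = contradiction a ¬a
        alone′ _ _ (skips _ n e) (skips _ n′ f)
          with refl ← +0-injective e f | refl ← Fin.suc-injective (trans (sym n) n′) = refl
        alone′ _ _ (signs′ {k = k} _ r e) (signs′ {k = k′} _ r′ f)
          with refl ← +0-injective e f | refl ← role-injective k k′ r r′ = refl
        alone′ _ _ (firsts {u} {ρ} {k = k} _ r e) (firsts {v} {k = k′} _ r′ f)
          with refl ← +-cancelʳ-≡ (shift (along ρ)) u v (trans (sym e) f) | refl ← role-injective k k′ r r′ = refl
        alone′ _ v<U (firsts {ρ = ρ} a _ e) (seconds b _ bad f) = contradiction bad (clash-free {ρ} v<U a e b f)
        alone′ u<U _ (seconds {ρ = ρ} b _ bad f) (firsts a _ e) = contradiction bad (clash-free {ρ} u<U a e b f)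
        alone′ _ _ (seconds {k = k} _ r _ e) (seconds {k = k′} _ r′ _ f)
          with refl ← +0-injective e f | refl ← role-injective k k′ r r′ = refl

        painted⇒≡ : ∀ {u a} → is-painted u a ≡ true → θ u ≡ a
        painted⇒≡ {u} {a} h with θ u Fin.≟ a
        ... | yes e = e

        unpainted⇒≢ : ∀ {u a} → not (is-painted u a) ≡ true → θ u ≢ a
        unpainted⇒≢ {u} {a} h with θ u Fin.≟ a
        ... | no e = e

        use-special : ∀ {u a k c p} → θ u ≡ a → ∀ r → role k ≡ r → (c , p) ∈ map (place u) (special a r) → Use (u , agent true a k) (c , p)
        use-special e (signed-by j) r (here refl) = signs′ e r refl
        use-special {a = a} e (side ρ true b) r m with allowed ρ a b | m
        ... | false | here refl = firsts e r refl
        use-special {a = b} e (side ρ false a) r m with allowed ρ a b in bad | m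
        ... | false | here refl = seconds e r bad refl

        Use-complete : ∀ α p → use α p ≡ true → Use α p
        Use-complete (u , hub) (c , p) h with (c , p) ≟ᵖ hub-period u
        ... | yes refl = hubs refl refl refl
        Use-complete (u , agent true a k) (c , p) h with ∧-true h
        ... | s , h′ with usable⇒∈ (u , agent true a k) (c , p) h′
        ...   | here refl         = link (sym s) refl refl
        ...   | there (here refl) = picks (painted⇒≡ s) refl refl
        ...   | there (there m)   = use-special (painted⇒≡ s) (role k) refl m
        Use-complete (u , agent false a k) (c , p) h with ∧-true h
        ... | s , h′ with usable⇒∈ (u , agent false a k) (c , p) h′
        ...   | here refl         = link (sym (not-true s)) refl refl
          where
          not-true : ∀ {b} → not b ≡ true → b ≡ false
          not-true {false} _ = refl
        ...   | there (here refl) = skips (unpainted⇒≢ s) refl refl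

        distinct : ∀ τ → AllPairs (λ m n → proj₁ m ≢ proj₁ n) (needs τ)
        distinct hub = AllPairs.map⁺ (AllPairs.map (λ { a≢b refl → a≢b refl }) (Unique.allFin⁺ q))
        distinct (agent false a k) = ((λ ()) ∷ []) ∷ [] ∷ []
        distinct (agent true a k) with special a (role k) | special-view a (role k)
        ... | _ | nil     = ((λ ()) ∷ []) ∷ [] ∷ []
        ... | _ | one _ _ = ((λ ()) ∷ (λ ()) ∷ []) ∷ ((λ ()) ∷ []) ∷ [] ∷ []

        find-∈ : ∀ ns {c o} → AllPairs (λ m n → proj₁ m ≢ proj₁ n) ns → (c , o) ∈ ns → find-need c ns ≡ just o
        find-∈ ((d , _) ∷ ns) _ (here refl) rewrite dec-true (d C.≟ d) refl = refl
        find-∈ ((d , _) ∷ ns) {c} (d∉ ∷ ds) (there m) with c C.≟ d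
        ... | yes refl = contradiction refl (All.lookup d∉ m)
        ... | no _     = find-∈ ns ds m

        ∈⇒usable : ∀ u τ n → n ∈ needs τ → usable (u , τ) (place u n) ≡ true
        ∈⇒usable u τ (c , o) m rewrite find-∈ (needs τ) (distinct τ) m = ≡⇒≡ᵇ-true (u + shift o)

        shift≤W : ∀ o → shift o ≤ W
        shift≤W none = z≤n
        shift≤W one  = s≤s z≤n
        shift≤W row  = ≤-refl

        in-span : ∀ {u} → u < U → ∀ o → u + shift o < Y
        in-span l o = +-mono-<-≤ l (shift≤W o)

        ∈-pn : ∀ {u} → u < U → ∀ n → place u n ∈ pn
        ∈-pn l (c , o) = ∈-cartesianProduct⁺ (C.∈-elements c) (∈-upTo⁺ (in-span l o))

        an-below : ∀ {α} → α ∈ an → proj₁ α < U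
        an-below m = ∈-upTo⁻ (proj₁ (∈-cartesianProduct⁻ (upTo U) types m))

        plenty : ∀ {p} → p < Y → at (List.replicate Y true ++ []) p ≡ true
        plenty {p} l = trans (cong (λ w → at w p) (++-identityʳ (List.replicate Y true))) (at-replicate Y true l)

        Use-available : ∀ {α p} → proj₁ α < U → Use α p → available p ≡ true
        Use-available l (hubs _ _ refl)   = plenty (in-span l none)
        Use-available l (link _ _ refl)   = plenty (in-span l none)
        Use-available l (picks _ _ refl)  = plenty (in-span l none)
        Use-available l (skips _ _ refl)  = plenty (in-span l none)
        Use-available l (firsts {ρ = ρ} _ _ refl) = plenty (in-span l (along ρ))
        Use-available l (seconds _ _ _ refl) = plenty (in-span l none)
        Use-available l (signs′ {u} {j = j} refl _ refl) = subst (λ p → at (word (signs j (θ u)) x) p ≡ true) (sym (+-identityʳ u)) (signed j u l)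

        fits : ∀ α p → use α p ≡ true → usable α p ≡ true
        fits (u , hub) p h with p ≟ᵖ hub-period u
        ... | yes refl = ∈⇒usable u hub (chain true (θ u) (fromℕ K) , none) (∈-map⁺ _ (∈-allFin (θ u)))
        fits (u , agent s a k) p h = proj₂ (∧-true {served (u , agent s a k)} h)

        bit-1 : ∀ {b} → b ≡ true → 1 ≤ bit-of b
        bit-1 refl = ≤-refl

        satisfied : ∀ α → α ∈ an → served α ≡ true → demand (proj₂ α) ≤ sumOf (bit-of ∘ use α) pn
        satisfied (u , hub) m _ = length≤sumOf (bit-of ∘ use (u , hub)) (hub-period u ∷ []) pn ([] ∷ [])
          λ { _ (here refl) → ∈-pn (an-below m) (chain true (θ u) (fromℕ K) , none) , bit-1 (dec-true (hub-period u ≟ᵖ hub-period u) refl) }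
        satisfied (u , agent s a k) m h = ≤-trans (≤-reflexive (sym (length-needs u (agent s a k))))
          (length≤sumOf (bit-of ∘ use (u , agent s a k)) (needs-at (u , agent s a k)) pn
            (AllPairs.map⁺ (AllPairs.map (λ ≢ e → ≢ (cong proj₁ e)) (distinct (agent s a k)))) used)
          where
          used : ∀ p → p ∈ needs-at (u , agent s a k) → p ∈ pn × 1 ≤ bit-of (use (u , agent s a k) p)
          used p m′ with ∈-map⁻ (place u) m′
          ... | n , m″ , refl = ∈-pn (an-below m) n , bit-1 (cong₂ _∧_ h (∈⇒usable u (agent s a k) n m″))

        an-unique : Unique an
        an-unique = Unique.cartesianProduct⁺ (Unique.upTo⁺ U) (All.++⁺ (no-hub true) (no-hub false) ∷
          Unique.++⁺ (Unique.map⁺ (λ { refl → refl }) pairs-unique) (Unique.map⁺ (λ { refl → refl }) pairs-unique) disjoint)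
          where
          pairs-unique : Unique pairs
          pairs-unique = Finite.elements-unique (finite-× (finite-Fin q) (finite-Fin K))
          no-hub : ∀ s → All (λ τ → _≢_ {A = Type} hub τ) (map (λ ak → inj₂ (s , ak)) pairs)
          no-hub s = All.map⁺ (All.tabulate λ _ → λ ())
          disjoint : ∀ {τ} → ¬ (τ ∈ map pick pairs × τ ∈ map skip pairs)
          disjoint (m , m′) with ∈-map⁻ pick m | ∈-map⁻ skip m′
          ... | _ , _ , refl | _ , _ , ()

        total : U * suc (length pairs) ≤ sumOf (bit-of ∘ served) an
        total = ≤-reflexive (sym (begin
          sumOf (bit-of ∘ served) an                                          ≡⟨ sumOf-product (bit-of ∘ served) (upTo U) types ⟩
          sumOf (λ u → sumOf (λ τ → bit-of (served (u , τ))) types) (upTo U)  ≡⟨ each (upTo U) ⟩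
          length (upTo U) * suc (length pairs)                                ≡⟨ cong (_* suc (length pairs)) (length-upTo U) ⟩
          U * suc (length pairs)                                              ∎))
          where
          open ≡-Reasoning
          one-of : ∀ u aks → sumOf (λ ak → bit-of (served (u , pick ak)) + bit-of (served (u , skip ak))) aks ≡ length aks
          one-of u []        = refl
          one-of u ((a , _) ∷ aks) = cong₂ _+_ (bits (is-painted u a)) (one-of u aks)
            where
            bits : ∀ b → bit-of b + bit-of (not b) ≡ 1
            bits true  = refl
            bits false = refl
          each : ∀ us → sumOf (λ u → sumOf (λ τ → bit-of (served (u , τ))) types) us ≡ length us * suc (length pairs)
          each []       = refl
          each (u ∷ us) = cong₂ _+_ (trans (sum-types (λ τ → bit-of (served (u , τ)))) (cong suc (one-of u pairs))) (each us)

        achievable : Achievable problem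
        achievable = achieved use served an-unique fits
          (λ α β p m m′ h h′ → alone′ (an-below m) (an-below m′) (Use-complete α p h) (Use-complete β p h′))
          (λ α p m h → Use-available (an-below m) (Use-complete α p h)) satisfied total

      gadget : (∃[ θ ] Solution x θ) ⇔ Achievable problem
      gadget = mk⇔ (λ (θ , sol) → Complete.achievable θ sol)
                   (λ a → Sound.tiling (achievable⇒selection I a))

module Printing where

  open StackPrograms using (top; Stacks; popAt; choose)
  open LoopPrograms
  open Encodings
  open TilingSystems using (Piece; times; onInput; piece; Word; word; poly-mono)

  module _ {A : Set} where

    iterate : ℕ → (A → A) → A → A
    iterate zero    f a = a
    iterate (suc n) f a = iterate n f (f a)

    iterate-+ : ∀ m n f a → iterate (m + n) f a ≡ iterate n f (iterate m f a)
    iterate-+ zero    n f a = refl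
    iterate-+ (suc m) n f a = iterate-+ m n f (f a)

    iterate-* : ∀ m n f a → iterate (m * n) f a ≡ iterate m (iterate n f) a
    iterate-* zero    n f a = refl
    iterate-* (suc m) n f a = trans (iterate-+ n (m * n) f a) (iterate-* m n f (iterate n f a))

    iterate-cong : ∀ n {f g : A → A} → (∀ a → f a ≡ g a) → ∀ a → iterate n f a ≡ iterate n g a
    iterate-cong zero    h a = refl
    iterate-cong (suc n) h a = trans (cong (iterate n _) (h a)) (iterate-cong n h _)

    iterate-id : ∀ n {f : A → A} {a} → f a ≡ a → iterate n f a ≡ a
    iterate-id zero    e = refl
    iterate-id (suc n) {f} e = trans (cong (iterate n f) e) (iterate-id n e)

  replicate-∷ : ∀ {A : Set} n (a : A) w → replicate n a ++ a ∷ w ≡ a ∷ replicate n a ++ w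
  replicate-∷ zero    a w = refl
  replicate-∷ (suc n) a w = cong (a ∷_) (replicate-∷ n a w)

  replicate-+ : ∀ {A : Set} m n (a : A) → replicate (m + n) a ≡ replicate m a ++ replicate n a
  replicate-+ zero    n a = refl
  replicate-+ (suc m) n a = cong (a ∷_) (replicate-+ m n a)

  module _ {k : ℕ} where

    times-do : ℕ → Gen k → Gen k
    times-do zero    P = skip
    times-do (suc n) P = P ⍮ times-do n P

    repeat : Poly → Gen k → Gen k
    repeat (con n) P = times-do n P
    repeat var     P = for P P
    repeat (p ⊕ q) P = repeat p P ⍮ repeat q P
    repeat (p ⊗ q) P = repeat p (repeat q P)

    exec-repeat : ∀ p P x μ → exec (repeat p P) x μ ≡ iterate (⟦ p ⟧ (length x)) (exec P x) μ
    exec-repeat (con n) P x μ = go n μ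
      where
      go : ∀ n μ → exec (times-do n P) x μ ≡ iterate n (exec P x) μ
      go zero    μ = refl
      go (suc n) μ = go n _
    exec-repeat var P x μ = go x μ
      where
      go : ∀ y μ → execs P P x y μ ≡ iterate (length y) (exec P x) μ
      go []          μ = refl
      go (false ∷ y) μ = go y _
      go (true ∷ y)  μ = go y _
    exec-repeat (p ⊕ q) P x μ = trans (exec-repeat q P x _)
      (trans (cong (iterate (⟦ q ⟧ (length x)) (exec P x)) (exec-repeat p P x μ)) (sym (iterate-+ (⟦ p ⟧ (length x)) (⟦ q ⟧ (length x)) (exec P x) μ)))
    exec-repeat (p ⊗ q) P x μ = trans (exec-repeat p (repeat q P) x μ)
      (trans (iterate-cong (⟦ p ⟧ (length x)) (exec-repeat q P x) μ) (sym (iterate-* (⟦ p ⟧ (length x)) (⟦ q ⟧ (length x)) (exec P x) μ)))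

    each : Fin k → (Bool → Gen k) → Gen k
    each r P = case r skip (pop r ⍮ P false) (pop r ⍮ P true)

    each-iterates : ∀ {A : Set} r P x (σ : Bits → A → Stacks k) (f : A → Bool → A) →
      (∀ y a → lookup (σ y a) r ≡ y) → (∀ b y a → exec (P b) x (popAt r (σ (b ∷ y) a)) ≡ σ y (f a b)) →
      ∀ n y a → length y ≤ n → iterate n (exec (each r P) x) (σ y a) ≡ σ [] (foldl f a y)
    each-iterates r P x σ f look does n [] a _ = iterate-id n (idle (look [] a))
      where
      idle : ∀ {s} → s ≡ [] → choose (top s) (σ [] a) (exec (P false) x (popAt r (σ [] a))) (exec (P true) x (popAt r (σ [] a))) ≡ σ [] a
      idle refl = refl
    each-iterates r P x σ f look does (suc n) (b ∷ y) a (s≤s l) =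
      trans (cong (iterate n (exec (each r P) x)) (one b (look (b ∷ y) a))) (each-iterates r P x σ f look does n y (f a b) l)
      where
      one : ∀ b {s} → s ≡ b ∷ y →
        choose (top s) (σ (b ∷ y) a) (exec (P false) x (popAt r (σ (b ∷ y) a))) (exec (P true) x (popAt r (σ (b ∷ y) a))) ≡ σ y (f a b)
      one false refl = does false y a
      one true  refl = does true y a

  pattern out   = zero
  pattern below = suc zero
  pattern above = suc (suc zero)
  pattern num   = suc (suc (suc zero))
  pattern tmp   = suc (suc (suc (suc zero)))

  Program : Set
  Program = Gen 5

  stacks : Bits → Bits → Bits → Bits → Bits → Stacks 5
  stacks o l r a t = o ∷ l ∷ r ∷ a ∷ t ∷ []

  -- The output is printed from its last bit to its first one.
  record Prints (P : Program) (x l r w : Bits) : Set where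
    constructor prints
    field run : ∀ o → exec P x (stacks o l r [] []) ≡ stacks (w ++ o) l r [] []

  open Prints

  infixr 5 _before_

  _before_ : Program → Program → Program
  P before Q = Q ⍮ P

  literal : Bits → Program
  literal []      = skip
  literal (b ∷ w) = literal w ⍮ push out b

  forAll : ∀ {A : Set} → (A → Program) → List A → Program
  forAll P []       = skip
  forAll P (a ∷ as) = P a before forAll P as

  module _ {x : Bits} where

    private
      n : ℕ
      n = length x

    before-prints : ∀ {P Q l r v w} → Prints P x l r v → Prints Q x l r w → Prints (P before Q) x l r (v ++ w)
    before-prints {P} {Q} {l} {r} {v} {w} p q = prints λ o →
      trans (cong (exec P x) (run q o)) (trans (run p (w ++ o)) (cong (λ o → stacks o l r [] []) (sym (++-assoc v w o))))

    skip-prints : ∀ {l r} → Prints skip x l r []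
    skip-prints = prints λ o → refl

    exec-literal : ∀ w o l r a t → exec (literal w) x (stacks o l r a t) ≡ stacks (w ++ o) l r a t
    exec-literal []      o l r a t = refl
    exec-literal (b ∷ w) o l r a t rewrite exec-literal w o l r a t = refl

    literal-prints : ∀ w {l r} → Prints (literal w) x l r w
    literal-prints w {l} {r} = prints λ o → exec-literal w o l r [] []

    forAll-prints : ∀ {A : Set} {P : A → Program} {f : A → Bits} {l r} as → (∀ a → Prints (P a) x l r (f a)) →
                    Prints (forAll P as) x l r (concatMap f as)
    forAll-prints []       h = skip-prints
    forAll-prints (a ∷ as) h = before-prints (h a) (forAll-prints as h)

    repeat-prints : ∀ p {P l r w} → Prints P x l r w → Prints (repeat p P) x l r (concatMap {A = Bool} (λ _ → w) (replicate (⟦ p ⟧ n) true))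
    repeat-prints p {P} {l} {r} {w} h = prints λ o → trans (exec-repeat p P x _) (go (⟦ p ⟧ n) o)
      where
      rotate : ∀ i o → concatMap {A = Bool} (λ _ → w) (replicate i true) ++ w ++ o ≡ w ++ concatMap {A = Bool} (λ _ → w) (replicate i true) ++ o
      rotate zero    o = refl
      rotate (suc i) o = trans (++-assoc w _ _) (cong (w ++_) (trans (rotate i o) (sym (++-assoc w _ o))))
      go : ∀ i o → iterate i (exec P x) (stacks o l r [] []) ≡ stacks (concatMap {A = Bool} (λ _ → w) (replicate i true) ++ o) l r [] []
      go zero    o = refl
      go (suc i) o = trans (cong (iterate i (exec P x)) (run h o)) (trans (go i (w ++ o))
        (cong (λ o → stacks o l r [] []) (trans (rotate i o) (sym (++-assoc w _ o)))))

  concatMap-replicate : ∀ (f : Bool → Bits) i b → concatMap f (replicate i b) ≡ concatMap (λ _ → f b) (replicate i true)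
  concatMap-replicate f zero    b = refl
  concatMap-replicate f (suc i) b = cong (f b ++_) (concatMap-replicate f i b)

  concatMap-singletons : ∀ i (b : Bool) → concatMap {A = Bool} (λ _ → b ∷ []) (replicate i true) ≡ replicate i b
  concatMap-singletons zero    b = refl
  concatMap-singletons (suc i) b = cong (b ∷_) (concatMap-singletons i b)

  foldl-reverse : ∀ (g : Bool → Bits) y o → foldl (λ o b → g b ++ o) o (List.reverse y) ≡ concatMap g y ++ o
  foldl-reverse g []      o = refl
  foldl-reverse g (b ∷ y) o = begin
    foldl f o (List.reverse (b ∷ y))    ≡⟨ cong (foldl f o) (ʳ++-defn y {b ∷ []}) ⟩
    foldl f o (List.reverse y ++ b ∷ []) ≡⟨ foldl-∷ʳ f o b (List.reverse y) ⟩
    g b ++ foldl f o (List.reverse y)   ≡⟨ cong (g b ++_) (foldl-reverse g y o) ⟩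
    g b ++ concatMap g y ++ o           ≡⟨ ++-assoc (g b) _ o ⟨
    (g b ++ concatMap g y) ++ o         ∎
    where
    open ≡-Reasoning
    f : Bits → Bool → Bits
    f o b = g b ++ o

  length-reverse : ∀ (y : Bits) → length (List.reverse y) ≡ length y
  length-reverse = Data.List.Properties.length-reverse
    where import Data.List.Properties

  increment : Bits → Bits
  increment []           = false ∷ []
  increment (false ∷ ds) = true ∷ ds
  increment (true ∷ ds)  = false ∷ increment ds

  val-increment : ∀ ds → val (increment ds) ≡ suc (val ds)
  val-increment []           = refl
  val-increment (false ∷ ds) = arith (val ds)
    where
    arith : ∀ v → 2 * suc v ≡ suc (suc (2 * v))
    arith = solve-∀
  val-increment (true ∷ ds) = cong (λ v → suc (2 * v)) (val-increment ds)

  length≤val : ∀ ds → length ds ≤ val ds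
  length≤val []           = z≤n
  length≤val (false ∷ ds) = s≤s (≤-trans (length≤val ds) (m≤m+n (val ds) _))
  length≤val (true ∷ ds)  = ≤-trans (s≤s (length≤val ds)) (m≤m+n (suc (val ds)) _)

  carry settle restore : Poly → Program
  carry p   = repeat p (case num skip skip (pop num ⍮ push tmp false))
  settle p  = case num (push num false) (pop num ⍮ push num true) skip
  restore p = repeat p (each tmp (λ b → push num b))

  succeed : Poly → Program
  succeed p = carry p ⍮ settle p ⍮ restore p

  printDigits : Poly → Program
  printDigits p = push out false ⍮ repeat p (each num (λ b → push tmp b)) ⍮ repeat p (each tmp (λ b → literal (true ∷ b ∷ [])))

  number : Poly → Program
  number p = repeat p (succeed p) ⍮ printDigits p

  module _ {x : Bits} (p : Poly) where

    private
      N : ℕ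
      N = ⟦ p ⟧ (length x)

    record Carried (ds t : Bits) (μ : Stacks 5) (o l r : Bits) : Set where
      constructor carried
      field
        {ones} : ℕ
        {rest} : Bits
        state  : μ ≡ stacks o l r rest (replicate ones false ++ t)
        value  : replicate ones false ++ rest ≡ increment ds
        short  : ones ≤ length ds

    carries : ∀ ds n t o l r → length ds ≤ n →
      Carried ds t (exec (settle p) x (iterate n (exec (case num skip skip (pop num ⍮ push tmp false)) x) (stacks o l r ds t))) o l r
    carries [] n t o l r _
      rewrite iterate-id n {exec (case num skip skip (pop num ⍮ push tmp false)) x} {stacks o l r [] t} refl =
      carried {ones = 0} refl refl z≤n
    carries (false ∷ ds) n t o l r _
      rewrite iterate-id n {exec (case num skip skip (pop num ⍮ push tmp false)) x} {stacks o l r (false ∷ ds) t} refl =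
      carried {ones = 0} refl refl z≤n
    carries (true ∷ ds) (suc n) t o l r (s≤s le) with carries ds n (false ∷ t) o l r le
    ... | carried {j} {rest} e v s = carried {ones = suc j} (trans e (cong (stacks o l r rest) (replicate-∷ j false t))) (cong (false ∷_) v) (s≤s s)

    exec-succeed : ∀ ds o l r → length ds ≤ N → exec (succeed p) x (stacks o l r ds []) ≡ stacks o l r (increment ds) []
    exec-succeed ds o l r le
      rewrite exec-repeat p (case num skip skip (pop num ⍮ push tmp false)) x (stacks o l r ds []) with carries ds N [] o l r le
    ... | carried {j} {rest} e v s = trans (cong (exec (restore p) x) e) (trans (exec-repeat p (each tmp (λ b → push num b)) x _)
      (trans (each-iterates tmp (λ b → push num b) x (λ y a → stacks o l r a y) (λ a b → b ∷ a) (λ _ _ → refl)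
               (λ { false _ _ → refl ; true _ _ → refl }) N (replicate j false ++ []) rest bound)
        (cong (λ a → stacks o l r a []) (trans (back j rest) v))))
      where
      bound : length (replicate j false ++ []) ≤ N
      bound = ≤-trans (≤-reflexive (trans (cong length (++-identityʳ (replicate j false))) (length-replicate j))) (≤-trans s le)
      back : ∀ j rest → foldl (λ a b → b ∷ a) rest (replicate j false ++ []) ≡ replicate j false ++ rest
      back zero    rest = refl
      back (suc j) rest = trans (back j (false ∷ rest)) (replicate-∷ j false rest)

    counts : ∀ i ds o l r → i + val ds ≤ N →
      ∃[ es ] val es ≡ i + val ds × iterate i (exec (succeed p) x) (stacks o l r ds []) ≡ stacks o l r es []
    counts zero    ds o l r le = ds , refl , refl
    counts (suc i) ds o l r le =
      let es , v , e = counts i (increment ds) o l r (≤-trans (≤-reflexive step) le)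
      in es , trans v step , trans (cong (iterate i (exec (succeed p) x)) (exec-succeed ds o l r (≤-trans (length≤val ds) (≤-trans (m≤n+m _ (suc i)) le)))) e
      where
      step : i + val (increment ds) ≡ suc i + val ds
      step = trans (cong (i +_) (val-increment ds)) (+-suc i (val ds))

    exec-digits : ∀ ds o l r → length ds ≤ N → exec (printDigits p) x (stacks o l r ds []) ≡ stacks (numeral ds ++ o) l r [] []
    exec-digits ds o l r le = begin
      exec second x (exec first x (stacks (false ∷ o) l r ds []))                  ≡⟨ cong (exec second x) (exec-repeat p (each num (λ b → push tmp b)) x _) ⟩
      exec second x (iterate N (exec (each num (λ b → push tmp b)) x) (stacks (false ∷ o) l r ds []))
        ≡⟨ cong (exec second x) (each-iterates num (λ b → push tmp b) x (λ y a → stacks (false ∷ o) l r y a) (λ a b → b ∷ a) (λ _ _ → refl) (λ { false _ _ → refl ; true _ _ → refl }) N ds [] le) ⟩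
      exec second x (stacks (false ∷ o) l r [] (List.reverse ds))                  ≡⟨ exec-repeat p (each tmp (λ b → literal (true ∷ b ∷ []))) x _ ⟩
      iterate N (exec (each tmp (λ b → literal (true ∷ b ∷ []))) x) (stacks (false ∷ o) l r [] (List.reverse ds))
        ≡⟨ each-iterates tmp (λ b → literal (true ∷ b ∷ [])) x (λ y a → stacks a l r [] y) (λ a b → true ∷ b ∷ a) (λ _ _ → refl) (λ { false _ _ → refl ; true _ _ → refl }) N
             (List.reverse ds) (false ∷ o) (≤-trans (≤-reflexive (length-reverse ds)) le) ⟩
      stacks (foldl (λ a b → true ∷ b ∷ a) (false ∷ o) (List.reverse ds)) l r [] []  ≡⟨ cong (λ o → stacks o l r [] []) (trans (foldl-reverse (λ b → true ∷ b ∷ []) ds (false ∷ o)) (spell ds)) ⟩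
      stacks (numeral ds ++ o) l r [] [] ∎
      where
      open ≡-Reasoning
      first second : Program
      first  = repeat p (each num (λ b → push tmp b))
      second = repeat p (each tmp (λ b → literal (true ∷ b ∷ [])))
      spell : ∀ ds → concatMap (λ b → true ∷ b ∷ []) ds ++ false ∷ o ≡ numeral ds ++ o
      spell []       = refl
      spell (d ∷ ds) = cong (λ w → true ∷ d ∷ w) (spell ds)

    number-prints : ∀ {l r} → Prints (number p) x l r (encodeℕ N)
    number-prints {l} {r} = prints go
      where
      go : ∀ o → exec (number p) x (stacks o l r [] []) ≡ stacks (encodeℕ N ++ o) l r [] []
      go o with counts N [] o l r (≤-reflexive (+-identityʳ N))
      ... | es , v , e = begin
        exec (printDigits p) x (exec (repeat p (succeed p)) x (stacks o l r [] []))        ≡⟨ cong (exec (printDigits p) x) (trans (exec-repeat p (succeed p) x _) e) ⟩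
        exec (printDigits p) x (stacks o l r es [])                                        ≡⟨ exec-digits es o l r (≤-trans (length≤val es) (≤-reflexive N≡)) ⟩
        stacks (numeral es ++ o) l r [] []                                                 ≡⟨ cong (λ w → stacks (w ++ o) l r [] []) (trans (sym (encodeℕ-val es)) (cong encodeℕ N≡)) ⟩
        stacks (encodeℕ N ++ o) l r [] []                                                  ∎
        where
        open ≡-Reasoning
        N≡ : val es ≡ N
        N≡ = trans v (+-identityʳ N)

  spread : (Bool → Bits) → Piece → Program
  spread g (times p b) = repeat p (literal (g b))
  spread g (onInput f) = for (push tmp false) (push tmp true) ⍮ repeat var (each tmp (λ b → literal (g (f b))))

  spread-prints : ∀ g q {x l r} → Prints (spread g q) x l r (concatMap g (piece q x))
  spread-prints g (times p b) {x} = prints λ o → trans (run (repeat-prints p (literal-prints (g b))) o)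
    (cong (λ w → stacks (w ++ o) _ _ [] []) (sym (concatMap-replicate g (⟦ p ⟧ (length x)) b)))
  spread-prints g (onInput f) {x} {l} {r} = prints λ o → begin
    exec second x (execs (push tmp false) (push tmp true) x x (stacks o l r [] []))  ≡⟨ cong (exec second x) (copy x []) ⟩
    exec second x (stacks o l r [] (List.reverse x))                                 ≡⟨ exec-repeat var (each tmp (λ b → literal (g (f b)))) x _ ⟩
    iterate (length x) (exec (each tmp (λ b → literal (g (f b)))) x) (stacks o l r [] (List.reverse x))
      ≡⟨ each-iterates tmp (λ b → literal (g (f b))) x (λ y a → stacks a l r [] y) (λ a b → g (f b) ++ a) (λ _ _ → refl)
           (λ { b y a → exec-literal {x} (g (f b)) a l r [] y }) (length x) (List.reverse x) o (≤-reflexive (length-reverse x)) ⟩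
    stacks (foldl (λ a b → g (f b) ++ a) o (List.reverse x)) l r [] []               ≡⟨ cong (λ o → stacks o l r [] []) (trans (foldl-reverse (g ∘ f) x o) (cong (_++ o) (sym (concatMap-map g f x)))) ⟩
    stacks (concatMap g (map f x) ++ o) l r [] [] ∎
    where
    open ≡-Reasoning
    second : Program
    second = repeat var (each tmp (λ b → literal (g (f b))))
    copy : ∀ {o} y t → execs (push tmp false) (push tmp true) x y (stacks o l r [] t) ≡ stacks o l r [] (foldl (λ t b → b ∷ t) t y)
    copy []          t = refl
    copy (false ∷ y) t = copy y (false ∷ t)
    copy (true ∷ y)  t = copy y (true ∷ t)

  concatMap-concatMap : ∀ {A B : Set} (g : B → Bits) (f : A → List B) as → concatMap g (concatMap f as) ≡ concatMap (λ a → concatMap g (f a)) as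
  concatMap-concatMap g f []       = refl
  concatMap-concatMap g f (a ∷ as) = trans (concatMap-++ g (f a) (concatMap f as)) (cong (concatMap g (f a) ++_) (concatMap-concatMap g f as))

  copy : Fin 5 → Poly → Program
  copy s p = repeat p (each s (λ b → push tmp b ⍮ push out b)) ⍮ repeat p (each tmp (λ b → push s b))

  module _ {x : Bits} (p : Poly) where

    private
      N : ℕ
      N = ⟦ p ⟧ (length x)
      both : Bits × Bits → Bool → Bits × Bits
      both (o , t) b = b ∷ o , b ∷ t
      foldl-true : ∀ u t → foldl (λ t b → b ∷ t) t (replicate u true) ≡ replicate u true ++ t
      foldl-true zero    t = refl
      foldl-true (suc u) t = trans (foldl-true u (true ∷ t)) (replicate-∷ u true t)
      foldl-both : ∀ u o t → foldl both (o , t) (replicate u true) ≡ (replicate u true ++ o , replicate u true ++ t)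
      foldl-both zero    o t = refl
      foldl-both (suc u) o t = trans (foldl-both u (true ∷ o) (true ∷ t)) (cong₂ _,_ (replicate-∷ u true o) (replicate-∷ u true t))

      exec-copy : ∀ s (σ : Bits → Bits → Bits → Stacks 5) →
        (∀ y o t → lookup (σ y o t) s ≡ y) →
        (∀ b y o t → exec (push tmp b ⍮ push out b) x (popAt s (σ (b ∷ y) o t)) ≡ σ y (b ∷ o) (b ∷ t)) →
        (∀ y o t → lookup (σ y o t) tmp ≡ t) →
        (∀ b y o t → exec (push s b) x (popAt tmp (σ y o (b ∷ t))) ≡ σ (b ∷ y) o t) →
        ∀ u o → u ≤ N → exec (copy s p) x (σ (replicate u true) o []) ≡ σ (replicate u true) (replicate u true ++ o) []
      exec-copy s σ look pops look′ pushes u o le = begin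
        exec second x (exec first x (σ us o []))                ≡⟨ cong (exec second x) (exec-repeat p (each s (λ b → push tmp b ⍮ push out b)) x (σ us o [])) ⟩
        exec second x (iterate N (exec (each s (λ b → push tmp b ⍮ push out b)) x) (σ us o []))
          ≡⟨ cong (exec second x) (each-iterates s (λ b → push tmp b ⍮ push out b) x (λ y a → σ y (proj₁ a) (proj₂ a)) both
               (λ y a → look y (proj₁ a) (proj₂ a)) (λ b y a → pops b y (proj₁ a) (proj₂ a)) N us (o , []) bound) ⟩
        exec second x (σ [] (proj₁ (foldl both (o , []) us)) (proj₂ (foldl both (o , []) us)))
          ≡⟨ cong (λ a → exec second x (σ [] (proj₁ a) (proj₂ a))) (trans (foldl-both u o []) (cong (us ++ o ,_) (++-identityʳ us))) ⟩
        exec second x (σ [] (us ++ o) us)                       ≡⟨ exec-repeat p (each tmp (λ b → push s b)) x (σ [] (us ++ o) us) ⟩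
        iterate N (exec (each tmp (λ b → push s b)) x) (σ [] (us ++ o) us)
          ≡⟨ each-iterates tmp (λ b → push s b) x (λ t y → σ y (us ++ o) t) (λ y b → b ∷ y)
               (λ t y → look′ y (us ++ o) t) (λ b t y → pushes b y (us ++ o) t) N us [] bound ⟩
        σ (foldl (λ y b → b ∷ y) [] us) (us ++ o) []            ≡⟨ cong (λ y → σ y (us ++ o) []) (trans (foldl-true u []) (++-identityʳ us)) ⟩
        σ us (us ++ o) []                                       ∎
        where
        open ≡-Reasoning
        us : Bits
        us = replicate u true
        first second : Program
        first  = repeat p (each s (λ b → push tmp b ⍮ push out b))
        second = repeat p (each tmp (λ b → push s b))
        bound : length us ≤ N
        bound = ≤-trans (≤-reflexive (length-replicate u)) le

    copy-below-prints : ∀ u r → u ≤ N → Prints (copy below p) x (replicate u true) r (replicate u true)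
    copy-below-prints u r le = prints λ o → exec-copy below (λ y o t → stacks o y r [] t)
      (λ _ _ _ → refl) (λ _ _ _ _ → refl) (λ _ _ _ → refl) (λ _ _ _ _ → refl) u o le

    copy-above-prints : ∀ l v → v ≤ N → Prints (copy above p) x l (replicate v true) (replicate v true)
    copy-above-prints l v le = prints λ o → exec-copy above (λ y o t → stacks o l y [] t)
      (λ _ _ _ → refl) (λ _ _ _ _ → refl) (λ _ _ _ → refl) (λ _ _ _ _ → refl) v o le

module BlueprintPrinting where

  open LoopPrograms
  open TilingSystems using (Piece; Word; word; piece; at)
  open NamedInstances using (bit-of)
  open Blueprints
  open Printing

  length-product : ∀ {A B : Set} (as : List A) (bs : List B) → length (cartesianProduct as bs) ≡ length as * length bs
  length-product []       bs = refl
  length-product (a ∷ as) bs = trans (length-++ (map (a ,_) bs)) (cong₂ _+_ (length-map (a ,_) bs) (length-product as bs))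

  map-product : ∀ {A B C : Set} (f : A × B → C) as bs → map f (cartesianProduct as bs) ≡ concatMap (λ a → map (λ b → f (a , b)) bs) as
  map-product f []       bs = refl
  map-product f (a ∷ as) bs = trans (map-++ f (map (a ,_) bs) _) (cong₂ _++_ (sym (map-∘ bs)) (map-product f as bs))

  map-fromList : ∀ {A B : Set} (f : A → B) as → Vec.toList (Vec.map f (Vec.fromList as)) ≡ map f as
  map-fromList f as = trans (toList-map f (Vec.fromList as)) (cong (map f) (toList∘fromList as))

  map-upTo : ∀ {A : Set} (f : ℕ → A) n → map f (upTo n) ≡ applyUpTo f n
  map-upTo f n = map-applyUpTo (λ i → i) f n

  map-at : ∀ w → map (at w) (upTo (length w)) ≡ w
  map-at w = trans (map-upTo (at w) (length w)) (go w)
    where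
    go : ∀ w → applyUpTo (at w) (length w) ≡ w
    go []      = refl
    go (b ∷ w) = cong (b ∷_) (go w)

  map-true : ∀ n → map (λ (_ : ℕ) → true) (upTo n) ≡ replicate n true
  map-true n = trans (map-upTo (λ _ → true) n) (go n)
    where
    go : ∀ n → applyUpTo (λ _ → true) n ≡ replicate n true
    go zero    = refl
    go (suc n) = cong (true ∷_) (go n)

  all-but-one : ∀ d e → map (λ p → not (p ≡ᵇ d)) (upTo (d + suc e)) ≡ replicate d true ++ false ∷ replicate e true
  all-but-one d e = trans (map-upTo (λ p → not (p ≡ᵇ d)) (d + suc e)) (go d)
    where
    go : ∀ d → applyUpTo (λ p → not (p ≡ᵇ d)) (d + suc e) ≡ replicate d true ++ false ∷ replicate e true
    go zero    = cong (false ∷_) (trans (sym (map-upTo (λ _ → true) e)) (map-true e))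
    go (suc d) = cong (true ∷_) (go d)

  module Printer (B : Blueprint) where

    open Blueprint B

    periodCount agentCount target : Poly
    periodCount = con (length consts) ⊗ span
    agentCount  = area ⊗ con (length types)
    target      = area ⊗ con quota

    trues : Poly → Program
    trues p = repeat p (literal (true ∷ []))

    middle : Shift → Program
    middle none = literal (false ∷ []) before trues (con 1 ⊕ extra)
    middle one  = literal (true ∷ false ∷ []) before trues extra
    middle row  = trues (con 1 ⊕ extra) before literal (false ∷ [])

    gapRow : Maybe Shift → Program
    gapRow nothing  = trues span
    gapRow (just o) = copy below area before middle o before copy above area

    printAgent : Type → Program
    printAgent τ = literal (encodeℕ 1) before number periodCount before literal (encodeℕ (demand τ)) before forAll (λ c → gapRow (reach τ c)) consts

    printCell : Program
    printCell = forAll printAgent types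

    printSupply : Program
    printSupply = forAll (λ c → forAll (spread (λ b → encodeℕ (bit-of b))) (supply c)) consts

    -- The cells are printed from the last one; the registers below and above
    -- hold their numbers of predecessors and successors.
    printAgents : Program
    printAgents = repeat area (push below true) ⍮ repeat area (pop below ⍮ printCell ⍮ push above true)

    header footer printer : Program
    header  = number periodCount before printSupply before number agentCount
    footer  = literal (true ∷ []) before number target
    printer = footer ⍮ printAgents ⍮ header

    module _ (x : Bits) where

      open At x

      trues-prints : ∀ p {l r} → Prints (trues p) x l r (replicate (⟦ p ⟧ (length x)) true)
      trues-prints p = subst (Prints (trues p) x _ _) (concatMap-singletons (⟦ p ⟧ (length x)) true) (repeat-prints p (literal-prints (true ∷ [])))

      trues-++ : ∀ m n (w : Bits) → replicate (m + n) true ++ w ≡ replicate m true ++ replicate n true ++ w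
      trues-++ m n w = trans (cong (_++ w) (replicate-+ m n true)) (++-assoc (replicate m true) _ w)

      rowText : Maybe Shift → ℕ → Bits
      rowText m u = map (λ p → not (reached m u p)) (upTo Y)

      middleText : Shift → Bits
      middleText none = (false ∷ []) ++ replicate W true
      middleText one  = (true ∷ false ∷ []) ++ replicate (⟦ extra ⟧ (length x)) true
      middleText row  = replicate W true ++ false ∷ []

      middle-prints : ∀ o {l r} → Prints (middle o) x l r (middleText o)
      middle-prints none = before-prints (literal-prints (false ∷ [])) (trues-prints (con 1 ⊕ extra))
      middle-prints one  = before-prints (literal-prints (true ∷ false ∷ [])) (trues-prints extra)
      middle-prints row  = before-prints (trues-prints (con 1 ⊕ extra)) (literal-prints (false ∷ []))

      module _ {u v : ℕ} (at-cell : u + suc v ≡ U) where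

        private
          us vs : Bits
          us = replicate u true
          vs = replicate v true

        row-text : ∀ o → rowText (just o) u ≡ us ++ middleText o ++ vs
        row-text o = trans (cong (λ y → map (λ p → not (reached (just o) u p)) (upTo y)) (trans (cong (_+ W) (sym at-cell)) (total o)))
            (trans (all-but-one (u + shift o) (after o)) (parts o))
          where
          after : Shift → ℕ
          after none = W + v
          after one  = ⟦ extra ⟧ (length x) + v
          after row  = v
          total : ∀ o → u + suc v + W ≡ u + shift o + suc (after o)
          total none = arith u v W
            where
            arith : ∀ u v w → u + suc v + w ≡ u + 0 + suc (w + v)
            arith = solve-∀
          total one = arith u v (⟦ extra ⟧ (length x))
            where
            arith : ∀ u v e → u + suc v + suc e ≡ u + 1 + suc (e + v)
            arith = solve-∀
          total row = arith u v W
            where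
            arith : ∀ u v w → u + suc v + w ≡ u + w + suc v
            arith = solve-∀
          parts : ∀ o → replicate (u + shift o) true ++ false ∷ replicate (after o) true ≡ us ++ middleText o ++ vs
          parts none = trans (trues-++ u 0 _) (cong (λ w → us ++ false ∷ w) (replicate-+ W v true))
          parts one  = trans (trues-++ u 1 _) (cong (λ w → us ++ true ∷ false ∷ w) (replicate-+ (⟦ extra ⟧ (length x)) v true))
          parts row  = trans (trues-++ u W _) (cong (us ++_) (sym (++-assoc (replicate W true) (false ∷ []) vs)))

        gapRow-prints : ∀ m → Prints (gapRow m) x us vs (rowText m u)
        gapRow-prints nothing  = subst (Prints (trues span) x us vs) (sym (map-true Y)) (trues-prints span)
        gapRow-prints (just o) = subst (Prints (gapRow (just o)) x us vs) (sym (row-text o))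
          (before-prints (copy-below-prints area u vs (≤-trans (m≤m+n u (suc v)) (≤-reflexive at-cell)))
            (before-prints (middle-prints o) (copy-above-prints area us v (≤-trans (n≤1+n v) (≤-trans (m≤n+m (suc v) u) (≤-reflexive at-cell))))))

      periodCount≡ : ⟦ periodCount ⟧ (length x) ≡ T
      periodCount≡ = sym (trans (length-product consts (upTo Y)) (cong (length consts *_) (length-upTo Y)))

      agentCount≡ : ⟦ agentCount ⟧ (length x) ≡ n
      agentCount≡ = sym (trans (length-product (upTo U) types) (cong (_* length types) (length-upTo U)))

      number-prints′ : ∀ p {l r m} → ⟦ p ⟧ (length x) ≡ m → Prints (number p) x l r (encodeℕ m)
      number-prints′ p refl = number-prints p

      encodeAgent-text : ∀ u τ → encodeAgent (agent-of (u , τ)) ≡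
        encodeℕ 1 ++ encodeℕ T ++ encodeℕ (demand τ) ++ concatMap (λ c → rowText (reach τ c) u) consts
      encodeAgent-text u τ = cong₂ (λ d w → encodeℕ 1 ++ encodeℕ d ++ encodeℕ (demand τ) ++ w) (proj₂ last-period)
        (trans (map-fromList (λ p → not (usable (u , τ) p)) periods) (map-product (λ p → not (usable (u , τ) p)) consts (upTo Y)))

      cellText : ℕ → Bits
      cellText u = concatMap (λ τ → encodeAgent (agent-of (u , τ))) types

      printCell-prints : ∀ {u v} → u + suc v ≡ U → Prints printCell x (replicate u true) (replicate v true) (cellText u)
      printCell-prints {u} {v} at-cell = forAll-prints types λ τ →
        subst (Prints (printAgent τ) x _ _) (sym (encodeAgent-text u τ))
          (before-prints (literal-prints (encodeℕ 1)) (before-prints (number-prints′ periodCount periodCount≡)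
            (before-prints (literal-prints (encodeℕ (demand τ))) (forAll-prints consts (λ c → gapRow-prints at-cell (reach τ c))))))

      supplyText : Bits
      supplyText = concatMap (λ c → concatMap (λ q → concatMap (λ b → encodeℕ (bit-of b)) (piece q x)) (supply c)) consts

      supplyText≡ : supplyText ≡ concatMap encodeℕ (Vec.toList (Scheduling.supply I))
      supplyText≡ = sym (begin
        concatMap encodeℕ (Vec.toList (Scheduling.supply I))      ≡⟨ cong (concatMap encodeℕ) (map-fromList supply-of periods) ⟩
        concatMap encodeℕ (map supply-of periods)                 ≡⟨ cong (concatMap encodeℕ) (map-product supply-of consts (upTo Y)) ⟩
        concatMap encodeℕ (concatMap (λ c → map (λ p → supply-of (c , p)) (upTo Y)) consts)
                                                                  ≡⟨ concatMap-concatMap encodeℕ (λ c → map (λ p → supply-of (c , p)) (upTo Y)) consts ⟩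
        concatMap (λ c → concatMap encodeℕ (map (λ p → supply-of (c , p)) (upTo Y))) consts  ≡⟨ concatMap-cong one-const consts ⟩
        supplyText                                                ∎)
        where
        open ≡-Reasoning
        one-const : ∀ c → concatMap encodeℕ (map (λ p → supply-of (c , p)) (upTo Y)) ≡
                          concatMap (λ q → concatMap (λ b → encodeℕ (bit-of b)) (piece q x)) (supply c)
        one-const c = begin
          concatMap encodeℕ (map (λ p → supply-of (c , p)) (upTo Y))     ≡⟨ concatMap-map encodeℕ (λ p → supply-of (c , p)) (upTo Y) ⟩
          concatMap (λ p → encodeℕ (supply-of (c , p))) (upTo Y)         ≡⟨ concatMap-map (λ b → encodeℕ (bit-of b)) (at (word (supply c) x)) (upTo Y) ⟨
          concatMap (λ b → encodeℕ (bit-of b)) (map (at (word (supply c) x)) (upTo Y))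
            ≡⟨ cong (λ y → concatMap (λ b → encodeℕ (bit-of b)) (map (at (word (supply c) x)) (upTo y))) (supply-length c x) ⟨
          concatMap (λ b → encodeℕ (bit-of b)) (map (at (word (supply c) x)) (upTo (length (word (supply c) x))))
            ≡⟨ cong (concatMap (λ b → encodeℕ (bit-of b))) (map-at (word (supply c) x)) ⟩
          concatMap (λ b → encodeℕ (bit-of b)) (word (supply c) x)       ≡⟨ concatMap-concatMap (λ b → encodeℕ (bit-of b)) (λ q → piece q x) (supply c) ⟩
          concatMap (λ q → concatMap (λ b → encodeℕ (bit-of b)) (piece q x)) (supply c) ∎

      agentsText≡ : concatMap cellText (upTo U) ≡ concatMap encodeAgent (Vec.toList (Scheduling.agents I))
      agentsText≡ = sym (begin
        concatMap encodeAgent (Vec.toList (Scheduling.agents I))           ≡⟨ cong (concatMap encodeAgent) (map-fromList agent-of agents) ⟩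
        concatMap encodeAgent (map agent-of agents)                        ≡⟨ cong (concatMap encodeAgent) (map-product agent-of (upTo U) types) ⟩
        concatMap encodeAgent (concatMap (λ u → map (λ τ → agent-of (u , τ)) types) (upTo U))
          ≡⟨ concatMap-concatMap encodeAgent (λ u → map (λ τ → agent-of (u , τ)) types) (upTo U) ⟩
        concatMap (λ u → concatMap encodeAgent (map (λ τ → agent-of (u , τ)) types)) (upTo U)
          ≡⟨ concatMap-cong (λ u → concatMap-map encodeAgent (λ τ → agent-of (u , τ)) types) (upTo U) ⟩
        concatMap cellText (upTo U)                                        ∎)
        where open ≡-Reasoning

      exec-cells : ∀ u v o → u + v ≡ U →
        iterate u (exec (pop below ⍮ printCell ⍮ push above true) x) (stacks o (replicate u true) (replicate v true) [] []) ≡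
        stacks (concatMap cellText (upTo u) ++ o) [] (replicate U true) [] []
      exec-cells zero    v o refl = refl
      exec-cells (suc u) v o e = begin
        iterate u f (exec (push above true) x (exec printCell x (stacks o (replicate u true) (replicate v true) [] [])))
          ≡⟨ cong (λ μ → iterate u f (exec (push above true) x μ)) (Prints.run (printCell-prints {u} {v} (trans (+-suc u v) e)) o) ⟩
        iterate u f (stacks (cellText u ++ o) (replicate u true) (replicate (suc v) true) [] [])
          ≡⟨ exec-cells u (suc v) (cellText u ++ o) (trans (+-suc u v) e) ⟩
        stacks (concatMap cellText (upTo u) ++ cellText u ++ o) [] (replicate U true) [] []
          ≡⟨ cong (λ w → stacks w [] (replicate U true) [] []) text ⟩
        stacks (concatMap cellText (upTo (suc u)) ++ o) [] (replicate U true) [] [] ∎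
        where
        open ≡-Reasoning
        f = exec (pop below ⍮ printCell ⍮ push above true) x
        text : concatMap cellText (upTo u) ++ cellText u ++ o ≡ concatMap cellText (upTo (suc u)) ++ o
        text = trans (sym (++-assoc (concatMap cellText (upTo u)) (cellText u) o)) (cong (_++ o) (sym (begin
          concatMap cellText (upTo (suc u))                          ≡⟨ cong (concatMap cellText) (upTo-∷ʳ u) ⟨
          concatMap cellText (upTo u ++ u ∷ [])                      ≡⟨ concatMap-++ cellText (upTo u) (u ∷ []) ⟩
          concatMap cellText (upTo u) ++ concatMap cellText (u ∷ []) ≡⟨ cong (concatMap cellText (upTo u) ++_) (++-identityʳ (cellText u)) ⟩
          concatMap cellText (upTo u) ++ cellText u                  ∎)))

      exec-agents : ∀ o → exec printAgents x (stacks o [] [] [] []) ≡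
        stacks (concatMap cellText (upTo U) ++ o) [] (replicate U true) [] []
      exec-agents o = begin
        exec second x (exec (repeat area (push below true)) x (stacks o [] [] [] []))  ≡⟨ cong (exec second x) (trans (exec-repeat area (push below true) x (stacks o [] [] [] [])) (fill U [])) ⟩
        exec second x (stacks o (replicate U true ++ []) [] [] [])                     ≡⟨ cong (λ l → exec second x (stacks o l [] [] [])) (++-identityʳ (replicate U true)) ⟩
        exec second x (stacks o (replicate U true) [] [] [])                           ≡⟨ exec-repeat area (pop below ⍮ printCell ⍮ push above true) x (stacks o (replicate U true) [] [] []) ⟩
        iterate U (exec (pop below ⍮ printCell ⍮ push above true) x) (stacks o (replicate U true) [] [] [])  ≡⟨ exec-cells U 0 o (+-identityʳ U) ⟩
        stacks (concatMap cellText (upTo U) ++ o) [] (replicate U true) [] [] ∎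
        where
        open ≡-Reasoning
        second : Program
        second = repeat area (pop below ⍮ printCell ⍮ push above true)
        fill : ∀ i l → iterate i (exec (push below true) x) (stacks o l [] [] []) ≡ stacks o (replicate i true ++ l) [] [] []
        fill zero    l = refl
        fill (suc i) l = trans (fill i (true ∷ l)) (cong (λ l → stacks o l [] [] []) (replicate-∷ i true l))

      header-prints : ∀ {l r} → Prints header x l r (encodeℕ T ++ supplyText ++ encodeℕ n)
      header-prints = before-prints (number-prints′ periodCount periodCount≡)
        (before-prints (forAll-prints consts (λ c → forAll-prints (supply c) (λ q → spread-prints (λ b → encodeℕ (bit-of b)) q))) (number-prints′ agentCount agentCount≡))

      footer-prints : ∀ {l r} → Prints footer x l r (true ∷ encodeℕ (U * quota))
      footer-prints = before-prints (literal-prints (true ∷ [])) (number-prints′ target refl)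

      exec-printer : Vec.head (exec printer x (Vec.replicate 5 [])) ≡ encodeInstance problem
      exec-printer = begin
        Vec.head (exec header x (exec printAgents x (exec footer x (stacks [] [] [] [] []))))
          ≡⟨ cong (λ μ → Vec.head (exec header x (exec printAgents x μ))) (Prints.run footer-prints []) ⟩
        Vec.head (exec header x (exec printAgents x (stacks (F ++ []) [] [] [] [])))
          ≡⟨ cong (λ μ → Vec.head (exec header x μ)) (exec-agents (F ++ [])) ⟩
        Vec.head (exec header x (stacks (concatMap cellText (upTo U) ++ F ++ []) [] (replicate U true) [] []))
          ≡⟨ cong Vec.head (Prints.run header-prints (concatMap cellText (upTo U) ++ F ++ [])) ⟩
        (encodeℕ T ++ supplyText ++ encodeℕ n) ++ concatMap cellText (upTo U) ++ F ++ []
          ≡⟨ trans (++-assoc (encodeℕ T) _ _) (cong (encodeℕ T ++_) (++-assoc supplyText (encodeℕ n) _)) ⟩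
        encodeℕ T ++ supplyText ++ encodeℕ n ++ concatMap cellText (upTo U) ++ F ++ []
          ≡⟨ cong₂ (λ s a → encodeℕ T ++ s ++ encodeℕ n ++ a) supplyText≡ (cong₂ _++_ agentsText≡ (++-identityʳ F)) ⟩
        encodeInstance problem ∎
        where
        open ≡-Reasoning
        F : Bits
        F = true ∷ encodeℕ (U * quota)

module Hardness where

  open LoopPrograms
  open Encodings using (encodeInstance-injective)
  open VerifierCompleteness using (++-lengthˡ; ++-lengthʳ; concatMap-length)
  open Membership
  open TilingSystems using (TilingSystem)
  open CookLevinTilings using (cook-levin)
  open NamedInstances using (bit-of)
  open Blueprints
  open Gadgets
  open BlueprintPrinting
  open import Data.Nat.Binary.Base using (fromℕ)

  encodeℕ-nonempty : ∀ m → 1 ≤ length (encodeℕ m)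
  encodeℕ-nonempty m with fromℕ m
  ... | zero     = s≤s z≤n
  ... | 2[1+ _ ] = s≤s z≤n
  ... | 1+[2 _ ] = s≤s z≤n

  encodeAgent-nonempty : ∀ {T} (A : Agent T) → 1 ≤ length (encodeAgent A)
  encodeAgent-nonempty A = ≤-trans (encodeℕ-nonempty (Agent.value A)) (++-lengthˡ (encodeℕ (Agent.value A)) _)

  periods-bounded : ∀ I V → Scheduling.periods I ≤ length (encodeInstance (I , V))
  periods-bounded I V = ≤-trans (concatMap-length encodeℕ encodeℕ-nonempty supply)
    (≤-trans (++-lengthˡ (concatMap encodeℕ (Vec.toList supply)) _) (++-lengthʳ (encodeℕ periods) _))
    where open Scheduling I

  agents-bounded : ∀ I V → Scheduling.n I ≤ length (encodeInstance (I , V))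
  agents-bounded I V = ≤-trans (concatMap-length encodeAgent encodeAgent-nonempty agents)
    (≤-trans (++-lengthˡ (concatMap encodeAgent (Vec.toList agents)) _)
      (≤-trans (++-lengthʳ (encodeℕ n) _) (≤-trans (++-lengthʳ (concatMap encodeℕ (Vec.toList supply)) _) (++-lengthʳ (encodeℕ periods) _))))
    where open Scheduling I

  bound : Poly
  bound = var ⊕ con 3

  module Bounded (B : Blueprint) (x : Bits) where

    open Blueprint B
    open At x

    L : ℕ
    L = length (encodeInstance problem)

    long : ∀ {m} → m ≤ L → m ≤ L + 3
    long m≤ = ≤-trans m≤ (m≤m+n L 3)

    small : ∀ {m} → m ≤ 3 → m ≤ L + 3
    small m≤ = ≤-trans m≤ (m≤n+m 3 L)

    class : ∀ b → Class b problem
    class false = tt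
    class true  = (λ i → subst (λ A → Agent.demand A ≤ 3) (sym (agent-name i)) (demand≤3 (proj₂ (name i)))) , due-end

    all-agents : ∀ αs → All (_≤ L + 3) (concatMap numbersOfAgent (map agent-of αs))
    all-agents []             = []
    all-agents ((u , τ) ∷ αs) = small (s≤s z≤n) ∷ subst (_≤ L + 3) (sym (proj₂ last-period)) (long (periods-bounded I (proj₂ problem))) ∷
      small (demand≤3 τ) ∷ all-agents αs

    bounded : NumbersBoundedBy ChargeSchedulingWithGaps bound problem
    bounded = long (periods-bounded I (proj₂ problem)) ∷ All.++⁺
      (subst (All (_≤ L + 3)) (sym (map-fromList supply-of periods)) (All.map⁺ (All.tabulate λ {p} _ → small (bit≤3 (available p)))))
      (long (agents-bounded I (proj₂ problem)) ∷ All.++⁺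
        (subst (λ As → All (_≤ L + 3) (concatMap numbersOfAgent As)) (sym (map-fromList agent-of agents)) (all-agents agents))
        (long (≤-trans few (agents-bounded I (proj₂ problem))) ∷ []))
      where
      bit≤3 : ∀ b → bit-of b ≤ 3
      bit≤3 true  = s≤s z≤n
      bit≤3 false = z≤n
      few : U * quota ≤ n
      few = ≤-trans (*-monoʳ-≤ U quota≤) (≤-reflexive (Printer.agentCount≡ B x))

  PolyTime-cong : ∀ {k} {f g : Vec Bits k → Bits} → (∀ xs → f xs ≡ g xs) → PolyTime f → PolyTime g
  PolyTime-cong f≗g (M , p , run) = M , p , λ xs → let t , c , t≤ , halts , out = run xs in t , c , t≤ , halts , trans out (f≗g xs)

  printer-polytime : ∀ B → PolyTime {1} (λ xs → encodeInstance (Blueprint.At.problem B (Vec.head xs)))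
  printer-polytime B = PolyTime-cong (λ xs → Printer.exec-printer B (Vec.head xs)) (generates⇒PolyTime (Printer.printer B))

  Restricted : Bool → Scheduling × ℤ → Set
  Restricted b I = Class b I × NumbersBoundedBy ChargeSchedulingWithGaps bound I

  blueprint-reduction : ∀ b K B → (∀ x → K x ⇔ Achievable (Blueprint.At.problem B x)) → K ≤ₚ language ChargeSchedulingWithGaps (Restricted b)
  blueprint-reduction b K B K⇔ = (λ x → encodeInstance (problem x)) , printer-polytime B , λ x → mk⇔
    (λ k → problem x , refl , (Bounded.class B x b , Bounded.bounded B x) , Equivalence.to (K⇔ x) k)
    (λ (J , e , _ , achievable) → Equivalence.from (K⇔ x) (subst Achievable (encodeInstance-injective J (problem x) e) achievable))
    where
    problem : Bits → Scheduling × ℤ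
    problem = Blueprint.At.problem B

  tiling-reduction : ∀ b K 𝒯 → (∀ x → K x ⇔ (∃[ θ ] TilingSystem.Solution 𝒯 x θ)) → K ≤ₚ language ChargeSchedulingWithGaps (Restricted b)
  tiling-reduction b K 𝒯 K⇔ = blueprint-reduction b K (Gadget.blueprint 𝒯) λ x → Gadget.gadget 𝒯 x ⇔-∘ K⇔ x

  hardness : ∀ b → NPHard (language ChargeSchedulingWithGaps (Restricted b))
  hardness b K K∈NP = let 𝒯 , K⇔ = cook-levin K K∈NP in tiling-reduction b K 𝒯 K⇔

open Hardness using (bound; hardness)
open Membership using (membership)

theorem3 :
    StronglyNPComplete ChargeSchedulingWithGaps AllInstances
    × ∃[ D ] StronglyNPComplete ChargeSchedulingWithGaps
        (λ I → DemandsAtMost D I × DeadlinesAtEnd I)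
theorem3 = (membership false , bound , hardness false) , 3 , membership true , bound , hardness true
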